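{- For every integer $n\ge 0$ let $$A_{\delta}(n)=\sum_{k=0}^{n}(-1)^k\,3^{\,n-3k}\binom{n}{3k}\binom{n+k}{n}\frac{(3k)!}{k!^3}.$$ Then for all primes $p\ge 5$ and all integers $m\ge 1$, $r\ge 1$, $$A_{\delta}(mp^r)\equiv A_{\delta}(mp^{r-1}) \pmod{p^{3r}}.$$
   Context: $A_\delta(n)$ is the sporadic (Almkvist–Zudilin) sequence labelled $(\delta)$. Equivalently, $A_\delta(n)$ is the constant term of $\Lambda(x,y,z)^n$, where $\Lambda(x,y,z)=\frac{(x+y-1)(x+z+1)(y-x+z)(y-z+1)}{xyz}$. -}

module Defs where

open import Data.Nat as ℕ using (ℕ; zero; suc; _∸_; _!)
open import Data.Nat.Combinatorics using (_C_)
open import Data.Nat.DivMod using (_/_)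
open import Data.Nat.Properties using (_!≢0; m*n≢0)
open import Data.Integer as ℤ using (ℤ; +_; -_)

sign : ℕ → ℤ
sign zero = + 1
sign (suc k) = - sign k

-- (3k)! / (k!)^3  (exact division: a multinomial coefficient)
multi3 : ℕ → ℕ
multi3 k = ((3 ℕ.* k) !) / ((k !) ℕ.* (k !) ℕ.* (k !))
  where
  instance
    nz : ℕ.NonZero ((k !) ℕ.* (k !) ℕ.* (k !))
    nz = m*n≢0 ((k !) ℕ.* (k !)) (k !) {{m*n≢0 (k !) (k !) {{k !≢0}} {{k !≢0}}}} {{k !≢0}}

-- the k-th summand: (-1)^k 3^(n-3k) C(n,3k) C(n+k,n) (3k)!/k!^3
-- (when 3k > n the binomial C(n,3k) is 0, so truncated subtraction is harmless)
term : ℕ → ℕ → ℤ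
term n k = sign k ℤ.* (+ (3 ℕ.^ (n ∸ 3 ℕ.* k) ℕ.* (n C (3 ℕ.* k))
                           ℕ.* ((n ℕ.+ k) C n) ℕ.* multi3 k))

sumTo : ℕ → (ℕ → ℤ) → ℤ
sumTo zero f = f 0
sumTo (suc K) f = sumTo K f ℤ.+ f (suc K)

Aδ : ℕ → ℤ
Aδ n = sumTo n (term n)

{-# OPTIONS --safe #-}
module Submission where

-- Aδ(n) is also T(n), the coefficient of (xyzw)ⁿ in (L₀L₁L₂L₃)ⁿ, where the coefficients of the
-- linear forms Lᵢ are the rows of a conference matrix M, M Mᵀ = 3: both sequences satisfy
-- (n+1)³u(n+1) = (2n+1)(7n²+7n+3)u(n) − 81n³u(n−1).
--
-- Let n = mpʳ. Expanding the four powers Lᵢⁿ writes T(n) as a sum over 4×3 arrays of exponents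
-- with all row and column sums equal to n. Call a row regular if p divides all of its entries.
-- The column sums exclude a single irregular row. The trinomial coefficient of an irregular row is
-- divisible by pʳ, so three of them give p³ʳ term by term. For two irregular rows the sum runs over
-- blocks of p-power length on which the product of the binomials is constant up to the factor
-- (−1)ᵇb⁻², and the sums of (−1)ᵇb⁻² cancel under reflection. If all rows are regular, Jacobsthal's
-- congruence compares the term with the term of T(n/p) at the array divided by p, and the column
-- sums supply the powers of p that a single trinomial coefficient lacks.

import Data.Integer.Divisibility.Signed as Signed
import Data.Integer.Properties as ℤₚ
import Data.Nat.DivMod as ℕᵐ
import Data.Nat.Divisibility as ℕᵈ
import Data.Nat.Properties as ℕₚ
import Data.Nat.Tactic.RingSolver as ℕS

-- The identity M Mᵀ = 3 is used twice. It makes the derivation attached to row i send Lₖ to 3 or to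
-- 0, which yields the linear relations behind the recurrence of T. It also says that two rows of M,
-- which have exactly two common columns, agree in sign in one of them and differ in the other; this
-- is the origin of the factor (-1)ᵇ for two irregular rows. The obstacle throughout is the supply
-- of powers of p. For two irregular rows the absorption of binomials gives p²ʳ, but the
-- cancellation gives only pᵗ, where pᵗ divides the sums of the regular entries in the relevant
-- columns. The missing pʳ⁻ᵗ sits in the trinomial coefficients of the regular rows, because an
-- entry times the coefficient of its row is divisible by pʳ. For this reason the lemma on pairs and
-- Jacobsthal's congruence are proved with an arbitrary multiplier (`g`, `G`) and a divisibility
-- hypothesis on products with it. All congruences stay in ℤ: the inverse square of a unit is
-- represented by an even power, whose base may also be a multiple of p.

module ConstantTerm where

  open import Defs
  open import Algebra.Properties.AbelianGroup ℤₚ.+-0-abelianGroup using () renaming (∙-cancelʳ to +-cancelʳ)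
  open import Data.Bool using (Bool; true; false; _∧_)
  open import Data.Fin using (Fin; zero; suc)
  open import Data.Fin.Patterns using (0F; 1F; 2F; 3F)
  open import Data.Integer as ℤ using (ℤ; +_; -[1+_]; _+_; _*_; -_; _-_; 0ℤ; 1ℤ; -1ℤ; ∣_∣)
  open import Data.Integer.Tactic.RingSolver using (solve-∀)
  open import Data.List as List using (List; []; _∷_; _++_; map)
  open import Data.Nat as ℕ using (ℕ; zero; suc; _!; s≤s; z≤n)
  open import Data.Nat.Combinatorics using (_C_; nCk≡n!/k![n-k]!; k![n∸k]!∣n!; k>n⇒nCk≡0)
  open import Data.Product using (_×_; _,_; proj₁; proj₂)
  open import Data.Sum using (inj₁; inj₂)
  open import Function using (_∘_)
  open import Relation.Binary.PropositionalEquality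
  open import Relation.Nullary using (Dec; yes; no)

  -- Coefficients of polynomials in four variables, the forms Lᵢ and their derivations.

  data P4 : Set where
    pt : (a b c d : ℤ) → P4

  coord : Fin 4 → P4 → ℤ
  coord 0F (pt a b c d) = a
  coord 1F (pt a b c d) = b
  coord 2F (pt a b c d) = c
  coord 3F (pt a b c d) = d

  ind : Fin 4 → Fin 4 → ℤ
  ind 0F 0F = 1ℤ
  ind 1F 1F = 1ℤ
  ind 2F 2F = 1ℤ
  ind 3F 3F = 1ℤ
  ind _ _ = 0ℤ

  bump : Fin 4 → ℤ → P4 → P4
  bump l t (pt a b c d) =
    pt (a + t * ind 0F l) (b + t * ind 1F l) (c + t * ind 2F l) (d + t * ind 3F l)

  pt-cong : ∀ {a a′ b b′ c c′ d d′} → a ≡ a′ → b ≡ b′ → c ≡ c′ → d ≡ d′ → pt a b c d ≡ pt a′ b′ c′ d′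
  pt-cong refl refl refl refl = refl

  coord-bump : ∀ j l t κ → coord j (bump l t κ) ≡ coord j κ + t * ind j l
  coord-bump 0F l t (pt _ _ _ _) = refl
  coord-bump 1F l t (pt _ _ _ _) = refl
  coord-bump 2F l t (pt _ _ _ _) = refl
  coord-bump 3F l t (pt _ _ _ _) = refl

  bump-comm : ∀ j s l t κ → bump j s (bump l t κ) ≡ bump l t (bump j s κ)
  bump-comm j s l t (pt a b c d) = pt-cong (swap a _ _) (swap b _ _) (swap c _ _) (swap d _ _)
    where
    swap : ∀ a x y → a + x + y ≡ a + y + x
    swap = solve-∀

  bump-inverse : ∀ l κ → bump l 1ℤ (bump l -1ℤ κ) ≡ κ
  bump-inverse l (pt a b c d) = pt-cong (cancel a _) (cancel b _) (cancel c _) (cancel d _)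
    where
    cancel : ∀ a x → a + -1ℤ * x + 1ℤ * x ≡ a
    cancel = solve-∀

  opaque
    Σ4 : (Fin 4 → ℤ) → ℤ
    Σ4 g = g 0F + g 1F + g 2F + g 3F

    Σ4-def : ∀ g → Σ4 g ≡ g 0F + g 1F + g 2F + g 3F
    Σ4-def g = refl

    Σ4-cong : ∀ {g h : Fin 4 → ℤ} → (∀ j → g j ≡ h j) → Σ4 g ≡ Σ4 h
    Σ4-cong e = cong₂ _+_ (cong₂ _+_ (cong₂ _+_ (e 0F) (e 1F)) (e 2F)) (e 3F)

    Σ4-+ : ∀ g h → Σ4 (λ j → g j + h j) ≡ Σ4 g + Σ4 h
    Σ4-+ g h = eq (g 0F) (g 1F) (g 2F) (g 3F) (h 0F) (h 1F) (h 2F) (h 3F)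
      where
      eq : ∀ a b c d a′ b′ c′ d′ → (a + a′) + (b + b′) + (c + c′) + (d + d′) ≡ (a + b + c + d) + (a′ + b′ + c′ + d′)
      eq = solve-∀

    Σ4-* : ∀ t g → Σ4 (λ j → t * g j) ≡ t * Σ4 g
    Σ4-* t g = eq t (g 0F) (g 1F) (g 2F) (g 3F)
      where
      eq : ∀ t a b c d → t * a + t * b + t * c + t * d ≡ t * (a + b + c + d)
      eq = solve-∀

    Σ4-swap : ∀ (g : Fin 4 → Fin 4 → ℤ) → Σ4 (λ j → Σ4 (g j)) ≡ Σ4 (λ l → Σ4 (λ j → g j l))
    Σ4-swap g = sym (trans (Σ4-+ (λ l → g 0F l + g 1F l + g 2F l) (g 3F))
      (cong (_+ Σ4 (g 3F)) (trans (Σ4-+ (λ l → g 0F l + g 1F l) (g 2F))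
        (cong (_+ Σ4 (g 2F)) (Σ4-+ (g 0F) (g 1F))))))

    Σ4-ind : ∀ l (g : Fin 4 → ℤ) → Σ4 (λ j → ind j l * g j) ≡ g l
    Σ4-ind 0F g = eq (g 0F) (g 1F) (g 2F) (g 3F)
      where
      eq : ∀ a b c d → 1ℤ * a + 0ℤ * b + 0ℤ * c + 0ℤ * d ≡ a
      eq = solve-∀
    Σ4-ind 1F g = eq (g 0F) (g 1F) (g 2F) (g 3F)
      where
      eq : ∀ a b c d → 0ℤ * a + 1ℤ * b + 0ℤ * c + 0ℤ * d ≡ b
      eq = solve-∀
    Σ4-ind 2F g = eq (g 0F) (g 1F) (g 2F) (g 3F)
      where
      eq : ∀ a b c d → 0ℤ * a + 0ℤ * b + 1ℤ * c + 0ℤ * d ≡ c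
      eq = solve-∀
    Σ4-ind 3F g = eq (g 0F) (g 1F) (g 2F) (g 3F)
      where
      eq : ∀ a b c d → 0ℤ * a + 0ℤ * b + 0ℤ * c + 1ℤ * d ≡ d
      eq = solve-∀

  -- In variables x, y, z, w the rows are L₀ = y - z + w, L₁ = x + z + w, L₂ = x + y - w, L₃ = -x +
  -- y + z. At w = 1 these are the four factors of the numerator of Λ, and the coefficient of
  -- (xyzw)ⁿ in the homogeneous product becomes the constant term of Λⁿ.
  M : Fin 4 → Fin 4 → ℤ
  M 0F 0F = 0ℤ
  M 0F 1F = 1ℤ
  M 0F 2F = -1ℤ
  M 0F 3F = 1ℤ
  M 1F 0F = 1ℤ
  M 1F 1F = 0ℤ
  M 1F 2F = 1ℤ
  M 1F 3F = 1ℤ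
  M 2F 0F = 1ℤ
  M 2F 1F = 1ℤ
  M 2F 2F = 0ℤ
  M 2F 3F = -1ℤ
  M 3F 0F = -1ℤ
  M 3F 1F = 1ℤ
  M 3F 2F = 1ℤ
  M 3F 3F = 0ℤ

  opaque
    unfolding Σ4

    gram : ∀ i k → Σ4 (λ j → M i j * M k j) ≡ + 3 * ind i k
    gram 0F 0F = refl
    gram 0F 1F = refl
    gram 0F 2F = refl
    gram 0F 3F = refl
    gram 1F 0F = refl
    gram 1F 1F = refl
    gram 1F 2F = refl
    gram 1F 3F = refl
    gram 2F 0F = refl
    gram 2F 1F = refl
    gram 2F 2F = refl
    gram 2F 3F = refl
    gram 3F 0F = refl
    gram 3F 1F = refl
    gram 3F 2F = refl
    gram 3F 3F = refl

  Coeffs : Set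
  Coeffs = P4 → ℤ

  mul : Fin 4 → Coeffs → Coeffs
  mul i f κ = Σ4 λ l → M i l * f (bump l -1ℤ κ)

  -- The derivation Σⱼ Mᵢⱼ ∂ⱼ: the coefficient at κ of ∂ⱼf comes from the monomial one step higher
  -- in direction j. Exponents range over all of ℤ, so there are no boundary cases.
  der : Fin 4 → Coeffs → Coeffs
  der i f κ = Σ4 λ j → M i j * ((coord j κ + 1ℤ) * f (bump j 1ℤ κ))

  mul-cong : ∀ i {f g} → (∀ κ → f κ ≡ g κ) → ∀ κ → mul i f κ ≡ mul i g κ
  mul-cong i e κ = Σ4-cong λ l → cong (M i l *_) (e _)

  mul-+ : ∀ i f g κ → mul i (λ κ → f κ + g κ) κ ≡ mul i f κ + mul i g κ
  mul-+ i f g κ = trans (Σ4-cong λ l → ℤₚ.*-distribˡ-+ (M i l) (f (bump l -1ℤ κ)) (g (bump l -1ℤ κ)))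
    (Σ4-+ (λ l → M i l * f (bump l -1ℤ κ)) (λ l → M i l * g (bump l -1ℤ κ)))

  mul-scale : ∀ i t f κ → mul i (λ κ → t * f κ) κ ≡ t * mul i f κ
  mul-scale i t f κ = trans (Σ4-cong λ l → eq (M i l) t (f (bump l -1ℤ κ))) (Σ4-* t (λ l → M i l * f (bump l -1ℤ κ)))
    where
    eq : ∀ m t x → m * (t * x) ≡ t * (m * x)
    eq = solve-∀

  mul-comm : ∀ i k f κ → mul i (mul k f) κ ≡ mul k (mul i f) κ
  mul-comm i k f κ =
    trans (Σ4-cong λ l → sym (Σ4-* (M i l) (λ j → M k j * f (bump j -1ℤ (bump l -1ℤ κ)))))
    (trans (Σ4-swap (λ l j → M i l * (M k j * f (bump j -1ℤ (bump l -1ℤ κ)))))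
    (Σ4-cong λ j → trans (Σ4-cong λ l →
       trans (eq (M i l) (M k j) (f (bump j -1ℤ (bump l -1ℤ κ)))) (cong (λ z → M k j * (M i l * f z)) (bump-comm j -1ℤ l -1ℤ κ)))
       (Σ4-* (M k j) (λ l → M i l * f (bump l -1ℤ (bump j -1ℤ κ))))))
    where
    eq : ∀ a b x → a * (b * x) ≡ b * (a * x)
    eq = solve-∀

  -- Leibniz rule: the commutator of the derivation with multiplication by Lₖ is multiplication by
  -- the constant Σⱼ MᵢⱼMₖⱼ. In coordinates, the shift in direction l changes coordinate j only for
  -- j = l, so the correction is the diagonal of the double sum, evaluated by `gram`.
  der-mul : ∀ i k f κ → der i (mul k f) κ ≡ mul k (der i f) κ + + 3 * ind i k * f κ
  der-mul i k f κ = begin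
    Σ4 (λ j → M i j * ((coord j κ + 1ℤ) * Σ4 (λ l → M k l * f (bump l -1ℤ (bump j 1ℤ κ)))))
      ≡⟨ Σ4-cong (λ j → trans (regroup (M i j) (coord j κ + 1ℤ) (mul k f (bump j 1ℤ κ))) (sym (Σ4-* (M i j * (coord j κ + 1ℤ)) (λ l → M k l * f (bump l -1ℤ (bump j 1ℤ κ)))))) ⟩
    Σ4 (λ j → Σ4 (λ l → M i j * (coord j κ + 1ℤ) * (M k l * f (bump l -1ℤ (bump j 1ℤ κ)))))
      ≡⟨ Σ4-cong (λ j → Σ4-cong λ l → split j l) ⟩
    Σ4 (λ j → Σ4 (λ l → M k l * (M i j * ((coord j (bump l -1ℤ κ) + 1ℤ) * h j l)) + ind j l * (M i j * (M k l * h j l))))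
      ≡⟨ trans (Σ4-cong (λ j → Σ4-+ (u j) (v j))) (Σ4-+ (λ j → Σ4 (u j)) (λ j → Σ4 (v j))) ⟩
    Σ4 (λ j → Σ4 (λ l → M k l * (M i j * ((coord j (bump l -1ℤ κ) + 1ℤ) * h j l)))) + Σ4 (λ j → Σ4 (λ l → ind j l * (M i j * (M k l * h j l))))
      ≡⟨ cong₂ _+_ (trans (Σ4-swap u) (Σ4-cong λ l → Σ4-* (M k l) (λ j → M i j * ((coord j (bump l -1ℤ κ) + 1ℤ) * h j l)))) diagonal ⟩
    mul k (der i f) κ + + 3 * ind i k * f κ ∎
    where
    open ≡-Reasoning
    h : Fin 4 → Fin 4 → ℤ
    h j l = f (bump j 1ℤ (bump l -1ℤ κ))
    u v : Fin 4 → Fin 4 → ℤ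
    u j l = M k l * (M i j * ((coord j (bump l -1ℤ κ) + 1ℤ) * h j l))
    v j l = ind j l * (M i j * (M k l * h j l))
    regroup : ∀ a b c → a * (b * c) ≡ a * b * c
    regroup = solve-∀
    eq : ∀ m c m′ δ x → m * (c + 1ℤ) * (m′ * x) ≡ m′ * (m * ((c + -1ℤ * δ + 1ℤ) * x)) + δ * (m * (m′ * x))
    eq = solve-∀
    split : ∀ j l → M i j * (coord j κ + 1ℤ) * (M k l * f (bump l -1ℤ (bump j 1ℤ κ)))
      ≡ M k l * (M i j * ((coord j (bump l -1ℤ κ) + 1ℤ) * h j l)) + ind j l * (M i j * (M k l * h j l))
    split j l = trans (cong (λ z → M i j * (coord j κ + 1ℤ) * (M k l * f z)) (bump-comm l -1ℤ j 1ℤ κ))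
      (trans (eq (M i j) (coord j κ) (M k l) (ind j l) (h j l))
             (cong (λ z → M k l * (M i j * ((z + 1ℤ) * h j l)) + v j l) (sym (coord-bump j l -1ℤ κ))))
    pull : ∀ a b x → a * (b * x) ≡ x * (a * b)
    pull = solve-∀
    diagonal : Σ4 (λ j → Σ4 (λ l → ind j l * (M i j * (M k l * h j l)))) ≡ + 3 * ind i k * f κ
    diagonal = begin
      Σ4 (λ j → Σ4 (λ l → ind j l * (M i j * (M k l * h j l)))) ≡⟨ Σ4-swap v ⟩
      Σ4 (λ l → Σ4 (λ j → ind j l * (M i j * (M k l * h j l)))) ≡⟨ Σ4-cong (λ l → Σ4-ind l (λ j → M i j * (M k l * h j l))) ⟩
      Σ4 (λ l → M i l * (M k l * h l l)) ≡⟨ Σ4-cong (λ l → trans (cong (λ z → M i l * (M k l * f z)) (bump-inverse l κ)) (pull (M i l) (M k l) (f κ))) ⟩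
      Σ4 (λ l → f κ * (M i l * M k l)) ≡⟨ Σ4-* (f κ) (λ l → M i l * M k l) ⟩
      f κ * Σ4 (λ l → M i l * M k l) ≡⟨ trans (cong (f κ *_) (gram i k)) (ℤₚ.*-comm (f κ) (+ 3 * ind i k)) ⟩
      + 3 * ind i k * f κ ∎

  ind-subst : ∀ (g : Fin 4 → ℤ) i k → ind i k * g i ≡ ind i k * g k
  ind-subst g 0F 0F = refl
  ind-subst g 0F 1F = refl
  ind-subst g 0F 2F = refl
  ind-subst g 0F 3F = refl
  ind-subst g 1F 0F = refl
  ind-subst g 1F 1F = refl
  ind-subst g 1F 2F = refl
  ind-subst g 1F 3F = refl
  ind-subst g 2F 0F = refl
  ind-subst g 2F 1F = refl
  ind-subst g 2F 2F = refl
  ind-subst g 2F 3F = refl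
  ind-subst g 3F 0F = refl
  ind-subst g 3F 1F = refl
  ind-subst g 3F 2F = refl
  ind-subst g 3F 3F = refl

  count : Fin 4 → Coeffs → Coeffs
  count i f = mul i (der i f)

  -- Multiplication by Lₖ maps eigenvectors of `count i` to eigenvectors and shifts the eigenvalue
  -- by 3 when k = i. The commutator produces Lᵢf instead of Lₖf, which is harmless because it
  -- carries the factor `ind i k`.
  count-mul : ∀ i k {f} c → (∀ κ → count i f κ ≡ c * f κ) →
    ∀ κ → count i (mul k f) κ ≡ (c + + 3 * ind i k) * mul k f κ
  count-mul i k {f} c e κ = begin
    mul i (der i (mul k f)) κ ≡⟨ mul-cong i (der-mul i k f) κ ⟩
    mul i (λ κ → mul k (der i f) κ + + 3 * ind i k * f κ) κ ≡⟨ trans (mul-+ i (mul k (der i f)) (λ κ → + 3 * ind i k * f κ) κ) (cong₂ _+_ (mul-comm i k (der i f) κ) (mul-scale i (+ 3 * ind i k) f κ)) ⟩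
    mul k (count i f) κ + + 3 * ind i k * mul i f κ ≡⟨ cong₂ _+_ (trans (mul-cong k e κ) (mul-scale k c f κ)) collapse ⟩
    c * mul k f κ + + 3 * ind i k * mul k f κ ≡⟨ ℤₚ.*-distribʳ-+ (mul k f κ) c (+ 3 * ind i k) ⟨
    (c + + 3 * ind i k) * mul k f κ ∎
    where
    open ≡-Reasoning
    collapse : + 3 * ind i k * mul i f κ ≡ + 3 * ind i k * mul k f κ
    collapse = trans (ℤₚ.*-assoc (+ 3) (ind i k) (mul i f κ)) (trans (cong (+ 3 *_) (ind-subst (λ t → mul t f κ) i k)) (sym (ℤₚ.*-assoc (+ 3) (ind i k) (mul k f κ))))

  δ : ℤ → ℤ
  δ (+ zero) = 1ℤ
  δ _ = 0ℤ

  origin : Coeffs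
  origin (pt a b c d) = δ a * δ b * (δ c * δ d)

  mulAll : Coeffs → Coeffs
  mulAll f = mul 0F (mul 1F (mul 2F (mul 3F f)))

  F : ℕ → Coeffs
  F zero = origin
  F (suc n) = mulAll (F n)

  a*δa : ∀ a → a * δ a ≡ 0ℤ
  a*δa (+ zero) = refl
  a*δa (+ suc n) = ℤₚ.*-zeroʳ (+ suc n)
  a*δa -[1+ n ] = ℤₚ.*-zeroʳ (-[1+ n ])

  coord*origin : ∀ j κ → coord j κ * origin κ ≡ 0ℤ
  coord*origin 0F (pt a b c d) = trans (eq a (δ a) (δ b) (δ c * δ d)) (cong (_* (δ b * (δ c * δ d))) (a*δa a))
    where
    eq : ∀ a x y z → a * (x * y * z) ≡ a * x * (y * z)
    eq = solve-∀
  coord*origin 1F (pt a b c d) = trans (eq b (δ a) (δ b) (δ c * δ d)) (cong (_* (δ a * (δ c * δ d))) (a*δa b))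
    where
    eq : ∀ a x y z → a * (x * y * z) ≡ a * y * (x * z)
    eq = solve-∀
  coord*origin 2F (pt a b c d) = trans (eq c (δ a * δ b) (δ c) (δ d)) (cong (_* (δ a * δ b * δ d)) (a*δa c))
    where
    eq : ∀ a x y z → a * (x * (y * z)) ≡ a * y * (x * z)
    eq = solve-∀
  coord*origin 3F (pt a b c d) = trans (eq d (δ a * δ b) (δ c) (δ d)) (cong (_* (δ a * δ b * δ c)) (a*δa d))
    where
    eq : ∀ a x y z → a * (x * (y * z)) ≡ a * z * (x * y)
    eq = solve-∀

  ind-refl : ∀ j → ind j j ≡ 1ℤ
  ind-refl 0F = refl
  ind-refl 1F = refl
  ind-refl 2F = refl
  ind-refl 3F = refl

  Σ4-0 : ∀ {g} → (∀ j → g j ≡ 0ℤ) → Σ4 g ≡ 0ℤ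
  Σ4-0 {g} e = trans (Σ4-cong {g} {λ _ → 0ℤ * 0ℤ} e) (Σ4-* 0ℤ (λ _ → 0ℤ))

  der-origin : ∀ i κ → der i origin κ ≡ 0ℤ
  der-origin i κ = Σ4-0 λ j → trans (cong (M i j *_)
    (trans (cong (_* origin (bump j 1ℤ κ)) (sym (trans (coord-bump j j 1ℤ κ) (cong (λ t → coord j κ + 1ℤ * t) (ind-refl j)))))
           (coord*origin j (bump j 1ℤ κ)))) (ℤₚ.*-zeroʳ (M i j))

  count-F : ∀ i n κ → count i (F n) κ ≡ + 3 * + n * F n κ
  count-F i zero κ = trans (mul-cong i (der-origin i) κ) (Σ4-0 λ l → ℤₚ.*-zeroʳ (M i l))
  count-F i (suc n) κ = begin
    count i (F (suc n)) κ
      ≡⟨ count-mul i 0F {f₁} c₁ (count-mul i 1F {f₂} c₂ (count-mul i 2F {f₃} c₃ (count-mul i 3F {F n} (+ 3 * + n) (count-F i n)))) κ ⟩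
    (c₁ + + 3 * ind i 0F) * F (suc n) κ
      ≡⟨ cong (_* F (suc n) κ) (trans (total (+ n) (ind i 0F) (ind i 1F) (ind i 2F) (ind i 3F)) (cong (λ t → + 3 * (t + + n)) (one i))) ⟩
    + 3 * + suc n * F (suc n) κ ∎
    where
    open ≡-Reasoning
    f₃ f₂ f₁ : Coeffs
    f₃ = mul 3F (F n)
    f₂ = mul 2F f₃
    f₁ = mul 1F f₂
    c₃ c₂ c₁ : ℤ
    c₃ = + 3 * + n + + 3 * ind i 3F
    c₂ = c₃ + + 3 * ind i 2F
    c₁ = c₂ + + 3 * ind i 1F
    total : ∀ n a b c d → + 3 * n + + 3 * d + + 3 * c + + 3 * b + + 3 * a ≡ + 3 * ((a + b + c + d) + n)
    total = solve-∀
    one : ∀ i → ind i 0F + ind i 1F + ind i 2F + ind i 3F ≡ 1ℤ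
    one 0F = refl
    one 1F = refl
    one 2F = refl
    one 3F = refl

  -- Symbolic linear relations between coefficients, and the certificate of the recurrence.

  Poly₁ : Set
  Poly₁ = List ℤ

  ev : Poly₁ → ℤ → ℤ
  ev [] ν = 0ℤ
  ev (c ∷ cs) ν = c + ν * ev cs ν

  add₁ : Poly₁ → Poly₁ → Poly₁
  add₁ [] q = q
  add₁ p@(_ ∷ _) [] = p
  add₁ (a ∷ p) (b ∷ q) = a + b ∷ add₁ p q

  scale₁ : ℤ → Poly₁ → Poly₁
  scale₁ t [] = []
  scale₁ t (a ∷ p) = t * a ∷ scale₁ t p

  mul₁ : Poly₁ → Poly₁ → Poly₁
  mul₁ [] q = []
  mul₁ (a ∷ p) q = add₁ (scale₁ a q) (0ℤ ∷ mul₁ p q)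

  ev-add₁ : ∀ p q ν → ev (add₁ p q) ν ≡ ev p ν + ev q ν
  ev-add₁ [] q ν = sym (ℤₚ.+-identityˡ (ev q ν))
  ev-add₁ (a ∷ p) [] ν = sym (ℤₚ.+-identityʳ (ev (a ∷ p) ν))
  ev-add₁ (a ∷ p) (b ∷ q) ν = trans (cong (λ t → a + b + ν * t) (ev-add₁ p q ν)) (eq a b ν (ev p ν) (ev q ν))
    where
    eq : ∀ a b ν x y → a + b + ν * (x + y) ≡ (a + ν * x) + (b + ν * y)
    eq = solve-∀

  ev-scale₁ : ∀ t p ν → ev (scale₁ t p) ν ≡ t * ev p ν
  ev-scale₁ t [] ν = sym (ℤₚ.*-zeroʳ t)
  ev-scale₁ t (a ∷ p) ν = trans (cong (λ z → t * a + ν * z) (ev-scale₁ t p ν)) (eq t a ν (ev p ν))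
    where
    eq : ∀ t a ν x → t * a + ν * (t * x) ≡ t * (a + ν * x)
    eq = solve-∀

  ev-mul₁ : ∀ p q ν → ev (mul₁ p q) ν ≡ ev p ν * ev q ν
  ev-mul₁ [] q ν = refl
  ev-mul₁ (a ∷ p) q ν = trans (ev-add₁ (scale₁ a q) (0ℤ ∷ mul₁ p q) ν)
    (trans (cong₂ (λ x y → x + (0ℤ + ν * y)) (ev-scale₁ a q ν) (ev-mul₁ p q ν)) (eq a ν (ev p ν) (ev q ν)))
    where
    eq : ∀ a ν x y → a * y + (0ℤ + ν * (x * y)) ≡ (a + ν * x) * y
    eq = solve-∀

  -- A polynomial Σ c(ν)xᵉ as a list of pairs (c, e). `val` takes its product with f and reads off
  -- the coefficient at κ, so that a relation among neighbouring coefficients of f becomes a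
  -- polynomial.
  Poly : Set
  Poly = List (Poly₁ × P4)

  infixl 6 _⊝_
  _⊝_ : P4 → P4 → P4
  pt a b c d ⊝ pt a′ b′ c′ d′ = pt (a - a′) (b - b′) (c - c′) (d - d′)

  ⊝-bump : ∀ l t κ e → bump l t (κ ⊝ e) ≡ κ ⊝ bump l (- t) e
  ⊝-bump l t (pt a b c d) (pt a′ b′ c′ d′) = pt-cong (eq a a′ t (ind 0F l)) (eq b b′ t (ind 1F l)) (eq c c′ t (ind 2F l)) (eq d d′ t (ind 3F l))
    where
    eq : ∀ a b t x → a - b + t * x ≡ a - (b + - t * x)
    eq = solve-∀

  _≟₄_ : (κ κ′ : P4) → Dec (κ ≡ κ′)
  pt a b c d ≟₄ pt a′ b′ c′ d′ with a ℤₚ.≟ a′ | b ℤₚ.≟ b′ | c ℤₚ.≟ c′ | d ℤₚ.≟ d′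
  ... | yes refl | yes refl | yes refl | yes refl = yes refl
  ... | no ¬p | _ | _ | _ = no λ { refl → ¬p refl }
  ... | _ | no ¬p | _ | _ = no λ { refl → ¬p refl }
  ... | _ | _ | no ¬p | _ = no λ { refl → ¬p refl }
  ... | _ | _ | _ | no ¬p = no λ { refl → ¬p refl }

  insert : Poly₁ × P4 → Poly → Poly
  insert t [] = t ∷ []
  insert (c , e) ((c′ , e′) ∷ q) with e ≟₄ e′
  ... | yes _ = (add₁ c c′ , e′) ∷ q
  ... | no _ = (c′ , e′) ∷ insert (c , e) q

  opaque
    normalise : Poly → Poly
    normalise [] = []
    normalise (t ∷ q) = insert t (normalise q)

  scale : Poly₁ → Poly → Poly
  scale c [] = []
  scale c ((c′ , e) ∷ q) = (mul₁ c c′ , e) ∷ scale c q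

  mulP : Fin 4 → Poly → Poly
  mulP i [] = []
  mulP i ((c , e) ∷ q) =
    (scale₁ (M i 0F) c , bump 0F 1ℤ e) ∷ (scale₁ (M i 1F) c , bump 1F 1ℤ e) ∷
    (scale₁ (M i 2F) c , bump 2F 1ℤ e) ∷ (scale₁ (M i 3F) c , bump 3F 1ℤ e) ∷ mulP i q

  opaque
    mulAllP : Poly → Poly
    mulAllP q = normalise (mulP 3F (normalise (mulP 2F (normalise (mulP 1F (normalise (mulP 0F q)))))))

  for : (Fin 4 → Poly) → Poly
  for g = g 0F ++ g 1F ++ g 2F ++ g 3F ++ []

  -- Since M Mᵀ = 3, the operator Σⱼ Mᵢⱼ ∂ⱼ multiplies (L₀L₁L₂L₃)ⁿ by 3n / Lᵢ. Multiplied by Lᵢ and read off at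
  -- a coefficient, this is a linear relation, with coefficients in ν = n + 1, among neighbouring coefficients.
  relation : Fin 4 → P4 → Poly
  relation i e = (+ 3 ∷ - + 3 ∷ [] , e) ∷ for λ l → for λ j →
    (scale₁ (M i l * M i j) (+ 2 - coord j (bump l 1ℤ e) ∷ 1ℤ ∷ []) , bump j -1ℤ (bump l 1ℤ e)) ∷ []

  isZero₁ : Poly₁ → Bool
  isZero₁ [] = true
  isZero₁ (+ zero ∷ p) = isZero₁ p
  isZero₁ (_ ∷ p) = false

  isZero : Poly → Bool
  isZero [] = true
  isZero ((c , _) ∷ q) = isZero₁ c ∧ isZero q

  Instance : Set
  Instance = Poly₁ × Fin 4 × P4

  -- Three of the signed permutations of the coordinates that permute the forms Lᵢ up to sign.
  rot₄ rot₃ flip₂ : Instance → Instance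
  rot₄ (c , i , pt a b c′ d) = scale₁ (-1ℤ ℤ.^ ∣ c′ ∣) c , next i , pt d a b c′
    where
    next : Fin 4 → Fin 4
    next 0F = 1F
    next 1F = 2F
    next 2F = 3F
    next 3F = 0F
  rot₃ (c , i , pt a b c′ d) = scale₁ (-1ℤ ℤ.^ ∣ b + c′ ∣) c , next i , pt a d b c′
    where
    next : Fin 4 → Fin 4
    next 0F = 0F
    next 1F = 2F
    next 2F = 3F
    next 3F = 1F
  flip₂ (c , i , pt a b c′ d) = scale₁ (-1ℤ ℤ.^ ∣ d ∣) c , next i , pt a c′ b d
    where
    next : Fin 4 → Fin 4
    next 0F = 0F
    next 1F = 2F
    next 2F = 1F
    next 3F = 3F

  orbit : List Instance → List Instance
  orbit = closeₙ 3 rot₄ ∘ closeₙ 2 rot₃ ∘ closeₙ 1 flip₂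
    where
    closeₙ : ℕ → (Instance → Instance) → List Instance → List Instance
    closeₙ zero g xs = xs
    closeₙ (suc n) g xs = xs ++ map g (closeₙ n g xs)

  -- Found by linear algebra: summed over the orbit, these multiples of the relations give 4 times the recurrence.
  opaque
    certificate : List Instance
    certificate = orbit
      ( (- + 2 ∷ - + 5 ∷ - + 3 ∷ [] , 0F , pt (+ 0) (+ 1) (+ 1) (+ 6))
      ∷ (- + 2 ∷ - + 6 ∷ - + 4 ∷ [] , 0F , pt (+ 0) (+ 1) (+ 2) (+ 5))
      ∷ (+ 2 ∷ + 4 ∷ + 2 ∷ [] , 0F , pt (+ 0) (+ 1) (+ 3) (+ 4))
      ∷ (- + 2 ∷ - + 5 ∷ - + 3 ∷ [] , 0F , pt (+ 0) (+ 2) (+ 3) (+ 3))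
      ∷ (+ 6 ∷ + 4 ∷ - + 8 ∷ [] , 0F , pt (+ 1) (+ 1) (+ 2) (+ 4))
      ∷ (+ 2 ∷ + 5 ∷ + 4 ∷ [] , 0F , pt (+ 2) (+ 1) (+ 1) (+ 4))
      ∷ (+ 0 ∷ + 2 ∷ + 8 ∷ [] , 0F , pt (+ 2) (+ 1) (+ 2) (+ 3))
      ∷ [])

  combination : List Instance → Poly
  combination [] = []
  combination ((c , i , e) ∷ xs) = scale c (relation i e) ++ combination xs

  diag : ℤ → P4
  diag t = pt t t t t

  -- With ν as the middle index, these are (ν + 1)³, -(2ν + 1)(7ν² + 7ν + 3) and 81ν³.
  cubic₂ cubic₁ cubic₀ : Poly₁
  cubic₂ = + 1 ∷ + 3 ∷ + 3 ∷ + 1 ∷ []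
  cubic₁ = - + 3 ∷ - + 13 ∷ - + 21 ∷ - + 14 ∷ []
  cubic₀ = + 0 ∷ + 0 ∷ + 0 ∷ + 81 ∷ []

  opaque
    recurrence : Poly
    recurrence = mulAllP (mulAllP ((cubic₂ , diag (+ 0)) ∷ [])) ++ mulAllP ((cubic₁ , diag (+ 1)) ∷ []) ++ (cubic₀ , diag (+ 2)) ∷ []

    recurrence-def : recurrence ≡ mulAllP (mulAllP ((cubic₂ , diag (+ 0)) ∷ [])) ++ mulAllP ((cubic₁ , diag (+ 1)) ∷ []) ++ (cubic₀ , diag (+ 2)) ∷ []
    recurrence-def = refl

  opaque
    unfolding recurrence certificate normalise mulAllP

    -- A polynomial identity in ν and the four variables, homogeneous of degree 8 in the variables,
    -- so evaluation decides it for all ν at once. Degree 8 is forced: `F m` is homogeneous of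
    -- degree 4m, and the coefficient read is the one at `diag (+ (2 + m))`.
    certified : isZero (normalise (scale (- + 4 ∷ []) recurrence ++ combination certificate)) ≡ true
    certified = refl

  val : ℤ → Coeffs → P4 → Poly → ℤ
  val ν f κ [] = 0ℤ
  val ν f κ ((c , e) ∷ q) = ev c ν * f (κ ⊝ e) + val ν f κ q

  module _ (ν : ℤ) (f : Coeffs) (κ : P4) where

    private V = val ν f κ

    val-++ : ∀ p q → V (p ++ q) ≡ V p + V q
    val-++ [] q = sym (ℤₚ.+-identityˡ (V q))
    val-++ ((c , e) ∷ p) q = trans (cong (λ z → ev c ν * f (κ ⊝ e) + z) (val-++ p q)) (sym (ℤₚ.+-assoc (ev c ν * f (κ ⊝ e)) (V p) (V q)))

    val-insert : ∀ c e q → V (insert (c , e) q) ≡ ev c ν * f (κ ⊝ e) + V q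
    val-insert c e [] = refl
    val-insert c e ((c′ , e′) ∷ q) with e ≟₄ e′
    ... | yes refl = trans (cong (λ t → t * f (κ ⊝ e′) + V q) (ev-add₁ c c′ ν)) (eq (ev c ν) (ev c′ ν) (f (κ ⊝ e′)) (V q))
      where
      eq : ∀ a b x v → (a + b) * x + v ≡ a * x + (b * x + v)
      eq = solve-∀
    ... | no _ = trans (cong (λ z → ev c′ ν * f (κ ⊝ e′) + z) (val-insert c e q)) (eq (ev c′ ν * f (κ ⊝ e′)) (ev c ν * f (κ ⊝ e)) (V q))
      where
      eq : ∀ a b v → a + (b + v) ≡ b + (a + v)
      eq = solve-∀

    opaque
      unfolding normalise

      val-normalise : ∀ q → V (normalise q) ≡ V q
      val-normalise [] = refl
      val-normalise ((c , e) ∷ q) = trans (val-insert c e (normalise q)) (cong (λ z → ev c ν * f (κ ⊝ e) + z) (val-normalise q))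

    val-scale : ∀ c q → V (scale c q) ≡ ev c ν * V q
    val-scale c [] = sym (ℤₚ.*-zeroʳ (ev c ν))
    val-scale c ((c′ , e) ∷ q) = trans (cong₂ (λ x y → x * f (κ ⊝ e) + y) (ev-mul₁ c c′ ν) (val-scale c q)) (eq (ev c ν) (ev c′ ν) (f (κ ⊝ e)) (V q))
      where
      eq : ∀ a b x v → a * b * x + a * v ≡ a * (b * x + v)
      eq = solve-∀

    val-isZero : ∀ q → isZero q ≡ true → V q ≡ 0ℤ
    val-isZero [] _ = refl
    val-isZero ((c , e) ∷ q) p with isZero₁ c in eq
    ... | true = cong₂ (λ x y → x * f (κ ⊝ e) + y) (ev-isZero₁ c eq) (val-isZero q p)
      where
      ev-isZero₁ : ∀ c → isZero₁ c ≡ true → ev c ν ≡ 0ℤ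
      ev-isZero₁ [] _ = refl
      ev-isZero₁ (+ zero ∷ c) p = trans (cong (λ t → 0ℤ + ν * t) (ev-isZero₁ c p)) (cong (λ z → 0ℤ + z) (ℤₚ.*-zeroʳ ν))
      ev-isZero₁ (+ suc _ ∷ c) ()
      ev-isZero₁ (-[1+ _ ] ∷ c) ()

    val-for : ∀ g → V (for g) ≡ Σ4 (λ j → V (g j))
    val-for g = trans (val-++ (g 0F) _) (trans (cong (λ z → V (g 0F) + z) (trans (val-++ (g 1F) _) (cong (λ z → V (g 1F) + z)
      (trans (val-++ (g 2F) _) (cong (λ z → V (g 2F) + z) (val-++ (g 3F) []))))))
      (trans (eq (V (g 0F)) (V (g 1F)) (V (g 2F)) (V (g 3F))) (sym (Σ4-def _))))
      where
      eq : ∀ a b c d → a + (b + (c + (d + 0ℤ))) ≡ a + b + c + d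
      eq = solve-∀

  val-mulP : ∀ ν f κ i q → val ν f κ (mulP i q) ≡ val ν (mul i f) κ q
  val-mulP ν f κ i [] = refl
  val-mulP ν f κ i ((c , e) ∷ q) = begin
    a 0F * x 0F + (a 1F * x 1F + (a 2F * x 2F + (a 3F * x 3F + val ν f κ (mulP i q))))
      ≡⟨ eq (a 0F * x 0F) (a 1F * x 1F) (a 2F * x 2F) (a 3F * x 3F) (val ν f κ (mulP i q)) ⟩
    (a 0F * x 0F + a 1F * x 1F + a 2F * x 2F + a 3F * x 3F) + val ν f κ (mulP i q)
      ≡⟨ cong₂ _+_ (sym (Σ4-def (λ l → a l * x l))) (val-mulP ν f κ i q) ⟩
    Σ4 (λ l → a l * x l) + val ν (mul i f) κ q
      ≡⟨ cong (_+ val ν (mul i f) κ q) (trans (Σ4-cong λ l → trans (cong (_* x l) (ev-scale₁ (M i l) c ν))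
           (trans (regroup (M i l) (ev c ν) (x l)) (cong (λ z → ev c ν * (M i l * f z)) (sym (⊝-bump l -1ℤ κ e)))))
           (Σ4-* (ev c ν) (λ l → M i l * f (bump l -1ℤ (κ ⊝ e))))) ⟩
    ev c ν * mul i f (κ ⊝ e) + val ν (mul i f) κ q ∎
    where
    open ≡-Reasoning
    a x : Fin 4 → ℤ
    a l = ev (scale₁ (M i l) c) ν
    x l = f (κ ⊝ bump l 1ℤ e)
    eq : ∀ a b c d v → a + (b + (c + (d + v))) ≡ (a + b + c + d) + v
    eq = solve-∀
    regroup : ∀ m c x → m * c * x ≡ c * (m * x)
    regroup = solve-∀

  opaque
    unfolding mulAllP

    val-mulAllP : ∀ ν f κ q → val ν f κ (mulAllP q) ≡ val ν (mulAll f) κ q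
    val-mulAllP ν f κ q = begin
      val ν f κ (normalise (mulP 3F q₂)) ≡⟨ val-normalise ν f κ (mulP 3F q₂) ⟩
      val ν f κ (mulP 3F q₂) ≡⟨ val-mulP ν f κ 3F q₂ ⟩
      val ν f₃ κ (normalise (mulP 2F q₁)) ≡⟨ val-normalise ν f₃ κ (mulP 2F q₁) ⟩
      val ν f₃ κ (mulP 2F q₁) ≡⟨ val-mulP ν f₃ κ 2F q₁ ⟩
      val ν f₂ κ (normalise (mulP 1F q₀)) ≡⟨ val-normalise ν f₂ κ (mulP 1F q₀) ⟩
      val ν f₂ κ (mulP 1F q₀) ≡⟨ val-mulP ν f₂ κ 1F q₀ ⟩
      val ν f₁ κ (normalise (mulP 0F q)) ≡⟨ val-normalise ν f₁ κ (mulP 0F q) ⟩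
      val ν f₁ κ (mulP 0F q) ≡⟨ val-mulP ν f₁ κ 0F q ⟩
      val ν (mul 0F f₁) κ q ≡⟨ val-ext (mul-comm₄ f) q ⟩
      val ν (mulAll f) κ q ∎
      where
      open ≡-Reasoning
      q₀ q₁ q₂ : Poly
      q₀ = normalise (mulP 0F q)
      q₁ = normalise (mulP 1F q₀)
      q₂ = normalise (mulP 2F q₁)
      f₁ f₂ f₃ : Coeffs
      f₃ = mul 3F f
      f₂ = mul 2F f₃
      f₁ = mul 1F f₂
      mul-comm₄ : ∀ f κ → mul 0F (mul 1F (mul 2F (mul 3F f))) κ ≡ mulAll f κ
      mul-comm₄ f κ = refl
      val-ext : ∀ {g h} → (∀ κ → g κ ≡ h κ) → ∀ q → val ν g κ q ≡ val ν h κ q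
      val-ext e [] = refl
      val-ext e ((c , d) ∷ q) = cong₂ (λ x y → ev c ν * x + y) (e _) (val-ext e q)

  -- For f = `F m` and ν = m + 1 the number 3(ν - 1) is the eigenvalue of `count i` at f, so each
  -- relation vanishes. The point `diag (ν + 1ℤ)` is the one at which T(m + 2) is read.
  val-relation : ∀ ν f i e → let κ = diag (ν + 1ℤ) in
    val ν f κ (relation i e) ≡ count i f (κ ⊝ e) - + 3 * (ν - 1ℤ) * f (κ ⊝ e)
  val-relation ν f i e = begin
    ev (+ 3 ∷ - + 3 ∷ []) ν * f (κ ⊝ e) + V (for λ l → for λ j → t l j ∷ [])
      ≡⟨ cong (λ z → ev (+ 3 ∷ - + 3 ∷ []) ν * f (κ ⊝ e) + z) (trans (val-for ν f κ (λ l → for λ j → t l j ∷ [])) (Σ4-cong λ l →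
           trans (val-for ν f κ (λ j → t l j ∷ [])) (trans (Σ4-cong λ j → term-value l j) (Σ4-* (M i l) (h l))))) ⟩
    ev (+ 3 ∷ - + 3 ∷ []) ν * f (κ ⊝ e) + count i f (κ ⊝ e)
      ≡⟨ eq ν (f (κ ⊝ e)) (count i f (κ ⊝ e)) ⟩
    count i f (κ ⊝ e) - + 3 * (ν - 1ℤ) * f (κ ⊝ e) ∎
    where
    open ≡-Reasoning
    κ = diag (ν + 1ℤ)
    V = val ν f κ
    t : Fin 4 → Fin 4 → Poly₁ × P4
    t l j = scale₁ (M i l * M i j) (+ 2 - coord j (bump l 1ℤ e) ∷ 1ℤ ∷ []) , bump j -1ℤ (bump l 1ℤ e)
    h : Fin 4 → Fin 4 → ℤ
    h l j = M i j * ((coord j (bump l -1ℤ (κ ⊝ e)) + 1ℤ) * f (bump j 1ℤ (bump l -1ℤ (κ ⊝ e))))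
    eq : ∀ ν x y → (+ 3 + ν * (- + 3 + ν * 0ℤ)) * x + y ≡ y - + 3 * (ν - 1ℤ) * x
    eq = solve-∀
    coord-⊝ : ∀ j e → coord j (κ ⊝ e) ≡ ν + 1ℤ - coord j e
    coord-⊝ 0F (pt _ _ _ _) = refl
    coord-⊝ 1F (pt _ _ _ _) = refl
    coord-⊝ 2F (pt _ _ _ _) = refl
    coord-⊝ 3F (pt _ _ _ _) = refl
    lin : ∀ a b ν c x → a * b * (+ 2 - c + ν * (1ℤ + ν * 0ℤ)) * x + 0ℤ ≡ a * (b * ((ν + 1ℤ - c + 1ℤ) * x))
    lin = solve-∀
    term-value : ∀ l j → V (t l j ∷ []) ≡ M i l * h l j
    term-value l j = begin
      ev (scale₁ (M i l * M i j) (+ 2 - c ∷ 1ℤ ∷ [])) ν * y + 0ℤ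
        ≡⟨ cong (λ z → z * y + 0ℤ) (ev-scale₁ (M i l * M i j) (+ 2 - c ∷ 1ℤ ∷ []) ν) ⟩
      M i l * M i j * (+ 2 - c + ν * (1ℤ + ν * 0ℤ)) * y + 0ℤ
        ≡⟨ lin (M i l) (M i j) ν c y ⟩
      M i l * (M i j * ((ν + 1ℤ - c + 1ℤ) * y))
        ≡⟨ cong₂ (λ x z → M i l * (M i j * ((x + 1ℤ) * f z))) coord-value (sym point-value) ⟩
      M i l * h l j ∎
      where
      c y : ℤ
      c = coord j (bump l 1ℤ e)
      y = f (κ ⊝ bump j -1ℤ (bump l 1ℤ e))
      coord-value : ν + 1ℤ - c ≡ coord j (bump l -1ℤ (κ ⊝ e))
      coord-value = sym (trans (cong (coord j) (⊝-bump l -1ℤ κ e)) (coord-⊝ j (bump l 1ℤ e)))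
      point-value : bump j 1ℤ (bump l -1ℤ (κ ⊝ e)) ≡ κ ⊝ bump j -1ℤ (bump l 1ℤ e)
      point-value = trans (cong (bump j 1ℤ) (⊝-bump l -1ℤ κ e)) (⊝-bump j 1ℤ κ (bump l 1ℤ e))

  -- The recurrence of T.

  T : ℕ → ℤ
  T n = F n (diag (+ n))

  module _ (m : ℕ) where
    private
      ν = + suc m
      κ = diag (ν + 1ℤ)
      V = val ν (F m) κ

    relation-vanishes : ∀ i e → V (relation i e) ≡ 0ℤ
    relation-vanishes i e = trans (val-relation ν (F m) i e)
      (trans (cong (_- + 3 * (ν - 1ℤ) * F m (κ ⊝ e)) (count-F i m (κ ⊝ e))) (eq (+ m) (F m (κ ⊝ e))))
      where
      eq : ∀ m x → + 3 * m * x - + 3 * (1ℤ + m - 1ℤ) * x ≡ 0ℤ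
      eq = solve-∀

    combination-vanishes : ∀ xs → V (combination xs) ≡ 0ℤ
    combination-vanishes [] = refl
    combination-vanishes ((c , i , e) ∷ xs) = trans (val-++ ν (F m) κ (scale c (relation i e)) (combination xs))
      (cong₂ _+_ (trans (val-scale ν (F m) κ c (relation i e)) (trans (cong (ev c ν *_) (relation-vanishes i e)) (ℤₚ.*-zeroʳ (ev c ν))))
                 (combination-vanishes xs))

    recurrence-vanishes : V recurrence ≡ 0ℤ
    recurrence-vanishes = ℤₚ.*-cancelˡ-≡ (- + 4) (V recurrence) 0ℤ (begin
      - + 4 * V recurrence ≡⟨ cong (_* V recurrence) (four ν) ⟨
      ev (- + 4 ∷ []) ν * V recurrence ≡⟨ val-scale ν (F m) κ (- + 4 ∷ []) recurrence ⟨
      V (scale (- + 4 ∷ []) recurrence) ≡⟨ ℤₚ.+-identityʳ (V (scale (- + 4 ∷ []) recurrence)) ⟨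
      V (scale (- + 4 ∷ []) recurrence) + 0ℤ ≡⟨ cong (λ z → V (scale (- + 4 ∷ []) recurrence) + z) (combination-vanishes certificate) ⟨
      V (scale (- + 4 ∷ []) recurrence) + V (combination certificate) ≡⟨ val-++ ν (F m) κ (scale (- + 4 ∷ []) recurrence) (combination certificate) ⟨
      V total ≡⟨ val-normalise ν (F m) κ total ⟨
      V (normalise total) ≡⟨ val-isZero ν (F m) κ (normalise total) certified ⟩
      0ℤ ∎)
      where
      open ≡-Reasoning
      total = scale (- + 4 ∷ []) recurrence ++ combination certificate
      four : ∀ ν → - + 4 + ν * 0ℤ ≡ - + 4
      four = solve-∀

    -- Each factor L₀L₁L₂L₃ in `recurrence` turns `F m` into its successor, and the shifts `diag 0`,
    -- `diag 1`, `diag 2` move the reading point from m + 2 down to the diagonal that belongs to the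
    -- resulting power.
    T-recurrence : ev cubic₂ ν * T (2 ℕ.+ m) + (ev cubic₁ ν * T (suc m) + ev cubic₀ ν * T m) ≡ 0ℤ
    T-recurrence = trans (sym value) recurrence-vanishes
      where
      open ≡-Reasoning
      p₂ p₁ p₀ : Poly
      p₂ = (cubic₂ , diag (+ 0)) ∷ []
      p₁ = (cubic₁ , diag (+ 1)) ∷ []
      p₀ = (cubic₀ , diag (+ 2)) ∷ []
      single : ∀ c n a → ν + 1ℤ - a ≡ + n → val ν (F n) κ ((c , diag a) ∷ []) ≡ ev c ν * T n
      single c n a eq = trans (ℤₚ.+-identityʳ (ev c ν * F n (κ ⊝ diag a))) (cong (λ z → ev c ν * F n z) (pt-cong eq eq eq eq))
      s₂ : ∀ m → 1ℤ + m + 1ℤ - 0ℤ ≡ + 2 + m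
      s₂ = solve-∀
      s₁ : ∀ m → 1ℤ + m + 1ℤ - 1ℤ ≡ 1ℤ + m
      s₁ = solve-∀
      s₀ : ∀ m → 1ℤ + m + 1ℤ - + 2 ≡ m
      s₀ = solve-∀
      v₂ : V (mulAllP (mulAllP p₂)) ≡ ev cubic₂ ν * T (2 ℕ.+ m)
      v₂ = trans (val-mulAllP ν (F m) κ (mulAllP p₂)) (trans (val-mulAllP ν (F (suc m)) κ p₂) (single cubic₂ (2 ℕ.+ m) (+ 0) (s₂ (+ m))))
      v₁ : V (mulAllP p₁) ≡ ev cubic₁ ν * T (suc m)
      v₁ = trans (val-mulAllP ν (F m) κ p₁) (single cubic₁ (suc m) (+ 1) (s₁ (+ m)))
      value : V recurrence ≡ ev cubic₂ ν * T (2 ℕ.+ m) + (ev cubic₁ ν * T (suc m) + ev cubic₀ ν * T m)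
      value = begin
        V recurrence ≡⟨ cong V recurrence-def ⟩
        V (mulAllP (mulAllP p₂) ++ mulAllP p₁ ++ p₀) ≡⟨ val-++ ν (F m) κ (mulAllP (mulAllP p₂)) (mulAllP p₁ ++ p₀) ⟩
        V (mulAllP (mulAllP p₂)) + V (mulAllP p₁ ++ p₀) ≡⟨ cong₂ _+_ v₂ (trans (val-++ ν (F m) κ (mulAllP p₁) p₀) (cong₂ _+_ v₁ (single cubic₀ m (+ 2) (s₀ (+ m))))) ⟩
        ev cubic₂ ν * T (2 ℕ.+ m) + (ev cubic₁ ν * T (suc m) + ev cubic₀ ν * T m) ∎

  -- The same recurrence for Aδ, by creative telescoping.

  C-! : ∀ a b → ((a ℕ.+ b) C a) ℕ.* (a ! ℕ.* b !) ≡ (a ℕ.+ b) !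
  C-! a b = begin
    ((a ℕ.+ b) C a) ℕ.* (a ! ℕ.* b !)
      ≡⟨ cong (λ c → ((a ℕ.+ b) C a) ℕ.* (a ! ℕ.* c !)) (ℕₚ.m+n∸m≡n a b) ⟨
    ((a ℕ.+ b) C a) ℕ.* (a ! ℕ.* (a ℕ.+ b ℕ.∸ a) !)
      ≡⟨ cong (ℕ._* (a ! ℕ.* (a ℕ.+ b ℕ.∸ a) !)) (nCk≡n!/k![n-k]! a≤a+b) ⟩
    ((a ℕ.+ b) ! ℕᵐ./ (a ! ℕ.* (a ℕ.+ b ℕ.∸ a) !)) ℕ.* (a ! ℕ.* (a ℕ.+ b ℕ.∸ a) !)
      ≡⟨ ℕᵐ.m/n*n≡m (k![n∸k]!∣n! a≤a+b) ⟩
    (a ℕ.+ b) ! ∎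
    where
    open ≡-Reasoning
    a≤a+b = ℕₚ.m≤m+n a b
    instance _ = a ℕₚ.!* (a ℕ.+ b ℕ.∸ a) !≢0

  opaque
    bin : ℕ → ℕ → ℕ
    bin a b = (a ℕ.+ b) C a

    bin≡C : ∀ a b → bin a b ≡ (a ℕ.+ b) C a
    bin≡C a b = refl

    bin-! : ∀ a b → bin a b ℕ.* (a ! ℕ.* b !) ≡ (a ℕ.+ b) !
    bin-! = C-!

  multi3-! : ∀ k → multi3 k ℕ.* (k ! ℕ.* k ! ℕ.* k !) ≡ (3 ℕ.* k) !
  multi3-! k = ℕᵐ.m/n*n≡m {{nz}} (ℕᵈ.divides (bin k (k ℕ.+ k) ℕ.* bin k k) (begin
    (3 ℕ.* k) ! ≡⟨ cong _! (three k) ⟩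
    (k ℕ.+ (k ℕ.+ k)) ! ≡⟨ bin-! k (k ℕ.+ k) ⟨
    bin k (k ℕ.+ k) ℕ.* (k ! ℕ.* (k ℕ.+ k) !) ≡⟨ cong (λ x → bin k (k ℕ.+ k) ℕ.* (k ! ℕ.* x)) (bin-! k k) ⟨
    bin k (k ℕ.+ k) ℕ.* (k ! ℕ.* (bin k k ℕ.* (k ! ℕ.* k !))) ≡⟨ eq (bin k (k ℕ.+ k)) (k !) (bin k k) ⟩
    bin k (k ℕ.+ k) ℕ.* bin k k ℕ.* (k ! ℕ.* k ! ℕ.* k !) ∎))
    where
    open ≡-Reasoning
    nz = ℕₚ.m*n≢0 (k ! ℕ.* k !) (k !) {{ℕₚ.m*n≢0 (k !) (k !) {{k ℕₚ.!≢0}} {{k ℕₚ.!≢0}}}} {{k ℕₚ.!≢0}}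
    three : ∀ k → 3 ℕ.* k ≡ k ℕ.+ (k ℕ.+ k)
    three = ℕS.solve-∀
    eq : ∀ a f b → a ℕ.* (f ℕ.* (b ℕ.* (f ℕ.* f))) ≡ a ℕ.* b ℕ.* (f ℕ.* f ℕ.* f)
    eq = ℕS.solve-∀

  term-vanishes : ∀ n k → n ℕ.< 3 ℕ.* k → term n k ≡ 0ℤ
  term-vanishes n k n<3k rewrite k>n⇒nCk≡0 n<3k | ℕₚ.*-zeroʳ (3 ℕ.^ (n ℕ.∸ 3 ℕ.* k)) = ℤₚ.*-zeroʳ (sign k)

  fourth : ℕ → ℕ
  fourth x = x ℕ.* x ℕ.* (x ℕ.* x)

  -- The factorials n! and (3k)! cancel among the binomials, leaving the hypergeometric form (-1)ᵏ
  -- 3ʲ (n + k)! / (k!⁴ j!) with j = n - 3k.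
  term-! : ∀ k j → let n = 3 ℕ.* k ℕ.+ j in
    term n k * + (fourth (k !) ℕ.* j !) ≡ sign k * + (3 ℕ.^ j ℕ.* (n ℕ.+ k) !)
  term-! k j = begin
    sign k * + w * + d ≡⟨ ℤₚ.*-assoc (sign k) (+ w) (+ d) ⟩
    sign k * (+ w * + d) ≡⟨ cong (λ z → sign k * z) (ℤₚ.pos-* w d) ⟨
    sign k * + (w ℕ.* d) ≡⟨ cong (λ x → sign k * + x) (ℕₚ.*-cancelʳ-≡ (w ℕ.* d) (3 ℕ.^ j ℕ.* (n ℕ.+ k) !) (t ℕ.* n !) natural) ⟩
    sign k * + (3 ℕ.^ j ℕ.* (n ℕ.+ k) !) ∎
    where
    open ≡-Reasoning
    n t w d : ℕ
    n = 3 ℕ.* k ℕ.+ j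
    t = (3 ℕ.* k) !
    w = 3 ℕ.^ (n ℕ.∸ 3 ℕ.* k) ℕ.* (n C (3 ℕ.* k)) ℕ.* ((n ℕ.+ k) C n) ℕ.* multi3 k
    d = fourth (k !) ℕ.* j !
    instance _ = ℕₚ.m*n≢0 t (n !) {{(3 ℕ.* k) ℕₚ.!≢0}} {{n ℕₚ.!≢0}}
    eq : ∀ p a b c f g t h → p ℕ.* a ℕ.* b ℕ.* c ℕ.* (f ℕ.* f ℕ.* (f ℕ.* f) ℕ.* g) ℕ.* (t ℕ.* h) ≡
      p ℕ.* (b ℕ.* (h ℕ.* f)) ℕ.* ((c ℕ.* (f ℕ.* f ℕ.* f)) ℕ.* (a ℕ.* (t ℕ.* g)))
    eq = ℕS.solve-∀
    natural : w ℕ.* d ℕ.* (t ℕ.* n !) ≡ 3 ℕ.^ j ℕ.* (n ℕ.+ k) ! ℕ.* (t ℕ.* n !)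
    natural = trans (eq (3 ℕ.^ (n ℕ.∸ 3 ℕ.* k)) (n C (3 ℕ.* k)) ((n ℕ.+ k) C n) (multi3 k) (k !) (j !) t (n !))
      (cong₂ ℕ._*_ (cong₂ (λ x y → 3 ℕ.^ x ℕ.* y) (ℕₚ.m+n∸m≡n (3 ℕ.* k) j) (C-! n k))
                   (cong₂ ℕ._*_ (multi3-! k) (C-! (3 ℕ.* k) j)))

  fall : ℕ → ℕ → ℤ
  fall zero q = 1ℤ
  fall (suc a) zero = 0ℤ
  fall (suc a) (suc q) = + suc q * fall a q

  -- Brings the terms for neighbouring n over one denominator k!⁴ q!, since 1/(q - a)! is the
  -- falling factorial `fall a q` divided by q!. For q < a both sides are 0: the term because n <
  -- 3k, the falling factorial because it meets the factor 0.
  term-shift : ∀ a k q n → n ℕ.+ a ≡ 3 ℕ.* k ℕ.+ q →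
    + (3 ℕ.^ a) * term n k * + (fourth (k !) ℕ.* q !) ≡ sign k * + (3 ℕ.^ q) * fall a q * + ((n ℕ.+ k) !)
  term-shift zero k q n e with refl ← trans (sym (ℕₚ.+-identityʳ n)) e = begin
    1ℤ * term n k * + (fourth (k !) ℕ.* q !) ≡⟨ cong (_* + (fourth (k !) ℕ.* q !)) (ℤₚ.*-identityˡ (term n k)) ⟩
    term n k * + (fourth (k !) ℕ.* q !) ≡⟨ term-! k q ⟩
    sign k * + (3 ℕ.^ q ℕ.* (n ℕ.+ k) !) ≡⟨ cong (λ z → sign k * z) (ℤₚ.pos-* (3 ℕ.^ q) ((n ℕ.+ k) !)) ⟩
    sign k * (+ (3 ℕ.^ q) * + ((n ℕ.+ k) !)) ≡⟨ eq (sign k) (+ (3 ℕ.^ q)) (+ ((n ℕ.+ k) !)) ⟩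
    sign k * + (3 ℕ.^ q) * 1ℤ * + ((n ℕ.+ k) !) ∎
    where
    open ≡-Reasoning
    eq : ∀ a b c → a * (b * c) ≡ a * b * 1ℤ * c
    eq = solve-∀
  term-shift (suc a) k zero n e = trans
    (cong (λ z → + (3 ℕ.^ suc a) * z * + (fourth (k !) ℕ.* 1)) (term-vanishes n k n<3k))
    (eq (+ (3 ℕ.^ suc a)) (+ (fourth (k !) ℕ.* 1)) (sign k) (+ ((n ℕ.+ k) !)))
    where
    n<3k : n ℕ.< 3 ℕ.* k
    n<3k = ℕₚ.≤-trans (ℕₚ.m≤m+n (suc n) a) (ℕₚ.≤-reflexive (trans (sym (ℕₚ.+-suc n a)) (trans e (ℕₚ.+-identityʳ (3 ℕ.* k)))))
    eq : ∀ x y s z → x * 0ℤ * y ≡ s * 1ℤ * 0ℤ * z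
    eq = solve-∀
  term-shift (suc a) k (suc q) n e = begin
    + (3 ℕ.^ suc a) * t * + (f ℕ.* (suc q ℕ.* q !))
      ≡⟨ cong₂ (λ x y → x * t * y) (ℤₚ.pos-* 3 (3 ℕ.^ a)) (trans (ℤₚ.pos-* f (suc q ℕ.* q !)) (trans (cong (λ z → + f * z) (ℤₚ.pos-* (suc q) (q !))) refl)) ⟩
    + 3 * + (3 ℕ.^ a) * t * (+ f * (+ suc q * + (q !)))
      ≡⟨ eq₁ (+ (3 ℕ.^ a)) t (+ f) (+ suc q) (+ (q !)) ⟩
    + 3 * + suc q * (+ (3 ℕ.^ a) * t * (+ f * + (q !)))
      ≡⟨ cong (λ z → + 3 * + suc q * (+ (3 ℕ.^ a) * t * z)) (ℤₚ.pos-* f (q !)) ⟨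
    + 3 * + suc q * (+ (3 ℕ.^ a) * t * + (f ℕ.* q !))
      ≡⟨ cong (λ z → + 3 * + suc q * z) (term-shift a k q n (ℕₚ.suc-injective (trans (sym (ℕₚ.+-suc n a)) (trans e (ℕₚ.+-suc (3 ℕ.* k) q))))) ⟩
    + 3 * + suc q * (sign k * + (3 ℕ.^ q) * fall a q * + ((n ℕ.+ k) !))
      ≡⟨ eq₂ (+ suc q) (sign k) (+ (3 ℕ.^ q)) (fall a q) (+ ((n ℕ.+ k) !)) ⟩
    sign k * (+ 3 * + (3 ℕ.^ q)) * (+ suc q * fall a q) * + ((n ℕ.+ k) !)
      ≡⟨ cong (λ z → sign k * z * (+ suc q * fall a q) * + ((n ℕ.+ k) !)) (ℤₚ.pos-* 3 (3 ℕ.^ q)) ⟨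
    sign k * + (3 ℕ.^ suc q) * (+ suc q * fall a q) * + ((n ℕ.+ k) !) ∎
    where
    open ≡-Reasoning
    t = term n k
    f = fourth (k !)
    eq₁ : ∀ a t f q g → + 3 * a * t * (f * (q * g)) ≡ + 3 * q * (a * t * (f * g))
    eq₁ = solve-∀
    eq₂ : ∀ q s w x y → + 3 * q * (s * w * x * y) ≡ s * (+ 3 * w) * (q * x) * y
    eq₂ = solve-∀

  fall₁ : ∀ q → fall 1 q ≡ + q
  fall₁ zero = refl
  fall₁ (suc q) = ℤₚ.*-identityʳ (+ suc q)

  fall₂ : ∀ q → fall 2 q ≡ + q * (+ q - 1ℤ)
  fall₂ zero = refl
  fall₂ (suc q) = cong (λ z → + suc q * z) (trans (fall₁ q) (eq (+ q)))
    where
    eq : ∀ q → q ≡ 1ℤ + q - 1ℤ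
    eq = solve-∀

  fall₃ : ∀ q → fall 3 q ≡ + q * ((+ q - 1ℤ) * (+ q - + 2))
  fall₃ zero = refl
  fall₃ (suc q) = cong (λ z → + suc q * z) (trans (fall₂ q) (eq (+ q)))
    where
    eq : ∀ q → q * (q - 1ℤ) ≡ (1ℤ + q - 1ℤ) * (1ℤ + q - + 2)
    eq = solve-∀

  +suc! : ∀ x → + (suc x !) ≡ (1ℤ + + x) * + (x !)
  +suc! x = ℤₚ.pos-* (suc x) (x !)

  -- Zeilberger's certificate: g n k · term (n - 1) k is the antidifference of the recurrence at k + 1.
  g : ℤ → ℤ → ℤ
  g ν k = + 12 * (+ 4 * ν + 1ℤ) * (ν + k) * (ν - 1ℤ - + 3 * k)

  module _ (m : ℕ) where
    private ν = + suc m

    G : ℕ → ℤ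
    G zero = 0ℤ
    G (suc k) = g ν (+ k) * term m k

    step : ℕ → ℤ
    step k = ev cubic₂ ν * term (2 ℕ.+ m) k + (ev cubic₁ ν * term (1 ℕ.+ m) k + ev cubic₀ ν * term m k)

    step-0 : step 0 ≡ G 1
    step-0 = begin
      step 0 ≡⟨ cong₂ (λ x y → ev cubic₂ ν * x + y) (pow (2 ℕ.+ m)) (cong₂ (λ x y → ev cubic₁ ν * x + ev cubic₀ ν * y) (pow (1 ℕ.+ m)) (pow m)) ⟩
      ev cubic₂ ν * + (3 ℕ.^ (2 ℕ.+ m)) + (ev cubic₁ ν * + (3 ℕ.^ (1 ℕ.+ m)) + ev cubic₀ ν * w)
        ≡⟨ cong₂ (λ x y → ev cubic₂ ν * x + (ev cubic₁ ν * y + ev cubic₀ ν * w)) (trans (ℤₚ.pos-* 3 (3 ℕ.* 3 ℕ.^ m)) (cong (λ z → + 3 * z) (ℤₚ.pos-* 3 (3 ℕ.^ m)))) (ℤₚ.pos-* 3 (3 ℕ.^ m)) ⟩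
      ev cubic₂ ν * (+ 3 * (+ 3 * w)) + (ev cubic₁ ν * (+ 3 * w) + ev cubic₀ ν * w) ≡⟨ eq ν w ⟩
      g ν 0ℤ * w ≡⟨ cong (λ z → g ν 0ℤ * z) (pow m) ⟨
      g ν 0ℤ * term m 0 ∎
      where
      open ≡-Reasoning
      w = + (3 ℕ.^ m)
      pow : ∀ n → term n 0 ≡ + (3 ℕ.^ n)
      pow n = ℤₚ.*-cancelʳ-≡ (term n 0) (+ (3 ℕ.^ n)) (+ (n !)) {{n ℕₚ.!≢0}}
        (trans (cong (λ x → term n 0 * + x) (sym (ℕₚ.*-identityˡ (n !)))) (trans (term-! 0 n) (trans (ℤₚ.*-identityˡ _)
          (trans (cong (λ x → + (3 ℕ.^ n ℕ.* x !)) (ℕₚ.+-identityʳ n)) (ℤₚ.pos-* (3 ℕ.^ n) (n !))))))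
      eq : ∀ ν w → (+ 1 + ν * (+ 3 + ν * (+ 3 + ν * (+ 1 + ν * 0ℤ)))) * (+ 3 * (+ 3 * w)) +
        ((- + 3 + ν * (- + 13 + ν * (- + 21 + ν * (- + 14 + ν * 0ℤ)))) * (+ 3 * w) + (+ 0 + ν * (+ 0 + ν * (+ 0 + ν * (+ 81 + ν * 0ℤ)))) * w)
        ≡ + 12 * (+ 4 * ν + 1ℤ) * (ν + 0ℤ) * (ν - 1ℤ - + 3 * 0ℤ) * w
      eq = solve-∀

  private
    -- The telescoping step at k + 1 multiplied by 27 (k + 1)!⁴ q!, for m = 3k + q and μ = m + k.
    -- Here X stands for (-1)ᵏ 3^q (m + k)!; the minus signs come from passing to k + 1, the fourth
    -- power of 1 + κ from (k + 1)!⁴ / k!⁴.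
    polynomial : ∀ κ q X → let ν = 1ℤ + (+ 3 * κ + q); μ = + 3 * κ + q + κ in
      + 9 * (+ 1 + ν * (+ 3 + ν * (+ 3 + ν * (+ 1 + ν * 0ℤ)))) * (- X * q * ((+ 3 + μ) * ((+ 2 + μ) * (1ℤ + μ)))) +
      (+ 3 * (- + 3 + ν * (- + 13 + ν * (- + 21 + ν * (- + 14 + ν * 0ℤ)))) * (- X * (q * (q - 1ℤ)) * ((+ 2 + μ) * (1ℤ + μ))) +
       (+ 0 + ν * (+ 0 + ν * (+ 0 + ν * (+ 81 + ν * 0ℤ)))) * (- X * (q * ((q - 1ℤ) * (q - + 2))) * (1ℤ + μ)))
      ≡ + 12 * (+ 4 * ν + 1ℤ) * (ν + (1ℤ + κ)) * (ν - 1ℤ - + 3 * (1ℤ + κ)) * (- X * (q * ((q - 1ℤ) * (q - + 2))) * (1ℤ + μ))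
        - + 27 * (+ 12 * (+ 4 * ν + 1ℤ) * (ν + κ) * (ν - 1ℤ - + 3 * κ)) * ((1ℤ + κ) * (1ℤ + κ) * ((1ℤ + κ) * (1ℤ + κ)) * X)
    polynomial = solve-∀

    collect : ∀ c₂ c₁ c₀ t₂ t₁ t₀ D → + 27 * D * (c₂ * t₂ + (c₁ * t₁ + c₀ * t₀)) ≡
      + 9 * c₂ * (+ 3 * t₂ * D) + (+ 3 * c₁ * (+ 9 * t₁ * D) + c₀ * (+ 27 * t₀ * D))
    collect = solve-∀

    collect′ : ∀ g₁ g₀ t₀ t D → + 27 * D * (g₁ * t₀ - g₀ * t) ≡ g₁ * (+ 27 * t₀ * D) - + 27 * g₀ * (t * D)
    collect′ = solve-∀

  -- If m < 3k, then m + 2 < 3(k + 1) and every term involved is 0. Otherwise m = 3k + q, the shifts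
  -- a = 1, 2, 3 of `term-shift` bring all terms to one denominator, and only `polynomial` is left.
  step-suc : ∀ m k → step m (suc k) ≡ G m (2 ℕ.+ k) - G m (suc k)
  step-suc m k with ℕₚ.≤-<-connex (3 ℕ.* k) m
  ... | inj₂ m<3k = begin
    step m (suc k)
      ≡⟨ cong₂ (λ x y → ev cubic₂ ν * x + y) (term-vanishes (2 ℕ.+ m) (suc k) (bound 2 (s≤s (s≤s z≤n))))
          (cong₂ (λ x y → ev cubic₁ ν * x + ev cubic₀ ν * y) (term-vanishes (1 ℕ.+ m) (suc k) (bound 1 (s≤s z≤n))) vanish₀) ⟩
    ev cubic₂ ν * 0ℤ + (ev cubic₁ ν * 0ℤ + ev cubic₀ ν * 0ℤ) ≡⟨ eq (ev cubic₂ ν) (ev cubic₁ ν) (ev cubic₀ ν) (g ν (+ suc k)) (g ν (+ k)) ⟩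
    g ν (+ suc k) * 0ℤ - g ν (+ k) * 0ℤ ≡⟨ cong₂ (λ x y → g ν (+ suc k) * x - g ν (+ k) * y) vanish₀ (term-vanishes m k m<3k) ⟨
    G m (2 ℕ.+ k) - G m (suc k) ∎
    where
    open ≡-Reasoning
    ν = + suc m
    three : ∀ k → 3 ℕ.+ 3 ℕ.* k ≡ 3 ℕ.* suc k
    three = ℕS.solve-∀
    bound : ∀ a → a ℕ.≤ 2 → a ℕ.+ m ℕ.< 3 ℕ.* suc k
    bound a a≤2 = ℕₚ.≤-trans (ℕₚ.+-mono-≤ (s≤s a≤2) (ℕₚ.<⇒≤ m<3k)) (ℕₚ.≤-reflexive (three k))
    vanish₀ : term m (suc k) ≡ 0ℤ
    vanish₀ = term-vanishes m (suc k) (bound 0 z≤n)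
    eq : ∀ a b c x y → a * 0ℤ + (b * 0ℤ + c * 0ℤ) ≡ x * 0ℤ - y * 0ℤ
    eq = solve-∀
  ... | inj₁ 3k≤m with ℕₚ.m≤n⇒∃[o]m+o≡n 3k≤m
  ... | q , refl = ℤₚ.*-cancelˡ-≡ (+ 27 * D) (step m (suc k)) (G m (2 ℕ.+ k) - G m (suc k)) {{ℤₚ.i*j≢0 (+ 27) D}} (begin
    + 27 * D * (c₂ * t₂ + (c₁ * t₁ + c₀ * t₀)) ≡⟨ collect c₂ c₁ c₀ t₂ t₁ t₀ D ⟩
    + 9 * c₂ * (+ 3 * t₂ * D) + (+ 3 * c₁ * (+ 9 * t₁ * D) + c₀ * (+ 27 * t₀ * D))
      ≡⟨ cong₂ (λ x y → + 9 * c₂ * x + y) e₂ (cong₂ (λ x y → + 3 * c₁ * x + c₀ * y) e₁ e₀) ⟩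
    + 9 * c₂ * (- X * + q * ((+ 3 + μ) * ((+ 2 + μ) * (1ℤ + μ)))) + (+ 3 * c₁ * (- X * (+ q * (+ q - 1ℤ)) * ((+ 2 + μ) * (1ℤ + μ))) + c₀ * (- X * (+ q * ((+ q - 1ℤ) * (+ q - + 2))) * (1ℤ + μ)))
      ≡⟨ substituted ⟩
    g ν (+ suc k) * (- X * (+ q * ((+ q - 1ℤ) * (+ q - + 2))) * (1ℤ + μ)) - + 27 * g ν (+ k) * (K⁴ * X)
      ≡⟨ cong₂ (λ x y → g ν (+ suc k) * x - + 27 * g ν (+ k) * y) e₀ e ⟨
    g ν (+ suc k) * (+ 27 * t₀ * D) - + 27 * g ν (+ k) * (t * D) ≡⟨ collect′ (g ν (+ suc k)) (g ν (+ k)) t₀ t D ⟨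
    + 27 * D * (G m (2 ℕ.+ k) - G m (suc k)) ∎)
    where
    open ≡-Reasoning
    f = fourth (suc k !)
    D X P μ K⁴ ν c₂ c₁ c₀ t₂ t₁ t₀ t s w : ℤ
    ν = + suc m
    D = + (f ℕ.* q !)
    P = + ((m ℕ.+ k) !)
    s = sign k
    w = + (3 ℕ.^ q)
    X = s * w * P
    μ = + (m ℕ.+ k)
    K⁴ = (1ℤ + + k) * (1ℤ + + k) * ((1ℤ + + k) * (1ℤ + + k))
    c₂ = ev cubic₂ ν
    c₁ = ev cubic₁ ν
    c₀ = ev cubic₀ ν
    t₂ = term (2 ℕ.+ m) (suc k)
    t₁ = term (1 ℕ.+ m) (suc k)
    t₀ = term m (suc k)
    t = term m k
    instance
      D≢0 : ℤ.NonZero D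
      D≢0 = ℕₚ.m*n≢0 f (q !) {{ℕₚ.m*n≢0 (a ℕ.* a) (a ℕ.* a) {{ℕₚ.m*n≢0 a a {{a≢0}} {{a≢0}}}} {{ℕₚ.m*n≢0 a a {{a≢0}} {{a≢0}}}}}} {{q ℕₚ.!≢0}}
        where
        a = suc k !
        a≢0 = suc k ℕₚ.!≢0
    index : ∀ a b → a ℕ.+ b ≡ 3 → a ℕ.+ m ℕ.+ b ≡ 3 ℕ.* suc k ℕ.+ q
    index a b e = trans (trans (cong (ℕ._+ b) (ℕₚ.+-comm a m)) (trans (ℕₚ.+-assoc m a b) (cong (m ℕ.+_) e))) (eq k q)
      where
      eq : ∀ k q → 3 ℕ.* k ℕ.+ q ℕ.+ 3 ≡ 3 ℕ.* suc k ℕ.+ q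
      eq = ℕS.solve-∀
    !₁ : + ((m ℕ.+ suc k) !) ≡ (1ℤ + μ) * P
    !₁ = trans (cong (λ x → + (x !)) (ℕₚ.+-suc m k)) (+suc! (m ℕ.+ k))
    !₂ : + ((1 ℕ.+ m ℕ.+ suc k) !) ≡ (+ 2 + μ) * ((1ℤ + μ) * P)
    !₂ = trans (+suc! (m ℕ.+ suc k)) (cong₂ (λ x y → (1ℤ + + x) * y) (ℕₚ.+-suc m k) !₁)
    !₃ : + ((2 ℕ.+ m ℕ.+ suc k) !) ≡ (+ 3 + μ) * ((+ 2 + μ) * ((1ℤ + μ) * P))
    !₃ = trans (+suc! (1 ℕ.+ m ℕ.+ suc k)) (cong₂ (λ x y → (1ℤ + + suc x) * y) (ℕₚ.+-suc m k) !₂)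
    shape : ∀ s w x y P → - s * w * x * (y * P) ≡ - (s * w * P) * x * y
    shape = solve-∀
    e₂ : + 3 * t₂ * D ≡ - X * + q * ((+ 3 + μ) * ((+ 2 + μ) * (1ℤ + μ)))
    e₂ = trans (term-shift 1 (suc k) q (2 ℕ.+ m) (index 2 1 refl))
      (trans (cong₂ (λ x y → - s * w * x * y) (fall₁ q) (trans !₃ (eq (+ 3 + μ) (+ 2 + μ) (1ℤ + μ) P))) (shape s w (+ q) ((+ 3 + μ) * ((+ 2 + μ) * (1ℤ + μ))) P))
      where
      eq : ∀ a b c P → a * (b * (c * P)) ≡ a * (b * c) * P
      eq = solve-∀
    e₁ : + 9 * t₁ * D ≡ - X * (+ q * (+ q - 1ℤ)) * ((+ 2 + μ) * (1ℤ + μ))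
    e₁ = trans (term-shift 2 (suc k) q (1 ℕ.+ m) (index 1 2 refl))
      (trans (cong₂ (λ x y → - s * w * x * y) (fall₂ q) (trans !₂ (sym (ℤₚ.*-assoc (+ 2 + μ) (1ℤ + μ) P)))) (shape s w (+ q * (+ q - 1ℤ)) ((+ 2 + μ) * (1ℤ + μ)) P))
    e₀ : + 27 * t₀ * D ≡ - X * (+ q * ((+ q - 1ℤ) * (+ q - + 2))) * (1ℤ + μ)
    e₀ = trans (term-shift 3 (suc k) q m (index 0 3 refl))
      (trans (cong₂ (λ x y → - s * w * x * y) (fall₃ q) !₁) (shape s w (+ q * ((+ q - 1ℤ) * (+ q - + 2))) (1ℤ + μ) P))
    e : t * D ≡ K⁴ * X
    e = begin
      t * D ≡⟨ cong (λ z → t * z) split ⟩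
      t * (K⁴ * + (fourth (k !) ℕ.* q !)) ≡⟨ eq t K⁴ (+ (fourth (k !) ℕ.* q !)) ⟩
      K⁴ * (1ℤ * t * + (fourth (k !) ℕ.* q !)) ≡⟨ cong (λ z → K⁴ * z) (term-shift 0 k q m (ℕₚ.+-identityʳ m)) ⟩
      K⁴ * (s * w * 1ℤ * P) ≡⟨ cong (λ z → K⁴ * (z * P)) (ℤₚ.*-identityʳ (s * w)) ⟩
      K⁴ * X ∎
      where
      eq : ∀ t x y → t * (x * y) ≡ x * (1ℤ * t * y)
      eq = solve-∀
      natural : ∀ a b c → a ℕ.* b ℕ.* (a ℕ.* b) ℕ.* (a ℕ.* b ℕ.* (a ℕ.* b)) ℕ.* c ≡ a ℕ.* a ℕ.* (a ℕ.* a) ℕ.* (b ℕ.* b ℕ.* (b ℕ.* b) ℕ.* c)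
      natural = ℕS.solve-∀
      split : D ≡ K⁴ * + (fourth (k !) ℕ.* q !)
      split = trans (cong +_ (natural (suc k) (k !) (q !))) (trans (ℤₚ.pos-* (suc k ℕ.* suc k ℕ.* (suc k ℕ.* suc k)) (fourth (k !) ℕ.* q !))
        (cong (_* + (fourth (k !) ℕ.* q !)) (trans (ℤₚ.pos-* (suc k ℕ.* suc k) (suc k ℕ.* suc k)) (cong₂ _*_ (ℤₚ.pos-* (suc k) (suc k)) (ℤₚ.pos-* (suc k) (suc k))))))
    m-value : + m ≡ + 3 * + k + + q
    m-value = trans (ℤₚ.pos-+ (3 ℕ.* k) q) (cong (_+ + q) (ℤₚ.pos-* 3 k))
    substituted : + 9 * c₂ * (- X * + q * ((+ 3 + μ) * ((+ 2 + μ) * (1ℤ + μ)))) + (+ 3 * c₁ * (- X * (+ q * (+ q - 1ℤ)) * ((+ 2 + μ) * (1ℤ + μ))) + c₀ * (- X * (+ q * ((+ q - 1ℤ) * (+ q - + 2))) * (1ℤ + μ)))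
      ≡ g ν (+ suc k) * (- X * (+ q * ((+ q - 1ℤ) * (+ q - + 2))) * (1ℤ + μ)) - + 27 * g ν (+ k) * (K⁴ * X)
    substituted = subst (λ M → Goal (1ℤ + M) (M + + k)) (sym m-value) (polynomial (+ k) (+ q) X)
      where
      Goal : ℤ → ℤ → Set
      Goal ν μ = + 9 * ev cubic₂ ν * (- X * + q * ((+ 3 + μ) * ((+ 2 + μ) * (1ℤ + μ)))) + (+ 3 * ev cubic₁ ν * (- X * (+ q * (+ q - 1ℤ)) * ((+ 2 + μ) * (1ℤ + μ))) + ev cubic₀ ν * (- X * (+ q * ((+ q - 1ℤ) * (+ q - + 2))) * (1ℤ + μ)))
        ≡ g ν (1ℤ + + k) * (- X * (+ q * ((+ q - 1ℤ) * (+ q - + 2))) * (1ℤ + μ)) - + 27 * g ν (+ k) * (K⁴ * X)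

  -- The three sums in the recurrence end at different indices; the extra zero terms give them a
  -- common range.
  Aδ-extend : ∀ d n → sumTo (d ℕ.+ n) (term n) ≡ Aδ n
  Aδ-extend zero n = refl
  Aδ-extend (suc d) n = trans (cong₂ _+_ (Aδ-extend d n) (term-vanishes n (suc (d ℕ.+ n)) small)) (ℤₚ.+-identityʳ (Aδ n))
    where
    small : n ℕ.< 3 ℕ.* suc (d ℕ.+ n)
    small = ℕₚ.≤-trans (s≤s (ℕₚ.m≤n+m n d)) (ℕₚ.m≤n*m (suc (d ℕ.+ n)) 3)

  sumTo-linear : ∀ K a b c f g h → sumTo K (λ k → a * f k + (b * g k + c * h k)) ≡ a * sumTo K f + (b * sumTo K g + c * sumTo K h)
  sumTo-linear zero a b c f g h = refl
  sumTo-linear (suc K) a b c f g h = trans (cong (_+ (a * f (suc K) + (b * g (suc K) + c * h (suc K)))) (sumTo-linear K a b c f g h))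
    (eq a b c (sumTo K f) (sumTo K g) (sumTo K h) (f (suc K)) (g (suc K)) (h (suc K)))
    where
    eq : ∀ a b c x y z x′ y′ z′ → (a * x + (b * y + c * z)) + (a * x′ + (b * y′ + c * z′)) ≡ a * (x + x′) + (b * (y + y′) + c * (z + z′))
    eq = solve-∀

  sum-step : ∀ m K → sumTo K (step m) ≡ G m (suc K)
  sum-step m zero = step-0 m
  sum-step m (suc K) = trans (cong₂ _+_ (sum-step m K) (step-suc m K)) (eq (G m (suc K)) (G m (2 ℕ.+ K)))
    where
    eq : ∀ a b → a + (b - a) ≡ b
    eq = solve-∀

  Aδ-recurrence : ∀ m → let ν = + suc m in ev cubic₂ ν * Aδ (2 ℕ.+ m) + (ev cubic₁ ν * Aδ (1 ℕ.+ m) + ev cubic₀ ν * Aδ m) ≡ 0ℤ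
  Aδ-recurrence m = begin
    c₂ * Aδ (2 ℕ.+ m) + (c₁ * Aδ (1 ℕ.+ m) + c₀ * Aδ m)
      ≡⟨ cong₂ (λ x y → c₂ * Aδ (2 ℕ.+ m) + (c₁ * x + c₀ * y)) (Aδ-extend 1 (1 ℕ.+ m)) (Aδ-extend 2 m) ⟨
    c₂ * sumTo K (term (2 ℕ.+ m)) + (c₁ * sumTo K (term (1 ℕ.+ m)) + c₀ * sumTo K (term m))
      ≡⟨ sumTo-linear K c₂ c₁ c₀ (term (2 ℕ.+ m)) (term (1 ℕ.+ m)) (term m) ⟨
    sumTo K (step m) ≡⟨ sum-step m K ⟩
    g (+ suc m) (+ K) * term m K ≡⟨ cong (λ z → g (+ suc m) (+ K) * z) (term-vanishes m K small) ⟩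
    g (+ suc m) (+ K) * 0ℤ ≡⟨ ℤₚ.*-zeroʳ (g (+ suc m) (+ K)) ⟩
    0ℤ ∎
    where
    open ≡-Reasoning
    K = 2 ℕ.+ m
    c₂ = ev cubic₂ (+ suc m)
    c₁ = ev cubic₁ (+ suc m)
    c₀ = ev cubic₀ (+ suc m)
    small : m ℕ.< 3 ℕ.* K
    small = ℕₚ.≤-trans (ℕₚ.n≤1+n (suc m)) (ℕₚ.m≤n*m K 3)

  opaque
    unfolding Σ4

    T-0 : T 0 ≡ + 1
    T-0 = refl

    T-1 : T 1 ≡ + 3
    T-1 = refl

  -- The leading coefficient (ν + 1)³ is never 0, so the common recurrence and the values 1 and 3 at
  -- n = 0 and n = 1 determine both sequences.
  T≡Aδ : ∀ n → T n ≡ Aδ n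
  T≡Aδ n = proj₁ (both n)
    where
    next : ∀ m → T m ≡ Aδ m → T (suc m) ≡ Aδ (suc m) → T (2 ℕ.+ m) ≡ Aδ (2 ℕ.+ m)
    next m e₀ e₁ = ℤₚ.*-cancelˡ-≡ c₂ (T (2 ℕ.+ m)) (Aδ (2 ℕ.+ m)) {{c₂≢0}}
      (+-cancelʳ (c₁ * Aδ (suc m) + c₀ * Aδ m) (c₂ * T (2 ℕ.+ m)) (c₂ * Aδ (2 ℕ.+ m))
      (trans (cong₂ (λ x y → c₂ * T (2 ℕ.+ m) + (c₁ * x + c₀ * y)) (sym e₁) (sym e₀)) (trans (T-recurrence m) (sym (Aδ-recurrence m)))))
      where
      c₂ = ev cubic₂ (+ suc m)
      c₁ = ev cubic₁ (+ suc m)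
      c₀ = ev cubic₀ (+ suc m)
      cube : ∀ ν → (1ℤ + ν) * ((1ℤ + ν) * (1ℤ + ν)) ≡ + 1 + ν * (+ 3 + ν * (+ 3 + ν * (+ 1 + ν * 0ℤ)))
      cube = solve-∀
      c₂≢0 : ℤ.NonZero c₂
      c₂≢0 = subst ℤ.NonZero (cube (+ suc m)) (ℤₚ.i*j≢0 (+ (2 ℕ.+ m)) (+ (2 ℕ.+ m) * + (2 ℕ.+ m)) {{_}} {{ℤₚ.i*j≢0 (+ (2 ℕ.+ m)) (+ (2 ℕ.+ m))}})
    both : ∀ n → T n ≡ Aδ n × T (suc n) ≡ Aδ (suc n)
    both zero = T-0 , T-1
    both (suc n) = proj₂ (both n) , next n (proj₁ (both n)) (proj₂ (both n))

module Congruences where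

  open ConstantTerm using (bin; bin-!; bin≡C; δ)
  open import Data.Bool using (if_then_else_)
  open import Data.Empty using (⊥-elim)
  open import Data.Integer as ℤ using (ℤ; +_; -[1+_]; _+_; _*_; -_; _-_; 0ℤ; 1ℤ; -1ℤ; _^_)
  open import Data.Integer.Divisibility.Signed
  open import Data.Integer.Tactic.RingSolver using (solve-∀)
  open import Data.Nat as ℕ using (ℕ; zero; suc; _!; s≤s; z≤n)
  open import Data.Nat.Combinatorics using (_C_; nCk+nC[k+1]≡[n+1]C[k+1]; nCn≡1; k>n⇒nCk≡0)
  open import Data.Nat.Primality using (Prime; euclidsLemma; prime⇒irreducible; prime⇒nonZero)
  open import Data.Product using (_×_; _,_; ∃; proj₁; proj₂)
  open import Data.Sum using (_⊎_; inj₁; inj₂)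
  open import Relation.Binary.PropositionalEquality using (_≡_; refl; sym; trans; cong; cong₂; subst; _≢_; module ≡-Reasoning)
  open import Relation.Nullary using (¬_; Dec; yes; no)
  open import Relation.Nullary.Decidable using (does; dec-true; dec-false)

  -- Congruences in ℤ, finite sums and products.

  ∣-0 : ∀ d → d ∣ 0ℤ
  ∣-0 d = divides 0ℤ refl

  ∣-resp : ∀ {d x y} → x ≡ y → d ∣ x → d ∣ y
  ∣-resp refl h = h

  *-mono-∣ : ∀ {a b c d} → a ∣ b → c ∣ d → a * c ∣ b * d
  *-mono-∣ {a} {b} {c} {d} (divides q e) (divides q′ e′) = divides (q * q′) (trans (cong₂ _*_ e e′) (eq q a q′ c))
    where
    eq : ∀ q a q′ c → q * a * (q′ * c) ≡ q * q′ * (a * c)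
    eq = solve-∀

  infix 4 _≡_mod_
  record _≡_mod_ (x y d : ℤ) : Set where
    constructor by
    field divides-difference : d ∣ x - y
  open _≡_mod_ public

  module _ {d : ℤ} where
    ≡⇒≡mod : ∀ {x y} → x ≡ y → x ≡ y mod d
    ≡⇒≡mod {x} refl = by (∣-resp (sym (ℤₚ.+-inverseʳ x)) (∣-0 d))

    refl-mod : ∀ {x} → x ≡ x mod d
    refl-mod = ≡⇒≡mod refl

    sym-mod : ∀ {x y} → x ≡ y mod d → y ≡ x mod d
    sym-mod {x} {y} (by h) = by (∣-resp (eq x y) (∣m⇒∣-m h))
      where
      eq : ∀ x y → - (x - y) ≡ y - x
      eq = solve-∀

    trans-mod : ∀ {x y z} → x ≡ y mod d → y ≡ z mod d → x ≡ z mod d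
    trans-mod {x} {y} {z} (by h) (by k) = by (∣-resp (eq x y z) (∣m∣n⇒∣m+n h k))
      where
      eq : ∀ x y z → (x - y) + (y - z) ≡ x - z
      eq = solve-∀

    +-mod : ∀ {x y x′ y′} → x ≡ y mod d → x′ ≡ y′ mod d → x + x′ ≡ y + y′ mod d
    +-mod {x} {y} {x′} {y′} (by h) (by k) = by (∣-resp (eq x y x′ y′) (∣m∣n⇒∣m+n h k))
      where
      eq : ∀ x y x′ y′ → (x - y) + (x′ - y′) ≡ x + x′ - (y + y′)
      eq = solve-∀

    *-mod : ∀ {x y x′ y′} → x ≡ y mod d → x′ ≡ y′ mod d → x * x′ ≡ y * y′ mod d
    *-mod {x} {y} {x′} {y′} (by h) (by k) = by (∣-resp (eq x y x′ y′) (∣m∣n⇒∣m+n (∣m⇒∣m*n x′ h) (∣n⇒∣m*n y k)))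
      where
      eq : ∀ x y x′ y′ → (x - y) * x′ + y * (x′ - y′) ≡ x * x′ - y * y′
      eq = solve-∀

    *ˡ-mod : ∀ z {x y} → x ≡ y mod d → z * x ≡ z * y mod d
    *ˡ-mod z = *-mod {z} {z} refl-mod

    *ʳ-mod : ∀ z {x y} → x ≡ y mod d → x * z ≡ y * z mod d
    *ʳ-mod z h = *-mod {x′ = z} h refl-mod

    ^-mod : ∀ {x y} n → x ≡ y mod d → x ^ n ≡ y ^ n mod d
    ^-mod zero h = refl-mod
    ^-mod (suc n) h = *-mod h (^-mod n h)

    mod-∣ : ∀ {x y} → x ≡ y mod d → d ∣ y → d ∣ x
    mod-∣ {x} {y} (by h) k = ∣-resp (eq x y) (∣m∣n⇒∣m+n h k)
      where
      eq : ∀ x y → x - y + y ≡ x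
      eq = solve-∀

    ∣⇒≡0mod : ∀ {x} → d ∣ x → x ≡ 0ℤ mod d
    ∣⇒≡0mod {x} h = by (∣-resp (sym (ℤₚ.+-identityʳ x)) h)

  mod-weaken : ∀ {d e x y} → d ∣ e → x ≡ y mod e → x ≡ y mod d
  mod-weaken h (by k) = by (∣-trans h k)

  Σ< : ℕ → (ℕ → ℤ) → ℤ
  Σ< zero f = 0ℤ
  Σ< (suc n) f = Σ< n f + f n

  Π< : ℕ → (ℕ → ℤ) → ℤ
  Π< zero f = 1ℤ
  Π< (suc n) f = Π< n f * f n

  Σ<-cong : ∀ n {f g} → (∀ i → i ℕ.< n → f i ≡ g i) → Σ< n f ≡ Σ< n g
  Σ<-cong zero e = refl
  Σ<-cong (suc n) e = cong₂ _+_ (Σ<-cong n (λ i i<n → e i (ℕₚ.m≤n⇒m≤1+n i<n))) (e n ℕₚ.≤-refl)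

  Σ<-cong-mod : ∀ {d} n {f g} → (∀ i → i ℕ.< n → f i ≡ g i mod d) → Σ< n f ≡ Σ< n g mod d
  Σ<-cong-mod zero e = refl-mod
  Σ<-cong-mod (suc n) e = +-mod (Σ<-cong-mod n (λ i i<n → e i (ℕₚ.m≤n⇒m≤1+n i<n))) (e n ℕₚ.≤-refl)

  Π<-cong-mod : ∀ {d} n {f g} → (∀ i → i ℕ.< n → f i ≡ g i mod d) → Π< n f ≡ Π< n g mod d
  Π<-cong-mod zero e = refl-mod
  Π<-cong-mod (suc n) e = *-mod (Π<-cong-mod n (λ i i<n → e i (ℕₚ.m≤n⇒m≤1+n i<n))) (e n ℕₚ.≤-refl)

  Σ<-* : ∀ n c f → Σ< n (λ i → c * f i) ≡ c * Σ< n f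
  Σ<-* zero c f = sym (ℤₚ.*-zeroʳ c)
  Σ<-* (suc n) c f = trans (cong (_+ c * f n) (Σ<-* n c f)) (sym (ℤₚ.*-distribˡ-+ c (Σ< n f) (f n)))

  Σ<-+ : ∀ n f g → Σ< n (λ i → f i + g i) ≡ Σ< n f + Σ< n g
  Σ<-+ zero f g = refl
  Σ<-+ (suc n) f g = trans (cong (_+ (f n + g n)) (Σ<-+ n f g)) (eq (Σ< n f) (Σ< n g) (f n) (g n))
    where
    eq : ∀ a b c d → a + b + (c + d) ≡ a + c + (b + d)
    eq = solve-∀

  Σ<-∣ : ∀ {d} n {f} → (∀ i → i ℕ.< n → d ∣ f i) → d ∣ Σ< n f
  Σ<-∣ {d} zero h = ∣-0 d
  Σ<-∣ (suc n) h = ∣m∣n⇒∣m+n (Σ<-∣ n (λ i i<n → h i (ℕₚ.m≤n⇒m≤1+n i<n))) (h n ℕₚ.≤-refl)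

  Σ<-split : ∀ m n f → Σ< (m ℕ.+ n) f ≡ Σ< m f + Σ< n (λ i → f (m ℕ.+ i))
  Σ<-split m zero f rewrite ℕₚ.+-identityʳ m = sym (ℤₚ.+-identityʳ (Σ< m f))
  Σ<-split m (suc n) f rewrite ℕₚ.+-suc m n = trans (cong (_+ f (m ℕ.+ n)) (Σ<-split m n f)) (ℤₚ.+-assoc (Σ< m f) _ _)

  Π<-split : ∀ m n f → Π< (m ℕ.+ n) f ≡ Π< m f * Π< n (λ i → f (m ℕ.+ i))
  Π<-split m zero f rewrite ℕₚ.+-identityʳ m = sym (ℤₚ.*-identityʳ (Π< m f))
  Π<-split m (suc n) f rewrite ℕₚ.+-suc m n = trans (cong (_* f (m ℕ.+ n)) (Π<-split m n f)) (ℤₚ.*-assoc (Π< m f) _ _)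

  Σ<-blocks : ∀ q n f → Σ< (q ℕ.* n) f ≡ Σ< n (λ β → Σ< q (λ ρ → f (q ℕ.* β ℕ.+ ρ)))
  Σ<-blocks q zero f rewrite ℕₚ.*-zeroʳ q = refl
  Σ<-blocks q (suc n) f rewrite ℕₚ.*-suc q n | ℕₚ.+-comm q (q ℕ.* n) =
    trans (Σ<-split (q ℕ.* n) q f) (cong (_+ Σ< q (λ ρ → f (q ℕ.* n ℕ.+ ρ))) (Σ<-blocks q n f))

  Σ<-reverse : ∀ n f → Σ< n f ≡ Σ< n (λ i → f (n ℕ.∸ suc i))
  Σ<-reverse zero f = refl
  Σ<-reverse (suc n) f = begin
    Σ< n f + f n ≡⟨ cong (_+ f n) (Σ<-reverse n f) ⟩
    Σ< n (λ i → f (n ℕ.∸ suc i)) + f n ≡⟨ eq (Σ< n (λ i → f (n ℕ.∸ suc i))) (f n) ⟩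
    0ℤ + f n + Σ< n (λ i → f (n ℕ.∸ suc i)) ≡⟨ Σ<-split 1 n (λ i → f (n ℕ.∸ i)) ⟨
    Σ< (suc n) (λ i → f (n ℕ.∸ i)) ∎
    where
    open ≡-Reasoning
    eq : ∀ a b → a + b ≡ 0ℤ + b + a
    eq = solve-∀

  Π<-reverse : ∀ n f → Π< n f ≡ Π< n (λ i → f (n ℕ.∸ suc i))
  Π<-reverse zero f = refl
  Π<-reverse (suc n) f = begin
    Π< n f * f n ≡⟨ cong (_* f n) (Π<-reverse n f) ⟩
    Π< n (λ i → f (n ℕ.∸ suc i)) * f n ≡⟨ eq (Π< n (λ i → f (n ℕ.∸ suc i))) (f n) ⟩
    1ℤ * f n * Π< n (λ i → f (n ℕ.∸ suc i)) ≡⟨ Π<-split 1 n (λ i → f (n ℕ.∸ i)) ⟨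
    Π< (suc n) (λ i → f (n ℕ.∸ i)) ∎
    where
    open ≡-Reasoning
    eq : ∀ a b → a * b ≡ 1ℤ * b * a
    eq = solve-∀

  Π<-cong : ∀ n {f g} → (∀ i → i ℕ.< n → f i ≡ g i) → Π< n f ≡ Π< n g
  Π<-cong zero e = refl
  Π<-cong (suc n) e = cong₂ _*_ (Π<-cong n (λ i i<n → e i (ℕₚ.m≤n⇒m≤1+n i<n))) (e n ℕₚ.≤-refl)

  Π<-* : ∀ n f g → Π< n (λ i → f i * g i) ≡ Π< n f * Π< n g
  Π<-* zero f g = refl
  Π<-* (suc n) f g = trans (cong (_* (f n * g n)) (Π<-* n f g)) (eq (Π< n f) (Π< n g) (f n) (g n))
    where
    eq : ∀ a b c d → a * b * (c * d) ≡ a * c * (b * d)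
    eq = solve-∀

  -- Sums over a + b = n and the binomial theorem.

  anti : ℕ → (ℕ → ℕ → ℤ) → ℤ
  anti zero u = u 0 0
  anti (suc n) u = u 0 (suc n) + anti n (λ a b → u (suc a) b)

  anti-cong : ∀ n {u v : ℕ → ℕ → ℤ} → (∀ a b → a ℕ.+ b ≡ n → u a b ≡ v a b) → anti n u ≡ anti n v
  anti-cong zero e = e 0 0 refl
  anti-cong (suc n) e = cong₂ _+_ (e 0 (suc n) refl) (anti-cong n (λ a b h → e (suc a) b (cong suc h)))

  anti-+ : ∀ n u v → anti n (λ a b → u a b + v a b) ≡ anti n u + anti n v
  anti-+ zero u v = refl
  anti-+ (suc n) u v = trans (cong (λ z → u 0 (suc n) + v 0 (suc n) + z) (anti-+ n (λ a → u (suc a)) (λ a → v (suc a))))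
    (eq (u 0 (suc n)) (v 0 (suc n)) (anti n (λ a → u (suc a))) (anti n (λ a → v (suc a))))
    where
    eq : ∀ a b c d → a + b + (c + d) ≡ a + c + (b + d)
    eq = solve-∀

  anti-* : ∀ n c u → anti n (λ a b → c * u a b) ≡ c * anti n u
  anti-* zero c u = refl
  anti-* (suc n) c u = trans (cong (λ z → c * u 0 (suc n) + z) (anti-* n c (λ a → u (suc a)))) (sym (ℤₚ.*-distribˡ-+ c (u 0 (suc n)) (anti n (λ a → u (suc a)))))

  anti-last : ∀ n u → anti (suc n) u ≡ anti n (λ a b → u a (suc b)) + u (suc n) 0
  anti-last zero u = refl
  anti-last (suc n) u = trans (cong (λ z → u 0 (2 ℕ.+ n) + z) (anti-last n (λ a → u (suc a))))
    (sym (ℤₚ.+-assoc (u 0 (2 ℕ.+ n)) (anti n (λ a b → u (suc a) (suc b))) (u (2 ℕ.+ n) 0)))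

  anti-flip : ∀ n u → anti n u ≡ anti n (λ a b → u b a)
  anti-flip zero u = refl
  anti-flip (suc n) u = trans (cong (λ z → u 0 (suc n) + z) (anti-flip n (λ a → u (suc a))))
    (trans (ℤₚ.+-comm (u 0 (suc n)) (anti n (λ a b → u (suc b) a))) (sym (anti-last n (λ a b → u b a))))

  anti-assoc : ∀ n (u : ℕ → ℕ → ℕ → ℤ) → anti n (λ a m → anti m (u a)) ≡ anti n (λ m c → anti m (λ a b → u a b c))
  anti-assoc zero u = refl
  anti-assoc (suc n) u = begin
    anti (suc n) (u 0) + anti n (λ a m → anti m (u (suc a)))
      ≡⟨ cong (λ z → anti (suc n) (u 0) + z) (anti-assoc n (λ a → u (suc a))) ⟩
    u 0 0 (suc n) + anti n (λ m c → u 0 (suc m) c) + anti n (λ m c → anti m (λ a b → u (suc a) b c))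
      ≡⟨ ℤₚ.+-assoc (u 0 0 (suc n)) _ _ ⟩
    u 0 0 (suc n) + (anti n (λ m c → u 0 (suc m) c) + anti n (λ m c → anti m (λ a b → u (suc a) b c)))
      ≡⟨ cong (λ z → u 0 0 (suc n) + z) (anti-+ n (λ m c → u 0 (suc m) c) (λ m c → anti m (λ a b → u (suc a) b c))) ⟨
    u 0 0 (suc n) + anti n (λ m c → u 0 (suc m) c + anti m (λ a b → u (suc a) b c)) ∎
    where open ≡-Reasoning

  -- Pascal's rule in summed form: an interior point receives from both neighbours, a point on the
  -- boundary only from the one that exists.
  anti-pascal : ∀ n x y z → (∀ b → x 0 (suc b) ≡ z 0 b) → (∀ a → x (suc a) 0 ≡ y a 0) →
    (∀ a b → x (suc a) (suc b) ≡ y a (suc b) + z (suc a) b) → anti (suc n) x ≡ anti n y + anti n z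
  anti-pascal zero x y z e₁ e₂ e₃ = trans (cong₂ _+_ (e₁ 0) (e₂ 0)) (ℤₚ.+-comm (z 0 0) (y 0 0))
  anti-pascal (suc n) x y z e₁ e₂ e₃ = trans (cong₂ _+_ (e₁ (suc n)) (tail n (λ a → x (suc a)) y (λ a → z (suc a)) e₂ e₃))
    (eq (z 0 (suc n)) (anti (suc n) y) (anti n (λ a → z (suc a))))
    where
    eq : ∀ a b c → a + (b + c) ≡ b + (a + c)
    eq = solve-∀
    eq′ : ∀ a b c d → a + b + (c + d) ≡ (a + c) + (b + d)
    eq′ = solve-∀
    tail : ∀ n x y z → (∀ a → x a 0 ≡ y a 0) → (∀ a b → x a (suc b) ≡ y a (suc b) + z a b) → anti (suc n) x ≡ anti (suc n) y + anti n z
    tail zero x y z e₁ e₂ = trans (cong₂ _+_ (e₂ 0 0) (e₁ 1)) (eq″ (y 0 1) (z 0 0) (y 1 0))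
      where
      eq″ : ∀ a b c → a + b + c ≡ a + c + b
      eq″ = solve-∀
    tail (suc n) x y z e₁ e₂ = trans (cong₂ _+_ (e₂ 0 (suc n)) (tail n (λ a → x (suc a)) (λ a → y (suc a)) (λ a → z (suc a)) (λ a → e₁ (suc a)) (λ a b → e₂ (suc a) b)))
      (eq′ (y 0 (2 ℕ.+ n)) (z 0 (suc n)) (anti (suc n) (λ a → y (suc a))) (anti n (λ a → z (suc a))))

  bin-zeroʳ : ∀ a → bin a 0 ≡ 1
  bin-zeroʳ a = trans (bin≡C a 0) (trans (cong (_C a) (ℕₚ.+-identityʳ a)) (nCn≡1 a))

  bin-zeroˡ : ∀ b → bin 0 b ≡ 1
  bin-zeroˡ b = ℕₚ.*-cancelʳ-≡ (bin 0 b) 1 (1 ℕ.* b !) {{ℕₚ.m*n≢0 1 (b !) {{_}} {{b ℕₚ.!≢0}}}} (trans (bin-! 0 b) (eq (b !)))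
    where
    eq : ∀ x → x ≡ 1 ℕ.* (1 ℕ.* x)
    eq = ℕS.solve-∀

  opaque
    unfolding bin

    bin-pascal : ∀ a b → bin (suc a) (suc b) ≡ bin a (suc b) ℕ.+ bin (suc a) b
    bin-pascal a b = trans (sym (nCk+nC[k+1]≡[n+1]C[k+1] (a ℕ.+ suc b) a)) (cong (λ x → bin a (suc b) ℕ.+ x C suc a) (ℕₚ.+-suc a b))

  bin-absorb : ∀ a b → suc a ℕ.* bin (suc a) b ≡ (suc a ℕ.+ b) ℕ.* bin a b
  bin-absorb a b = ℕₚ.*-cancelʳ-≡ (suc a ℕ.* bin (suc a) b) ((suc a ℕ.+ b) ℕ.* bin a b) (a ! ℕ.* b !) {{ℕₚ.m*n≢0 (a !) (b !) {{a ℕₚ.!≢0}} {{b ℕₚ.!≢0}}}} (begin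
    suc a ℕ.* bin (suc a) b ℕ.* (a ! ℕ.* b !) ≡⟨ eq (suc a) (bin (suc a) b) (a !) (b !) ⟩
    bin (suc a) b ℕ.* (suc a ! ℕ.* b !) ≡⟨ bin-! (suc a) b ⟩
    (suc a ℕ.+ b) ! ≡⟨ cong ((suc a ℕ.+ b) ℕ.*_) (bin-! a b) ⟨
    (suc a ℕ.+ b) ℕ.* (bin a b ℕ.* (a ! ℕ.* b !)) ≡⟨ ℕₚ.*-assoc (suc a ℕ.+ b) (bin a b) (a ! ℕ.* b !) ⟨
    (suc a ℕ.+ b) ℕ.* bin a b ℕ.* (a ! ℕ.* b !) ∎)
    where
    open ≡-Reasoning
    eq : ∀ s x a b → s ℕ.* x ℕ.* (a ℕ.* b) ≡ x ℕ.* (s ℕ.* a ℕ.* b)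
    eq = ℕS.solve-∀

  bin-comm : ∀ a b → bin a b ≡ bin b a
  bin-comm a b = ℕₚ.*-cancelʳ-≡ (bin a b) (bin b a) (a ! ℕ.* b !) {{ℕₚ.m*n≢0 (a !) (b !) {{a ℕₚ.!≢0}} {{b ℕₚ.!≢0}}}}
    (trans (bin-! a b) (trans (cong _! (ℕₚ.+-comm a b)) (trans (sym (bin-! b a)) (cong (bin b a ℕ.*_) (ℕₚ.*-comm (b !) (a !))))))

  -- The arbitrary v makes this serve both the binomial theorem and, applied twice, the expansion of
  -- a power of a form with three terms.
  binomial-sum-suc : ∀ n (v : ℕ → ℕ → ℤ) → anti (suc n) (λ a b → + bin a b * v a b) ≡ anti n (λ a b → + bin a b * (v (suc a) b + v a (suc b)))
  binomial-sum-suc n v = trans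
    (anti-pascal n (λ a b → + bin a b * v a b) (λ a b → + bin a b * v (suc a) b) (λ a b → + bin a b * v a (suc b))
      (λ b → cong (λ x → + x * v 0 (suc b)) (trans (bin-zeroˡ (suc b)) (sym (bin-zeroˡ b))))
      (λ a → cong (λ x → + x * v (suc a) 0) (trans (bin-zeroʳ (suc a)) (sym (bin-zeroʳ a))))
      (λ a b → trans (cong (λ x → + x * v (suc a) (suc b)) (bin-pascal a b)) (ℤₚ.*-distribʳ-+ (v (suc a) (suc b)) (+ bin a (suc b)) (+ bin (suc a) b))))
    (trans (sym (anti-+ n (λ a b → + bin a b * v (suc a) b) (λ a b → + bin a b * v a (suc b))))
           (anti-cong n (λ a b _ → sym (ℤₚ.*-distribˡ-+ (+ bin a b) (v (suc a) b) (v a (suc b))))))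

  binomial-theorem : ∀ x y n → (x + y) ^ n ≡ anti n (λ a b → + bin a b * (x ^ a * y ^ b))
  binomial-theorem x y zero = cong (λ z → + z * (1ℤ * 1ℤ)) (sym (bin-zeroʳ 0))
  binomial-theorem x y (suc n) = sym (begin
    anti (suc n) (λ a b → + bin a b * (x ^ a * y ^ b)) ≡⟨ binomial-sum-suc n (λ a b → x ^ a * y ^ b) ⟩
    anti n (λ a b → + bin a b * (x * x ^ a * y ^ b + x ^ a * (y * y ^ b))) ≡⟨ anti-cong n (λ a b _ → eq (+ bin a b) x y (x ^ a) (y ^ b)) ⟩
    anti n (λ a b → (x + y) * (+ bin a b * (x ^ a * y ^ b))) ≡⟨ anti-* n (x + y) (λ a b → + bin a b * (x ^ a * y ^ b)) ⟩
    (x + y) * anti n (λ a b → + bin a b * (x ^ a * y ^ b)) ≡⟨ cong (λ z → (x + y) * z) (binomial-theorem x y n) ⟨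
    (x + y) * (x + y) ^ n ∎)
    where
    open ≡-Reasoning
    eq : ∀ β x y a b → β * (x * a * b + a * (y * b)) ≡ (x + y) * (β * (a * b))
    eq = solve-∀

  anti-∣ : ∀ {d} n {u : ℕ → ℕ → ℤ} → (∀ a b → a ℕ.+ b ≡ n → d ∣ u a b) → d ∣ anti n u
  anti-∣ zero h = h 0 0 refl
  anti-∣ (suc n) h = ∣m∣n⇒∣m+n (h 0 (suc n) refl) (anti-∣ n (λ a b e → h (suc a) b (cong suc e)))

  ∣-pos : ∀ {m n} → m ℕᵈ.∣ n → + m ∣ + n
  ∣-pos {m} (ℕᵈ.divides q e) = divides (+ q) (trans (cong +_ e) (ℤₚ.pos-* q m))

  pos-∣ : ∀ {m n} → + m ∣ + n → m ℕᵈ.∣ n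
  pos-∣ = ∣⇒∣ᵤ

  pos-^ : ∀ p k → + (p ℕ.^ k) ≡ (+ p) ^ k
  pos-^ p zero = refl
  pos-^ p (suc k) = trans (ℤₚ.pos-* p (p ℕ.^ k)) (cong (λ z → + p * z) (pos-^ p k))

  geometric : ∀ x n → (x - 1ℤ) * Σ< n (x ^_) ≡ x ^ n - 1ℤ
  geometric x zero = ℤₚ.*-zeroʳ (x - 1ℤ)
  geometric x (suc n) = trans (ℤₚ.*-distribˡ-+ (x - 1ℤ) (Σ< n (x ^_)) (x ^ n)) (trans (cong (_+ (x - 1ℤ) * x ^ n) (geometric x n)) (eq x (x ^ n)))
    where
    eq : ∀ x y → y - 1ℤ + (x - 1ℤ) * y ≡ x * y - 1ℤ
    eq = solve-∀

  Σ<-1 : ∀ n → Σ< n (λ _ → 1ℤ) ≡ + n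
  Σ<-1 zero = refl
  Σ<-1 (suc n) = trans (cong (_+ 1ℤ) (Σ<-1 n)) (ℤₚ.+-comm (+ n) 1ℤ)

  even-or-odd : ∀ n → ∃ λ h → n ≡ h ℕ.+ h ⊎ n ≡ suc (h ℕ.+ h)
  even-or-odd zero = 0 , inj₁ refl
  even-or-odd (suc n) with even-or-odd n
  ... | h , inj₁ e = h , inj₂ (cong suc e)
  ... | h , inj₂ e = suc h , inj₁ (trans (cong suc e) (cong suc (sym (ℕₚ.+-suc h h))))

  ^-∣ : ∀ x {m n} → m ℕ.≤ n → x ^ m ∣ x ^ n
  ^-∣ x {m} m≤n with ℕₚ.m≤n⇒∃[o]m+o≡n m≤n
  ... | o , refl = divides (x ^ o) (trans (ℤₚ.^-distribˡ-+-* x m o) (ℤₚ.*-comm (x ^ m) (x ^ o)))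

  -- Units modulo p, and the theorems of Fermat and Euler.

  module Local (p : ℕ) (prime : Prime p) (5≤p : 5 ℕ.≤ p) where
    P : ℤ
    P = + p

    instance
      p≢0 : ℕ.NonZero p
      p≢0 = prime⇒nonZero prime
      P≢0 : ℤ.NonZero P
      P≢0 = p≢0

    euclid : ∀ x y → P ∣ x * y → P ∣ x ⊎ P ∣ y
    euclid x y h with euclidsLemma ℤ.∣ x ∣ ℤ.∣ y ∣ prime (subst (p ℕᵈ.∣_) (ℤₚ.abs-* x y) (∣⇒∣ᵤ h))
    ... | inj₁ k = inj₁ (∣ᵤ⇒∣ k)
    ... | inj₂ k = inj₂ (∣ᵤ⇒∣ k)

    Unit : ℤ → Set
    Unit x = ¬ (P ∣ x)

    unit-* : ∀ {x y} → Unit x → Unit y → Unit (x * y)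
    unit-* {x} {y} ux uy h with euclid x y h
    ... | inj₁ k = ux k
    ... | inj₂ k = uy k

    unit-< : ∀ {n} → n ≢ 0 → n ℕ.< p → Unit (+ n)
    unit-< {n} n≢0 n<p h = ℕₚ.<⇒≱ n<p (ℕᵈ.∣⇒≤ {{ℕ.≢-nonZero n≢0}} (pos-∣ h))

    unit-1 : Unit 1ℤ
    unit-1 = unit-< (λ ()) (ℕₚ.≤-trans (s≤s (s≤s z≤n)) 5≤p)

    unit-mod : ∀ {x y} → x ≡ y mod P → Unit y → Unit x
    unit-mod h uy k = uy (mod-∣ (sym-mod h) k)

    unit-cancel : ∀ {u} → Unit u → ∀ k {x} → P ^ k ∣ u * x → P ^ k ∣ x
    unit-cancel uu zero {x} h = divides x (sym (ℤₚ.*-identityʳ x))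
    unit-cancel {u} uu (suc k) {x} h with euclid u x (∣-trans (divides (P ^ k) (ℤₚ.*-comm P (P ^ k))) h)
    ... | inj₁ w = ⊥-elim (uu w)
    ... | inj₂ (divides y refl) = ∣-resp (ℤₚ.*-comm P y) (*-monoʳ-∣ P (unit-cancel uu k (*-cancelˡ-∣ P (∣-resp (eq u y P) h))))
      where
      eq : ∀ u y P → u * (y * P) ≡ P * (u * y)
      eq = solve-∀

    unit-cancel-mod : ∀ {u} → Unit u → ∀ k {x y} → u * x ≡ u * y mod P ^ k → x ≡ y mod P ^ k
    unit-cancel-mod {u} uu k {x} {y} (by h) = by (unit-cancel uu k (∣-resp (eq u x y) h))
      where
      eq : ∀ u x y → u * x - u * y ≡ u * (x - y)
      eq = solve-∀

    p-1 : ℕ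
    p-1 = ℕ.pred p

    suc-p-1 : suc p-1 ≡ p
    suc-p-1 = ℕₚ.suc-pred p

    half : ∃ λ h → p-1 ≡ h ℕ.+ h
    half with even-or-odd p-1
    ... | h , inj₁ e = h , e
    ... | h , inj₂ e with prime⇒irreducible prime (ℕᵈ.divides {2} {p} (suc h) (trans (sym suc-p-1) (trans (cong suc e) (eq h))))
      where
      eq : ∀ h → suc (suc (h ℕ.+ h)) ≡ suc h ℕ.* 2
      eq = ℕS.solve-∀
    ... | inj₁ ()
    ... | inj₂ 2≡p with s≤s (s≤s ()) ← subst (5 ℕ.≤_) (sym 2≡p) 5≤p

    middle-∣ : ∀ a b → suc a ℕ.+ suc b ≡ p → P ∣ + bin (suc a) (suc b)
    middle-∣ a b e with euclid (+ suc a) (+ bin (suc a) (suc b)) (∣-resp (trans (sym (cong +_ (bin-absorb a (suc b)))) (ℤₚ.pos-* (suc a) (bin (suc a) (suc b))))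
        (∣-pos (ℕᵈ.∣m⇒∣m*n (bin a (suc b)) (ℕᵈ.∣-reflexive (sym e)))))
    ... | inj₁ h = ⊥-elim (unit-< (λ ()) (subst (suc a ℕ.<_) e (ℕₚ.m<m+n (suc a) (s≤s z≤n))) h)
    ... | inj₂ h = h

    frobenius : ∀ x y → (x + y) ^ p ≡ x ^ p + y ^ p mod P
    frobenius x y = subst (λ n → n ≡ p → (x + y) ^ n ≡ x ^ n + y ^ n mod P) suc-p-1 (go p-1) refl
      where
      go : ∀ n → suc n ≡ p → (x + y) ^ suc n ≡ x ^ suc n + y ^ suc n mod P
      go zero e with s≤s () ← subst (5 ℕ.≤_) (sym e) 5≤p
      go (suc n) e = by (∣-resp (sym difference) (anti-∣ n (λ a b h → ∣m⇒∣m*n (x ^ suc a * y ^ suc b) (middle-∣ a b (trans (cong suc (ℕₚ.+-suc a b)) (trans (cong (λ z → suc (suc z)) h) e))))))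
        where
        middle = anti n (λ a b → + bin (suc a) (suc b) * (x ^ suc a * y ^ suc b))
        eq : ∀ X Y m → 1ℤ * (1ℤ * Y) + (m + 1ℤ * (X * 1ℤ)) - (X + Y) ≡ m
        eq = solve-∀
        difference : (x + y) ^ (2 ℕ.+ n) - (x ^ (2 ℕ.+ n) + y ^ (2 ℕ.+ n)) ≡ middle
        difference = trans (cong (_- (x ^ (2 ℕ.+ n) + y ^ (2 ℕ.+ n)))
          (trans (binomial-theorem x y (2 ℕ.+ n)) (trans (cong (λ z → + bin 0 (2 ℕ.+ n) * (1ℤ * y ^ (2 ℕ.+ n)) + z) (anti-last n (λ a b → + bin (suc a) b * (x ^ suc a * y ^ b))))
            (cong₂ (λ i j → + i * (1ℤ * y ^ (2 ℕ.+ n)) + (middle + + j * (x ^ (2 ℕ.+ n) * 1ℤ))) (bin-zeroˡ (2 ℕ.+ n)) (bin-zeroʳ (2 ℕ.+ n))))))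
          (eq (x ^ (2 ℕ.+ n)) (y ^ (2 ℕ.+ n)) middle)

    fermat-ℕ : ∀ c → (+ c) ^ p ≡ + c mod P
    fermat-ℕ zero = ≡⇒≡mod (subst (λ n → 0ℤ ^ n ≡ 0ℤ) suc-p-1 refl)
    fermat-ℕ (suc c) = trans-mod (frobenius 1ℤ (+ c)) (+-mod (≡⇒≡mod (ℤₚ.^-zeroˡ p)) (fermat-ℕ c))

    fermat : ∀ c → c ^ p ≡ c mod P
    fermat (+ c) = fermat-ℕ c
    fermat c@(-[1+ n ]) = trans-mod (^-mod p c≡k) (trans-mod (fermat-ℕ k) (sym-mod c≡k))
      where
      k = suc n ℕ.* p-1
      eq : ∀ s q → - s - s * q ≡ - s * (1ℤ + q)
      eq = solve-∀
      c≡k : c ≡ + k mod P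
      c≡k = by (divides c (trans (cong (λ z → c - z) (ℤₚ.pos-* (suc n) p-1)) (trans (eq (+ suc n) (+ p-1)) (cong (c *_) (cong +_ suc-p-1)))))

    fermat-unit : ∀ {c} → Unit c → c ^ p-1 ≡ 1ℤ mod P
    fermat-unit {c} uc = by (∣-trans (∣-reflexive (sym (ℤₚ.^-identityʳ P))) (unit-cancel uc 1 (∣-trans (∣-reflexive (ℤₚ.^-identityʳ P)) (∣-resp (trans (cong (λ n → c ^ n - c) (sym suc-p-1)) (eq c (c ^ p-1))) (divides-difference (fermat c))))))
      where
      eq : ∀ c x → c * x - c ≡ c * (x - 1ℤ)
      eq = solve-∀

    -- In xᵖ - 1 = (x - 1)(1 + x + ⋯ + xᵖ⁻¹) the second factor is congruent to p, hence to 0, modulo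
    -- p.
    lift : ∀ i {x} → x ≡ 1ℤ mod P ^ suc i → x ^ p ≡ 1ℤ mod P ^ (2 ℕ.+ i)
    lift i {x} h@(by d) = by (∣-resp (trans (ℤₚ.*-comm (Σ< p (x ^_)) (x - 1ℤ)) (geometric x p)) (*-mono-∣ geometric-∣ d))
      where
      geometric-∣ : P ∣ Σ< p (x ^_)
      geometric-∣ = mod-∣ (Σ<-cong-mod p (λ i _ → trans-mod (^-mod i (mod-weaken (divides (P ^ i′) (ℤₚ.*-comm P (P ^ i′))) h)) (≡⇒≡mod (ℤₚ.^-zeroˡ i)))) (∣-reflexive (sym (Σ<-1 p)))
        where i′ = i

    euler : ∀ T {c} → Unit c → c ^ (p-1 ℕ.* p ℕ.^ T) ≡ 1ℤ mod P ^ suc T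
    euler zero {c} uc = mod-weaken (∣-reflexive (ℤₚ.^-identityʳ P)) (subst (λ n → c ^ n ≡ 1ℤ mod P) (sym (ℕₚ.*-identityʳ p-1)) (fermat-unit uc))
    euler (suc T) {c} uc = subst (_≡ 1ℤ mod P ^ (2 ℕ.+ T)) (trans (ℤₚ.^-*-assoc c (p-1 ℕ.* p ℕ.^ T) p) (cong (c ^_) (eq p-1 (p ℕ.^ T) p))) (lift T (euler T uc))
      where
      eq : ∀ a b c → a ℕ.* b ℕ.* c ≡ a ℕ.* (c ℕ.* b)
      eq = ℕS.solve-∀

    n<p^n : ∀ n → n ℕ.< p ℕ.^ n
    n<p^n zero = s≤s z≤n
    n<p^n (suc n) = ℕₚ.≤-trans (ℕₚ.+-mono-≤ (ℕₚ.m^n>0 p n) (n<p^n n)) (ℕₚ.≤-trans (ℕₚ.≤-reflexive (eq (p ℕ.^ n))) (ℕₚ.*-monoˡ-≤ (p ℕ.^ n) (ℕₚ.≤-trans (s≤s (s≤s z≤n)) 5≤p)))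
      where
      eq : ∀ x → x ℕ.+ x ≡ 2 ℕ.* x
      eq = ℕS.solve-∀

    -- The even power (c²)ᵉ acts as c⁻² on units and vanishes on multiples of p.
    inverse-square : ∀ T → ∃ λ e → T ℕ.≤ e × (∀ {c} → Unit c → (c * c) ^ suc e ≡ 1ℤ mod P ^ T)
    inverse-square T with half
    ... | zero , e with s≤s () ← subst (5 ℕ.≤_) (trans (sym suc-p-1) (cong suc e)) 5≤p
    -- Euler's exponent (p - 1)pᵀ is (h + 1)pᵀ as an exponent of c², and the inverse needs one less.
    -- The bound T ≤ e comes from T < pᵀ.
    ... | suc h , e = ℕ.pred (suc h ℕ.* p ℕ.^ T) , ℕₚ.<⇒≤pred big , λ {c} uc →
        subst (_≡ 1ℤ mod P ^ T) (power c) (mod-weaken (^-∣ P (ℕₚ.n≤1+n T)) (euler T uc))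
      where
      big : T ℕ.< suc h ℕ.* p ℕ.^ T
      big = ℕₚ.≤-trans (n<p^n T) (ℕₚ.m≤n*m (p ℕ.^ T) (suc h))
      square : ∀ c n → (c * c) ^ n ≡ c ^ (n ℕ.+ n)
      square c zero = refl
      square c (suc n) = trans (cong (λ z → c * c * z) (square c n)) (trans (ℤₚ.*-assoc c c (c ^ (n ℕ.+ n))) (cong (λ z → c * c ^ z) (sym (ℕₚ.+-suc n n))))
      power : ∀ c → c ^ (p-1 ℕ.* p ℕ.^ T) ≡ (c * c) ^ suc (ℕ.pred (suc h ℕ.* p ℕ.^ T))
      power c = trans (cong (c ^_) (trans (cong (ℕ._* p ℕ.^ T) e) (ℕₚ.*-distribʳ-+ (p ℕ.^ T) (suc h) (suc h)))) (trans (sym (square c (suc h ℕ.* p ℕ.^ T)))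
        (cong ((c * c) ^_) (sym (ℕₚ.suc-pred (suc h ℕ.* p ℕ.^ T) {{ℕ.>-nonZero (ℕₚ.≤-<-trans z≤n big)}}))))

  -- Binomial coefficients modulo prime powers.

  c : ℕ → ℕ → ℤ
  c m k = + (m C k)

  c-bin : ∀ a b → c (a ℕ.+ b) a ≡ + bin a b
  c-bin a b = cong +_ (sym (bin≡C a b))

  c-zero : ∀ {m k} → m ℕ.< k → c m k ≡ 0ℤ
  c-zero m<k = cong +_ (k>n⇒nCk≡0 m<k)

  c-top : ∀ m k → (1ℤ + + k) * c (suc m) (suc k) ≡ (1ℤ + + m) * c m k
  c-top m k with ℕₚ.≤-<-connex k m
  ... | inj₂ m<k = trans (cong (λ z → (1ℤ + + k) * z) (c-zero (s≤s m<k))) (trans (eq (1ℤ + + k) (1ℤ + + m)) (cong (λ z → (1ℤ + + m) * z) (sym (c-zero m<k))))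
    where
    eq : ∀ a b → a * 0ℤ ≡ b * 0ℤ
    eq = solve-∀
  ... | inj₁ k≤m with ℕₚ.m≤n⇒∃[o]m+o≡n k≤m
  ... | o , refl = begin
    + suc k * c (suc k ℕ.+ o) (suc k) ≡⟨ cong (λ z → + suc k * z) (c-bin (suc k) o) ⟩
    + suc k * + bin (suc k) o ≡⟨ ℤₚ.pos-* (suc k) (bin (suc k) o) ⟨
    + (suc k ℕ.* bin (suc k) o) ≡⟨ cong +_ (bin-absorb k o) ⟩
    + (suc (k ℕ.+ o) ℕ.* bin k o) ≡⟨ ℤₚ.pos-* (suc (k ℕ.+ o)) (bin k o) ⟩
    + suc (k ℕ.+ o) * + bin k o ≡⟨ cong (λ z → + suc (k ℕ.+ o) * z) (c-bin k o) ⟨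
    + suc (k ℕ.+ o) * c (k ℕ.+ o) k ∎
    where open ≡-Reasoning

  c-symm : ∀ a b → c (a ℕ.+ b) a ≡ c (a ℕ.+ b) b
  c-symm a b = trans (c-bin a b) (trans (cong +_ (bin-comm a b)) (trans (sym (c-bin b a)) (cong (λ n → c n b) (ℕₚ.+-comm b a))))

  c-lower : ∀ m k → (1ℤ + + m - + k) * c (suc m) k ≡ (1ℤ + + m) * c m k
  c-lower m k with ℕₚ.≤-<-connex k m
  ... | inj₁ k≤m with ℕₚ.m≤n⇒∃[o]m+o≡n k≤m
  ... | o , refl = begin
    (1ℤ + + (k ℕ.+ o) - + k) * c (suc (k ℕ.+ o)) k ≡⟨ cong₂ _*_ (trans (cong (λ z → 1ℤ + z - + k) (ℤₚ.pos-+ k o)) (eq (+ k) (+ o)))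
       (trans (cong (λ n → c n k) (sym (ℕₚ.+-suc k o))) (trans (c-symm k (suc o)) (cong (λ n → c n (suc o)) (ℕₚ.+-suc k o)))) ⟩
    (1ℤ + + o) * c (suc (k ℕ.+ o)) (suc o) ≡⟨ c-top (k ℕ.+ o) o ⟩
    (1ℤ + + (k ℕ.+ o)) * c (k ℕ.+ o) o ≡⟨ cong (λ z → (1ℤ + + (k ℕ.+ o)) * z) (c-symm k o) ⟨
    (1ℤ + + (k ℕ.+ o)) * c (k ℕ.+ o) k ∎
    where
    open ≡-Reasoning
    eq : ∀ k o → 1ℤ + (k + o) - k ≡ 1ℤ + o
    eq = solve-∀
  c-lower m k | inj₂ m<k with ℕₚ.≤-<-connex k (suc m)
  ... | inj₁ k≤1+m with refl ← ℕₚ.≤-antisym k≤1+m m<k = trans (cong (_* c (suc m) (suc m)) (ℤₚ.+-inverseʳ (1ℤ + + m))) (trans (sym (ℤₚ.*-zeroʳ (1ℤ + + m))) (cong (λ z → (1ℤ + + m) * z) (sym (c-zero m<k))))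
  ... | inj₂ 1+m<k = trans (cong (λ z → (1ℤ + + m - + k) * z) (c-zero 1+m<k)) (trans (eq (1ℤ + + m - + k) (1ℤ + + m)) (cong (λ z → (1ℤ + + m) * z) (sym (c-zero m<k))))
    where
    eq : ∀ a b → a * 0ℤ ≡ b * 0ℤ
    eq = solve-∀

  c-absorb : ∀ m k → (1ℤ + + k) * c m (suc k) ≡ (+ m - + k) * c m k
  c-absorb zero zero = refl
  c-absorb zero (suc k) = trans (cong (λ z → (1ℤ + + suc k) * z) (c-zero {0} {2 ℕ.+ k} (s≤s z≤n))) (trans (eq (1ℤ + + suc k) (0ℤ - + suc k)) (cong (λ z → (0ℤ - + suc k) * z) (sym (c-zero {0} {suc k} (s≤s z≤n)))))
    where
    eq : ∀ a b → a * 0ℤ ≡ b * 0ℤ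
    eq = solve-∀
  c-absorb (suc m) k = trans (c-top m k) (sym (c-lower m k))

  ε : ℕ → ℤ
  ε n = -1ℤ ^ n

  ε-+ : ∀ m n → ε (m ℕ.+ n) ≡ ε m * ε n
  ε-+ = ℤₚ.^-distribˡ-+-* -1ℤ

  ε-double : ∀ h → ε (h ℕ.+ h) ≡ 1ℤ
  ε-double zero = refl
  ε-double (suc h) = trans (cong (λ n → -1ℤ * ε n) (ℕₚ.+-suc h h)) (trans (eq (ε (h ℕ.+ h))) (ε-double h))
    where
    eq : ∀ x → -1ℤ * (-1ℤ * x) ≡ x
    eq = solve-∀

  ε-square : ∀ n → ε n * ε n ≡ 1ℤ
  ε-square n = trans (sym (ε-+ n n)) (ε-double n)

  Π<-neg : ∀ n f → Π< n (λ i → - f i) ≡ ε n * Π< n f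
  Π<-neg zero f = refl
  Π<-neg (suc n) f = trans (cong (_* - f n) (Π<-neg n f)) (eq (ε n) (Π< n f) (f n))
    where
    eq : ∀ a b x → a * b * - x ≡ -1ℤ * a * (b * x)
    eq = solve-∀

  Σ<-interleave : ∀ h f → Σ< (suc (h ℕ.+ h)) f ≡ Σ< (suc h) (λ i → f (i ℕ.+ i)) + Σ< h (λ i → f (suc (i ℕ.+ i)))
  Σ<-interleave zero f = sym (ℤₚ.+-identityʳ (0ℤ + f 0))
  Σ<-interleave (suc h) f rewrite ℕₚ.+-suc h h = trans (cong (λ z → z + f (suc (h ℕ.+ h)) + f (2 ℕ.+ (h ℕ.+ h))) (Σ<-interleave h f))
    (eq (Σ< (suc h) (λ i → f (i ℕ.+ i))) (Σ< h (λ i → f (suc (i ℕ.+ i)))) (f (suc (h ℕ.+ h))) (f (2 ℕ.+ (h ℕ.+ h))))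
    where
    eq : ∀ a b x y → a + b + x + y ≡ a + y + (b + x)
    eq = solve-∀

  -- The period 2h + 1 is odd: doubling sends i ≤ h to the even residues and, after one period is
  -- removed, i > h to the odd ones.
  Σ<-doubling : ∀ {d} h f → (∀ i → f (suc (h ℕ.+ h) ℕ.+ i) ≡ f i mod d) → Σ< (suc (h ℕ.+ h)) (λ i → f (i ℕ.+ i)) ≡ Σ< (suc (h ℕ.+ h)) f mod d
  Σ<-doubling {d} h f periodic = trans-mod (≡⇒≡mod (Σ<-split (suc h) h (λ i → f (i ℕ.+ i))))
    (trans-mod (+-mod (refl-mod {x = Σ< (suc h) (λ i → f (i ℕ.+ i))}) (Σ<-cong-mod h (λ i _ → subst (λ n → f n ≡ f (suc (i ℕ.+ i)) mod d) (eq h i) (periodic (suc (i ℕ.+ i))))))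
               (≡⇒≡mod (sym (Σ<-interleave h f))))
    where
    eq : ∀ h i → suc (h ℕ.+ h) ℕ.+ suc (i ℕ.+ i) ≡ suc h ℕ.+ i ℕ.+ (suc h ℕ.+ i)
    eq = ℕS.solve-∀

  module Blocks (p : ℕ) (prime : Prime p) (5≤p : 5 ℕ.≤ p) where
    open Local p prime 5≤p

    q : ℕ
    q = p-1

    ε-q : ε q ≡ 1ℤ
    ε-q = trans (cong ε (proj₂ half)) (ε-double (proj₁ half))

    ε-p^ : ∀ j → ε (p ℕ.^ j) ≡ -1ℤ
    ε-p^ zero = refl
    ε-p^ (suc j) = trans (sym (ℤₚ.^-*-assoc -1ℤ p (p ℕ.^ j))) (trans (cong (_^ (p ℕ.^ j)) (trans (cong ε (sym suc-p-1)) (cong (λ z → -1ℤ * z) ε-q))) (ε-p^ j))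

    unit-suc : ∀ {r} → r ℕ.< q → ∀ β → Unit (+ (p ℕ.* β ℕ.+ suc r))
    unit-suc {r} r<q β = unit-mod (by (divides (+ β) (trans (cong (_- + suc r) (trans (ℤₚ.pos-+ (p ℕ.* β) (suc r)) (cong (_+ + suc r) (ℤₚ.pos-* p β)))) (eq P (+ β) (+ suc r)))))
      (unit-< (λ ()) (subst (suc r ℕ.<_) suc-p-1 (s≤s r<q)))
      where
      eq : ∀ P b r → P * b + r - r ≡ b * P
      eq = solve-∀

    unit-Π : ∀ n {f} → (∀ i → i ℕ.< n → Unit (f i)) → Unit (Π< n f)
    unit-Π zero h = unit-1
    unit-Π (suc n) h = unit-* (unit-Π n (λ i i<n → h i (ℕₚ.m≤n⇒m≤1+n i<n))) (h n ℕₚ.≤-refl)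

    -- The product of f j over the j ≤ pβ + ρ prime to p.
    ΠU : (ℕ → ℤ) → ℕ → ℕ → ℤ
    ΠU f β ρ = Π< β (λ b → Π< q (λ r → f (p ℕ.* b ℕ.+ suc r))) * Π< ρ (λ r → f (p ℕ.* β ℕ.+ suc r))

    -- With N = n + 1, the binomial C(pN - 1, k) is the product of (pN - j)/j over 1 ≤ j ≤ k. The
    -- factors with j = pb reduce to (N - b)/b and form C(N - 1, β); the others are the two products
    -- `ΠU`.
    c-ΠU : ∀ {m n} → suc m ≡ p ℕ.* suc n → ∀ β ρ → c m (p ℕ.* β ℕ.+ ρ) * ΠU +_ β ρ ≡ c n β * ΠU (λ j → + suc m - + j) β ρ
    c-ΠU {m} {n} e zero zero = cong (λ k → c m k * (1ℤ * 1ℤ)) (trans (ℕₚ.+-identityʳ (p ℕ.* 0)) (ℕₚ.*-zeroʳ p))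
    c-ΠU {m} {n} e β (suc ρ) = begin
      c m (p ℕ.* β ℕ.+ suc ρ) * (A * (B * + (p ℕ.* β ℕ.+ suc ρ)))
        ≡⟨ cong (λ k → c m k * (A * (B * + k))) (ℕₚ.+-suc (p ℕ.* β) ρ) ⟩
      c m (suc k) * (A * (B * + suc k)) ≡⟨ eq₁ (c m (suc k)) A B (+ suc k) ⟩
      + suc k * c m (suc k) * (A * B) ≡⟨ cong (_* (A * B)) (c-absorb m k) ⟩
      (+ m - + k) * c m k * (A * B) ≡⟨ ℤₚ.*-assoc (+ m - + k) (c m k) (A * B) ⟩
      (+ m - + k) * (c m k * (A * B)) ≡⟨ cong (λ z → (+ m - + k) * z) (c-ΠU e β ρ) ⟩
      (+ m - + k) * (c n β * (A′ * B′)) ≡⟨ eq₂ (+ m) (+ k) (c n β) A′ B′ ⟩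
      c n β * (A′ * (B′ * (+ suc m - + suc k))) ≡⟨ cong (λ k → c n β * (A′ * (B′ * (+ suc m - + k)))) (ℕₚ.+-suc (p ℕ.* β) ρ) ⟨
      c n β * (A′ * (B′ * (+ suc m - + (p ℕ.* β ℕ.+ suc ρ)))) ∎
      where
      open ≡-Reasoning
      k = p ℕ.* β ℕ.+ ρ
      A B A′ B′ : ℤ
      A = Π< β (λ b → Π< q (λ r → + (p ℕ.* b ℕ.+ suc r)))
      B = Π< ρ (λ r → + (p ℕ.* β ℕ.+ suc r))
      A′ = Π< β (λ b → Π< q (λ r → + suc m - + (p ℕ.* b ℕ.+ suc r)))
      B′ = Π< ρ (λ r → + suc m - + (p ℕ.* β ℕ.+ suc r))
      eq₁ : ∀ x a b k → x * (a * (b * k)) ≡ k * x * (a * b)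
      eq₁ = solve-∀
      eq₂ : ∀ m k x a b → (m - k) * (x * (a * b)) ≡ x * (a * (b * (1ℤ + m - (1ℤ + k))))
      eq₂ = solve-∀
    c-ΠU {m} {n} e (suc β) zero = ℤₚ.*-cancelˡ-≡ P _ _ (ℤₚ.*-cancelˡ-≡ (+ suc β) _ _ (begin
      + suc β * (P * (c m (p ℕ.* suc β ℕ.+ 0) * (U * 1ℤ))) ≡⟨ cong (λ i → + suc β * (P * (c m i * (U * 1ℤ)))) index ⟩
      + suc β * (P * (c m (suc k) * (U * 1ℤ))) ≡⟨ eq₁ (+ suc β) P (c m (suc k)) U ⟩
      P * + suc β * c m (suc k) * U ≡⟨ cong (λ z → z * c m (suc k) * U) (trans (sym (ℤₚ.pos-* p (suc β))) (cong +_ (trans (sym (ℕₚ.+-identityʳ (p ℕ.* suc β))) index))) ⟩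
      + suc k * c m (suc k) * U ≡⟨ cong (_* U) (c-absorb m k) ⟩
      (+ m - + k) * c m k * U ≡⟨ ℤₚ.*-assoc (+ m - + k) (c m k) U ⟩
      (+ m - + k) * (c m k * U) ≡⟨ cong₂ _*_ scaled (c-ΠU e β q) ⟩
      P * (+ n - + β) * (c n β * U′) ≡⟨ eq₂ P (+ n - + β) (c n β) U′ ⟩
      P * ((+ n - + β) * c n β) * U′ ≡⟨ cong (λ z → P * z * U′) (c-absorb n β) ⟨
      P * (+ suc β * c n (suc β)) * U′ ≡⟨ eq₃ P (+ suc β) (c n (suc β)) U′ ⟩
      + suc β * (P * (c n (suc β) * (U′ * 1ℤ))) ∎))
      where
      open ≡-Reasoning
      k = p ℕ.* β ℕ.+ q
      U U′ : ℤ
      U = ΠU +_ β q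
      U′ = ΠU (λ j → + suc m - + j) β q
      index : p ℕ.* suc β ℕ.+ 0 ≡ suc k
      index = trans (ℕₚ.+-identityʳ (p ℕ.* suc β)) (trans (ℕₚ.*-suc p β) (trans (ℕₚ.+-comm p (p ℕ.* β)) (trans (cong (p ℕ.* β ℕ.+_) (sym suc-p-1)) (ℕₚ.+-suc (p ℕ.* β) q))))
      eq₁ : ∀ s P x u → s * (P * (x * (u * 1ℤ))) ≡ P * s * x * u
      eq₁ = solve-∀
      eq₂ : ∀ P d x u → P * d * (x * u) ≡ P * (d * x) * u
      eq₂ = solve-∀
      eq₃ : ∀ P s x u → P * (s * x) * u ≡ s * (P * (x * (u * 1ℤ)))
      eq₃ = solve-∀
      eq₄ : ∀ P n b → P * (1ℤ + n) - P * (1ℤ + b) ≡ P * (n - b)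
      eq₄ = solve-∀
      eq₅ : ∀ m k → m - k ≡ 1ℤ + m - (1ℤ + k)
      eq₅ = solve-∀
      scaled : + m - + k ≡ P * (+ n - + β)
      scaled = trans (eq₅ (+ m) (+ k)) (trans (cong₂ _-_ (trans (cong +_ e) (ℤₚ.pos-* p (suc n))) (trans (cong +_ (sym (trans (sym (ℕₚ.+-identityʳ (p ℕ.* suc β))) index))) (ℤₚ.pos-* p (suc β)))) (eq₄ P (+ n) (+ β)))

    unit-ΠU : ∀ β {ρ} → ρ ℕ.≤ q → Unit (ΠU +_ β ρ)
    unit-ΠU β ρ≤q = unit-* (unit-Π β (λ b _ → unit-Π q (λ r r<q → unit-suc r<q b))) (unit-Π _ (λ r r<ρ → unit-suc (ℕₚ.<-≤-trans r<ρ ρ≤q) β))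

    ΠU-neg : ∀ f β ρ → ΠU (λ j → - f j) β ρ ≡ ε ρ * ΠU f β ρ
    ΠU-neg f β ρ = trans (cong₂ _*_ (Π<-cong β (λ b _ → trans (Π<-neg q _) (trans (cong (_* Π< q (λ r → f (p ℕ.* b ℕ.+ suc r))) ε-q) (ℤₚ.*-identityˡ _)))) (Π<-neg ρ _))
      (eq (Π< β (λ b → Π< q (λ r → f (p ℕ.* b ℕ.+ suc r)))) (ε ρ) (Π< ρ (λ r → f (p ℕ.* β ℕ.+ suc r))))
      where
      eq : ∀ a e b → a * (e * b) ≡ e * (a * b)
      eq = solve-∀

    ΠU-mod : ∀ {d f g} → (∀ j → f j ≡ g j mod d) → ∀ β ρ → ΠU f β ρ ≡ ΠU g β ρ mod d
    ΠU-mod h β ρ = *-mod (Π<-cong-mod β (λ b _ → Π<-cong-mod q (λ r _ → h _))) (Π<-cong-mod ρ (λ r _ → h _))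

    -- Each remaining factor (m + 1 - j)/j is -1 modulo pⁱ. A full block has p - 1 of them, an even
    -- number, so only the ρ factors of the last block affect the sign.
    c-mod : ∀ i {m n} → suc m ≡ p ℕ.* suc n → P ^ i ∣ + suc m → ∀ β {ρ} → ρ ℕ.≤ q → c m (p ℕ.* β ℕ.+ ρ) ≡ ε ρ * c n β mod P ^ i
    c-mod i {m} {n} e h β {ρ} ρ≤q = unit-cancel-mod (unit-ΠU β ρ≤q) i (trans-mod (≡⇒≡mod (trans (ℤₚ.*-comm (ΠU +_ β ρ) (c m (p ℕ.* β ℕ.+ ρ))) (c-ΠU e β ρ)))
      (trans-mod (*ˡ-mod (c n β) (trans-mod (ΠU-mod {f = λ j → + suc m - + j} {g = λ j → - (+ j)} (λ j → by (∣-resp (eq (+ suc m) (+ j)) h)) β ρ) (≡⇒≡mod (ΠU-neg +_ β ρ))))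
        (≡⇒≡mod (eq′ (c n β) (ε ρ) (ΠU +_ β ρ)))))
      where
      eq : ∀ m j → m ≡ m - j - - j
      eq = solve-∀
      eq′ : ∀ x e u → x * (e * u) ≡ u * (e * x)
      eq′ = solve-∀

  *-∣-mod : ∀ {d e a x y} → d ∣ a → x ≡ y mod e → a * x ≡ a * y mod d * e
  *-∣-mod {d} {e} {a} {x} {y} h (by k) = by (∣-resp (eq a x y) (*-mono-∣ h k))
    where
    eq : ∀ a x y → a * (x - y) ≡ a * x - a * y
    eq = solve-∀

  -- Sums over blocks of p-power length.

  module BlockSums (p : ℕ) (prime : Prime p) (5≤p : 5 ℕ.≤ p) where
    open Local p prime 5≤p
    open Blocks p prime 5≤p

    -- Good i j Ψ: for every s ≤ i the sums of Ψ over aligned blocks of length pˢ are divisible by pʲ⁺ˢ.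
    Good : ℕ → ℕ → (ℕ → ℤ) → Set
    Good zero j Ψ = ∀ β → P ^ j ∣ Ψ β
    Good (suc i) j Ψ = (∀ β → P ^ j ∣ Ψ β) × Good i (suc j) (λ β → Σ< p (λ ρ → Ψ (p ℕ.* β ℕ.+ ρ)))

    -- Summing p consecutive block sums of length pʲ gives a block sum of length pʲ⁺¹, so one
    -- divisibility statement about Φ supplies all levels of `Good`.
    good-blocks : ∀ Φ → (∀ j β → P ^ j ∣ Σ< (p ℕ.^ j) (λ ρ → Φ (p ℕ.^ j ℕ.* β ℕ.+ ρ))) →
      ∀ i j Ψ → (∀ β → Ψ β ≡ Σ< (p ℕ.^ j) (λ ρ → Φ (p ℕ.^ j ℕ.* β ℕ.+ ρ))) → Good i j Ψ
    good-blocks Φ h zero j Ψ e β = ∣-resp (sym (e β)) (h j β)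
    good-blocks Φ h (suc i) j Ψ e = (λ β → ∣-resp (sym (e β)) (h j β)) , good-blocks Φ h i (suc j) _ (λ β → begin
      Σ< p (λ ρ → Ψ (p ℕ.* β ℕ.+ ρ)) ≡⟨ Σ<-cong p (λ ρ _ → e (p ℕ.* β ℕ.+ ρ)) ⟩
      Σ< p (λ ρ → Σ< s (λ σ → Φ (s ℕ.* (p ℕ.* β ℕ.+ ρ) ℕ.+ σ))) ≡⟨ Σ<-cong p (λ ρ _ → Σ<-cong s (λ σ _ → cong Φ (eq s p β ρ σ))) ⟩
      Σ< p (λ ρ → Σ< s (λ σ → Φ (p ℕ.* s ℕ.* β ℕ.+ (s ℕ.* ρ ℕ.+ σ)))) ≡⟨ Σ<-blocks s p (λ τ → Φ (p ℕ.* s ℕ.* β ℕ.+ τ)) ⟨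
      Σ< (s ℕ.* p) (λ τ → Φ (p ℕ.* s ℕ.* β ℕ.+ τ)) ≡⟨ cong (λ n → Σ< n (λ τ → Φ (p ℕ.* s ℕ.* β ℕ.+ τ))) (ℕₚ.*-comm s p) ⟩
      Σ< (p ℕ.* s) (λ τ → Φ (p ℕ.* s ℕ.* β ℕ.+ τ)) ∎)
      where
      open ≡-Reasoning
      s = p ℕ.^ j
      eq : ∀ s p β ρ σ → s ℕ.* (p ℕ.* β ℕ.+ ρ) ℕ.+ σ ≡ p ℕ.* s ℕ.* β ℕ.+ (s ℕ.* ρ ℕ.+ σ)
      eq = ℕS.solve-∀

    pred-block : ∀ {m n} → suc m ≡ p ℕ.* suc n → m ≡ p ℕ.* n ℕ.+ q
    pred-block {m} {n} e = ℕₚ.suc-injective (trans e (trans (ℕₚ.*-suc p n) (trans (ℕₚ.+-comm p (p ℕ.* n)) (trans (cong (p ℕ.* n ℕ.+_) (sym suc-p-1)) (ℕₚ.+-suc (p ℕ.* n) q)))))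

    -- Modulo pⁱ the binomial product depends on β only through ⌊β/p⌋, so the sum collapses block by block.
    block-sum : ∀ i j Ψ {m l e x y z} → suc m ≡ p ℕ.^ i ℕ.* suc x → suc l ≡ p ℕ.^ i ℕ.* suc y → suc e ≡ p ℕ.^ i ℕ.* suc z →
      Good i j Ψ → P ^ j * P ^ i ∣ Σ< (suc e) (λ β → Ψ β * (c m β * c l (e ℕ.∸ β)))
    block-sum zero j Ψ {m} {l} {e} _ _ _ good = Σ<-∣ (suc e) (λ β _ → *-mono-∣ (good β) (divides (c m β * c l (e ℕ.∸ β)) (sym (ℤₚ.*-identityʳ _))))
    block-sum (suc i) j Ψ {m} {l} {e} {x} {y} {z} em el ee (good , good′) =
      mod-∣ (trans-mod (≡⇒≡mod (trans (cong (λ n → Σ< n f) (down ee)) (Σ<-blocks p (suc e′) f)))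
        (Σ<-cong-mod (suc e′) (λ β β<e → trans-mod (Σ<-cong-mod p (λ ρ ρ<p → *-∣-mod (good (p ℕ.* β ℕ.+ ρ)) (weights β ρ (ℕₚ.≤-pred β<e) (ℕₚ.≤-pred (subst (suc ρ ℕ.≤_) (sym suc-p-1) ρ<p)))))
          (≡⇒≡mod (trans (Σ<-cong p (λ ρ _ → ℤₚ.*-comm (Ψ (p ℕ.* β ℕ.+ ρ)) (w β))) (trans (Σ<-* p (w β) (λ ρ → Ψ (p ℕ.* β ℕ.+ ρ))) (ℤₚ.*-comm (w β) _)))))))
        (∣-trans (∣-reflexive (eq P (P ^ j) (P ^ i))) (block-sum i (suc j) _ (up x) (up y) (up z) good′))
      where
      f : ℕ → ℤ
      f β = Ψ β * (c m β * c l (e ℕ.∸ β))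
      m′ l′ e′ : ℕ
      m′ = ℕ.pred (p ℕ.^ i ℕ.* suc x)
      l′ = ℕ.pred (p ℕ.^ i ℕ.* suc y)
      e′ = ℕ.pred (p ℕ.^ i ℕ.* suc z)
      w : ℕ → ℤ
      w β = c m′ β * c l′ (e′ ℕ.∸ β)
      eq : ∀ P a b → a * (P * b) ≡ P * a * b
      eq = solve-∀
      up : ∀ x → suc (ℕ.pred (p ℕ.^ i ℕ.* suc x)) ≡ p ℕ.^ i ℕ.* suc x
      up x = ℕₚ.suc-pred _ {{ℕₚ.m*n≢0 (p ℕ.^ i) (suc x) {{ℕₚ.m^n≢0 p i}}}}
      down : ∀ {n x} → suc n ≡ p ℕ.^ suc i ℕ.* suc x → suc n ≡ p ℕ.* suc (ℕ.pred (p ℕ.^ i ℕ.* suc x))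
      down {n} {x} h = trans h (trans (ℕₚ.*-assoc p (p ℕ.^ i) (suc x)) (cong (p ℕ.*_) (sym (up x))))
      power-∣ : ∀ {n x} → suc n ≡ p ℕ.^ suc i ℕ.* suc x → P ^ suc i ∣ + suc n
      power-∣ {n} {x} h = divides (+ suc x) (trans (cong +_ h) (trans (ℤₚ.pos-* (p ℕ.^ suc i) (suc x)) (trans (cong (_* + suc x) (pos-^ p (suc i))) (ℤₚ.*-comm (P ^ suc i) (+ suc x)))))
      -- Since p divides e + 1, the last digit of e is p - 1 and subtracting pβ + ρ needs no borrow:
      -- the complement has digits e′ - β and q - ρ. The two signs multiply to (-1)^(p-1) = 1.
      weights : ∀ β ρ → β ℕ.≤ e′ → ρ ℕ.≤ q → c m (p ℕ.* β ℕ.+ ρ) * c l (e ℕ.∸ (p ℕ.* β ℕ.+ ρ)) ≡ w β mod P ^ suc i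
      weights β ρ β≤e′ ρ≤q = trans-mod (*-mod (c-mod (suc i) (down em) (power-∣ em) β ρ≤q)
          (subst (λ n → c l n ≡ ε (q ℕ.∸ ρ) * c l′ (e′ ℕ.∸ β) mod P ^ suc i) (sym index) (c-mod (suc i) (down el) (power-∣ el) (e′ ℕ.∸ β) (ℕₚ.m∸n≤m q ρ))))
        (≡⇒≡mod (trans (eq′ (ε ρ) (ε (q ℕ.∸ ρ)) (c m′ β) (c l′ (e′ ℕ.∸ β))) (trans (cong (_* w β) (trans (sym (ε-+ ρ (q ℕ.∸ ρ))) (trans (cong ε (ℕₚ.m+[n∸m]≡n ρ≤q)) ε-q))) (ℤₚ.*-identityˡ (w β)))))
        where
        eq′ : ∀ a b x y → a * x * (b * y) ≡ a * b * (x * y)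
        eq′ = solve-∀
        rearrange : ∀ p β r ρ s → p ℕ.* (β ℕ.+ r) ℕ.+ (ρ ℕ.+ s) ≡ p ℕ.* r ℕ.+ s ℕ.+ (p ℕ.* β ℕ.+ ρ)
        rearrange = ℕS.solve-∀
        index : e ℕ.∸ (p ℕ.* β ℕ.+ ρ) ≡ p ℕ.* (e′ ℕ.∸ β) ℕ.+ (q ℕ.∸ ρ)
        index = trans (cong (ℕ._∸ (p ℕ.* β ℕ.+ ρ)) (trans (pred-block (down ee)) (trans (cong₂ (λ b r → p ℕ.* b ℕ.+ r) (sym (ℕₚ.m+[n∸m]≡n β≤e′)) (sym (ℕₚ.m+[n∸m]≡n ρ≤q))) (rearrange p β (e′ ℕ.∸ β) ρ (q ℕ.∸ ρ)))))
          (ℕₚ.m+n∸n≡m _ (p ℕ.* β ℕ.+ ρ))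

    unit-2 : Unit (+ 2)
    unit-2 = unit-< (λ ()) (ℕₚ.≤-trans (s≤s (s≤s (s≤s z≤n))) 5≤p)

    unit-3 : Unit (+ 3)
    unit-3 = unit-< (λ ()) (ℕₚ.≤-trans (s≤s (s≤s (s≤s (s≤s z≤n)))) 5≤p)

    evenPower : ℕ → ℤ → ℤ
    evenPower e x = (x * x) ^ e

    evenPower-mod : ∀ {d x y} e → x ≡ y mod d → evenPower e x ≡ evenPower e y mod d
    evenPower-mod e h = ^-mod e (*-mod h h)

    evenPower-neg : ∀ e x → evenPower e (- x) ≡ evenPower e x
    evenPower-neg e x = cong (_^ e) (eq x)
      where
      eq : ∀ x → - x * - x ≡ x * x
      eq = solve-∀

    evenPower-∣ : ∀ j {e x} → 1 ℕ.≤ e → P ^ j ∣ x → P ^ j ∣ evenPower e x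
    evenPower-∣ j {suc e} {x} _ h = ∣m⇒∣m*n ((x * x) ^ e) (∣m⇒∣m*n x h)

    suc-pred-p^ : ∀ j → suc (ℕ.pred (p ℕ.^ j)) ≡ p ℕ.^ j
    suc-pred-p^ j = ℕₚ.suc-pred (p ℕ.^ j) {{ℕₚ.m^n≢0 p j}}

    p^-odd : ∀ j → ∃ λ h → p ℕ.^ j ≡ suc (h ℕ.+ h)
    p^-odd j with even-or-odd (p ℕ.^ j)
    ... | h , inj₂ e = h , e
    ... | h , inj₁ e with () ← trans (sym (ε-p^ j)) (trans (cong ε e) (ε-double h))

    -- The reflection ρ ↦ pʲ - 2 - ρ negates ρ + 1 modulo pʲ and, as pʲ is odd, reverses the sign;
    -- so twice the sum is 0 and 2 is a unit. The last index ρ = pʲ - 1 lies outside the reflection,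
    -- and its term is divisible because ρ + 1 = pʲ.
    alternating-block : ∀ e → 1 ℕ.≤ e → ∀ j β → P ^ j ∣ Σ< (p ℕ.^ j) (λ ρ → ε (p ℕ.^ j ℕ.* β ℕ.+ ρ) * evenPower e (+ suc (p ℕ.^ j ℕ.* β ℕ.+ ρ)))
    alternating-block e 1≤e j β = mod-∣ (trans-mod (Σ<-cong-mod s (λ ρ _ → trans-mod (*-mod (≡⇒≡mod (ε-+ (s ℕ.* β) ρ)) (evenPower-mod e (shift ρ)))
        (≡⇒≡mod (ℤₚ.*-assoc (ε (s ℕ.* β)) (ε ρ) (w (+ suc ρ)))))) (≡⇒≡mod (Σ<-* s (ε (s ℕ.* β)) g))) (∣n⇒∣m*n (ε (s ℕ.* β)) base)
      where
      s s′ : ℕ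
      s = p ℕ.^ j
      s′ = ℕ.pred s
      w : ℤ → ℤ
      w = evenPower e
      g : ℕ → ℤ
      g ρ = ε ρ * w (+ suc ρ)
      P^j≡s : P ^ j ≡ + s
      P^j≡s = sym (pos-^ p j)
      shift : ∀ ρ → + suc (s ℕ.* β ℕ.+ ρ) ≡ + suc ρ mod P ^ j
      shift ρ = by (divides (+ β) (trans (cong (_- + suc ρ) (trans (cong (λ z → 1ℤ + z) (trans (ℤₚ.pos-+ (s ℕ.* β) ρ) (cong (_+ + ρ) (ℤₚ.pos-* s β)))) refl)) (trans (eq (+ s) (+ β) (+ ρ)) (cong (λ z → + β * z) (sym P^j≡s)))))
        where
        eq : ∀ s b r → 1ℤ + (s * b + r) - (1ℤ + r) ≡ b * s
        eq = solve-∀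
      ε-s′ : ε s′ ≡ 1ℤ
      ε-s′ = trans (eq (ε s′)) (cong (λ z → -1ℤ * z) (trans (cong ε (suc-pred-p^ j)) (ε-p^ j)))
        where
        eq : ∀ x → x ≡ -1ℤ * (-1ℤ * x)
        eq = solve-∀
      reflected : ∀ ρ → ρ ℕ.< s′ → g (s′ ℕ.∸ suc ρ) ≡ - 1ℤ * g ρ mod P ^ j
      reflected ρ ρ<s′ = trans-mod (*-mod (≡⇒≡mod ε-reflected) (trans-mod (evenPower-mod e w-reflected) (≡⇒≡mod (evenPower-neg e (+ suc ρ))))) (≡⇒≡mod (ℤₚ.*-assoc -1ℤ (ε ρ) (w (+ suc ρ))))
        where
        sum : suc ρ ℕ.+ (s′ ℕ.∸ suc ρ) ≡ s′
        sum = ℕₚ.m+[n∸m]≡n ρ<s′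
        ε-reflected : ε (s′ ℕ.∸ suc ρ) ≡ -1ℤ * ε ρ
        ε-reflected = trans (sym (ℤₚ.*-identityˡ _)) (trans (cong (_* ε (s′ ℕ.∸ suc ρ)) (sym (ε-square (suc ρ)))) (trans (ℤₚ.*-assoc (ε (suc ρ)) (ε (suc ρ)) _)
          (trans (cong (λ z → ε (suc ρ) * z) (trans (sym (ε-+ (suc ρ) (s′ ℕ.∸ suc ρ))) (trans (cong ε sum) ε-s′))) (ℤₚ.*-identityʳ (ε (suc ρ))))))
        eq : ∀ r t → 1ℤ + t - - (1ℤ + r) ≡ 1ℤ + (1ℤ + r + t)
        eq = solve-∀
        w-reflected : + suc (s′ ℕ.∸ suc ρ) ≡ - (+ suc ρ) mod P ^ j
        w-reflected = by (∣-reflexive (sym (trans (eq (+ ρ) (+ (s′ ℕ.∸ suc ρ))) (trans (cong (λ z → 1ℤ + z) (trans (sym (ℤₚ.pos-+ (suc ρ) (s′ ℕ.∸ suc ρ))) (cong +_ sum))) (trans (cong +_ (suc-pred-p^ j)) (sym P^j≡s))))))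
      half-sum : P ^ j ∣ Σ< s′ g
      half-sum = unit-cancel unit-2 j (∣-resp (eq (Σ< s′ g)) (divides-difference (trans-mod (≡⇒≡mod (Σ<-reverse s′ g)) (trans-mod (Σ<-cong-mod s′ reflected) (≡⇒≡mod (Σ<-* s′ (- 1ℤ) g))))))
        where
        eq : ∀ x → x - - 1ℤ * x ≡ + 2 * x
        eq = solve-∀
      base : P ^ j ∣ Σ< s g
      base = subst (λ n → P ^ j ∣ Σ< n g) (suc-pred-p^ j) (∣m∣n⇒∣m+n half-sum (∣n⇒∣m*n (ε s′) (evenPower-∣ j {e} 1≤e (∣-reflexive (trans P^j≡s (cong +_ (sym (suc-pred-p^ j))))))))

    -- Multiplication by 2 permutes the residues modulo pʲ and multiplies c⁻² by 1/4.
    inverse-square-sum : ∀ {e} j → (∀ {x} → Unit x → (x * x) ^ suc e ≡ 1ℤ mod P ^ j) → P ^ j ∣ Σ< (p ℕ.^ j) (λ i → evenPower e (+ i))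
    inverse-square-sum {e} j inv with p^-odd j
    ... | h , odd = unit-cancel unit-3 j (∣-resp (eq (Σ< s g)) (divides-difference (trans-mod (*ˡ-mod (+ 4) (sym-mod doubled)) scaled)))
      where
      s : ℕ
      s = p ℕ.^ j
      g : ℕ → ℤ
      g i = evenPower e (+ i)
      eq : ∀ x → + 4 * x - x ≡ + 3 * x
      eq = solve-∀
      periodic : ∀ i → g (suc (h ℕ.+ h) ℕ.+ i) ≡ g i mod P ^ j
      periodic i = evenPower-mod {x = + (suc (h ℕ.+ h) ℕ.+ i)} {y = + i} e (by (∣-reflexive (sym (trans (cong (_- + i) (ℤₚ.pos-+ (suc (h ℕ.+ h)) i)) (trans (eq′ (+ suc (h ℕ.+ h)) (+ i)) (trans (cong +_ (sym odd)) (pos-^ p j)))))))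
        where
        eq′ : ∀ s i → s + i - i ≡ s
        eq′ = solve-∀
      doubled : Σ< s (λ i → g (i ℕ.+ i)) ≡ Σ< s g mod P ^ j
      doubled = subst (λ n → Σ< n (λ i → g (i ℕ.+ i)) ≡ Σ< n g mod P ^ j) (sym odd) (Σ<-doubling h g periodic)
      ^-distrib-* : ∀ x y n → (x * y) ^ n ≡ x ^ n * y ^ n
      ^-distrib-* x y zero = refl
      ^-distrib-* x y (suc n) = trans (cong (λ z → x * y * z) (^-distrib-* x y n)) (eq′ x y (x ^ n) (y ^ n))
        where
        eq′ : ∀ x y a b → x * y * (a * b) ≡ x * a * (y * b)
        eq′ = solve-∀
      -- Doubling multiplies the even power by 4ᵉ, and 4 · 4ᵉ ≡ 1 is the inverse-square property of
      -- the unit 2.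
      quarter : ∀ i → + 4 * g (i ℕ.+ i) ≡ g i mod P ^ j
      quarter i = trans-mod (≡⇒≡mod (trans (cong (λ z → + 4 * (z * z) ^ e) (ℤₚ.pos-+ i i)) (trans (cong (λ z → + 4 * z ^ e) (eq′ (+ i))) (trans (cong (λ z → + 4 * z) (^-distrib-* (+ 4) (+ i * + i) e)) (sym (ℤₚ.*-assoc (+ 4) ((+ 4) ^ e) (g i)))))))
        (trans-mod (*ʳ-mod (g i) (inv unit-2)) (≡⇒≡mod (ℤₚ.*-identityˡ (g i))))
        where
        eq′ : ∀ x → (x + x) * (x + x) ≡ + 4 * (x * x)
        eq′ = solve-∀
      scaled : + 4 * Σ< s (λ i → g (i ℕ.+ i)) ≡ Σ< s g mod P ^ j
      scaled = trans-mod (≡⇒≡mod (sym (Σ<-* s (+ 4) (λ i → g (i ℕ.+ i))))) (Σ<-cong-mod s (λ i _ → quarter i))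

  -- x′ = x + Y·A + Y²·B with A ≡ x·s: first-order expansion with logarithmic derivative s.
  record Expansion (d Y x′ x s : ℤ) : Set where
    constructor expansion
    field
      A B : ℤ
      expands : x′ ≡ x + Y * (A + Y * B)
      logarithmic : A ≡ x * s mod d

  expansion-* : ∀ {d Y x₁′ x₁ s₁ x₂′ x₂ s₂} → Expansion d Y x₁′ x₁ s₁ → Expansion d Y x₂′ x₂ s₂ → Expansion d Y (x₁′ * x₂′) (x₁ * x₂) (s₁ + s₂)
  expansion-* {d} {Y} {_} {x₁} {s₁} {_} {x₂} {s₂} (expansion A₁ B₁ refl h₁) (expansion A₂ B₂ refl h₂) =
    expansion (A₁ * x₂ + x₁ * A₂) (A₁ * A₂ + B₁ * x₂ + x₁ * B₂ + Y * (A₁ * B₂ + B₁ * A₂) + Y * (Y * (B₁ * B₂))) (eq x₁ x₂ Y A₁ A₂ B₁ B₂) (trans-mod (+-mod (*ʳ-mod x₂ h₁) (*ˡ-mod x₁ h₂)) (≡⇒≡mod (eq′ x₁ x₂ s₁ s₂)))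
    where
    eq : ∀ x y Y A A′ B B′ → (x + Y * (A + Y * B)) * (y + Y * (A′ + Y * B′)) ≡
      x * y + Y * (A * y + x * A′ + Y * (A * A′ + B * y + x * B′ + Y * (A * B′ + B * A′) + Y * (Y * (B * B′))))
    eq = solve-∀
    eq′ : ∀ x y s t → x * s * y + x * (y * t) ≡ x * y * (s + t)
    eq′ = solve-∀

  expansion-Π : ∀ {d Y} n {f′ f s : ℕ → ℤ} → (∀ i → i ℕ.< n → Expansion d Y (f′ i) (f i) (s i)) → Expansion d Y (Π< n f′) (Π< n f) (Σ< n s)
  expansion-Π {d} {Y} zero h = expansion 0ℤ 0ℤ (eq Y) refl-mod
    where
    eq : ∀ Y → 1ℤ ≡ 1ℤ + Y * (0ℤ + Y * 0ℤ)
    eq = solve-∀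
  expansion-Π (suc n) h = expansion-* (expansion-Π n (λ i i<n → h i (ℕₚ.m≤n⇒m≤1+n i<n))) (h n ℕₚ.≤-refl)

  -- Jacobsthal's congruence.

  module Supercongruence (p : ℕ) (prime : Prime p) (5≤p : 5 ℕ.≤ p) where
    open Local p prime 5≤p
    open Blocks p prime 5≤p
    open BlockSums p prime 5≤p

    valuation : ∀ k → k ≢ 0 → ∃ λ a → ∃ λ k′ → k ≡ p ℕ.^ a ℕ.* k′ × Unit (+ k′)
    valuation k k≢0 = go k k ℕₚ.≤-refl k≢0
      where
      go : ∀ fuel k → k ℕ.≤ fuel → k ≢ 0 → ∃ λ a → ∃ λ k′ → k ≡ p ℕ.^ a ℕ.* k′ × Unit (+ k′)
      go zero zero k≤ k≢0 = ⊥-elim (k≢0 refl)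
      go (suc fuel) k k≤ k≢0 with p ℕᵈ.∣? k
      ... | no ∤ = 0 , k , sym (ℕₚ.+-identityʳ k) , λ h → ∤ (pos-∣ h)
      ... | yes (ℕᵈ.divides i refl) with go fuel i (ℕₚ.≤-pred (ℕₚ.<-≤-trans i<ip k≤)) i≢0
        where
        i≢0 : i ≢ 0
        i≢0 refl = k≢0 refl
        i<ip : i ℕ.< i ℕ.* p
        i<ip = ℕₚ.m<m*n i p {{ℕ.≢-nonZero i≢0}} (ℕₚ.≤-trans (s≤s (s≤s z≤n)) 5≤p)
      ... | a , k′ , refl , u = suc a , k′ , eq (p ℕ.^ a) k′ p , u
        where
        eq : ∀ x k p → x ℕ.* k ℕ.* p ≡ p ℕ.* x ℕ.* k
        eq = ℕS.solve-∀

    -- For k = k₁ + 1 this is `ΠU f k₁ q`, a product ending with a full block; the index set j < pk,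
    -- p not dividing j, is then stable under j ↦ pk - j.
    V : (ℕ → ℤ) → ℕ → ℤ
    V f k = Π< k (λ b → Π< q (λ r → f (p ℕ.* b ℕ.+ suc r)))

    V-reflect : ∀ (g : ℤ → ℤ) k → V (λ j → g (+ j)) k ≡ V (λ j → g (+ (p ℕ.* k) - + j)) k
    V-reflect g k = trans (Π<-reverse k _) (Π<-cong k (λ b b<k → trans (Π<-reverse q _) (Π<-cong q (λ r r<q → cong g (index b r b<k r<q)))))
      where
      rearrange : ∀ p b b′ r r′ → p ℕ.* b′ ℕ.+ suc r′ ℕ.+ (p ℕ.* b ℕ.+ suc r) ≡ p ℕ.* (b ℕ.+ b′) ℕ.+ suc (suc r ℕ.+ r′)
      rearrange = ℕS.solve-∀
      eq : ∀ x y → x ≡ x + y - y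
      eq = solve-∀
      index : ∀ b r → b ℕ.< k → r ℕ.< q → + (p ℕ.* (k ℕ.∸ suc b) ℕ.+ suc (q ℕ.∸ suc r)) ≡ + (p ℕ.* k) - + (p ℕ.* b ℕ.+ suc r)
      index b r b<k r<q = trans (eq _ (+ (p ℕ.* b ℕ.+ suc r))) (cong (_- + (p ℕ.* b ℕ.+ suc r)) (trans (sym (ℤₚ.pos-+ (p ℕ.* (k ℕ.∸ suc b) ℕ.+ suc (q ℕ.∸ suc r)) (p ℕ.* b ℕ.+ suc r))) (cong +_
        (trans (rearrange p b (k ℕ.∸ suc b) r (q ℕ.∸ suc r)) (trans (cong (λ s → p ℕ.* (b ℕ.+ (k ℕ.∸ suc b)) ℕ.+ suc s) (ℕₚ.m+[n∸m]≡n r<q)) (trans (cong (p ℕ.* (b ℕ.+ (k ℕ.∸ suc b)) ℕ.+_) suc-p-1)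
          (trans (ℕₚ.+-comm (p ℕ.* (b ℕ.+ (k ℕ.∸ suc b))) p) (trans (sym (ℕₚ.*-suc p (b ℕ.+ (k ℕ.∸ suc b)))) (cong (p ℕ.*_) (ℕₚ.m+[n∸m]≡n b<k))))))))))

    V-* : ∀ f g k → V (λ j → f j * g j) k ≡ V f k * V g k
    V-* f g k = trans (Π<-cong k (λ b _ → Π<-* q _ _)) (Π<-* k _ _)

    *-pos₂ : ∀ a b x → + (a ℕ.* b) * x ≡ + a * + b * x
    *-pos₂ a b x = cong (_* x) (ℤₚ.pos-* a b)

    module Jacobsthal (k₁ m a k′ : ℕ) (k-val : suc k₁ ≡ p ℕ.^ a ℕ.* k′) (unit-k′ : Unit (+ k′)) (m-val : P ^ a ∣ + m) where
      k n : ℕ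
      k = suc k₁
      n = k ℕ.+ m

      Q Q′ Y : ℤ
      Q = V +_ k
      Q′ = V (λ j → + (p ℕ.* n) - + j) k
      Y = P * + n * (P * + m)

      B₀ B₀′ : ℤ
      B₀ = c n k
      B₀′ = c (p ℕ.* n) (p ℕ.* k)

      -- Absorption gives pk · C(pn, pk) = pn · C(pn - 1, pk - 1) and k · C(n, k) = n · C(n - 1, k -
      -- 1), with the same ratio n/k; `c-ΠU` compares the right-hand binomials.
      binomial-ratio : B₀′ * Q ≡ B₀ * Q′
      binomial-ratio = ℤₚ.*-cancelˡ-≡ P _ _ (ℤₚ.*-cancelˡ-≡ (+ k) _ _ (begin
        + k * (P * (B₀′ * Q)) ≡⟨ eq₁ (+ k) P B₀′ Q ⟩
        P * + k * B₀′ * Q ≡⟨ cong (_* Q) (trans (sym (*-pos₂ p k B₀′)) top) ⟩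
        + (p ℕ.* n) * c M K * Q ≡⟨ trans (cong (λ z → z * c M K * Q) (ℤₚ.pos-* p n)) (eq₂ P (+ n) (c M K) Q) ⟩
        P * (+ n * (c M K * Q)) ≡⟨ cong (λ z → P * (+ n * z)) (trans (c-ΠU {M} {k₁ ℕ.+ m} M-suc k₁ q) (cong (λ s → c (k₁ ℕ.+ m) k₁ * V (λ j → + s - + j) k) M-suc)) ⟩
        P * (+ n * (c (k₁ ℕ.+ m) k₁ * Q′)) ≡⟨ eq₃ P (+ n) (c (k₁ ℕ.+ m) k₁) Q′ ⟩
        P * (+ n * c (k₁ ℕ.+ m) k₁) * Q′ ≡⟨ cong (λ z → P * z * Q′) (c-top (k₁ ℕ.+ m) k₁) ⟨
        P * (+ k * B₀) * Q′ ≡⟨ eq₄ P (+ k) B₀ Q′ ⟩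
        + k * (P * (B₀ * Q′)) ∎))
        where
        open ≡-Reasoning
        M K : ℕ
        M = ℕ.pred (p ℕ.* n)
        K = p ℕ.* k₁ ℕ.+ q
        M-suc : suc M ≡ p ℕ.* n
        M-suc = ℕₚ.suc-pred (p ℕ.* n) {{ℕₚ.m*n≢0 p n}}
        K-suc : suc K ≡ p ℕ.* k
        K-suc = trans (sym (ℕₚ.+-suc (p ℕ.* k₁) q)) (trans (cong (p ℕ.* k₁ ℕ.+_) suc-p-1) (trans (ℕₚ.+-comm (p ℕ.* k₁) p) (sym (ℕₚ.*-suc p k₁))))
        top : + (p ℕ.* k) * B₀′ ≡ + (p ℕ.* n) * c M K
        top = subst₂ (λ x y → + y * c x y ≡ + x * c M K) M-suc K-suc (c-top M K)
          where
          subst₂ : ∀ (R : ℕ → ℕ → Set) {a b a′ b′} → a ≡ a′ → b ≡ b′ → R a b → R a′ b′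
          subst₂ R refl refl r = r
        eq₁ : ∀ k P x y → k * (P * (x * y)) ≡ P * k * x * y
        eq₁ = solve-∀
        eq₂ : ∀ P n x y → P * n * x * y ≡ P * (n * (x * y))
        eq₂ = solve-∀
        eq₃ : ∀ P n x y → P * (n * (x * y)) ≡ P * (n * x) * y
        eq₃ = solve-∀
        eq₄ : ∀ P k x y → P * (k * x) * y ≡ k * (P * (x * y))
        eq₄ = solve-∀

      pos-pk : + (p ℕ.* k) ≡ P * + k
      pos-pk = ℤₚ.pos-* p k

      pos-pn : + (p ℕ.* n) ≡ P * (+ k + + m)
      pos-pn = trans (ℤₚ.pos-* p n) (cong (λ z → P * z) (ℤₚ.pos-+ k m))

      -- Squares are compared because pairing j with pk - j makes the two products nearly equal
      -- factor by factor: in Q′² each factor j(pk - j) is increased by the same constant Y = pn ·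
      -- pm.
      Q-square : Q * Q ≡ V (λ j → + j * (P * + k - + j)) k
      Q-square = trans (cong (λ z → Q * z) (trans (V-reflect (λ z → z) k) (cong (λ s → V (λ j → s - + j) k) pos-pk))) (sym (V-* +_ (λ j → P * + k - + j) k))

      Q′-square : Q′ * Q′ ≡ V (λ j → + j * (P * + k - + j) + Y) k
      Q′-square = trans (cong (λ z → Q′ * z) (V-reflect (λ z → + (p ℕ.* n) - z) k)) (trans (sym (V-* (λ j → + (p ℕ.* n) - + j) (λ j → + (p ℕ.* n) - (+ (p ℕ.* k) - + j)) k))
        (Π<-cong k (λ b _ → Π<-cong q (λ r _ → pair (+ (p ℕ.* b ℕ.+ suc r))))))
        where
        eq : ∀ P k m j → (P * (k + m) - j) * (P * (k + m) - (P * k - j)) ≡ j * (P * k - j) + P * (k + m) * (P * m)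
        eq = solve-∀
        pair : ∀ j → (+ (p ℕ.* n) - j) * (+ (p ℕ.* n) - (+ (p ℕ.* k) - j)) ≡ j * (P * + k - j) + Y
        pair j = trans (cong₂ (λ x y → (x - j) * (x - (y - j))) pos-pn pos-pk) (trans (eq P (+ k) (+ m) j) (cong (λ z → j * (P * + k - j) + P * z * (P * + m)) (sym (ℤₚ.pos-+ k m))))

      P^a∣k : P ^ a ∣ + k
      P^a∣k = divides (+ k′) (trans (cong +_ k-val) (trans (ℤₚ.pos-* (p ℕ.^ a) k′) (trans (cong (_* + k′) (pos-^ p a)) (ℤₚ.*-comm (P ^ a) (+ k′)))))

      module WithInverse (e : ℕ) (1+a≤e : suc a ℕ.≤ e) (inv : ∀ {x} → Unit x → (x * x) ^ suc e ≡ 1ℤ mod P ^ suc a) where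
        j : ℕ → ℕ → ℤ
        j b r = + (p ℕ.* b ℕ.+ suc r)
        linear-term : ∀ w Y → w + Y ≡ w + Y * (1ℤ + Y * 0ℤ)
        linear-term = solve-∀
        log-term : ∀ pk j w → j * (pk - j) * - w ≡ (j * j) * w + pk * (- j * w)
        log-term = solve-∀
        P^1+a∣pk : P ^ suc a ∣ P * + k
        P^1+a∣pk = *-monoʳ-∣ P P^a∣k
        -- Because pᵃ⁺¹ divides pk, the reciprocal of j(pk - j) is -j⁻² to this precision.
        logarithmic : ∀ b {r} → r ℕ.< q → 1ℤ ≡ j b r * (P * + k - j b r) * - evenPower e (j b r) mod P ^ suc a
        logarithmic b {r} r<q = sym-mod (trans-mod (≡⇒≡mod (log-term (P * + k) (j b r) (evenPower e (j b r))))
          (trans-mod (+-mod (inv (unit-suc r<q b)) (∣⇒≡0mod (∣m⇒∣m*n (- j b r * evenPower e (j b r)) P^1+a∣pk))) refl-mod))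
        w : ℤ
        w = V (λ j → + j * (P * + k - + j)) k
        expanded : Expansion (P ^ suc a) Y (V (λ j → + j * (P * + k - + j) + Y) k) w (Σ< k (λ b → Σ< q (λ r → - evenPower e (j b r))))
        expanded = expansion-Π k (λ b b<k → expansion-Π q {λ r → j b r * (P * + k - j b r) + Y} {λ r → j b r * (P * + k - j b r)} {λ r → - evenPower e (j b r)}
          (λ r r<q → expansion 1ℤ 0ℤ (linear-term (j b r * (P * + k - j b r)) Y) (logarithmic b r<q)))
        g : ℕ → ℤ
        g i = evenPower e (+ i)
        neg-sum : ∀ b → Σ< q (λ r → - evenPower e (+ (p ℕ.* b ℕ.+ suc r))) ≡ - 1ℤ * Σ< p (λ ρ → g (p ℕ.* b ℕ.+ ρ)) mod P ^ suc a
        neg-sum b = trans-mod (≡⇒≡mod (trans (Σ<-cong q (λ r _ → neg (g (p ℕ.* b ℕ.+ suc r)))) (Σ<-* q (- 1ℤ) (λ r → g (p ℕ.* b ℕ.+ suc r)))))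
          (*ˡ-mod (- 1ℤ) (sym-mod (trans-mod (≡⇒≡mod (trans (cong (λ s → Σ< s (λ ρ → g (p ℕ.* b ℕ.+ ρ))) (sym suc-p-1)) (Σ<-split 1 q (λ ρ → g (p ℕ.* b ℕ.+ ρ)))))
            (trans-mod (+-mod (∣⇒≡0mod (∣m∣n⇒∣m+n (∣-0 (P ^ suc a)) multiple)) refl-mod) (≡⇒≡mod (ℤₚ.+-identityˡ _))))))
          where
          neg : ∀ x → - x ≡ - 1ℤ * x
          neg = solve-∀
          multiple : P ^ suc a ∣ g (p ℕ.* b ℕ.+ 0)
          multiple = ∣-trans (^-∣ P 1+a≤e) (power e (divides (+ b) (trans (cong +_ (ℕₚ.+-identityʳ (p ℕ.* b))) (trans (ℤₚ.pos-* p b) (ℤₚ.*-comm P (+ b))))))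
            where
            power : ∀ e {x} → P ∣ x → P ^ e ∣ evenPower e x
            power zero h = ∣-reflexive refl
            power (suc e) {x} h = *-mono-∣ (∣m⇒∣m*n x h) (power e h)
        -- As pk = pᵃ⁺¹k′, the range consists of k′ complete residue systems modulo pᵃ⁺¹, to each of
        -- which `inverse-square-sum` applies.
        total : P ^ suc a ∣ Σ< (p ℕ.* k) g
        total = ∣-resp (sym (trans (cong (λ s → Σ< s g) (trans (cong (p ℕ.*_) k-val) (sym (ℕₚ.*-assoc p (p ℕ.^ a) k′)))) (Σ<-blocks (p ℕ.^ suc a) k′ g)))
          (Σ<-∣ k′ (λ b _ → mod-∣ (Σ<-cong-mod (p ℕ.^ suc a) (λ i _ → evenPower-mod {x = + (p ℕ.^ suc a ℕ.* b ℕ.+ i)} {y = + i} e (by (divides (+ b) (shift b i))))) (inverse-square-sum {e} (suc a) inv)))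
          where
          eq : ∀ s b i → s * b + i - i ≡ b * s
          eq = solve-∀
          shift : ∀ b i → + (p ℕ.^ suc a ℕ.* b ℕ.+ i) - + i ≡ + b * P ^ suc a
          shift b i = trans (cong (_- + i) (trans (ℤₚ.pos-+ (p ℕ.^ suc a ℕ.* b) i) (cong (_+ + i) (trans (ℤₚ.pos-* (p ℕ.^ suc a) b) (cong (_* + b) (pos-^ p (suc a))))))) (eq (P ^ suc a) (+ b) (+ i))
        sum-∣ : P ^ suc a ∣ Σ< k (λ b → Σ< q (λ r → - evenPower e (+ (p ℕ.* b ℕ.+ suc r))))
        sum-∣ = mod-∣ (Σ<-cong-mod k (λ b _ → neg-sum b)) (∣-resp (sym (trans (Σ<-* k (- 1ℤ) (λ b → Σ< p (λ ρ → g (p ℕ.* b ℕ.+ ρ)))) (cong (λ z → - 1ℤ * z) (sym (Σ<-blocks p k g))))) (∣n⇒∣m*n (- 1ℤ) total))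
        conclude : Expansion (P ^ suc a) Y (V (λ j → + j * (P * + k - + j) + Y) k) w (Σ< k (λ b → Σ< q (λ r → - evenPower e (j b r)))) →
          ∃ λ z → Q′ * Q′ - Q * Q ≡ Y * (z * P ^ suc a)
        conclude (expansion A B expands A≡) = quotient divisible ,
          trans (cong₂ _-_ (trans Q′-square expands) Q-square) (trans (eq″ w (Y * (A + Y * B))) (cong (λ s → Y * s) (_∣_.equality divisible)))
          where
          eq″ : ∀ x y → x + y - x ≡ y
          eq″ = solve-∀
          -- A is divisible through the sum of inverse squares. In the second-order part the factor
          -- p · m of Y suffices, which is where `m-val` enters.
          divisible : P ^ suc a ∣ A + Y * B
          divisible = ∣m∣n⇒∣m+n (mod-∣ A≡ (∣n⇒∣m*n w sum-∣)) (∣m⇒∣m*n B (∣n⇒∣m*n (P * + n) (*-monoʳ-∣ P m-val)))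

      difference-of-squares : ∃ λ z → Q′ * Q′ - Q * Q ≡ Y * (z * P ^ suc a)
      difference-of-squares = let e , 1+a≤e , inv = inverse-square (suc a) in WithInverse.conclude e 1+a≤e inv (WithInverse.expanded e 1+a≤e inv)

      unit-Q : Unit Q
      unit-Q = unit-ΠU k₁ ℕₚ.≤-refl

      unit-Q′+Q : Unit (Q′ + Q)
      unit-Q′+Q = unit-mod (trans-mod (+-mod (trans-mod (ΠU-mod {f = λ j → + (p ℕ.* n) - + j} {g = λ j → - (+ j)} (λ j → by (divides (+ n) (trans (eq (+ (p ℕ.* n)) (+ j)) (trans (ℤₚ.pos-* p n) (ℤₚ.*-comm P (+ n)))))) k₁ q)
        (≡⇒≡mod (trans (ΠU-neg +_ k₁ q) (trans (cong (_* Q) ε-q) (ℤₚ.*-identityˡ Q))))) refl-mod) (≡⇒≡mod (eq′ Q))) (unit-* unit-2 unit-Q)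
        where
        eq : ∀ n j → n - j - - j ≡ n
        eq = solve-∀
        eq′ : ∀ x → x + x ≡ + 2 * x
        eq′ = solve-∀

      -- In Q′² - Q² the constant Y contributes p²nm and the bracket pᵃ⁺¹, that is pk up to the unit
      -- k′: together p³nkm. The factor Q′ + Q ≡ 2Q of the difference of squares is a unit. The
      -- multiplier G lets the factors n, k, m be absorbed by other binomials.
      jacobsthal : ∀ e G → P ^ e ∣ G * (B₀ * (+ n * (+ k * + m))) → P ^ (e ℕ.+ 3) ∣ G * (B₀′ - B₀)
      jacobsthal e G h = unit-cancel (unit-* unit-Q′+Q unit-Q) (e ℕ.+ 3) (∣-resp (proj₂ (final difference-of-squares)) (∣-trans (∣-reflexive (ℤₚ.^-distribˡ-+-* P e 3)) (∣m⇒∣m*n (proj₁ (final difference-of-squares)) (*-mono-∣ reduced ∣-refl))))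
        where
        open ≡-Reasoning
        eq₁ : ∀ G B₀ n m a k′ → G * (B₀ * (n * (a * k′ * m))) ≡ k′ * (G * B₀ * (n * m) * a)
        eq₁ = solve-∀
        reduced : P ^ e ∣ G * B₀ * (+ n * + m) * P ^ a
        reduced = unit-cancel unit-k′ e (∣-resp (trans (cong (λ s → G * (B₀ * (+ n * (s * + m)))) (trans (cong +_ k-val) (trans (ℤₚ.pos-* (p ℕ.^ a) k′) (cong (_* + k′) (pos-^ p a))))) (eq₁ G B₀ (+ n) (+ m) (P ^ a) (+ k′))) h)
        eq₂ : ∀ G B₀ n m a P z → G * B₀ * (n * m) * a * (P * (P * (P * 1ℤ))) * z ≡ G * (B₀ * (P * n * (P * m) * (z * (P * a))))
        eq₂ = solve-∀
        eq₃ : ∀ G B₀ Q Q′ → G * (B₀ * (Q′ * Q′ - Q * Q)) ≡ G * ((Q′ + Q) * (B₀ * Q′ - B₀ * Q))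
        eq₃ = solve-∀
        eq₄ : ∀ G B₀ B₀′ Q Q′ → G * ((Q′ + Q) * (B₀′ * Q - B₀ * Q)) ≡ (Q′ + Q) * Q * (G * (B₀′ - B₀))
        eq₄ = solve-∀
        final : (∃ λ z → Q′ * Q′ - Q * Q ≡ Y * (z * P ^ suc a)) → ∃ λ z → G * B₀ * (+ n * + m) * P ^ a * P ^ 3 * z ≡ (Q′ + Q) * Q * (G * (B₀′ - B₀))
        final (z , e) = z , (begin
          G * B₀ * (+ n * + m) * P ^ a * P ^ 3 * z ≡⟨ eq₂ G B₀ (+ n) (+ m) (P ^ a) P z ⟩
          G * (B₀ * (Y * (z * P ^ suc a))) ≡⟨ cong (λ s → G * (B₀ * s)) e ⟨
          G * (B₀ * (Q′ * Q′ - Q * Q)) ≡⟨ eq₃ G B₀ Q Q′ ⟩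
          G * ((Q′ + Q) * (B₀ * Q′ - B₀ * Q)) ≡⟨ cong (λ s → G * ((Q′ + Q) * (s - B₀ * Q))) binomial-ratio ⟨
          G * ((Q′ + Q) * (B₀′ * Q - B₀ * Q)) ≡⟨ eq₄ G B₀ B₀′ Q Q′ ⟩
          (Q′ + Q) * Q * (G * (B₀′ - B₀)) ∎)

  module Pairs (p : ℕ) (prime : Prime p) (5≤p : 5 ℕ.≤ p) where
    open Local p prime 5≤p
    open Blocks p prime 5≤p
    open BlockSums p prime 5≤p
    open Supercongruence p prime 5≤p

    private
      swap-factors : ∀ G B n k m → G * (B * (n * (k * m))) ≡ G * (B * (n * (m * k)))
      swap-factors = solve-∀

    -- The symmetry of the binomial allows the argument of smaller valuation to play the role of k
    -- in `Jacobsthal`; if an argument is 0 both binomials are 1.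
    bin-supercongruence : ∀ k m e G → P ^ e ∣ G * (+ bin k m * (+ (k ℕ.+ m) * (+ k * + m))) → P ^ (e ℕ.+ 3) ∣ G * (+ bin (p ℕ.* k) (p ℕ.* m) - + bin k m)
    bin-supercongruence zero m e G h = ∣-resp (sym (trans (cong (λ x → G * (+ x - + bin 0 m)) (trans (cong (λ z → bin z (p ℕ.* m)) (ℕₚ.*-zeroʳ p)) (trans (bin-zeroˡ (p ℕ.* m)) (sym (bin-zeroˡ m))))) (trans (cong (λ z → G * z) (ℤₚ.+-inverseʳ (+ bin 0 m))) (ℤₚ.*-zeroʳ G)))) (∣-0 _)
    bin-supercongruence (suc k) zero e G h = ∣-resp (sym (trans (cong (λ x → G * (+ x - + bin (suc k) 0)) (trans (cong (λ z → bin (p ℕ.* suc k) z) (ℕₚ.*-zeroʳ p)) (trans (bin-zeroʳ (p ℕ.* suc k)) (sym (bin-zeroʳ (suc k)))))) (trans (cong (λ z → G * z) (ℤₚ.+-inverseʳ (+ bin (suc k) 0))) (ℤₚ.*-zeroʳ G)))) (∣-0 _)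
    bin-supercongruence (suc k) (suc m) e G h = by-valuation (valuation (suc k) (λ ())) (valuation (suc m) (λ ()))
      where
      power-∣ : ∀ {a b} x → a ℕ.≤ b → P ^ a ∣ + (p ℕ.^ b ℕ.* x)
      power-∣ {a} {b} x a≤b = ∣-trans (^-∣ P a≤b) (divides (+ x) (trans (ℤₚ.pos-* (p ℕ.^ b) x) (trans (cong (_* + x) (pos-^ p b)) (ℤₚ.*-comm (P ^ b) (+ x)))))
      c-bin′ : ∀ k m → c (p ℕ.* (k ℕ.+ m)) (p ℕ.* k) ≡ + bin (p ℕ.* k) (p ℕ.* m)
      c-bin′ k m = trans (cong (λ z → c z (p ℕ.* k)) (ℕₚ.*-distribˡ-+ p k m)) (c-bin (p ℕ.* k) (p ℕ.* m))
      apply : ∀ k m {a k′} → suc k ≡ p ℕ.^ a ℕ.* k′ → Unit (+ k′) → P ^ a ∣ + m →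
        P ^ e ∣ G * (+ bin (suc k) m * (+ (suc k ℕ.+ m) * (+ suc k * + m))) → P ^ (e ℕ.+ 3) ∣ G * (+ bin (p ℕ.* suc k) (p ℕ.* m) - + bin (suc k) m)
      apply k m {a} {k′} k-val u m-val h = ∣-resp (cong₂ (λ x y → G * (x - y)) (c-bin′ (suc k) m) (c-bin (suc k) m))
        (Jacobsthal.jacobsthal k m a k′ k-val u m-val e G (∣-resp (cong (λ z → G * (z * (+ (suc k ℕ.+ m) * (+ suc k * + m)))) (sym (c-bin (suc k) m))) h))
      by-valuation : (∃ λ a → ∃ λ k′ → suc k ≡ p ℕ.^ a ℕ.* k′ × Unit (+ k′)) → (∃ λ b → ∃ λ m′ → suc m ≡ p ℕ.^ b ℕ.* m′ × Unit (+ m′)) →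
        P ^ (e ℕ.+ 3) ∣ G * (+ bin (p ℕ.* suc k) (p ℕ.* suc m) - + bin (suc k) (suc m))
      by-valuation (a , k′ , k-val , uk) (b , m′ , m-val , um) = choose (ℕₚ.≤-total a b)
        where
        choose : a ℕ.≤ b ⊎ b ℕ.≤ a → P ^ (e ℕ.+ 3) ∣ G * (+ bin (p ℕ.* suc k) (p ℕ.* suc m) - + bin (suc k) (suc m))
        choose (inj₁ a≤b) = apply k (suc m) {a} {k′} k-val uk (∣-resp (cong +_ (sym m-val)) (power-∣ m′ a≤b)) h
        choose (inj₂ b≤a) = ∣-resp (cong₂ (λ x y → G * (+ x - + y)) (bin-comm (p ℕ.* suc m) (p ℕ.* suc k)) (bin-comm (suc m) (suc k)))
          (apply m (suc k) {b} {m′} m-val um (∣-resp (cong +_ (sym k-val)) (power-∣ k′ b≤a))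
            (∣-resp (trans (swap-factors G (+ bin (suc k) (suc m)) (+ (suc k ℕ.+ suc m)) (+ suc k) (+ suc m)) (cong₂ (λ x y → G * (+ x * (+ y * (+ suc m * + suc k)))) (bin-comm (suc k) (suc m)) (ℕₚ.+-comm (suc k) (suc m)))) h))

    -- The alternating sum left by two irregular rows.

    χ : ℕ → ℤ
    χ b = if does (p ℕᵈ.∣? b) then 1ℤ else 0ℤ

    χ-yes : ∀ {b} → p ℕᵈ.∣ b → χ b ≡ 1ℤ
    χ-yes {b} h = cong (if_then 1ℤ else 0ℤ) (dec-true (p ℕᵈ.∣? b) h)

    χ-no : ∀ {b} → ¬ p ℕᵈ.∣ b → χ b ≡ 0ℤ
    χ-no {b} h = cong (if_then 1ℤ else 0ℤ) (dec-false (p ℕᵈ.∣? b) h)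

    pairTerm : ℕ → ℕ → ℕ → ℕ → ℤ
    pairTerm x y b b′ = (1ℤ - χ b) * (ε b * (c x b * c y b′))

    -- Here b and E - b are the entries of the two irregular rows in a common column, and x, y are
    -- the sums of the two entries of each row in the common columns. The factor 1 - `χ b` keeps the
    -- irregular arrays.
    pairSum : ℕ → ℕ → ℕ → ℤ
    pairSum x y E = Σ< (suc E) (λ b → pairTerm x y b (E ℕ.∸ b))

    pairTerm-∣ : ∀ {x y b b′} → p ℕᵈ.∣ b → pairTerm x y b b′ ≡ 0ℤ
    pairTerm-∣ {x} {y} {b} {b′} h = cong (λ z → (1ℤ - z) * (ε b * (c x b * c y b′))) (χ-yes h)

    P^t⇒p : ∀ {t n} → 1 ℕ.≤ t → P ^ t ∣ + n → p ℕᵈ.∣ n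
    P^t⇒p {suc t} _ h = pos-∣ (∣-trans (divides (P ^ t) (ℤₚ.*-comm P (P ^ t))) h)

    P^t-quotient : ∀ {t n} → P ^ t ∣ + suc n → ∃ λ x → suc n ≡ p ℕ.^ t ℕ.* suc x
    P^t-quotient {t} {n} h = positive (pos-∣ (∣-trans (∣-reflexive (pos-^ p t)) h))
      where
      positive : p ℕ.^ t ℕᵈ.∣ suc n → ∃ λ x → suc n ≡ p ℕ.^ t ℕ.* suc x
      positive (ℕᵈ.divides (suc x) e) = x , trans e (ℕₚ.*-comm (suc x) (p ℕ.^ t))

    module PairCore (r t n′ : ℕ) (1≤t : 1 ℕ.≤ t) (n-val : P ^ r ∣ + suc n′) where
      n : ℕ
      n = suc n′

      module NonDegenerate (x′ y′ E′ : ℕ) (x-val : P ^ t ∣ + suc x′) (y-val : P ^ t ∣ + suc y′) (E-val : P ^ t ∣ + suc E′)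
                           (e : ℕ) (t≤e : t ℕ.≤ e) (inv : ∀ {z} → Unit z → (z * z) ^ suc e ≡ 1ℤ mod P ^ t) where
        x y E : ℕ
        x = suc x′
        y = suc y′
        E = suc E′

        K N : ℤ
        K = c n′ x′ * c n′ y′
        N = + n * + n

        w : ℕ → ℤ
        w β = c x′ β * c y′ (E′ ℕ.∸ β)

        Ψ : ℕ → ℤ
        Ψ β = ε β * evenPower e (+ suc β)

        T : ℕ
        T = r ℕ.+ (r ℕ.+ t)

        N-∣ : ∀ {z} → P ^ t ∣ z → P ^ T ∣ N * z
        N-∣ {z} h = ∣-resp (sym (ℤₚ.*-assoc (+ n) (+ n) z)) (∣-trans (∣-reflexive (trans (ℤₚ.^-distribˡ-+-* P r (r ℕ.+ t)) (cong (λ s → P ^ r * s) (ℤₚ.^-distribˡ-+-* P r t)))) (*-mono-∣ n-val (*-mono-∣ n-val h)))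

        N-mod : ∀ {a b} → a ≡ b mod P ^ t → N * a ≡ N * b mod P ^ T
        N-mod {a} {b} (by h) = by (∣-resp (eq N a b) (N-∣ h))
          where
          eq : ∀ N a b → N * (a - b) ≡ N * a - N * b
          eq = solve-∀

        collapsed : P ^ T ∣ N * Σ< E (λ β → Ψ β * w β)
        collapsed = N-∣ (block-divides (P^t-quotient {t} {x′} x-val) (P^t-quotient {t} {y′} y-val) (P^t-quotient {t} {E′} E-val))
          where
          block-divides : (∃ λ s → x ≡ p ℕ.^ t ℕ.* suc s) → (∃ λ s → y ≡ p ℕ.^ t ℕ.* suc s) → (∃ λ s → E ≡ p ℕ.^ t ℕ.* suc s) → P ^ t ∣ Σ< E (λ β → Ψ β * w β)
          block-divides (a , ea) (b , eb) (d , ed) = ∣-trans (∣-reflexive (sym (ℤₚ.*-identityˡ (P ^ t)))) (block-sum t 0 Ψ {x′} {y′} {E′} {a} {b} {d} ea eb ed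
            (good-blocks Ψ (alternating-block e (ℕₚ.≤-trans 1≤t t≤e)) t 0 Ψ (λ β → sym (trans (ℤₚ.+-identityˡ (Ψ (1 ℕ.* β ℕ.+ 0))) (cong Ψ (trans (ℕₚ.+-identityʳ (1 ℕ.* β)) (ℕₚ.*-identityˡ β)))))))

        κ : ℤ
        κ = c n x * c n y

        u v : ℕ → ℤ
        u β = + suc β
        v β = 1ℤ + + y′ - + (E′ ℕ.∸ β)

        -- With b = β + 1 and b′ = E - b, `u β` is b and `v β` is y - b′ = y - E + b. Their product,
        -- which appears as a denominator, is therefore b² modulo pᵗ.
        v≡u : ∀ β → β ℕ.≤ E′ → v β ≡ u β mod P ^ t
        v≡u β β≤E′ = by (∣-resp (trans (eq (+ y′) (+ β) (+ (E′ ℕ.∸ β))) refl) (∣m∣n⇒∣m-n y-val (∣-resp (cong (λ s → 1ℤ + s) (trans (cong +_ (sym (ℕₚ.m+[n∸m]≡n β≤E′))) (ℤₚ.pos-+ β (E′ ℕ.∸ β)))) E-val)))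
          where
          eq : ∀ y b s → 1ℤ + y - (1ℤ + (b + s)) ≡ 1ℤ + y - s - (1ℤ + b)
          eq = solve-∀

        -- Two absorptions in each row: b · C(x, b) = x · C(x - 1, b - 1) and x · C(n, x) = n · C(n
        -- - 1, x - 1), and likewise for y with y - b′. The price bv buys the factor n².
        absorbed : ∀ β → u β * v β * (κ * (c x (suc β) * c y (E′ ℕ.∸ β))) ≡ N * (K * w β)
        absorbed β = begin
          u β * v β * (κ * (c x (suc β) * c y (E′ ℕ.∸ β))) ≡⟨ eq₁ (u β) (v β) (c n x) (c n y) (c x (suc β)) (c y (E′ ℕ.∸ β)) ⟩
          c n x * (u β * c x (suc β)) * (c n y * (v β * c y (E′ ℕ.∸ β))) ≡⟨ cong₂ (λ a b → c n x * a * (c n y * b)) (c-top x′ β) (c-lower y′ (E′ ℕ.∸ β)) ⟩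
          c n x * (+ x * c x′ β) * (c n y * (+ y * c y′ (E′ ℕ.∸ β))) ≡⟨ eq₂ (c n x) (+ x) (c x′ β) (c n y) (+ y) (c y′ (E′ ℕ.∸ β)) ⟩
          + x * c n x * (+ y * c n y) * w β ≡⟨ cong₂ (λ a b → a * b * w β) (c-top n′ x′) (c-top n′ y′) ⟩
          + n * c n′ x′ * (+ n * c n′ y′) * w β ≡⟨ eq₃ (+ n) (c n′ x′) (c n′ y′) (w β) ⟩
          N * (K * w β) ∎
          where
          open ≡-Reasoning
          eq₁ : ∀ u v a b s s′ → u * v * (a * b * (s * s′)) ≡ a * (u * s) * (b * (v * s′))
          eq₁ = solve-∀
          eq₂ : ∀ a x s b y s′ → a * (x * s) * (b * (y * s′)) ≡ x * a * (y * b) * (s * s′)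
          eq₂ = solve-∀
          eq₃ : ∀ n a b w → n * a * (n * b) * w ≡ n * n * (a * b * w)
          eq₃ = solve-∀

        -- If p divides b, the left side is 0 and the even power on the right is divisible by pᵗ
        -- because t ≤ e. Otherwise both sides are compared after multiplication by the unit bv. The
        -- sign is that of passing from b = β + 1 to β.
        termwise : ∀ β → β ℕ.≤ E′ → κ * pairTerm x y (suc β) (E′ ℕ.∸ β) ≡ N * (K * (- 1ℤ * (Ψ β * w β))) mod P ^ T
        termwise β β≤E′ = choose (p ℕᵈ.∣? suc β)
          where
          s : ℤ
          s = c x (suc β) * c y (E′ ℕ.∸ β)
          choose : Dec (p ℕᵈ.∣ suc β) → κ * pairTerm x y (suc β) (E′ ℕ.∸ β) ≡ N * (K * (- 1ℤ * (Ψ β * w β))) mod P ^ T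
          choose (yes p∣b) = trans-mod (≡⇒≡mod (trans (cong (λ z → κ * z) (pairTerm-∣ {x} {y} {suc β} {E′ ℕ.∸ β} p∣b)) (ℤₚ.*-zeroʳ κ)))
            (sym-mod (∣⇒≡0mod (N-∣ (∣n⇒∣m*n K (∣n⇒∣m*n (- 1ℤ) (∣m⇒∣m*n (w β) (∣n⇒∣m*n (ε β) (∣-trans (^-∣ P t≤e) (power e (∣-pos p∣b))))))))))
            where
            power : ∀ e {x} → P ∣ x → P ^ e ∣ evenPower e x
            power zero h = ∣-reflexive refl
            power (suc e) {x} h = *-mono-∣ (∣m⇒∣m*n x h) (power e h)
          choose (no p∤b) = unit-cancel-mod (unit-* unit-u unit-v) T (trans-mod (≡⇒≡mod left) (trans-mod (sym-mod right) refl-mod))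
            where
            unit-u : Unit (u β)
            unit-u h = p∤b (pos-∣ h)
            unit-v : Unit (v β)
            unit-v = unit-mod (mod-weaken (∣-trans (∣-reflexive (sym (ℤₚ.^-identityʳ P))) (^-∣ P 1≤t)) (v≡u β β≤E′)) unit-u
            eq₁ : ∀ uv κ b s → uv * (κ * ((1ℤ - 0ℤ) * (-1ℤ * b * s))) ≡ -1ℤ * b * (uv * (κ * s))
            eq₁ = solve-∀
            left : u β * v β * (κ * pairTerm x y (suc β) (E′ ℕ.∸ β)) ≡ -1ℤ * ε β * (N * (K * w β))
            left = trans (cong (λ z → u β * v β * (κ * ((1ℤ - z) * (ε (suc β) * s)))) (χ-no p∤b)) (trans (eq₁ (u β * v β) κ (ε β) s) (cong (λ z → -1ℤ * ε β * z) (absorbed β)))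
            eq₂ : ∀ u v N K b e w → u * v * (N * (K * (- 1ℤ * (b * e * w)))) ≡ N * (u * v * e * (K * (- 1ℤ * (b * w))))
            eq₂ = solve-∀
            eq₃ : ∀ N K b w → N * (1ℤ * (K * (- 1ℤ * (b * w)))) ≡ -1ℤ * b * (N * (K * w))
            eq₃ = solve-∀
            right : u β * v β * (N * (K * (- 1ℤ * (Ψ β * w β)))) ≡ -1ℤ * ε β * (N * (K * w β)) mod P ^ T
            right = trans-mod (≡⇒≡mod (eq₂ (u β) (v β) N K (ε β) (evenPower e (u β)) (w β)))
              (trans-mod (N-mod (*ʳ-mod (K * (- 1ℤ * (ε β * w β))) (trans-mod (*ʳ-mod (evenPower e (u β)) (*ˡ-mod (u β) (v≡u β β≤E′))) (inv unit-u))))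
                (≡⇒≡mod (eq₃ N K (ε β) (w β))))

        result : P ^ T ∣ κ * pairSum x y E
        result = mod-∣ (trans-mod (≡⇒≡mod (trans (sym (Σ<-* (suc E) κ f)) (Σ<-split 1 E (λ b → κ * f b)))) (trans-mod (+-mod (≡⇒≡mod first) (Σ<-cong-mod E (λ β β<E → termwise β (ℕₚ.≤-pred β<E)))) (≡⇒≡mod (ℤₚ.+-identityˡ _))))
          (∣-resp factor (∣n⇒∣m*n (K * - 1ℤ) collapsed))
          where
          f : ℕ → ℤ
          f b = pairTerm x y b (E ℕ.∸ b)
          first : 0ℤ + κ * f 0 ≡ 0ℤ
          first = trans (ℤₚ.+-identityˡ (κ * f 0)) (trans (cong (λ z → κ * z) (pairTerm-∣ {x} {y} {0} {E} (p ℕᵈ.∣0))) (ℤₚ.*-zeroʳ κ))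
          eq : ∀ K N z → K * - 1ℤ * (N * z) ≡ N * (K * - 1ℤ) * z
          eq = solve-∀
          eq′ : ∀ K N z → N * (K * - 1ℤ) * z ≡ N * (K * (- 1ℤ * z))
          eq′ = solve-∀
          factor : K * - 1ℤ * (N * Σ< E (λ β → Ψ β * w β)) ≡ Σ< E (λ β → N * (K * (- 1ℤ * (Ψ β * w β))))
          factor = trans (eq K N (Σ< E (λ β → Ψ β * w β))) (trans (sym (Σ<-* E (N * (K * - 1ℤ)) (λ β → Ψ β * w β))) (Σ<-cong E (λ β _ → eq′ K N (Ψ β * w β))))

      vanishing : ∀ x y E → (∀ b → b ℕ.≤ E → pairTerm x y b (E ℕ.∸ b) ≡ 0ℤ) → P ^ (r ℕ.+ (r ℕ.+ t)) ∣ c n x * c n y * pairSum x y E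
      vanishing x y E h = ∣n⇒∣m*n (c n x * c n y) (Σ<-∣ (suc E) (λ b b<E → ∣-resp (sym (h b (ℕₚ.≤-pred b<E))) (∣-0 _)))

      -- The factor n² gives p²ʳ and the cancellation over blocks gives pᵗ. If x, y or E is 0, then
      -- only b = 0 or b = E can have nonzero binomials, and these b are multiples of p, hence
      -- excluded.
      pair-core : ∀ x y E → P ^ t ∣ + x → P ^ t ∣ + y → P ^ t ∣ + E → P ^ (r ℕ.+ (r ℕ.+ t)) ∣ c n x * c n y * pairSum x y E
      pair-core zero y E xv yv Ev = vanishing 0 y E λ
        { zero _ → pairTerm-∣ {0} {y} {0} {E} (p ℕᵈ.∣0)
        ; (suc b) _ → trans (cong (λ z → (1ℤ - χ (suc b)) * (ε (suc b) * (z * c y (E ℕ.∸ suc b)))) (c-zero {0} {suc b} (s≤s z≤n))) (eq (1ℤ - χ (suc b)) (ε (suc b)) (c y (E ℕ.∸ suc b))) }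
        where
        eq : ∀ a b d → a * (b * (0ℤ * d)) ≡ 0ℤ
        eq = solve-∀
      pair-core (suc x) zero E xv yv Ev = vanishing (suc x) 0 E λ b b≤E → last b b≤E (E ℕ.∸ b) refl
        where
        eq : ∀ a b d → a * (b * (d * 0ℤ)) ≡ 0ℤ
        eq = solve-∀
        last : ∀ b → b ℕ.≤ E → ∀ d → E ℕ.∸ b ≡ d → pairTerm (suc x) 0 b d ≡ 0ℤ
        last b b≤E zero e = pairTerm-∣ {suc x} {0} {b} {0} (subst (p ℕᵈ.∣_) (trans (sym (ℕₚ.m+[n∸m]≡n b≤E)) (trans (cong (b ℕ.+_) e) (ℕₚ.+-identityʳ b))) (P^t⇒p {t} {E} 1≤t Ev))
        last b b≤E (suc d) e = trans (cong (λ z → (1ℤ - χ b) * (ε b * (c (suc x) b * z))) (c-zero {0} {suc d} (s≤s z≤n))) (eq (1ℤ - χ b) (ε b) (c (suc x) b))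
      pair-core (suc x) (suc y) zero xv yv Ev = vanishing (suc x) (suc y) 0 λ { zero _ → pairTerm-∣ {suc x} {suc y} {0} {0} (p ℕᵈ.∣0) }
      pair-core (suc x) (suc y) (suc E) xv yv Ev = let e , t≤e , inv = inverse-square t in NonDegenerate.result x y E xv yv Ev e t≤e inv

  -- Sums over one row of exponents, and trinomial coefficients.

  Weight : Set
  Weight = ℕ → ℕ → ℕ → ℤ

  ∑₃ : ℕ → Weight → ℤ
  ∑₃ n v = anti n (λ a m → anti m (v a))

  ∑₃-cong : ∀ n {u v : Weight} → (∀ a b d → a ℕ.+ (b ℕ.+ d) ≡ n → u a b d ≡ v a b d) → ∑₃ n u ≡ ∑₃ n v
  ∑₃-cong n e = anti-cong n (λ a m h → anti-cong m (λ b d h′ → e a b d (trans (cong (a ℕ.+_) h′) h)))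

  ∑₃-+ : ∀ n (u v : Weight) → ∑₃ n (λ a b d → u a b d + v a b d) ≡ ∑₃ n u + ∑₃ n v
  ∑₃-+ n u v = trans (anti-cong n (λ a m _ → anti-+ m (u a) (v a))) (anti-+ n _ _)

  ∑₃-* : ∀ n x (u : Weight) → ∑₃ n (λ a b d → x * u a b d) ≡ x * ∑₃ n u
  ∑₃-* n x u = trans (anti-cong n (λ a m _ → anti-* m x (u a))) (anti-* n x _)

  ∑₃-∣ : ∀ {d} n {u : Weight} → (∀ a b e → a ℕ.+ (b ℕ.+ e) ≡ n → d ∣ u a b e) → d ∣ ∑₃ n u
  ∑₃-∣ n h = anti-∣ n (λ a m e → anti-∣ m (λ b d e′ → h a b d (trans (cong (a ℕ.+_) e′) e)))

  ∑₃-swap₂₃ : ∀ n (u : Weight) → ∑₃ n u ≡ ∑₃ n (λ a b d → u a d b)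
  ∑₃-swap₂₃ n u = anti-cong n (λ a m _ → anti-flip m (u a))

  ∑₃-swap₁₂ : ∀ n (u : Weight) → ∑₃ n u ≡ ∑₃ n (λ a b d → u b a d)
  ∑₃-swap₁₂ n u = trans (anti-assoc n u) (trans (anti-cong n (λ m d _ → anti-flip m (λ a b → u a b d))) (sym (anti-assoc n (λ a b d → u b a d))))

  record Linear (Φ : Weight → ℤ) : Set where
    field
      ext : ∀ {u v : Weight} → (∀ a b d → u a b d ≡ v a b d) → Φ u ≡ Φ v
      add : ∀ (u v : Weight) → Φ (λ a b d → u a b d + v a b d) ≡ Φ u + Φ v
      scale : ∀ x (u : Weight) → Φ (λ a b d → x * u a b d) ≡ x * Φ u
  open Linear public

  weighted : ℕ → Weight → Weight → ℤ
  weighted n W v = ∑₃ n (λ a b d → W a b d * v a b d)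

  weighted-linear : ∀ n W → Linear (weighted n W)
  weighted-linear n W .ext e = ∑₃-cong n (λ a b d _ → cong (λ z → W a b d * z) (e a b d))
  weighted-linear n W .add u v = trans (∑₃-cong n (λ a b d _ → ℤₚ.*-distribˡ-+ (W a b d) (u a b d) (v a b d))) (∑₃-+ n _ _)
  weighted-linear n W .scale x u = trans (∑₃-cong n (λ a b d _ → eq (W a b d) x (u a b d))) (∑₃-* n x _)
    where
    eq : ∀ w x u → w * (x * u) ≡ x * (w * u)
    eq = solve-∀

  anti-exchange : ∀ {Φ} → Linear Φ → ∀ n (f : ℕ → ℕ → Weight) → anti n (λ i j → Φ (f i j)) ≡ Φ (λ a b d → anti n (λ i j → f i j a b d))
  anti-exchange L zero f = refl
  anti-exchange {Φ} L (suc n) f = trans (cong (λ z → Φ (f 0 (suc n)) + z) (anti-exchange L n (λ i → f (suc i)))) (sym (L .add (f 0 (suc n)) _))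

  weighted-exchange : ∀ {Φ} → Linear Φ → ∀ n W (f : ℕ → ℕ → ℕ → Weight) →
    weighted n W (λ i j k → Φ (f i j k)) ≡ Φ (λ a b d → weighted n W (λ i j k → f i j k a b d))
  weighted-exchange {Φ} L n W f = trans (anti-cong n (λ i m _ → trans (anti-cong m (λ j k _ → sym (L .scale (W i j k) (f i j k)))) (anti-exchange L m (λ j k a b d → W i j k * f i j k a b d))))
    (anti-exchange L n (λ i m a b d → anti m (λ j k → W i j k * f i j k a b d)))

  trinomial : ℕ → ℕ → ℕ → ℕ
  trinomial a b d = bin a (b ℕ.+ d) ℕ.* bin b d

  trinomial-! : ∀ a b d → trinomial a b d ℕ.* (a ! ℕ.* (b ! ℕ.* d !)) ≡ (a ℕ.+ (b ℕ.+ d)) !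
  trinomial-! a b d = trans (eq (bin a (b ℕ.+ d)) (bin b d) (a !) (b ! ℕ.* d !)) (trans (cong (λ z → bin a (b ℕ.+ d) ℕ.* (a ! ℕ.* z)) (bin-! b d)) (bin-! a (b ℕ.+ d)))
    where
    eq : ∀ x y a z → x ℕ.* y ℕ.* (a ℕ.* z) ≡ x ℕ.* (a ℕ.* (y ℕ.* z))
    eq = ℕS.solve-∀

  trinomial-swap₁₂ : ∀ a b d → trinomial a b d ≡ trinomial b a d
  trinomial-swap₁₂ a b d = ℕₚ.*-cancelʳ-≡ (trinomial a b d) (trinomial b a d) (a ! ℕ.* (b ! ℕ.* d !))
    {{ℕₚ.m*n≢0 (a !) (b ! ℕ.* d !) {{a ℕₚ.!≢0}} {{ℕₚ.m*n≢0 (b !) (d !) {{b ℕₚ.!≢0}} {{d ℕₚ.!≢0}}}}}}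
    (trans (trinomial-! a b d) (trans (cong _! (eq a b d)) (trans (sym (trinomial-! b a d)) (cong (trinomial b a d ℕ.*_) (eq′ (a !) (b !) (d !))))))
    where
    eq : ∀ a b d → a ℕ.+ (b ℕ.+ d) ≡ b ℕ.+ (a ℕ.+ d)
    eq = ℕS.solve-∀
    eq′ : ∀ a b d → b ℕ.* (a ℕ.* d) ≡ a ℕ.* (b ℕ.* d)
    eq′ = ℕS.solve-∀

  trinomial-swap₂₃ : ∀ a b d → trinomial a b d ≡ trinomial a d b
  trinomial-swap₂₃ a b d = cong₂ (λ x y → bin a x ℕ.* y) (ℕₚ.+-comm b d) (bin-comm b d)

  W : Weight
  W a b d = + trinomial a b d

  -- A trinomial coefficient is a product of two binomials, so the rule with three neighbours is
  -- `binomial-sum-suc` for the outer sum and again for the inner one.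
  W-pascal : ∀ n (u : Weight) → weighted (suc n) W u ≡ weighted n W (λ a b d → u (suc a) b d + u a (suc b) d + u a b (suc d))
  W-pascal n u = begin
    weighted (suc n) W u ≡⟨ as-bin (suc n) u ⟩
    anti (suc n) (λ a m → + bin a m * B m (u a)) ≡⟨ binomial-sum-suc n (λ a m → B m (u a)) ⟩
    anti n (λ a m → + bin a m * (B m (u (suc a)) + B (suc m) (u a)))
      ≡⟨ anti-cong n (λ a m _ → cong (λ z → + bin a m * z) (trans (cong (λ z → B m (u (suc a)) + z) (binomial-sum-suc m (u a))) (trans (sym (anti-+ m _ _)) (anti-cong m (λ b d _ → eq (+ bin b d) (u (suc a) b d) (u a (suc b) d) (u a b (suc d))))))) ⟩
    anti n (λ a m → + bin a m * B m (λ b d → u (suc a) b d + u a (suc b) d + u a b (suc d))) ≡⟨ as-bin n _ ⟨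
    weighted n W (λ a b d → u (suc a) b d + u a (suc b) d + u a b (suc d)) ∎
    where
    open ≡-Reasoning
    B : ℕ → (ℕ → ℕ → ℤ) → ℤ
    B m v = anti m (λ b d → + bin b d * v b d)
    eq : ∀ β x y z → β * x + β * (y + z) ≡ β * (x + y + z)
    eq = solve-∀
    as-bin : ∀ n u → weighted n W u ≡ anti n (λ a m → + bin a m * B m (u a))
    as-bin n u = anti-cong n (λ a m _ → trans (anti-cong m (λ b d e → trans (cong (_* u a b d) (trans (ℤₚ.pos-* (bin a (b ℕ.+ d)) (bin b d)) (cong (λ k → + bin a k * + bin b d) e))) (ℤₚ.*-assoc (+ bin a m) (+ bin b d) (u a b d))))
      (anti-* m (+ bin a m) (λ b d → + bin b d * u a b d)))

  -- For a > 0 the quotient is the trinomial coefficient with a lowered by one. This is how a single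
  -- row supplies powers of p: through the product of an entry with its weight.
  trinomial-absorb : ∀ a b d → a ℕ.+ (b ℕ.+ d) ℕᵈ.∣ a ℕ.* trinomial a b d
  trinomial-absorb zero b d = ℕᵈ.divides 0 refl
  trinomial-absorb (suc a) b d = ℕᵈ.divides (bin a (b ℕ.+ d) ℕ.* bin b d)
    (trans (sym (ℕₚ.*-assoc (suc a) (bin (suc a) (b ℕ.+ d)) (bin b d))) (trans (cong (ℕ._* bin b d) (bin-absorb a (b ℕ.+ d))) (eq (suc a ℕ.+ (b ℕ.+ d)) (bin a (b ℕ.+ d)) (bin b d))))
    where
    eq : ∀ n x y → n ℕ.* x ℕ.* y ≡ x ℕ.* y ℕ.* n
    eq = ℕS.solve-∀

  module _ {D : ℤ} {n : ℕ} (D∣n : D ∣ + n) where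
    absorb₁ : ∀ a b d → a ℕ.+ (b ℕ.+ d) ≡ n → D ∣ + a * W a b d
    absorb₁ a b d refl = ∣-trans D∣n (∣-trans (∣-pos (trinomial-absorb a b d)) (∣-reflexive (ℤₚ.pos-* a (trinomial a b d))))

    absorb₂ : ∀ a b d → a ℕ.+ (b ℕ.+ d) ≡ n → D ∣ + b * W a b d
    absorb₂ a b d e = ∣-resp (cong (λ z → + b * + z) (trinomial-swap₁₂ b a d)) (absorb₁ b a d (trans (eq a b d) e))
      where
      eq : ∀ a b d → b ℕ.+ (a ℕ.+ d) ≡ a ℕ.+ (b ℕ.+ d)
      eq = ℕS.solve-∀

    absorb₃ : ∀ a b d → a ℕ.+ (b ℕ.+ d) ≡ n → D ∣ + d * W a b d
    absorb₃ a b d e = ∣-resp (cong (λ z → + d * + z) (trinomial-swap₂₃ a d b)) (absorb₂ a d b (trans (cong (a ℕ.+_) (ℕₚ.+-comm d b)) e))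

  anti-drop : ∀ k n (u : ℕ → ℕ → ℤ) → (∀ i j → i ℕ.< k → u i j ≡ 0ℤ) → anti (k ℕ.+ n) u ≡ anti n (λ a b → u (k ℕ.+ a) b)
  anti-drop zero n u h = refl
  anti-drop (suc k) n u h = trans (cong₂ _+_ (h 0 (suc (k ℕ.+ n)) (s≤s z≤n)) (anti-drop k n (λ a → u (suc a)) (λ i j i<k → h (suc i) j (s≤s i<k)))) (ℤₚ.+-identityˡ _)

  anti-range : ∀ n (u : ℕ → ℕ → ℤ) → anti n u ≡ Σ< (suc n) (λ i → u i (n ℕ.∸ i))
  anti-range zero u = sym (ℤₚ.+-identityˡ (u 0 0))
  anti-range (suc n) u = trans (cong (λ z → u 0 (suc n) + z) (anti-range n (λ a → u (suc a)))) (trans (cong (_+ Σ< (suc n) (λ i → u (suc i) (n ℕ.∸ i))) (sym (ℤₚ.+-identityˡ (u 0 (suc n))))) (sym (Σ<-split 1 (suc n) (λ i → u i (suc n ℕ.∸ i)))))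

  δ-zero : ∀ z → z ≡ 0ℤ ⊎ δ z ≡ 0ℤ
  δ-zero (+ zero) = inj₁ refl
  δ-zero (+ suc n) = inj₂ refl
  δ-zero (-[1+ n ]) = inj₂ refl

  Σ<-extend : ∀ m n f → (∀ i → m ℕ.≤ i → f i ≡ 0ℤ) → Σ< (m ℕ.+ n) f ≡ Σ< m f
  Σ<-extend m n f h = trans (Σ<-split m n f) (trans (cong (λ z → Σ< m f + z) (zero-sum n (λ i → h (m ℕ.+ i) (ℕₚ.m≤m+n m i)))) (ℤₚ.+-identityʳ (Σ< m f)))
    where
    zero-sum : ∀ n {f} → (∀ i → f i ≡ 0ℤ) → Σ< n f ≡ 0ℤ
    zero-sum zero h = refl
    zero-sum (suc n) h = cong₂ _+_ (zero-sum n h) (h n)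

  Σ<-exchange-bounds : ∀ m n f → (∀ i → m ℕ.< i → f i ≡ 0ℤ) → (∀ i → n ℕ.< i → f i ≡ 0ℤ) → Σ< (suc m) f ≡ Σ< (suc n) f
  Σ<-exchange-bounds m n f h k = trans (sym (Σ<-extend (suc m) n f h)) (trans (cong (λ s → Σ< s f) (cong suc (ℕₚ.+-comm m n))) (Σ<-extend (suc n) m f k))

  Σ<-pick : ∀ n f k → (∀ i → i ≢ k → f i ≡ 0ℤ) → (n ℕ.< k → f k ≡ 0ℤ) → Σ< (suc n) f ≡ f k
  Σ<-pick n f k h out = trans (Σ<-exchange-bounds n k f (λ i n<i → beyond i n<i (i ℕ.≟ k)) (λ i k<i → h i (λ e → ℕₚ.<⇒≢ k<i (sym e))))
    (trans (cong (_+ f k) (zero-sum k (λ i i<k → h i (ℕₚ.<⇒≢ i<k)))) (ℤₚ.+-identityˡ (f k)))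
    where
    beyond : ∀ i → n ℕ.< i → Dec (i ≡ k) → f i ≡ 0ℤ
    beyond i n<i (yes refl) = out n<i
    beyond i n<i (no i≢k) = h i i≢k
    zero-sum : ∀ m → (∀ i → i ℕ.< m → f i ≡ 0ℤ) → Σ< m f ≡ 0ℤ
    zero-sum zero h = refl
    zero-sum (suc m) h = cong₂ _+_ (zero-sum m (λ i i<m → h i (ℕₚ.m≤n⇒m≤1+n i<m))) (h m ℕₚ.≤-refl)

  δ-≢ : ∀ {z} → z ≢ 0ℤ → δ z ≡ 0ℤ
  δ-≢ {z} h with δ-zero z
  ... | inj₁ e = ⊥-elim (h e)
  ... | inj₂ e = e

  -- The column condition determines b′ = E - b. The range b ≤ m may be exchanged for b ≤ E, since
  -- the binomial vanishes beyond m and the inner sum beyond E.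
  collapse : ∀ m m′ E (h : ℕ → ℤ) →
    anti m (λ b d → + bin b d * anti m′ (λ b′ d′ → + bin b′ d′ * (δ (+ E - + b - + b′) * h b))) ≡ Σ< (suc E) (λ b → c m b * c m′ (E ℕ.∸ b) * h b)
  collapse m m′ E h = begin
    anti m (λ b d → + bin b d * inner b) ≡⟨ anti-range m _ ⟩
    Σ< (suc m) (λ b → + bin b (m ℕ.∸ b) * inner b) ≡⟨ Σ<-cong (suc m) (λ b b≤m → cong (_* inner b) (to-c (ℕₚ.≤-pred b≤m))) ⟩
    Σ< (suc m) (λ b → c m b * inner b) ≡⟨ Σ<-exchange-bounds m E (λ b → c m b * inner b) (λ b m<b → cong (_* inner b) (c-zero m<b)) (λ b E<b → trans (cong (λ z → c m b * z) (beyond b E<b)) (ℤₚ.*-zeroʳ (c m b))) ⟩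
    Σ< (suc E) (λ b → c m b * inner b) ≡⟨ Σ<-cong (suc E) (λ b b≤E → trans (cong (λ z → c m b * z) (inner-value b (ℕₚ.≤-pred b≤E))) (sym (ℤₚ.*-assoc (c m b) (c m′ (E ℕ.∸ b)) (h b)))) ⟩
    Σ< (suc E) (λ b → c m b * c m′ (E ℕ.∸ b) * h b) ∎
    where
    open ≡-Reasoning
    inner : ℕ → ℤ
    inner b = anti m′ (λ b′ d′ → + bin b′ d′ * (δ (+ E - + b - + b′) * h b))
    to-c : ∀ {m b} → b ℕ.≤ m → + bin b (m ℕ.∸ b) ≡ c m b
    to-c {m} {b} b≤m = trans (sym (c-bin b (m ℕ.∸ b))) (cong (λ z → c z b) (ℕₚ.m+[n∸m]≡n b≤m))
    range : ∀ b → inner b ≡ Σ< (suc m′) (λ b′ → c m′ b′ * (δ (+ E - + b - + b′) * h b))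
    range b = trans (anti-range m′ _) (Σ<-cong (suc m′) (λ b′ b′≤m′ → cong (_* (δ (+ E - + b - + b′) * h b)) (to-c (ℕₚ.≤-pred b′≤m′))))
    eq : ∀ E b b′ → E ≡ E - b - b′ + (b + b′)
    eq = solve-∀
    sum : ∀ {b b′} → + E - + b - + b′ ≡ 0ℤ → E ≡ b ℕ.+ b′
    sum {b} {b′} e = ℤₚ.+-injective (trans (eq (+ E) (+ b) (+ b′)) (trans (cong (_+ (+ b + + b′)) e) (trans (ℤₚ.+-identityˡ _) (sym (ℤₚ.pos-+ b b′)))))
    killed : ∀ b b′ → + E - + b - + b′ ≢ 0ℤ → c m′ b′ * (δ (+ E - + b - + b′) * h b) ≡ 0ℤ
    killed b b′ ne = trans (cong (λ z → c m′ b′ * (z * h b)) (δ-≢ ne)) (ℤₚ.*-zeroʳ (c m′ b′))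
    beyond : ∀ b → E ℕ.< b → inner b ≡ 0ℤ
    beyond b E<b = trans (range b) (trans (Σ<-pick m′ _ 0 (λ i _ → killed b i (no-sum i)) (λ _ → killed b 0 (no-sum 0))) (killed b 0 (no-sum 0)))
      where
      no-sum : ∀ i → + E - + b - + i ≢ 0ℤ
      no-sum i e = ℕₚ.<⇒≱ E<b (ℕₚ.≤-trans (ℕₚ.m≤m+n b i) (ℕₚ.≤-reflexive (sym (sum {b} {i} e))))
    inner-value : ∀ b → b ℕ.≤ E → inner b ≡ c m′ (E ℕ.∸ b) * h b
    inner-value b b≤E = trans (range b) (trans (Σ<-pick m′ _ (E ℕ.∸ b)
        (λ i i≢ → killed b i (λ e → i≢ (sym (trans (cong (ℕ._∸ b) (sum {b} {i} e)) (ℕₚ.m+n∸m≡n b i)))))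
        (λ m′< → cong (_* (δ (+ E - + b - + (E ℕ.∸ b)) * h b)) (c-zero m′<)))
      (cong (λ z → c m′ (E ℕ.∸ b) * z) (trans (cong (_* h b) (cong δ zero-arg)) (ℤₚ.*-identityˡ (h b)))))
      where
      eq′ : ∀ b s → b + s - b - s ≡ 0ℤ
      eq′ = solve-∀
      zero-arg : + E - + b - + (E ℕ.∸ b) ≡ 0ℤ
      zero-arg = trans (cong (λ z → z - + b - + (E ℕ.∸ b)) (trans (cong +_ (sym (ℕₚ.m+[n∸m]≡n b≤E))) (ℤₚ.pos-+ b (E ℕ.∸ b)))) (eq′ (+ b) (+ (E ℕ.∸ b)))

  ∣-leftSummand : ∀ {i m n} → i ℕᵈ.∣ m ℕ.+ n → i ℕᵈ.∣ n → i ℕᵈ.∣ m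
  ∣-leftSummand {i} {m} {n} h = ℕᵈ.∣m+n∣m⇒∣n (subst (i ℕᵈ.∣_) (ℕₚ.+-comm m n) h)

  ^-distrib-* : ∀ x y n → (x * y) ^ n ≡ x ^ n * y ^ n
  ^-distrib-* x y zero = refl
  ^-distrib-* x y (suc n) = trans (cong (λ z → x * y * z) (^-distrib-* x y n)) (eq x y (x ^ n) (y ^ n))
    where
    eq : ∀ x y a b → x * y * (a * b) ≡ x * a * (y * b)
    eq = solve-∀

  sign-complement : ∀ {σ} → σ * σ ≡ 1ℤ → ∀ b d → σ ^ d ≡ σ ^ (b ℕ.+ d) * σ ^ b
  sign-complement {σ} h b d = sym (trans (cong (_* σ ^ b) (ℤₚ.^-distribˡ-+-* σ b d)) (trans (eq (σ ^ b) (σ ^ d)) (trans (cong (_* σ ^ d) (trans (sym (^-distrib-* σ σ b)) (trans (cong (_^ b) h) (ℤₚ.^-zeroˡ b)))) (ℤₚ.*-identityˡ (σ ^ d)))))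
    where
    eq : ∀ x y → x * y * x ≡ x * x * y
    eq = solve-∀

  anti-comm : ∀ m n (f : ℕ → ℕ → ℕ → ℕ → ℤ) → anti m (λ a b → anti n (f a b)) ≡ anti n (λ a′ b′ → anti m (λ a b → f a b a′ b′))
  anti-comm zero n f = refl
  anti-comm (suc m) n f = trans (cong (λ z → anti n (f 0 (suc m)) + z) (anti-comm m n (λ a → f (suc a)))) (sym (anti-+ n _ _))

  δ-neg : ∀ {e n z} → n ℕ.< z → ∀ i j → e ≡ + n - + z - + i - + j → δ e ≡ 0ℤ
  δ-neg {n = n} {z} n<z i j refl = δ-≢ (λ e → ℕₚ.<⇒≱ n<z (ℕₚ.≤-trans (ℕₚ.m≤m+n z (i ℕ.+ j)) (ℕₚ.≤-reflexive (sym (ℤₚ.+-injective (trans (eq (+ n) (+ z) (+ i) (+ j)) (trans (cong (_+ (+ z + (+ i + + j))) e) (trans (ℤₚ.+-identityˡ _) (trans (cong (λ s → + z + s) (sym (ℤₚ.pos-+ i j))) (sym (ℤₚ.pos-+ z (i ℕ.+ j)))))))))))) 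
    where
    eq : ∀ n z i j → n ≡ n - z - i - j + (z + (i + j))
    eq = solve-∀

  -- Two irregular rows.

  module PairLemma (p : ℕ) (prime : Prime p) (5≤p : 5 ℕ.≤ p) where
    open Local p prime 5≤p
    open Pairs p prime 5≤p

    ultrametric : ∀ t d {g X} → P ^ (t ℕ.+ d) ∣ g * X → ¬ (P ^ suc t ∣ X) → P ^ d ∣ g
    ultrametric zero d {g} {X} h ∤ = unit-cancel (λ k → ∤ (∣-trans (∣-reflexive (ℤₚ.^-identityʳ P)) k)) d (∣-resp (ℤₚ.*-comm g X) h)
    ultrametric (suc t) d {g} {X} h ∤ with P ∣? X
    ... | no P∤X = unit-cancel P∤X d (∣-resp (ℤₚ.*-comm g X) (∣-trans (^-∣ P (ℕₚ.m≤n+m d (suc t))) h))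
    ... | yes (divides Y refl) = ultrametric t d (*-cancelˡ-∣ P (∣-resp (eq g Y P) h)) (λ k → ∤ (∣-resp (ℤₚ.*-comm P Y) (*-monoʳ-∣ P k)))
      where
      eq : ∀ g y P → g * (y * P) ≡ P * (g * y)
      eq = solve-∀

    -- Whatever is missing from the divisibility of S is supplied by g.
    balance : ∀ r {g S X Y Z} → 1 ℕ.≤ r → (∀ t → 1 ℕ.≤ t → P ^ t ∣ X → P ^ t ∣ Y → P ^ t ∣ Z → P ^ (r ℕ.+ (r ℕ.+ t)) ∣ S) →
      P ∣ X → P ∣ Y → P ∣ Z → P ^ r ∣ g * X → P ^ r ∣ g * Y → P ^ r ∣ g * Z → P ^ (3 ℕ.* r) ∣ g * S
    balance (suc r₀) {g} {S} {X} {Y} {Z} _ h x y z gx gy gz = go r₀ 1 (s≤s z≤n) refl (one x) (one y) (one z)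
      where
      r = suc r₀
      one : ∀ {X} → P ∣ X → P ^ 1 ∣ X
      one = ∣-trans (∣-reflexive (ℤₚ.^-identityʳ P))
      go : ∀ d t → 1 ℕ.≤ t → t ℕ.+ d ≡ r → P ^ t ∣ X → P ^ t ∣ Y → P ^ t ∣ Z → P ^ (3 ℕ.* r) ∣ g * S
      stop : ∀ d t → 1 ℕ.≤ t → t ℕ.+ d ≡ r → P ^ t ∣ X → P ^ t ∣ Y → P ^ t ∣ Z → P ^ d ∣ g → P ^ (3 ℕ.* r) ∣ g * S
      stop d t 1≤t e hx hy hz hg = ∣-trans (∣-reflexive (trans (cong (P ^_) (trans (cong (λ s → r ℕ.+ (r ℕ.+ (s ℕ.+ 0))) (sym e)) (eq r t d))) (ℤₚ.^-distribˡ-+-* P d (r ℕ.+ (r ℕ.+ t))))) (*-mono-∣ hg (h t 1≤t hx hy hz))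
        where
        eq : ∀ r t d → r ℕ.+ (r ℕ.+ (t ℕ.+ d ℕ.+ 0)) ≡ d ℕ.+ (r ℕ.+ (r ℕ.+ t))
        eq = ℕS.solve-∀
      go zero t 1≤t e hx hy hz = stop zero t 1≤t e hx hy hz (divides g (sym (ℤₚ.*-identityʳ g)))
      go (suc d) t 1≤t e hx hy hz = decide (P ^ suc t ∣? X) (P ^ suc t ∣? Y) (P ^ suc t ∣? Z)
        where
        missing : ∀ {X} → P ^ r ∣ g * X → ¬ (P ^ suc t ∣ X) → P ^ suc d ∣ g
        missing gX ∤ = ultrametric t (suc d) (∣-trans (∣-reflexive (cong (P ^_) e)) gX) ∤
        decide : Dec (P ^ suc t ∣ X) → Dec (P ^ suc t ∣ Y) → Dec (P ^ suc t ∣ Z) → P ^ (3 ℕ.* r) ∣ g * S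
        decide (yes x′) (yes y′) (yes z′) = go d (suc t) (s≤s z≤n) (trans (sym (ℕₚ.+-suc t d)) e) x′ y′ z′
        decide (no ∤) _ _ = stop (suc d) t 1≤t e hx hy hz (missing gx ∤)
        decide (yes _) (no ∤) _ = stop (suc d) t 1≤t e hx hy hz (missing gy ∤)
        decide (yes _) (yes _) (no ∤) = stop (suc d) t 1≤t e hx hy hz (missing gz ∤)

    χ-idem : ∀ b → χ b * χ b ≡ χ b
    χ-idem b with p ℕᵈ.∣? b
    ... | yes h = refl
    ... | no h = refl

    χ-cong : ∀ {b d} → (p ℕᵈ.∣ b → p ℕᵈ.∣ d) → (p ℕᵈ.∣ d → p ℕᵈ.∣ b) → χ b ≡ χ d
    χ-cong {b} {d} f g with p ℕᵈ.∣? b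
    ... | yes h = sym (χ-yes (f h))
    ... | no h = sym (χ-no (λ k → h (g k)))

    χ-complement : ∀ {b d m} → b ℕ.+ d ≡ m → p ℕᵈ.∣ m → χ d ≡ χ b
    χ-complement {b} {d} refl h = χ-cong (λ k → ∣-leftSummand h k) (λ k → ℕᵈ.∣m+n∣m⇒∣n h k)

    ρ : Weight
    ρ a b d = 1ℤ - χ a * (χ b * χ d)

    RW : Weight
    RW a b d = ρ a b d * W a b d

    -- `ρ` is the indicator of irregular rows. When p divides a and b + d, it divides b exactly when
    -- it divides d, so one entry decides.
    ρ-pair : ∀ {a b d m} → p ℕᵈ.∣ a → b ℕ.+ d ≡ m → p ℕᵈ.∣ m → ρ a b d ≡ 1ℤ - χ b
    ρ-pair {a} {b} {d} ha e hm = trans (cong₂ (λ x y → 1ℤ - x * (χ b * y)) (χ-yes ha) (χ-complement {b} e hm)) (cong (λ z → 1ℤ - z) (trans (ℤₚ.*-identityˡ (χ b * χ b)) (χ-idem b)))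

    -- The first entry of each row lies in the column that the other irregular row misses; the
    -- second and third lie in the two common columns. Here x, y, z are the sums of the regular
    -- entries in the columns of a, of a′, and of b and b′; `e₄` is what the last column leaves for
    -- d + d′. The hypothesis `odd` expresses the orthogonality of two rows of M: ββ′ + γγ′ = 0 for
    -- signs.
    module TwoRows (r n n′ : ℕ) (n-suc : suc n′ ≡ n) (1≤r : 1 ℕ.≤ r) (n-val : P ^ r ∣ + n)
                   (α β γ α′ β′ γ′ : ℤ) (γγ : γ * γ ≡ 1ℤ) (β′β′ : β′ * β′ ≡ 1ℤ) (γ′γ′ : γ′ * γ′ ≡ 1ℤ) (odd : β * γ * (β′ * γ′) ≡ -1ℤ)
                   (x y z : ℕ) (e₄ : ℤ) where
      J : ℕ → ℕ → ℕ → Weight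
      J a b d a′ b′ d′ = (α ^ a * β ^ b * γ ^ d) * (α′ ^ a′ * β′ ^ b′ * γ′ ^ d′) *
        (δ (+ n - + x - + a) * δ (+ n - + y - + a′) * (δ (+ n - + z - + b - + b′) * δ (e₄ - + d - + d′)))

      inner : ℕ → ℕ → ℕ → ℕ → ℤ
      inner a m a′ m′ = anti m (λ b d → anti m′ (λ b′ d′ → RW a b d * (RW a′ b′ d′ * J a b d a′ b′ d′)))

      rearranged : weighted n RW (λ a b d → weighted n RW (J a b d)) ≡ anti n (λ a m → anti n (λ a′ m′ → inner a m a′ m′))
      rearranged = anti-cong n (λ a m _ → trans (anti-cong m (λ b d _ → trans (sym (anti-* n (RW a b d) _)) (anti-cong n (λ a′ m′ _ → sym (anti-* m′ (RW a b d) _)))))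
        (anti-comm m n (λ b d a′ m′ → anti m′ (λ b′ d′ → RW a b d * (RW a′ b′ d′ * J a b d a′ b′ d′)))))

      p∣n : p ℕᵈ.∣ n
      p∣n = P^t⇒p {r} {n} 1≤r n-val

      module Fixed (a a′ E : ℕ) (ax : a ℕ.+ x ≡ n) (ay : a′ ℕ.+ y ≡ n) (Ez : + n - + z ≡ + E) (p∣x : p ℕᵈ.∣ x) (p∣y : p ℕᵈ.∣ y) (p∣E : p ℕᵈ.∣ E) where
        p∣a : ∀ {a x} → a ℕ.+ x ≡ n → p ℕᵈ.∣ x → p ℕᵈ.∣ a
        p∣a {a} {x} e h = ∣-leftSummand (subst (p ℕᵈ.∣_) (sym e) p∣n) h

        D₁₂ K constant : ℤ
        D₁₂ = δ (+ n - + x - + a) * δ (+ n - + y - + a′)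
        -- When b + d = x, b′ + d′ = y and b + b′ = E, the sum d + d′ is x + y - E, so the last
        -- column condition does not depend on b.
        K = δ (e₄ - + x - + y + + E)
        constant = α ^ a * γ ^ x * (α′ ^ a′ * β′ ^ E * (γ′ ^ y * γ′ ^ E)) * (D₁₂ * K)

        kernel : ℕ → ℤ
        kernel b = (1ℤ - χ b) * ε b

        -- Unless b + b′ = E both sides are 0. If it holds, the two rows are irregular together
        -- because p divides E, and all sign powers can be expressed through b: what varies is
        -- (βγβ′γ′)ᵇ = (-1)ᵇ.
        pointwise : ∀ b d b′ d′ → b ℕ.+ d ≡ x → b′ ℕ.+ d′ ≡ y →
          RW a b d * (RW a′ b′ d′ * J a b d a′ b′ d′) ≡ + bin a x * + bin a′ y * constant * (+ bin b d * (+ bin b′ d′ * (δ (+ E - + b - + b′) * kernel b)))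
        pointwise b d b′ d′ e e′ = by-δ (δ-zero (+ E - + b - + b′))
          where
          s₁ s₂ B B′ : ℤ
          s₁ = α ^ a * β ^ b * γ ^ d
          s₂ = α′ ^ a′ * β′ ^ b′ * γ′ ^ d′
          B = + bin a x * + bin a′ y
          B′ = constant
          δ₃ : δ (+ n - + z - + b - + b′) ≡ δ (+ E - + b - + b′)
          δ₃ = cong (λ t → δ (t - + b - + b′)) Ez
          eq-zero : ∀ R R′ s D X B k w w′ → R * (R′ * (s * (D * (0ℤ * X)))) ≡ B * (w * (w′ * (0ℤ * k)))
          eq-zero = solve-∀
          W-split : ∀ {a b d m} → b ℕ.+ d ≡ m → W a b d ≡ + bin a m * + bin b d
          W-split {a} {b} {d} refl = ℤₚ.pos-* (bin a (b ℕ.+ d)) (bin b d)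
          by-δ : + E - + b - + b′ ≡ 0ℤ ⊎ δ (+ E - + b - + b′) ≡ 0ℤ → RW a b d * (RW a′ b′ d′ * J a b d a′ b′ d′) ≡ B * B′ * (+ bin b d * (+ bin b′ d′ * (δ (+ E - + b - + b′) * kernel b)))
          by-δ (inj₂ δ≡0) = trans (cong (λ t → RW a b d * (RW a′ b′ d′ * (s₁ * s₂ * (D₁₂ * (t * δ (e₄ - + d - + d′)))))) (trans δ₃ δ≡0))
            (trans (eq-zero (RW a b d) (RW a′ b′ d′) (s₁ * s₂) D₁₂ (δ (e₄ - + d - + d′)) (B * B′) (kernel b) (+ bin b d) (+ bin b′ d′))
              (cong (λ t → B * B′ * (+ bin b d * (+ bin b′ d′ * (t * kernel b)))) (sym δ≡0)))
          by-δ (inj₁ zero-arg) = begin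
            RW a b d * (RW a′ b′ d′ * J a b d a′ b′ d′)
              ≡⟨ cong₂ (λ t u → ρ a b d * t * (ρ a′ b′ d′ * u * J a b d a′ b′ d′)) (W-split {a} e) (W-split {a′} e′) ⟩
            ρ a b d * (+ bin a x * + bin b d) * (ρ a′ b′ d′ * (+ bin a′ y * + bin b′ d′) * J a b d a′ b′ d′)
              ≡⟨ cong₂ (λ t u → t * (+ bin a x * + bin b d) * (u * (+ bin a′ y * + bin b′ d′) * J a b d a′ b′ d′)) (ρ-pair (p∣a ax p∣x) e p∣x)
                   (trans (ρ-pair (p∣a ay p∣y) e′ p∣y) (cong (λ t → 1ℤ - t) (χ-complement {b} (sym E-sum) p∣E))) ⟩
            (1ℤ - χ b) * (+ bin a x * + bin b d) * ((1ℤ - χ b) * (+ bin a′ y * + bin b′ d′) * J a b d a′ b′ d′)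
              ≡⟨ cong (λ t → (1ℤ - χ b) * (+ bin a x * + bin b d) * ((1ℤ - χ b) * (+ bin a′ y * + bin b′ d′) * t)) J-value ⟩
            (1ℤ - χ b) * (+ bin a x * + bin b d) * ((1ℤ - χ b) * (+ bin a′ y * + bin b′ d′) * (S * ε b * (D₁₂ * (Δ * K))))
              ≡⟨ eq (χ b) (+ bin a x) (+ bin b d) (+ bin a′ y) (+ bin b′ d′) S (ε b) D₁₂ Δ K ⟩
            B * (S * (D₁₂ * K)) * (+ bin b d * (+ bin b′ d′ * (Δ * ((1ℤ - χ b) * (1ℤ - χ b) * ε b))))
              ≡⟨ cong (λ t → B * B′ * (+ bin b d * (+ bin b′ d′ * (Δ * (t * ε b))))) (trans (square (χ b)) (trans (cong (λ t → 1ℤ - + 2 * χ b + t) (χ-idem b)) (simplify (χ b)))) ⟩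
            B * B′ * (+ bin b d * (+ bin b′ d′ * (Δ * kernel b))) ∎
            where
            open ≡-Reasoning
            S Δ : ℤ
            S = α ^ a * γ ^ x * (α′ ^ a′ * β′ ^ E * (γ′ ^ y * γ′ ^ E))
            Δ = δ (+ E - + b - + b′)
            square : ∀ x → (1ℤ - x) * (1ℤ - x) ≡ 1ℤ - + 2 * x + x * x
            square = solve-∀
            simplify : ∀ x → 1ℤ - + 2 * x + x ≡ 1ℤ - x
            simplify = solve-∀
            eq : ∀ χ A b A′ b′ S e D Δ K → (1ℤ - χ) * (A * b) * ((1ℤ - χ) * (A′ * b′) * (S * e * (D * (Δ * K)))) ≡ A * A′ * (S * (D * K)) * (b * (b′ * (Δ * ((1ℤ - χ) * (1ℤ - χ) * e))))
            eq = solve-∀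
            undo : ∀ E b b′ → E ≡ E - b - b′ + (b + b′)
            undo = solve-∀
            E-sum : E ≡ b ℕ.+ b′
            E-sum = ℤₚ.+-injective (trans (undo (+ E) (+ b) (+ b′)) (trans (cong (_+ (+ b + + b′)) zero-arg) (trans (ℤₚ.+-identityˡ _) (sym (ℤₚ.pos-+ b b′)))))
            e₄-arg : ∀ e b d b′ d′ → e - d - d′ ≡ e - (b + d) - (b′ + d′) + (b + b′)
            e₄-arg = solve-∀
            δ₄ : δ (e₄ - + d - + d′) ≡ K
            δ₄ = cong δ (trans (e₄-arg e₄ (+ b) (+ d) (+ b′) (+ d′)) (cong₂ (λ t u → t + u) (cong₂ (λ t u → e₄ - t - u) (trans (sym (ℤₚ.pos-+ b d)) (cong +_ e)) (trans (sym (ℤₚ.pos-+ b′ d′)) (cong +_ e′))) (trans (sym (ℤₚ.pos-+ b b′)) (cong +_ (sym E-sum)))))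
            γ^d : γ ^ d ≡ γ ^ x * γ ^ b
            γ^d = trans (sign-complement γγ b d) (cong (λ k → γ ^ k * γ ^ b) e)
            β′^b′ : β′ ^ b′ ≡ β′ ^ E * β′ ^ b
            β′^b′ = trans (sign-complement β′β′ b b′) (cong (λ k → β′ ^ k * β′ ^ b) (sym E-sum))
            γ′^d′ : γ′ ^ d′ ≡ γ′ ^ y * (γ′ ^ E * γ′ ^ b)
            γ′^d′ = trans (sign-complement γ′γ′ b′ d′) (cong₂ (λ k t → γ′ ^ k * t) e′ (trans (sign-complement γ′γ′ b b′) (cong (λ k → γ′ ^ k * γ′ ^ b) (sym E-sum))))
            signs : ∀ A b c X A′ b′ E Y F d → A * b * (X * c) * (A′ * (E * b′) * (Y * (F * d))) ≡ A * X * (A′ * E * (Y * F)) * (b * c * (b′ * d))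
            signs = solve-∀
            total-sign : s₁ * s₂ ≡ S * ε b
            total-sign = trans (cong₂ (λ t u → α ^ a * β ^ b * t * u) γ^d (cong₂ (λ t u → α′ ^ a′ * t * u) β′^b′ γ′^d′))
              (trans (signs (α ^ a) (β ^ b) (γ ^ b) (γ ^ x) (α′ ^ a′) (β′ ^ b) (β′ ^ E) (γ′ ^ y) (γ′ ^ E) (γ′ ^ b))
                (cong (λ t → S * t) (trans (cong₂ _*_ (sym (^-distrib-* β γ b)) (sym (^-distrib-* β′ γ′ b))) (trans (sym (^-distrib-* (β * γ) (β′ * γ′) b)) (cong (_^ b) odd)))))
            J-value : J a b d a′ b′ d′ ≡ S * ε b * (D₁₂ * (Δ * K))
            J-value = cong₂ (λ t u → t * (D₁₂ * u)) total-sign (cong₂ _*_ δ₃ δ₄)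

        reduced : inner a x a′ y ≡ constant * (c n x * c n y * pairSum x y E)
        reduced = begin
          inner a x a′ y ≡⟨ anti-cong x (λ b d e → trans (anti-cong y (λ b′ d′ e′ → pointwise b d b′ d′ e e′)) (trans (anti-* y (B * constant) _) (cong (λ t → B * constant * t) (anti-* y (+ bin b d) _)))) ⟩
          anti x (λ b d → B * constant * (+ bin b d * anti y (λ b′ d′ → + bin b′ d′ * (δ (+ E - + b - + b′) * kernel b)))) ≡⟨ anti-* x (B * constant) _ ⟩
          B * constant * anti x (λ b d → + bin b d * anti y (λ b′ d′ → + bin b′ d′ * (δ (+ E - + b - + b′) * kernel b))) ≡⟨ cong (λ t → B * constant * t) (collapse x y E kernel) ⟩
          B * constant * Σ< (suc E) (λ b → c x b * c y (E ℕ.∸ b) * kernel b) ≡⟨ cong (λ t → B * constant * t) (Σ<-cong (suc E) (λ b _ → eq (c x b * c y (E ℕ.∸ b)) (1ℤ - χ b) (ε b))) ⟩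
          B * constant * pairSum x y E ≡⟨ cong (λ t → t * constant * pairSum x y E) (cong₂ _*_ (to-c ax) (to-c ay)) ⟩
          c n x * c n y * constant * pairSum x y E ≡⟨ eq′ (c n x * c n y) constant (pairSum x y E) ⟩
          constant * (c n x * c n y * pairSum x y E) ∎
          where
          open ≡-Reasoning
          B : ℤ
          B = + bin a x * + bin a′ y
          to-c : ∀ {a x} → a ℕ.+ x ≡ n → + bin a x ≡ c n x
          to-c {a} {x} e = trans (sym (c-bin a x)) (trans (c-symm a x) (cong (λ k → c k x) e))
          eq : ∀ s k e → s * (k * e) ≡ k * (e * s)
          eq = solve-∀
          eq′ : ∀ x k s → x * k * s ≡ k * (x * s)
          eq′ = solve-∀

      inner-vanishes : ∀ a m a′ m′ → (∀ b d b′ d′ → J a b d a′ b′ d′ ≡ 0ℤ) → inner a m a′ m′ ≡ 0ℤ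
      inner-vanishes a m a′ m′ h = trans (anti-cong m (λ b d _ → trans (anti-cong m′ (λ b′ d′ _ → trans (cong (λ t → RW a b d * (RW a′ b′ d′ * t)) (h b d b′ d′)) (eq (RW a b d) (RW a′ b′ d′)))) (anti-* m′ 0ℤ (λ _ _ → 0ℤ)))) (anti-* m 0ℤ (λ _ _ → 0ℤ))
        where
        eq : ∀ x y → x * (y * 0ℤ) ≡ 0ℤ * 0ℤ
        eq = solve-∀

      -- The column conditions force a = n - x, a′ = n - y and E = n - z, and leave nothing if z >
      -- n. The remaining sum is a multiple of the one in `pair-core`, and `balance` trades the
      -- exponent t there against the divisibility of g.
      pair-lemma : ∀ {g} → p ℕᵈ.∣ x → p ℕᵈ.∣ y → p ℕᵈ.∣ z → P ^ r ∣ g * + x → P ^ r ∣ g * + y → P ^ r ∣ g * + z →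
        P ^ (3 ℕ.* r) ∣ g * weighted n RW (λ a b d → weighted n RW (J a b d))
      pair-lemma {g} p∣x p∣y p∣z gx gy gz = ∣-resp (cong (λ t → g * t) (sym rearranged))
        (∣-resp (trans (anti-cong n (λ a m _ → anti-* n g (inner a m))) (anti-* n g _)) (anti-∣ n (λ a m e → anti-∣ n (λ a′ m′ e′ → each a m a′ m′ e e′ (δ-zero (+ n - + x - + a)) (δ-zero (+ n - + y - + a′)) (ℕₚ.≤-<-connex z n)))))
        where
        zero-∣ : ∀ a m a′ m′ → (∀ b d b′ d′ → J a b d a′ b′ d′ ≡ 0ℤ) → P ^ (3 ℕ.* r) ∣ g * inner a m a′ m′
        zero-∣ a m a′ m′ h = ∣-resp (sym (trans (cong (λ t → g * t) (inner-vanishes a m a′ m′ h)) (ℤₚ.*-zeroʳ g))) (∣-0 _)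
        undo : ∀ n x a → n ≡ n - x - a + (a + x)
        undo = solve-∀
        sum : ∀ a x → + n - + x - + a ≡ 0ℤ → a ℕ.+ x ≡ n
        sum a x e = sym (ℤₚ.+-injective (trans (undo (+ n) (+ x) (+ a)) (trans (cong (_+ (+ a + + x)) e) (trans (ℤₚ.+-identityˡ _) (sym (ℤₚ.pos-+ a x))))))
        k₁ : ∀ s y w → s * (0ℤ * y * w) ≡ 0ℤ
        k₁ = solve-∀
        k₂ : ∀ s x w → s * (x * 0ℤ * w) ≡ 0ℤ
        k₂ = solve-∀
        k₃ : ∀ s x w → s * (x * (0ℤ * w)) ≡ 0ℤ
        k₃ = solve-∀
        each : ∀ a m a′ m′ → a ℕ.+ m ≡ n → a′ ℕ.+ m′ ≡ n → + n - + x - + a ≡ 0ℤ ⊎ δ (+ n - + x - + a) ≡ 0ℤ → + n - + y - + a′ ≡ 0ℤ ⊎ δ (+ n - + y - + a′) ≡ 0ℤ →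
          z ℕ.≤ n ⊎ n ℕ.< z → P ^ (3 ℕ.* r) ∣ g * inner a m a′ m′
        each a m a′ m′ e e′ (inj₂ δ≡0) _ _ = zero-∣ a m a′ m′ (λ b d b′ d′ → trans (cong (λ t → (α ^ a * β ^ b * γ ^ d) * (α′ ^ a′ * β′ ^ b′ * γ′ ^ d′) * (t * δ (+ n - + y - + a′) * (δ (+ n - + z - + b - + b′) * δ (e₄ - + d - + d′)))) δ≡0)
          (k₁ ((α ^ a * β ^ b * γ ^ d) * (α′ ^ a′ * β′ ^ b′ * γ′ ^ d′)) (δ (+ n - + y - + a′)) (δ (+ n - + z - + b - + b′) * δ (e₄ - + d - + d′))))
        each a m a′ m′ e e′ (inj₁ _) (inj₂ δ≡0) _ = zero-∣ a m a′ m′ (λ b d b′ d′ → trans (cong (λ t → (α ^ a * β ^ b * γ ^ d) * (α′ ^ a′ * β′ ^ b′ * γ′ ^ d′) * (δ (+ n - + x - + a) * t * (δ (+ n - + z - + b - + b′) * δ (e₄ - + d - + d′)))) δ≡0)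
          (k₂ ((α ^ a * β ^ b * γ ^ d) * (α′ ^ a′ * β′ ^ b′ * γ′ ^ d′)) (δ (+ n - + x - + a)) (δ (+ n - + z - + b - + b′) * δ (e₄ - + d - + d′))))
        each a m a′ m′ e e′ (inj₁ _) (inj₁ _) (inj₂ n<z) = zero-∣ a m a′ m′ (λ b d b′ d′ → trans (cong (λ t → (α ^ a * β ^ b * γ ^ d) * (α′ ^ a′ * β′ ^ b′ * γ′ ^ d′) * (δ (+ n - + x - + a) * δ (+ n - + y - + a′) * (t * δ (e₄ - + d - + d′)))) (δ-neg n<z b b′ refl))
          (k₃ ((α ^ a * β ^ b * γ ^ d) * (α′ ^ a′ * β′ ^ b′ * γ′ ^ d′)) (δ (+ n - + x - + a) * δ (+ n - + y - + a′)) (δ (e₄ - + d - + d′))))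
        each a m a′ m′ e e′ (inj₁ zx) (inj₁ zy) (inj₁ z-bound) = ∣-resp (cong (λ t → g * t) (trans (sym reduced) (cong₂ (λ m m′ → inner a m a′ m′) (complement {a} {x} {m} (sum a x zx) e) (complement {a′} {y} {m′} (sum a′ y zy) e′))))
          (∣-resp (eq g constant (c n x * c n y * pairSum x y E)) (∣n⇒∣m*n constant (balance r {g} 1≤r (λ t 1≤t tx ty tE → subst (λ k → P ^ (r ℕ.+ (r ℕ.+ t)) ∣ c k x * c k y * pairSum x y E) n-suc (PairCore.pair-core r t n′ 1≤t (∣-resp (cong +_ (sym n-suc)) n-val) x y E tx ty tE)) (∣-pos p∣x) (∣-pos p∣y) (∣-pos p∣E) gx gy gE)))
          where
          E : ℕ
          E = n ℕ.∸ z
          complement : ∀ {a x m} → a ℕ.+ x ≡ n → a ℕ.+ m ≡ n → x ≡ m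
          complement {a} {x} {m} h k = ℕₚ.+-cancelˡ-≡ a x m (trans h (sym k))
          E+z : E ℕ.+ z ≡ n
          E+z = ℕₚ.m∸n+n≡m z-bound
          p∣E : p ℕᵈ.∣ E
          p∣E = ∣-leftSummand (subst (p ℕᵈ.∣_) (sym E+z) p∣n) p∣z
          eq″ : ∀ E z → E + z - z ≡ E
          eq″ = solve-∀
          Ez : + n - + z ≡ + E
          Ez = trans (cong (_- + z) (trans (cong +_ (sym E+z)) (ℤₚ.pos-+ E z))) (eq″ (+ E) (+ z))
          open Fixed a a′ E (sum a x zx) (sum a′ y zy) Ez p∣x p∣y p∣E
          eq : ∀ g k s → k * (g * s) ≡ g * (k * s)
          eq = solve-∀
          eq‴ : ∀ g n z → g * n - g * z ≡ g * (n - z)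
          eq‴ = solve-∀
          gE : P ^ r ∣ g * + E
          gE = ∣-resp (trans (eq‴ g (+ n) (+ z)) (cong (λ t → g * t) Ez)) (∣m∣n⇒∣m-n (∣n⇒∣m*n g n-val) gz)

  bin-div : ∀ a m → a ℕ.+ m ℕᵈ.∣ a ℕ.* bin a m
  bin-div zero m = ℕᵈ.divides 0 refl
  bin-div (suc a) m = ℕᵈ.divides (bin a m) (trans (bin-absorb a m) (ℕₚ.*-comm (suc a ℕ.+ m) (bin a m)))

  -- Four regular rows.

  module DivisibleRows (p : ℕ) (prime : Prime p) (5≤p : 5 ℕ.≤ p) where
    open Local p prime 5≤p
    open Pairs p prime 5≤p

    W′ : Weight
    W′ a b d = W (p ℕ.* a) (p ℕ.* b) (p ℕ.* d)

    module _ (r s : ℕ) (s-val : P ^ r ∣ + s) where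
      private
        D : ℤ
        D = P ^ r

      ps-val : P ^ suc r ∣ + (p ℕ.* s)
      ps-val = ∣-resp (sym (ℤₚ.pos-* p s)) (*-monoʳ-∣ P s-val)

      private
        three : ∀ {x y z} → D ∣ x → D ∣ y → D ∣ z → P ^ (3 ℕ.* r) ∣ x * (y * z)
        three hx hy hz = ∣-trans (∣-reflexive (trans (cong (P ^_) (eq r)) (trans (ℤₚ.^-distribˡ-+-* P r (r ℕ.+ r)) (cong (λ t → P ^ r * t) (ℤₚ.^-distribˡ-+-* P r r))))) (*-mono-∣ hx (*-mono-∣ hy hz))
          where
          eq : ∀ r → 3 ℕ.* r ≡ r ℕ.+ (r ℕ.+ r)
          eq = ℕS.solve-∀

        sum₂ : ∀ {a m n x y} → a ℕ.+ m ≡ n → a ℕ.+ (x ℕ.+ y) ≡ n → + m ≡ + x + + y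
        sum₂ {a} {m} {n} {x} {y} e e′ = trans (cong +_ (ℕₚ.+-cancelˡ-≡ a m (x ℕ.+ y) (trans e (sym e′)))) (ℤₚ.pos-+ x y)

        difference : ∀ {b n x y} → b ℕ.+ (x ℕ.+ y) ≡ n → + b ≡ + n - + x - + y
        difference {b} {n} {x} {y} e = trans (eq (+ b) (+ x) (+ y)) (cong (λ t → t - + x - + y) (trans (cong (λ t → + b + t) (sym (ℤₚ.pos-+ x y))) (trans (sym (ℤₚ.pos-+ b (x ℕ.+ y))) (cong +_ e))))
          where
          eq : ∀ b x y → b ≡ b + (x + y) - x - y
          eq = solve-∀

      -- The columns of a, b, d miss the rows j, k, l respectively. For the binomial of a and m = b
      -- + d, the three factors pʳ come from s, from a times that binomial, and from m = xₖ + xₗ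
      -- against gₖ or gₗ. For the binomial of b and d the product mbd is split along m = xₖ + xₗ:
      -- with xₖ, gₖ is spent on xₖ, gⱼ and gₗ on b = s - yⱼ - yₗ, and the weight of the row itself
      -- on d; with xₗ, the roles of b and d are exchanged.
      row-lemma : ∀ a b d {gⱼ gₖ gₗ xₖ xₗ yⱼ yₗ zⱼ zₖ} →
        a ℕ.+ (b ℕ.+ d) ≡ s → a ℕ.+ (xₖ ℕ.+ xₗ) ≡ s → b ℕ.+ (yⱼ ℕ.+ yₗ) ≡ s → d ℕ.+ (zⱼ ℕ.+ zₖ) ≡ s →
        D ∣ + xₖ * gₖ → D ∣ + xₗ * gₗ → D ∣ + yⱼ * gⱼ → D ∣ + yₗ * gₗ → D ∣ + zⱼ * gⱼ → D ∣ + zₖ * gₖ →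
        P ^ (3 ℕ.* suc r) ∣ gⱼ * gₖ * gₗ * (W′ a b d - W a b d)
      row-lemma a b d {gⱼ} {gₖ} {gₗ} {xₖ} {xₗ} {yⱼ} {yₗ} {zⱼ} {zₖ} row colx coly colz hxₖ hxₗ hyⱼ hyₗ hzⱼ hzₖ =
        ∣-resp (trans (split G A A′ B B′) (cong₂ (λ x y → G * (x - y)) (sym W′-split) (sym W-split)))
          (∣-trans (∣-reflexive (cong (P ^_) (exponent r))) (∣m∣n⇒∣m+n (bin-supercongruence a m (3 ℕ.* r) (G * B′) first) (bin-supercongruence b d (3 ℕ.* r) (G * A) second)))
        where
        m : ℕ
        m = b ℕ.+ d
        G A A′ B B′ : ℤ
        G = gⱼ * gₖ * gₗ
        A = + bin a m
        A′ = + bin (p ℕ.* a) (p ℕ.* m)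
        B = + bin b d
        B′ = + bin (p ℕ.* b) (p ℕ.* d)
        exponent : ∀ r → 3 ℕ.* suc r ≡ 3 ℕ.* r ℕ.+ 3
        exponent = ℕS.solve-∀
        split : ∀ G A A′ B B′ → G * B′ * (A′ - A) + G * A * (B′ - B) ≡ G * (A′ * B′ - A * B)
        split = solve-∀
        W-split : W a b d ≡ A * B
        W-split = ℤₚ.pos-* (bin a m) (bin b d)
        W′-split : W′ a b d ≡ A′ * B′
        W′-split = trans (ℤₚ.pos-* (bin (p ℕ.* a) (p ℕ.* b ℕ.+ p ℕ.* d)) (bin (p ℕ.* b) (p ℕ.* d))) (cong (λ t → + bin (p ℕ.* a) t * B′) (sym (ℕₚ.*-distribˡ-+ p b d)))
        m-split : + m ≡ + xₖ + + xₗ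
        m-split = sum₂ {a} {x = xₖ} {xₗ} row colx
        eq₁ : ∀ gⱼ gₖ gₗ xₖ xₗ A B′ s a → B′ * gⱼ * (s * ((a * A) * (gₗ * (xₖ * gₖ) + gₖ * (xₗ * gₗ)))) ≡ gⱼ * gₖ * gₗ * B′ * (A * (s * (a * (xₖ + xₗ))))
        eq₁ = solve-∀
        first : P ^ (3 ℕ.* r) ∣ G * B′ * (A * (+ (a ℕ.+ m) * (+ a * + m)))
        first = ∣-resp (trans (eq₁ gⱼ gₖ gₗ (+ xₖ) (+ xₗ) A B′ (+ s) (+ a)) (cong₂ (λ x y → G * B′ * (A * (x * (+ a * y)))) (cong +_ (sym row)) (sym m-split)))
          (∣n⇒∣m*n (B′ * gⱼ) (three s-val (∣-trans s-val (∣-trans (∣-pos (subst (ℕᵈ._∣ a ℕ.* bin a m) row (bin-div a m))) (∣-reflexive (ℤₚ.pos-* a (bin a m)))))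
            (∣m∣n⇒∣m+n (∣n⇒∣m*n gₗ hxₖ) (∣n⇒∣m*n gₖ hxₗ))))
        eq₂ : ∀ gⱼ gₖ gₗ xₖ xₗ yⱼ yₗ zⱼ zₖ b d s A B → b ≡ s - yⱼ - yₗ → d ≡ s - zⱼ - zₖ →
          (xₖ * gₖ) * ((s * (gⱼ * gₗ) - gₗ * (yⱼ * gⱼ) - gⱼ * (yₗ * gₗ)) * (d * (A * B))) +
          (xₗ * gₗ) * ((s * (gⱼ * gₖ) - gₖ * (zⱼ * gⱼ) - gⱼ * (zₖ * gₖ)) * (b * (A * B))) ≡ gⱼ * gₖ * gₗ * A * (B * ((xₖ + xₗ) * (b * d)))
        eq₂ gⱼ gₖ gₗ xₖ xₗ yⱼ yₗ zⱼ zₖ b d s A B eb ed = trans (expand gⱼ gₖ gₗ xₖ xₗ yⱼ yₗ zⱼ zₖ b d s A B)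
          (trans (cong₂ (λ u v → gⱼ * gₖ * gₗ * A * B * (xₖ * u * d + xₗ * v * b)) (sym eb) (sym ed)) (regroup gⱼ gₖ gₗ xₖ xₗ b d A B))
          where
          expand : ∀ gⱼ gₖ gₗ xₖ xₗ yⱼ yₗ zⱼ zₖ b d s A B →
            (xₖ * gₖ) * ((s * (gⱼ * gₗ) - gₗ * (yⱼ * gⱼ) - gⱼ * (yₗ * gₗ)) * (d * (A * B))) +
            (xₗ * gₗ) * ((s * (gⱼ * gₖ) - gₖ * (zⱼ * gⱼ) - gⱼ * (zₖ * gₖ)) * (b * (A * B))) ≡ gⱼ * gₖ * gₗ * A * B * (xₖ * (s - yⱼ - yₗ) * d + xₗ * (s - zⱼ - zₖ) * b)
          expand = solve-∀
          regroup : ∀ gⱼ gₖ gₗ xₖ xₗ b d A B → gⱼ * gₖ * gₗ * A * B * (xₖ * b * d + xₗ * d * b) ≡ gⱼ * gₖ * gₗ * A * (B * ((xₖ + xₗ) * (b * d)))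
          regroup = solve-∀
        second : P ^ (3 ℕ.* r) ∣ G * A * (B * (+ (b ℕ.+ d) * (+ b * + d)))
        second = ∣-resp (trans (eq₂ gⱼ gₖ gₗ (+ xₖ) (+ xₗ) (+ yⱼ) (+ yₗ) (+ zⱼ) (+ zₖ) (+ b) (+ d) (+ s) A B (difference {b} {s} {yⱼ} {yₗ} coly) (difference {d} {s} {zⱼ} {zₖ} colz)) (cong (λ x → G * A * (B * (x * (+ b * + d)))) (sym m-split)))
          (∣m∣n⇒∣m+n
            (three hxₖ (∣m∣n⇒∣m-n (∣m∣n⇒∣m-n (∣m⇒∣m*n (gⱼ * gₗ) s-val) (∣n⇒∣m*n gₗ hyⱼ)) (∣n⇒∣m*n gⱼ hyₗ)) (∣-resp (cong (λ t → + d * t) W-split) (absorb₃ s-val a b d row)))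
            (three hxₗ (∣m∣n⇒∣m-n (∣m∣n⇒∣m-n (∣m⇒∣m*n (gⱼ * gₖ) s-val) (∣n⇒∣m*n gₖ hzⱼ)) (∣n⇒∣m*n gⱼ hzₖ)) (∣-resp (cong (λ t → + b * t) W-split) (absorb₂ s-val a b d row))))

      record RowDivisible (g : ℤ) (a b d : ℕ) : Set where
        constructor rowDivisible
        field
          div₁ : D ∣ + a * g
          div₂ : D ∣ + b * g
          div₃ : D ∣ + d * g
      open RowDivisible

      W-divisible : ∀ a b d → a ℕ.+ (b ℕ.+ d) ≡ s → RowDivisible (W a b d) a b d
      W-divisible a b d e = rowDivisible (absorb₁ s-val a b d e) (absorb₂ s-val a b d e) (absorb₃ s-val a b d e)

      scaled-sum : ∀ a b d → a ℕ.+ (b ℕ.+ d) ≡ s → p ℕ.* a ℕ.+ (p ℕ.* b ℕ.+ p ℕ.* d) ≡ p ℕ.* s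
      scaled-sum a b d refl = eq p a b d
        where
        eq : ∀ p a b d → p ℕ.* a ℕ.+ (p ℕ.* b ℕ.+ p ℕ.* d) ≡ p ℕ.* (a ℕ.+ (b ℕ.+ d))
        eq = ℕS.solve-∀

      W′-divisible : ∀ a b d → a ℕ.+ (b ℕ.+ d) ≡ s → RowDivisible (W′ a b d) a b d
      W′-divisible a b d e = rowDivisible (cancel a (absorb₁ ps-val (p ℕ.* a) (p ℕ.* b) (p ℕ.* d) e′)) (cancel b (absorb₂ ps-val (p ℕ.* a) (p ℕ.* b) (p ℕ.* d) e′)) (cancel d (absorb₃ ps-val (p ℕ.* a) (p ℕ.* b) (p ℕ.* d) e′))
        where
        e′ = scaled-sum a b d e
        cancel : ∀ x → P ^ suc r ∣ + (p ℕ.* x) * W′ a b d → D ∣ + x * W′ a b d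
        cancel x h = *-cancelˡ-∣ P (∣-resp (trans (cong (_* W′ a b d) (ℤₚ.pos-* p x)) (ℤₚ.*-assoc P (+ x) (W′ a b d))) h)

      -- One row at a time is changed from `W` to `W′` while the other three act as multipliers. The
      -- mixture of old and new weights is harmless: an entry of the divided array times either
      -- weight of its row is divisible by pʳ.
      quad-lemma : ∀ {a₀ b₀ c₀ a₁ b₁ c₁ a₂ b₂ c₂ a₃ b₃ c₃} →
        a₀ ℕ.+ (b₀ ℕ.+ c₀) ≡ s → a₁ ℕ.+ (b₁ ℕ.+ c₁) ≡ s → a₂ ℕ.+ (b₂ ℕ.+ c₂) ≡ s → a₃ ℕ.+ (b₃ ℕ.+ c₃) ≡ s →
        a₁ ℕ.+ (a₂ ℕ.+ a₃) ≡ s → a₀ ℕ.+ (b₂ ℕ.+ b₃) ≡ s → b₀ ℕ.+ (b₁ ℕ.+ c₃) ≡ s → c₀ ℕ.+ (c₁ ℕ.+ c₂) ≡ s →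
        P ^ (3 ℕ.* suc r) ∣ W′ a₀ b₀ c₀ * (W′ a₁ b₁ c₁ * (W′ a₂ b₂ c₂ * W′ a₃ b₃ c₃)) - W a₀ b₀ c₀ * (W a₁ b₁ c₁ * (W a₂ b₂ c₂ * W a₃ b₃ c₃))
      quad-lemma {a₀} {b₀} {c₀} {a₁} {b₁} {c₁} {a₂} {b₂} {c₂} {a₃} {b₃} {c₃} r₀ r₁ r₂ r₃ k₀ k₁ k₂ k₃ =
        ∣-resp (telescope (W a₀ b₀ c₀) (W a₁ b₁ c₁) (W a₂ b₂ c₂) (W a₃ b₃ c₃) (W′ a₀ b₀ c₀) (W′ a₁ b₁ c₁) (W′ a₂ b₂ c₂) (W′ a₃ b₃ c₃))
          (∣m∣n⇒∣m+n (∣m∣n⇒∣m+n (∣m∣n⇒∣m+n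
            (row-lemma a₀ b₀ c₀ {W′ a₁ b₁ c₁} {W′ a₂ b₂ c₂} {W′ a₃ b₃ c₃} {b₂} {b₃} {b₁} {c₃} {c₁} {c₂} r₀ k₁ k₂ k₃ (div₂ v₂) (div₂ v₃) (div₂ v₁) (div₃ v₃) (div₃ v₁) (div₃ v₂))
            (row-lemma a₁ b₁ c₁ {W a₀ b₀ c₀} {W′ a₂ b₂ c₂} {W′ a₃ b₃ c₃} {a₂} {a₃} {b₀} {c₃} {c₀} {c₂} r₁ k₀ (rot₁ b₀ b₁ c₃ k₂) (rot₁ c₀ c₁ c₂ k₃) (div₁ v₂) (div₁ v₃) (div₂ w₀) (div₃ v₃) (div₃ w₀) (div₃ v₂)))
            (row-lemma a₂ b₂ c₂ {W a₀ b₀ c₀} {W a₁ b₁ c₁} {W′ a₃ b₃ c₃} {a₁} {a₃} {a₀} {b₃} {c₀} {c₁} r₂ (rot₁ a₁ a₂ a₃ k₀) (rot₁ a₀ b₂ b₃ k₁) (rot₂ c₀ c₁ c₂ k₃) (div₁ w₁) (div₁ v₃) (div₁ w₀) (div₂ v₃) (div₃ w₀) (div₃ w₁)))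
            (row-lemma a₃ b₃ c₃ {W a₀ b₀ c₀} {W a₁ b₁ c₁} {W a₂ b₂ c₂} {a₁} {a₂} {a₀} {b₂} {b₀} {b₁} r₃ (rot₂ a₁ a₂ a₃ k₀) (rot₂ a₀ b₂ b₃ k₁) (rot₂ b₀ b₁ c₃ k₂) (div₁ w₁) (div₁ w₂) (div₁ w₀) (div₂ w₂) (div₂ w₀) (div₂ w₁)))
        where
        w₀ = W-divisible a₀ b₀ c₀ r₀
        w₁ = W-divisible a₁ b₁ c₁ r₁
        w₂ = W-divisible a₂ b₂ c₂ r₂
        v₁ = W′-divisible a₁ b₁ c₁ r₁
        v₂ = W′-divisible a₂ b₂ c₂ r₂
        v₃ = W′-divisible a₃ b₃ c₃ r₃
        rot₁ : ∀ x y z → x ℕ.+ (y ℕ.+ z) ≡ s → y ℕ.+ (x ℕ.+ z) ≡ s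
        rot₁ x y z e = trans (eq x y z) e
          where
          eq : ∀ x y z → y ℕ.+ (x ℕ.+ z) ≡ x ℕ.+ (y ℕ.+ z)
          eq = ℕS.solve-∀
        rot₂ : ∀ x y z → x ℕ.+ (y ℕ.+ z) ≡ s → z ℕ.+ (x ℕ.+ y) ≡ s
        rot₂ x y z e = trans (eq x y z) e
          where
          eq : ∀ x y z → z ℕ.+ (x ℕ.+ y) ≡ x ℕ.+ (y ℕ.+ z)
          eq = ℕS.solve-∀
        telescope : ∀ w₀ w₁ w₂ w₃ v₀ v₁ v₂ v₃ → v₁ * v₂ * v₃ * (v₀ - w₀) + w₀ * v₂ * v₃ * (v₁ - w₁) + w₀ * w₁ * v₃ * (v₂ - w₂) + w₀ * w₁ * w₂ * (v₃ - w₃)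
          ≡ v₀ * (v₁ * (v₂ * v₃)) - w₀ * (w₁ * (w₂ * w₃))
        telescope = solve-∀

module RowExpansion where

  open ConstantTerm using (δ; diag; T; M; T≡Aδ; Coeffs; F; P4; bump; mul; mul-comm; mul-cong; origin; pt; pt-cong; Σ4-def)
  open Congruences
  open import Defs using (Aδ)
  open import Data.Empty using (⊥)
  open import Data.Fin using (Fin)
  open import Data.Fin.Patterns using (0F; 1F; 2F; 3F)
  open import Data.Integer as ℤ using (ℤ; +_; _+_; _*_; -_; _-_; 0ℤ; 1ℤ; -1ℤ; _^_)
  open import Data.Integer.Divisibility.Signed
  open import Data.Integer.Tactic.RingSolver using (solve-∀)
  open import Data.Nat as ℕ using (ℕ; zero; suc; s≤s; z≤n)
  open import Data.Nat.Primality using (Prime)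
  open import Data.Product using (_×_; _,_; proj₁; proj₂)
  open import Data.Sum using (_⊎_; inj₁; inj₂; [_,_]′)
  open import Relation.Binary.PropositionalEquality using (_≡_; refl; sym; trans; cong; cong₂; subst; _≢_; module ≡-Reasoning)
  open import Relation.Nullary using (¬_; Dec; yes; no)

  -- T(n) as a sum over 4×3 arrays.

  pow : Fin 4 → ℕ → Coeffs → Coeffs
  pow i zero f = f
  pow i (suc n) f = mul i (pow i n f)

  pow-cong : ∀ i n {f g} → (∀ κ → f κ ≡ g κ) → ∀ κ → pow i n f κ ≡ pow i n g κ
  pow-cong i zero e κ = e κ
  pow-cong i (suc n) {f} {g} e κ = mul-cong i {pow i n f} {pow i n g} (pow-cong i n e) κ

  mul-pow : ∀ k i n f κ → mul k (pow i n f) κ ≡ pow i n (mul k f) κ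
  mul-pow k i zero f κ = refl
  mul-pow k i (suc n) f κ = trans (mul-comm k i (pow i n f) κ) (mul-cong i {mul k (pow i n f)} {pow i n (mul k f)} (mul-pow k i n f) κ)

  F-pow : ∀ n κ → F n κ ≡ pow 0F n (pow 1F n (pow 2F n (pow 3F n origin))) κ
  F-pow zero κ = refl
  F-pow (suc n) κ = begin
    mul 0F (mul 1F (mul 2F (mul 3F (F n)))) κ
      ≡⟨ m 0F (m 1F (m 2F (m 3F (F-pow n)))) κ ⟩
    mul 0F (mul 1F (mul 2F (mul 3F (pow 0F n x₁)))) κ
      ≡⟨ m 0F (m 1F (m 2F (λ κ → trans (mul-pow 3F 0F n x₁ κ) (pow-cong 0F n (λ κ → trans (mul-pow 3F 1F n x₂ κ) (pow-cong 1F n (mul-pow 3F 2F n x₃) κ)) κ)))) κ ⟩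
    mul 0F (mul 1F (mul 2F (pow 0F n (pow 1F n (pow 2F n y₃))))) κ
      ≡⟨ m 0F (m 1F (λ κ → trans (mul-pow 2F 0F n (pow 1F n (pow 2F n y₃)) κ) (pow-cong 0F n (mul-pow 2F 1F n (pow 2F n y₃)) κ))) κ ⟩
    mul 0F (mul 1F (pow 0F n (pow 1F n y₂))) κ
      ≡⟨ m 0F (mul-pow 1F 0F n (pow 1F n y₂)) κ ⟩
    mul 0F (pow 0F n (pow 1F (suc n) y₂)) κ ∎
    where
    open ≡-Reasoning
    x₃ x₂ x₁ y₃ y₂ : Coeffs
    x₃ = pow 3F n origin
    x₂ = pow 2F n x₃
    x₁ = pow 1F n x₂
    y₃ = mul 3F x₃
    y₂ = mul 2F (pow 2F n y₃)
    m : ∀ i {f g} → (∀ κ → f κ ≡ g κ) → ∀ κ → mul i f κ ≡ mul i g κ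
    m i {f} {g} = mul-cong i {f} {g}

  -- The trinomial theorem for an operator: the points `s a b d` are those reached after a, b, d
  -- shifts in the three directions of Lᵢ. One factor is commuted inwards onto f, and `W-pascal`
  -- merges its three shifts with those already made.
  row-expansion : ∀ i (α β γ : ℤ) (s : ℕ → ℕ → ℕ → P4) →
    (∀ f a b d → mul i f (s a b d) ≡ α * f (s (suc a) b d) + β * f (s a (suc b) d) + γ * f (s a b (suc d))) →
    ∀ n f → pow i n f (s 0 0 0) ≡ weighted n W (λ a b d → α ^ a * β ^ b * γ ^ d * f (s a b d))
  row-expansion i α β γ s step zero f = sym (trans (cong (λ z → + z * (1ℤ * 1ℤ * 1ℤ * f (s 0 0 0))) (cong₂ ℕ._*_ (bin-zeroʳ 0) (bin-zeroʳ 0))) (eq (f (s 0 0 0))))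
    where
    eq : ∀ x → 1ℤ * (1ℤ * 1ℤ * 1ℤ * x) ≡ x
    eq = solve-∀
  row-expansion i α β γ s step (suc n) f = begin
    mul i (pow i n f) (s 0 0 0) ≡⟨ mul-pow i i n f (s 0 0 0) ⟩
    pow i n (mul i f) (s 0 0 0) ≡⟨ row-expansion i α β γ s step n (mul i f) ⟩
    weighted n W (λ a b d → α ^ a * β ^ b * γ ^ d * mul i f (s a b d))
      ≡⟨ weighted-linear n W .ext (λ a b d → trans (cong (λ z → α ^ a * β ^ b * γ ^ d * z) (step f a b d)) (eq α β γ (α ^ a) (β ^ b) (γ ^ d) (f (s (suc a) b d)) (f (s a (suc b) d)) (f (s a b (suc d))))) ⟩
    weighted n W (λ a b d → u (suc a) b d + u a (suc b) d + u a b (suc d)) ≡⟨ W-pascal n u ⟨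
    weighted (suc n) W u ∎
    where
    open ≡-Reasoning
    u : Weight
    u a b d = α ^ a * β ^ b * γ ^ d * f (s a b d)
    eq : ∀ α β γ A B C x y z → A * B * C * (α * x + β * y + γ * z) ≡ α * A * B * C * x + A * (β * B) * C * y + A * B * (γ * C) * z
    eq = solve-∀

  private
    keep : ∀ x → x + -1ℤ * 0ℤ ≡ x
    keep = solve-∀

    drop : ∀ y a → y - a + -1ℤ * 1ℤ ≡ y - (1ℤ + a)
    drop = solve-∀

    four : ∀ i f κ → mul i f κ ≡ M i 0F * f (bump 0F -1ℤ κ) + M i 1F * f (bump 1F -1ℤ κ) + M i 2F * f (bump 2F -1ℤ κ) + M i 3F * f (bump 3F -1ℤ κ)
    four i f κ = Σ4-def (λ l → M i l * f (bump l -1ℤ κ))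

    three : ∀ {α β γ : ℤ} {x y z x′ y′ z′} → x ≡ x′ → y ≡ y′ → z ≡ z′ → α * x + β * y + γ * z ≡ α * x′ + β * y′ + γ * z′
    three refl refl refl = refl

  row₀ row₁ row₂ row₃ : P4 → ℕ → ℕ → ℕ → P4
  row₀ (pt x y z w) a b d = pt x (y - + a) (z - + b) (w - + d)
  row₁ (pt x y z w) a b d = pt (x - + a) y (z - + b) (w - + d)
  row₂ (pt x y z w) a b d = pt (x - + a) (y - + b) z (w - + d)
  row₃ (pt x y z w) a b d = pt (x - + a) (y - + b) (z - + d) w

  expand₀ : ∀ n f κ → pow 0F n f κ ≡ weighted n W (λ a b d → M 0F 1F ^ a * M 0F 2F ^ b * M 0F 3F ^ d * f (row₀ κ a b d))
  expand₀ n f κ@(pt x y z w) = trans (cong (pow 0F n f) (sym (pt-cong refl (ℤₚ.+-identityʳ y) (ℤₚ.+-identityʳ z) (ℤₚ.+-identityʳ w))))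
    (row-expansion 0F _ _ _ (row₀ κ) (λ f a b d → trans (four 0F f (row₀ κ a b d)) (trans (eq (f (bump 0F -1ℤ (row₀ κ a b d))) (f _) (f _) (f _)) (three {1ℤ} { -1ℤ} {1ℤ}
      (cong f (pt-cong (keep x) (drop y (+ a)) (keep (z - + b)) (keep (w - + d)))) (cong f (pt-cong (keep x) (keep (y - + a)) (drop z (+ b)) (keep (w - + d)))) (cong f (pt-cong (keep x) (keep (y - + a)) (keep (z - + b)) (drop w (+ d))))))) n f)
    where
    eq : ∀ s t u v → 0ℤ * s + 1ℤ * t + -1ℤ * u + 1ℤ * v ≡ 1ℤ * t + -1ℤ * u + 1ℤ * v
    eq = solve-∀

  expand₁ : ∀ n f κ → pow 1F n f κ ≡ weighted n W (λ a b d → M 1F 0F ^ a * M 1F 2F ^ b * M 1F 3F ^ d * f (row₁ κ a b d))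
  expand₁ n f κ@(pt x y z w) = trans (cong (pow 1F n f) (sym (pt-cong (ℤₚ.+-identityʳ x) refl (ℤₚ.+-identityʳ z) (ℤₚ.+-identityʳ w))))
    (row-expansion 1F _ _ _ (row₁ κ) (λ f a b d → trans (four 1F f (row₁ κ a b d)) (trans (eq (f _) (f (bump 1F -1ℤ (row₁ κ a b d))) (f _) (f _)) (three {1ℤ} {1ℤ} {1ℤ}
      (cong f (pt-cong (drop x (+ a)) (keep y) (keep (z - + b)) (keep (w - + d)))) (cong f (pt-cong (keep (x - + a)) (keep y) (drop z (+ b)) (keep (w - + d)))) (cong f (pt-cong (keep (x - + a)) (keep y) (keep (z - + b)) (drop w (+ d))))))) n f)
    where
    eq : ∀ s t u v → 1ℤ * s + 0ℤ * t + 1ℤ * u + 1ℤ * v ≡ 1ℤ * s + 1ℤ * u + 1ℤ * v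
    eq = solve-∀

  expand₂ : ∀ n f κ → pow 2F n f κ ≡ weighted n W (λ a b d → M 2F 0F ^ a * M 2F 1F ^ b * M 2F 3F ^ d * f (row₂ κ a b d))
  expand₂ n f κ@(pt x y z w) = trans (cong (pow 2F n f) (sym (pt-cong (ℤₚ.+-identityʳ x) (ℤₚ.+-identityʳ y) refl (ℤₚ.+-identityʳ w))))
    (row-expansion 2F _ _ _ (row₂ κ) (λ f a b d → trans (four 2F f (row₂ κ a b d)) (trans (eq (f _) (f _) (f (bump 2F -1ℤ (row₂ κ a b d))) (f _)) (three {1ℤ} {1ℤ} { -1ℤ}
      (cong f (pt-cong (drop x (+ a)) (keep (y - + b)) (keep z) (keep (w - + d)))) (cong f (pt-cong (keep (x - + a)) (drop y (+ b)) (keep z) (keep (w - + d)))) (cong f (pt-cong (keep (x - + a)) (keep (y - + b)) (keep z) (drop w (+ d))))))) n f)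
    where
    eq : ∀ s t u v → 1ℤ * s + 1ℤ * t + 0ℤ * u + -1ℤ * v ≡ 1ℤ * s + 1ℤ * t + -1ℤ * v
    eq = solve-∀

  expand₃ : ∀ n f κ → pow 3F n f κ ≡ weighted n W (λ a b d → M 3F 0F ^ a * M 3F 1F ^ b * M 3F 2F ^ d * f (row₃ κ a b d))
  expand₃ n f κ@(pt x y z w) = trans (cong (pow 3F n f) (sym (pt-cong (ℤₚ.+-identityʳ x) (ℤₚ.+-identityʳ y) (ℤₚ.+-identityʳ z) refl)))
    (row-expansion 3F _ _ _ (row₃ κ) (λ f a b d → trans (four 3F f (row₃ κ a b d)) (trans (eq (f _) (f _) (f _) (f (bump 3F -1ℤ (row₃ κ a b d)))) (three { -1ℤ} {1ℤ} {1ℤ}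
      (cong f (pt-cong (drop x (+ a)) (keep (y - + b)) (keep (z - + d)) (keep w))) (cong f (pt-cong (keep (x - + a)) (drop y (+ b)) (keep (z - + d)) (keep w))) (cong f (pt-cong (keep (x - + a)) (keep (y - + b)) (drop z (+ d)) (keep w)))))) n f)
    where
    eq : ∀ s t u v → -1ℤ * s + 1ℤ * t + 1ℤ * u + 0ℤ * v ≡ -1ℤ * s + 1ℤ * t + 1ℤ * u
    eq = solve-∀

  Weight⁴ : Set
  Weight⁴ = ℕ → ℕ → ℕ → ℕ → ℕ → ℕ → ℕ → ℕ → ℕ → Weight

  Functional : Set
  Functional = Weight → ℤ

  -- The row functionals are parameters, so that splitting each row sum into regular and irregular
  -- rows yields sixteen expressions of one shape.
  nest : Functional → Functional → Functional → Functional → Weight⁴ → ℤ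
  nest Φ₀ Φ₁ Φ₂ Φ₃ X = Φ₀ λ a₀ b₀ c₀ → Φ₁ λ a₁ b₁ c₁ → Φ₂ λ a₂ b₂ c₂ → Φ₃ (X a₀ b₀ c₀ a₁ b₁ c₁ a₂ b₂ c₂)

  sign₀ sign₁ sign₂ sign₃ : Weight
  sign₀ a b d = M 0F 1F ^ a * M 0F 2F ^ b * M 0F 3F ^ d
  sign₁ a b d = M 1F 0F ^ a * M 1F 2F ^ b * M 1F 3F ^ d
  sign₂ a b d = M 2F 0F ^ a * M 2F 1F ^ b * M 2F 3F ^ d
  sign₃ a b d = M 3F 0F ^ a * M 3F 1F ^ b * M 3F 2F ^ d

  -- Row i lists the exponents of Lᵢⁿ in the order of its three columns; the δ's impose the column sums.
  Ξ : ℕ → Weight⁴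
  Ξ n a₀ b₀ c₀ a₁ b₁ c₁ a₂ b₂ c₂ a₃ b₃ c₃ =
    sign₀ a₀ b₀ c₀ * sign₁ a₁ b₁ c₁ * (sign₂ a₂ b₂ c₂ * sign₃ a₃ b₃ c₃) *
    (δ (+ n - + a₁ - + a₂ - + a₃) * δ (+ n - + a₀ - + b₂ - + b₃) * (δ (+ n - + b₀ - + b₁ - + c₃) * δ (+ n - + c₀ - + c₁ - + c₂)))

  T-expansion : ∀ n → T n ≡ nest (weighted n W) (weighted n W) (weighted n W) (weighted n W) (Ξ n)
  T-expansion n = begin
    F n κ ≡⟨ F-pow n κ ⟩
    pow 0F n (pow 1F n (pow 2F n (pow 3F n origin))) κ ≡⟨ expand₀ n _ κ ⟩
    S (λ a₀ b₀ c₀ → sign₀ a₀ b₀ c₀ * pow 1F n (pow 2F n (pow 3F n origin)) (row₀ κ a₀ b₀ c₀))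
      ≡⟨ L .ext (λ a₀ b₀ c₀ → trans (cong (λ z → sign₀ a₀ b₀ c₀ * z) (second a₀ b₀ c₀)) (sym (L .scale (sign₀ a₀ b₀ c₀) _))) ⟩
    S (λ a₀ b₀ c₀ → S λ a₁ b₁ c₁ → sign₀ a₀ b₀ c₀ * (sign₁ a₁ b₁ c₁ * S λ a₂ b₂ c₂ → sign₂ a₂ b₂ c₂ * S λ a₃ b₃ c₃ → sign₃ a₃ b₃ c₃ * Δ a₀ b₀ c₀ a₁ b₁ c₁ a₂ b₂ c₂ a₃ b₃ c₃))
      ≡⟨ L .ext (λ a₀ b₀ c₀ → L .ext λ a₁ b₁ c₁ → trans (sym (ℤₚ.*-assoc (sign₀ a₀ b₀ c₀) (sign₁ a₁ b₁ c₁) _)) (trans (sym (L .scale (sign₀ a₀ b₀ c₀ * sign₁ a₁ b₁ c₁) _))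
           (L .ext λ a₂ b₂ c₂ → trans (sym (ℤₚ.*-assoc (sign₀ a₀ b₀ c₀ * sign₁ a₁ b₁ c₁) (sign₂ a₂ b₂ c₂) _)) (trans (sym (L .scale (sign₀ a₀ b₀ c₀ * sign₁ a₁ b₁ c₁ * sign₂ a₂ b₂ c₂) _))
             (L .ext λ a₃ b₃ c₃ → eq (sign₀ a₀ b₀ c₀ * sign₁ a₁ b₁ c₁) (sign₂ a₂ b₂ c₂) (sign₃ a₃ b₃ c₃) (Δ a₀ b₀ c₀ a₁ b₁ c₁ a₂ b₂ c₂ a₃ b₃ c₃)))))) ⟩
    nest S S S S (Ξ n) ∎
    where
    open ≡-Reasoning
    κ : P4
    κ = diag (+ n)
    S : Functional
    S = weighted n W
    L : Linear S
    L = weighted-linear n W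
    Δ : Weight⁴
    Δ a₀ b₀ c₀ a₁ b₁ c₁ a₂ b₂ c₂ a₃ b₃ c₃ = origin (row₃ (row₂ (row₁ (row₀ κ a₀ b₀ c₀) a₁ b₁ c₁) a₂ b₂ c₂) a₃ b₃ c₃)
    eq : ∀ s t u Δ → s * t * (u * Δ) ≡ s * (t * u) * Δ
    eq = solve-∀
    second : ∀ a₀ b₀ c₀ → pow 1F n (pow 2F n (pow 3F n origin)) (row₀ κ a₀ b₀ c₀) ≡
      S λ a₁ b₁ c₁ → sign₁ a₁ b₁ c₁ * S λ a₂ b₂ c₂ → sign₂ a₂ b₂ c₂ * S λ a₃ b₃ c₃ → sign₃ a₃ b₃ c₃ * Δ a₀ b₀ c₀ a₁ b₁ c₁ a₂ b₂ c₂ a₃ b₃ c₃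
    second a₀ b₀ c₀ = trans (expand₁ n (pow 2F n (pow 3F n origin)) κ₀) (L .ext λ a₁ b₁ c₁ → cong (λ z → sign₁ a₁ b₁ c₁ * z)
      (trans (expand₂ n (pow 3F n origin) (row₁ κ₀ a₁ b₁ c₁)) (L .ext λ a₂ b₂ c₂ → cong (λ z → sign₂ a₂ b₂ c₂ * z) (expand₃ n origin (row₂ (row₁ κ₀ a₁ b₁ c₁) a₂ b₂ c₂)))))
      where
      κ₀ : P4
      κ₀ = row₀ κ a₀ b₀ c₀

  -- The scalars x and y collect the weights of the outer rows; after four applications a difference
  -- of nested sums is reduced to single arrays.
  weighted-difference : ∀ {Q} n (U V : Weight) x y (f h : Weight) → (∀ a b d → a ℕ.+ (b ℕ.+ d) ≡ n → Q ∣ x * U a b d * f a b d - y * V a b d * h a b d) →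
    Q ∣ x * weighted n U f - y * weighted n V h
  weighted-difference {Q} n U V x y f h k = ∣-resp (begin
    ∑₃ n (λ a b d → x * U a b d * f a b d - y * V a b d * h a b d) ≡⟨ ∑₃-cong n (λ a b d _ → eq x (U a b d) (f a b d) y (V a b d) (h a b d)) ⟩
    ∑₃ n (λ a b d → x * (U a b d * f a b d) + - y * (V a b d * h a b d)) ≡⟨ ∑₃-+ n (λ a b d → x * (U a b d * f a b d)) (λ a b d → - y * (V a b d * h a b d)) ⟩
    ∑₃ n (λ a b d → x * (U a b d * f a b d)) + ∑₃ n (λ a b d → - y * (V a b d * h a b d)) ≡⟨ cong₂ _+_ (∑₃-* n x (λ a b d → U a b d * f a b d)) (∑₃-* n (- y) (λ a b d → V a b d * h a b d)) ⟩
    x * weighted n U f + - y * weighted n V h ≡⟨ eq′ (x * weighted n U f) y (weighted n V h) ⟩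
    x * weighted n U f - y * weighted n V h ∎) (∑₃-∣ n k)
    where
    open ≡-Reasoning
    eq : ∀ x u f y v h → x * u * f - y * v * h ≡ x * (u * f) + - y * (v * h)
    eq = solve-∀
    eq′ : ∀ a y b → a + - y * b ≡ a - y * b
    eq′ = solve-∀

  -- Splitting each row sum into regular and irregular rows.

  module Assembly (p : ℕ) (prime : Prime p) (5≤p : 5 ℕ.≤ p) where
    open Local p prime 5≤p
    open Blocks p prime 5≤p using (q; ε-q)
    open Pairs p prime 5≤p
    open PairLemma p prime 5≤p
    open DivisibleRows p prime 5≤p

    anti-multiples : ∀ s n (X : ℕ → ℕ → ℤ) → n ≡ p ℕ.* s → anti n (λ a m → χ a * X a m) ≡ anti s (λ a m → X (p ℕ.* a) (p ℕ.* m))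
    anti-multiples zero n X e with refl ← trans e (ℕₚ.*-zeroʳ p) = trans (cong (_* X 0 0) (χ-yes (p ℕᵈ.∣0))) (trans (ℤₚ.*-identityˡ (X 0 0)) (cong₂ X (sym (ℕₚ.*-zeroʳ p)) (sym (ℕₚ.*-zeroʳ p))))
    anti-multiples (suc s) n X e with refl ← trans e (trans (ℕₚ.*-suc p s) (cong (ℕ._+ p ℕ.* s) (sym suc-p-1))) = begin
      χ 0 * X 0 (suc (q ℕ.+ N)) + anti (q ℕ.+ N) (λ a m → χ (suc a) * X (suc a) m)
        ≡⟨ cong₂ _+_ (trans (cong (_* X 0 (suc (q ℕ.+ N))) (χ-yes (p ℕᵈ.∣0))) (trans (ℤₚ.*-identityˡ _) (cong₂ X (sym (ℕₚ.*-zeroʳ p)) e)))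
             (anti-drop q N (λ a m → χ (suc a) * X (suc a) m) (λ i j i<q → cong (_* X (suc i) j) (χ-no (λ h → ℕₚ.<⇒≱ (subst (suc i ℕ.<_) suc-p-1 (s≤s i<q)) (ℕᵈ.∣⇒≤ h))))) ⟩
      X (p ℕ.* 0) (p ℕ.* suc s) + anti N (λ a m → χ (suc (q ℕ.+ a)) * X (suc (q ℕ.+ a)) m)
        ≡⟨ cong (λ z → X (p ℕ.* 0) (p ℕ.* suc s) + z) (anti-cong N (λ a m _ → cong (λ k → χ k * X k m) (cong (ℕ._+ a) suc-p-1))) ⟩
      X (p ℕ.* 0) (p ℕ.* suc s) + anti N (λ a m → χ (p ℕ.+ a) * X (p ℕ.+ a) m)
        ≡⟨ cong (λ z → X (p ℕ.* 0) (p ℕ.* suc s) + z) (anti-cong N (λ a m _ → cong (_* X (p ℕ.+ a) m) (χ-cong (λ h → ℕᵈ.∣m+n∣m⇒∣n h ℕᵈ.∣-refl) (ℕᵈ.∣m∣n⇒∣m+n ℕᵈ.∣-refl)))) ⟩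
      X (p ℕ.* 0) (p ℕ.* suc s) + anti N (λ a m → χ a * X (p ℕ.+ a) m)
        ≡⟨ cong (λ z → X (p ℕ.* 0) (p ℕ.* suc s) + z) (anti-multiples s N (λ a m → X (p ℕ.+ a) m) refl) ⟩
      X (p ℕ.* 0) (p ℕ.* suc s) + anti s (λ a m → X (p ℕ.+ p ℕ.* a) (p ℕ.* m))
        ≡⟨ cong (λ z → X (p ℕ.* 0) (p ℕ.* suc s) + z) (anti-cong s (λ a m _ → cong (λ k → X k (p ℕ.* m)) (sym (ℕₚ.*-suc p a)))) ⟩
      X (p ℕ.* 0) (p ℕ.* suc s) + anti s (λ a m → X (p ℕ.* suc a) (p ℕ.* m)) ∎
      where
      open ≡-Reasoning
      N : ℕ
      N = p ℕ.* s

    module Rows (s n : ℕ) (n-def : n ≡ p ℕ.* s) where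
      opaque
        -- All rows, the regular ones, the irregular ones. `D` is indexed by the entries divided by
        -- p, with sum s, so that it can be compared with the expansion of T(s).
        S D R : Functional
        S = weighted n W
        R = weighted n RW
        D v = weighted s W′ (λ a b d → v (p ℕ.* a) (p ℕ.* b) (p ℕ.* d))

        R-def : R ≡ weighted n RW
        R-def = refl

        S-def : S ≡ weighted n W
        S-def = refl

        D-def : ∀ v → D v ≡ weighted s W′ (λ a b d → v (p ℕ.* a) (p ℕ.* b) (p ℕ.* d))
        D-def v = refl

        R-exchange : ∀ {Φ} → Linear Φ → ∀ (f : ℕ → ℕ → ℕ → Weight) → R (λ i j k → Φ (f i j k)) ≡ Φ (λ a b d → R (λ i j k → f i j k a b d))
        R-exchange L f = weighted-exchange L n RW f

        R-linear : Linear R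
        R-linear = weighted-linear n RW

        D-linear : Linear D
        D-linear .ext e = weighted-linear s W′ .ext (λ a b d → e (p ℕ.* a) (p ℕ.* b) (p ℕ.* d))
        D-linear .add u v = weighted-linear s W′ .add (λ a b d → u (p ℕ.* a) (p ℕ.* b) (p ℕ.* d)) (λ a b d → v (p ℕ.* a) (p ℕ.* b) (p ℕ.* d))
        D-linear .scale x u = weighted-linear s W′ .scale x (λ a b d → u (p ℕ.* a) (p ℕ.* b) (p ℕ.* d))

        S-split : ∀ v → S v ≡ D v + R v
        S-split v = begin
          S v ≡⟨ ∑₃-cong n (λ a b d _ → eq (χ a) (χ b * χ d) (W a b d) (v a b d)) ⟩
          ∑₃ n (λ a b d → χ a * (χ b * χ d * (W a b d * v a b d)) + RW a b d * v a b d) ≡⟨ ∑₃-+ n (λ a b d → χ a * (χ b * χ d * (W a b d * v a b d))) (λ a b d → RW a b d * v a b d) ⟩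
          ∑₃ n (λ a b d → χ a * (χ b * χ d * (W a b d * v a b d))) + R v ≡⟨ cong (_+ R v) multiples ⟩
          D v + R v ∎
          where
          open ≡-Reasoning
          eq : ∀ x y w v → w * v ≡ x * (y * (w * v)) + (1ℤ - x * y) * w * v
          eq = solve-∀
          multiples : ∑₃ n (λ a b d → χ a * (χ b * χ d * (W a b d * v a b d))) ≡ D v
          multiples = trans (anti-cong n (λ a m _ → anti-* m (χ a) (λ b d → χ b * χ d * (W a b d * v a b d))))
            (trans (anti-multiples s n (λ a m → anti m (λ b d → χ b * χ d * (W a b d * v a b d))) n-def)
              (anti-cong s (λ a m _ → trans (anti-cong (p ℕ.* m) (λ b d _ → ℤₚ.*-assoc (χ b) (χ d) (W (p ℕ.* a) b d * v (p ℕ.* a) b d)))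
                (trans (anti-multiples m (p ℕ.* m) (λ b d → χ d * (W (p ℕ.* a) b d * v (p ℕ.* a) b d)) refl)
                  (anti-cong m (λ b d _ → trans (cong (_* (W′ a b d * v (p ℕ.* a) (p ℕ.* b) (p ℕ.* d))) (χ-yes (ℕᵈ.m∣m*n d))) (ℤₚ.*-identityˡ _)))))))

      split₀ : ∀ {Φ₁ Φ₂ Φ₃} X → nest S Φ₁ Φ₂ Φ₃ X ≡ nest D Φ₁ Φ₂ Φ₃ X + nest R Φ₁ Φ₂ Φ₃ X
      split₀ X = S-split _

      split₁ : ∀ {Φ₀ Φ₂ Φ₃} → Linear Φ₀ → ∀ X → nest Φ₀ S Φ₂ Φ₃ X ≡ nest Φ₀ D Φ₂ Φ₃ X + nest Φ₀ R Φ₂ Φ₃ X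
      split₁ L₀ X = trans (L₀ .ext (λ a₀ b₀ c₀ → S-split _)) (L₀ .add _ _)

      split₂ : ∀ {Φ₀ Φ₁ Φ₃} → Linear Φ₀ → Linear Φ₁ → ∀ X → nest Φ₀ Φ₁ S Φ₃ X ≡ nest Φ₀ Φ₁ D Φ₃ X + nest Φ₀ Φ₁ R Φ₃ X
      split₂ L₀ L₁ X = trans (L₀ .ext (λ a₀ b₀ c₀ → trans (L₁ .ext (λ a₁ b₁ c₁ → S-split _)) (L₁ .add _ _))) (L₀ .add _ _)

      split₃ : ∀ {Φ₀ Φ₁ Φ₂} → Linear Φ₀ → Linear Φ₁ → Linear Φ₂ → ∀ X → nest Φ₀ Φ₁ Φ₂ S X ≡ nest Φ₀ Φ₁ Φ₂ D X + nest Φ₀ Φ₁ Φ₂ R X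
      split₃ L₀ L₁ L₂ X = trans (L₀ .ext (λ a₀ b₀ c₀ → trans (L₁ .ext (λ a₁ b₁ c₁ → trans (L₂ .ext (λ a₂ b₂ c₂ → S-split _)) (L₂ .add _ _))) (L₁ .add _ _))) (L₀ .add _ _)

      swap₀₁ : ∀ {Φ₁ Φ₂ Φ₃} → Linear Φ₁ → ∀ X → nest R Φ₁ Φ₂ Φ₃ X ≡ nest Φ₁ R Φ₂ Φ₃ (λ a₁ b₁ c₁ a₀ b₀ c₀ → X a₀ b₀ c₀ a₁ b₁ c₁)
      swap₀₁ L X = R-exchange L _

      swap₁₂ : ∀ {Φ₀ Φ₂ Φ₃} → Linear Φ₀ → Linear Φ₂ → ∀ X → nest Φ₀ R Φ₂ Φ₃ X ≡ nest Φ₀ Φ₂ R Φ₃ (λ a₀ b₀ c₀ a₂ b₂ c₂ a₁ b₁ c₁ → X a₀ b₀ c₀ a₁ b₁ c₁ a₂ b₂ c₂)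
      swap₁₂ L₀ L X = L₀ .ext (λ a₀ b₀ c₀ → R-exchange L _)

      swap₂₃ : ∀ {Φ₀ Φ₁ Φ₃} → Linear Φ₀ → Linear Φ₁ → Linear Φ₃ → ∀ X → nest Φ₀ Φ₁ R Φ₃ X ≡ nest Φ₀ Φ₁ Φ₃ R (λ a₀ b₀ c₀ a₁ b₁ c₁ a₃ b₃ c₃ a₂ b₂ c₂ → X a₀ b₀ c₀ a₁ b₁ c₁ a₂ b₂ c₂ a₃ b₃ c₃)
      swap₂₃ L₀ L₁ L X = L₀ .ext (λ a₀ b₀ c₀ → L₁ .ext (λ a₁ b₁ c₁ → R-exchange L _))

      opaque
        unfolding D

        D-∣ : ∀ {Q} {v : Weight} → (∀ a b d → Q ∣ v (p ℕ.* a) (p ℕ.* b) (p ℕ.* d)) → Q ∣ D v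
        D-∣ h = ∑₃-∣ s (λ a b d _ → ∣n⇒∣m*n (W′ a b d) (h a b d))

        DD-∣ : ∀ {Q} {X : ℕ → ℕ → ℕ → Weight} → (∀ a b d a′ b′ d′ → a ℕ.+ (b ℕ.+ d) ≡ s → a′ ℕ.+ (b′ ℕ.+ d′) ≡ s →
          Q ∣ W′ a b d * W′ a′ b′ d′ * X (p ℕ.* a) (p ℕ.* b) (p ℕ.* d) (p ℕ.* a′) (p ℕ.* b′) (p ℕ.* d′)) → Q ∣ D (λ a b d → D (X a b d))
        DD-∣ {Q} {X} h = ∑₃-∣ s (λ a b d e → ∣-resp (trans (∑₃-cong s (λ a′ b′ d′ _ → ℤₚ.*-assoc (W′ a b d) (W′ a′ b′ d′) (X (p ℕ.* a) (p ℕ.* b) (p ℕ.* d) (p ℕ.* a′) (p ℕ.* b′) (p ℕ.* d′))))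
            (∑₃-* s (W′ a b d) (λ a′ b′ d′ → W′ a′ b′ d′ * X (p ℕ.* a) (p ℕ.* b) (p ℕ.* d) (p ℕ.* a′) (p ℕ.* b′) (p ℕ.* d′))))
          (∑₃-∣ s (λ a′ b′ d′ e′ → h a b d a′ b′ d′ e e′)))

      module Bounds (r : ℕ) (n-val : P ^ r ∣ + n) where
        AllMultiples : ℕ → ℕ → ℕ → Set
        AllMultiples a b d = p ℕᵈ.∣ a × p ℕᵈ.∣ b × p ℕᵈ.∣ d

        opaque
          unfolding R

          -- An irregular row has an entry prime to p. That entry times the weight is divisible by
          -- pʳ, hence so is the weight.
          R-∣ : ∀ k {v : Weight} → (∀ a b d → ¬ AllMultiples a b d → P ^ k ∣ v a b d) → P ^ (r ℕ.+ k) ∣ R v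
          R-∣ k {v} h = ∑₃-∣ n (λ a b d e → decide a b d e (p ℕᵈ.∣? a) (p ℕᵈ.∣? b) (p ℕᵈ.∣? d))
            where
            Q : ℤ
            Q = P ^ (r ℕ.+ k)
            regular : ∀ a b d → P ^ r ∣ W a b d → ¬ AllMultiples a b d → Q ∣ RW a b d * v a b d
            regular a b d hW h¬ = ∣-trans (∣-reflexive (ℤₚ.^-distribˡ-+-* P r k)) (*-mono-∣ (∣n⇒∣m*n (ρ a b d) hW) (h a b d h¬))
            coprime : ∀ {x a b d} → ¬ p ℕᵈ.∣ x → P ^ r ∣ + x * W a b d → P ^ r ∣ W a b d
            coprime ∤ = unit-cancel (λ k → ∤ (pos-∣ k)) r
            decide : ∀ a b d → a ℕ.+ (b ℕ.+ d) ≡ n → Dec (p ℕᵈ.∣ a) → Dec (p ℕᵈ.∣ b) → Dec (p ℕᵈ.∣ d) → Q ∣ RW a b d * v a b d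
            decide a b d e (yes ha) (yes hb) (yes hd) = ∣-resp (sym (cong (λ t → t * W a b d * v a b d) (trans (cong₂ (λ x y → 1ℤ - x * y) (χ-yes ha) (cong₂ _*_ (χ-yes hb) (χ-yes hd))) refl))) (∣-0 Q)
            decide a b d e (no ∤) _ _ = regular a b d (coprime {a} {a} {b} {d} ∤ (absorb₁ n-val a b d e)) (λ h → ∤ (proj₁ h))
            decide a b d e (yes _) (no ∤) _ = regular a b d (coprime {b} {a} {b} {d} ∤ (absorb₂ n-val a b d e)) (λ h → ∤ (proj₁ (proj₂ h)))
            decide a b d e (yes _) (yes _) (no ∤) = regular a b d (coprime {d} {a} {b} {d} ∤ (absorb₃ n-val a b d e)) (λ h → ∤ (proj₂ (proj₂ h)))

        P^0-∣ : ∀ z → P ^ 0 ∣ z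
        P^0-∣ z = divides z (sym (ℤₚ.*-identityʳ z))

        Q : ℤ
        Q = P ^ (3 ℕ.* r)

        -- Three irregular rows contribute pʳ each, whatever the integrand and the fourth row.
        RRRS : ∀ {X : Weight⁴} → Q ∣ (R λ a₀ b₀ c₀ → R λ a₁ b₁ c₁ → R λ a₂ b₂ c₂ → S (X a₀ b₀ c₀ a₁ b₁ c₁ a₂ b₂ c₂))
        RRRS = R-∣ (r ℕ.+ (r ℕ.+ 0)) (λ _ _ _ _ → R-∣ (r ℕ.+ 0) (λ _ _ _ _ → R-∣ 0 (λ _ _ _ _ → P^0-∣ _)))

        RRDR : ∀ {X : Weight⁴} → Q ∣ (R λ a₀ b₀ c₀ → R λ a₁ b₁ c₁ → D λ a₂ b₂ c₂ → R (X a₀ b₀ c₀ a₁ b₁ c₁ a₂ b₂ c₂))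
        RRDR = R-∣ (r ℕ.+ (r ℕ.+ 0)) (λ _ _ _ _ → R-∣ (r ℕ.+ 0) (λ _ _ _ _ → D-∣ (λ _ _ _ → R-∣ 0 (λ _ _ _ _ → P^0-∣ _))))

        RDRR : ∀ {X : Weight⁴} → Q ∣ (R λ a₀ b₀ c₀ → D λ a₁ b₁ c₁ → R λ a₂ b₂ c₂ → R (X a₀ b₀ c₀ a₁ b₁ c₁ a₂ b₂ c₂))
        RDRR = R-∣ (r ℕ.+ (r ℕ.+ 0)) (λ _ _ _ _ → D-∣ (λ _ _ _ → R-∣ (r ℕ.+ 0) (λ _ _ _ _ → R-∣ 0 (λ _ _ _ _ → P^0-∣ _))))

        DRRR : ∀ {X : Weight⁴} → Q ∣ (D λ a₀ b₀ c₀ → R λ a₁ b₁ c₁ → R λ a₂ b₂ c₂ → R (X a₀ b₀ c₀ a₁ b₁ c₁ a₂ b₂ c₂))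
        DRRR = D-∣ (λ _ _ _ → R-∣ (r ℕ.+ (r ℕ.+ 0)) (λ _ _ _ _ → R-∣ (r ℕ.+ 0) (λ _ _ _ _ → R-∣ 0 (λ _ _ _ _ → P^0-∣ _))))

  private
    zero₀ : ∀ g y z w → g * (0ℤ * y * (z * w)) ≡ 0ℤ
    zero₀ = solve-∀
    zero₁ : ∀ g x z w → g * (x * 0ℤ * (z * w)) ≡ 0ℤ
    zero₁ = solve-∀
    zero₂ : ∀ g x y w → g * (x * y * (0ℤ * w)) ≡ 0ℤ
    zero₂ = solve-∀
    zero₃ : ∀ g x y z → g * (x * y * (z * 0ℤ)) ≡ 0ℤ
    zero₃ = solve-∀

  product-zero : ∀ g {x y z w} → x ≡ 0ℤ ⊎ y ≡ 0ℤ ⊎ z ≡ 0ℤ ⊎ w ≡ 0ℤ → g * (x * y * (z * w)) ≡ 0ℤ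
  product-zero g {_} {y} {z} {w} (inj₁ refl) = zero₀ g y z w
  product-zero g {x} {_} {z} {w} (inj₂ (inj₁ refl)) = zero₁ g x z w
  product-zero g {x} {y} {_} {w} (inj₂ (inj₂ (inj₁ refl))) = zero₂ g x y w
  product-zero g {x} {y} {z} {_} (inj₂ (inj₂ (inj₂ refl))) = zero₃ g x y z

  product-cong : ∀ g {x y z w x′ y′ z′ w′} → x ≡ x′ → y ≡ y′ → z ≡ z′ → w ≡ w′ → g * (x * y * (z * w)) ≡ g * (x′ * y′ * (z′ * w′))
  product-cong g refl refl refl refl = refl

  -- One or two irregular rows.

  module Conclusion (p : ℕ) (prime : Prime p) (5≤p : 5 ℕ.≤ p) (s n : ℕ) (n-def : n ≡ p ℕ.* s) (r₀ : ℕ) (s-val : (+ p) ^ r₀ ∣ + s) (s≢0 : s ≢ 0) where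
    open Local p prime 5≤p
    open Blocks p prime 5≤p using (q; ε-q)
    open Pairs p prime 5≤p
    open PairLemma p prime 5≤p
    open DivisibleRows p prime 5≤p
    open Assembly p prime 5≤p
    open Rows s n n-def

    r : ℕ
    r = suc r₀

    n-val : P ^ r ∣ + n
    n-val = ∣-resp (cong +_ (sym n-def)) (ps-val r₀ s s-val)

    open Bounds r n-val

    P∣n : P ∣ + n
    P∣n = ∣-trans (divides (P ^ r₀) (ℤₚ.*-comm P (P ^ r₀))) n-val

    P∣p* : ∀ v → P ∣ + (p ℕ.* v)
    P∣p* v = ∣-pos (ℕᵈ.m∣m*n v)

    module _ {u : ℕ} (∤ : ¬ p ℕᵈ.∣ u) (v w : ℕ) where
      private
        contradict : ∀ {z} → + u ≡ + n - + (p ℕ.* v) - + (p ℕ.* w) - z → z ≡ 0ℤ → ⊥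
        contradict e refl = ∤ (pos-∣ (∣-resp (sym e) (∣m∣n⇒∣m-n (∣m∣n⇒∣m-n (∣m∣n⇒∣m-n P∣n (P∣p* v)) (P∣p* w)) (∣-0 P))))
        eq₁ : ∀ n u v w → u ≡ n - v - w - (n - u - v - w)
        eq₁ = solve-∀
        eq₂ : ∀ n u v w → u ≡ n - v - w - (n - v - u - w)
        eq₂ = solve-∀
        eq₃ : ∀ n u v w → u ≡ n - v - w - (n - v - w - u)
        eq₃ = solve-∀

      -- A single irregular row puts an entry prime to p into a column whose other two entries are
      -- multiples of p, while the column sum n is a multiple of p.
      lone₁ : δ (+ n - + u - + (p ℕ.* v) - + (p ℕ.* w)) ≡ 0ℤ
      lone₁ = δ-≢ (contradict (eq₁ (+ n) (+ u) (+ (p ℕ.* v)) (+ (p ℕ.* w))))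

      lone₂ : δ (+ n - + (p ℕ.* v) - + u - + (p ℕ.* w)) ≡ 0ℤ
      lone₂ = δ-≢ (contradict (eq₂ (+ n) (+ u) (+ (p ℕ.* v)) (+ (p ℕ.* w))))

      lone₃ : δ (+ n - + (p ℕ.* v) - + (p ℕ.* w) - + u) ≡ 0ℤ
      lone₃ = δ-≢ (contradict (eq₃ (+ n) (+ u) (+ (p ℕ.* v)) (+ (p ℕ.* w))))

    not-all : ∀ {a b d} → ¬ AllMultiples a b d → ¬ p ℕᵈ.∣ a ⊎ ¬ p ℕᵈ.∣ b ⊎ ¬ p ℕᵈ.∣ d
    not-all {a} {b} {d} h = decide (p ℕᵈ.∣? a) (p ℕᵈ.∣? b)
      where
      decide : Dec (p ℕᵈ.∣ a) → Dec (p ℕᵈ.∣ b) → ¬ p ℕᵈ.∣ a ⊎ ¬ p ℕᵈ.∣ b ⊎ ¬ p ℕᵈ.∣ d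
      decide (no ∤) _ = inj₁ ∤
      decide (yes _) (no ∤) = inj₂ (inj₁ ∤)
      decide (yes ha) (yes hb) = inj₂ (inj₂ (λ hd → h (ha , hb , hd)))

    private
      zero-∣ : ∀ {z} k → z ≡ 0ℤ → P ^ k ∣ z
      zero-∣ k e = ∣-resp (sym e) (∣-0 (P ^ k))

    ColumnZero : ℕ → ℕ → ℕ → ℕ → ℕ → ℕ → ℕ → ℕ → ℕ → ℕ → ℕ → ℕ → Set
    ColumnZero a₀ b₀ c₀ a₁ b₁ c₁ a₂ b₂ c₂ a₃ b₃ c₃ =
      δ (+ n - + a₁ - + a₂ - + a₃) ≡ 0ℤ ⊎ δ (+ n - + a₀ - + b₂ - + b₃) ≡ 0ℤ ⊎ δ (+ n - + b₀ - + b₁ - + c₃) ≡ 0ℤ ⊎ δ (+ n - + c₀ - + c₁ - + c₂) ≡ 0ℤ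

    Ξ-zero-∣ : ∀ k a₀ b₀ c₀ a₁ b₁ c₁ a₂ b₂ c₂ a₃ b₃ c₃ → ColumnZero a₀ b₀ c₀ a₁ b₁ c₁ a₂ b₂ c₂ a₃ b₃ c₃ → P ^ k ∣ Ξ n a₀ b₀ c₀ a₁ b₁ c₁ a₂ b₂ c₂ a₃ b₃ c₃
    Ξ-zero-∣ k a₀ b₀ c₀ a₁ b₁ c₁ a₂ b₂ c₂ a₃ b₃ c₃ h = ∣-resp (sym (product-zero (sign₀ a₀ b₀ c₀ * sign₁ a₁ b₁ c₁ * (sign₂ a₂ b₂ c₂ * sign₃ a₃ b₃ c₃)) h)) (∣-0 (P ^ k))

    RDDD : Q ∣ (R λ a₀ b₀ c₀ → D λ a₁ b₁ c₁ → D λ a₂ b₂ c₂ → D (Ξ n a₀ b₀ c₀ a₁ b₁ c₁ a₂ b₂ c₂))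
    RDDD = R-∣ (r ℕ.+ (r ℕ.+ 0)) (λ a₀ b₀ c₀ h → D-∣ (λ a₁ b₁ c₁ → D-∣ (λ a₂ b₂ c₂ → D-∣ (λ a₃ b₃ c₃ → Ξ-zero-∣ (r ℕ.+ (r ℕ.+ 0)) a₀ b₀ c₀ (p ℕ.* a₁) (p ℕ.* b₁) (p ℕ.* c₁) (p ℕ.* a₂) (p ℕ.* b₂) (p ℕ.* c₂) (p ℕ.* a₃) (p ℕ.* b₃) (p ℕ.* c₃) ([ (λ ∤ → inj₂ (inj₁ (lone₁ ∤ b₂ b₃))) , [ (λ ∤ → inj₂ (inj₂ (inj₁ (lone₁ ∤ b₁ c₃)))) , (λ ∤ → inj₂ (inj₂ (inj₂ (lone₁ ∤ c₁ c₂)))) ]′ ]′ (not-all h))))))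

    DRDD : Q ∣ (D λ a₀ b₀ c₀ → R λ a₁ b₁ c₁ → D λ a₂ b₂ c₂ → D (Ξ n a₀ b₀ c₀ a₁ b₁ c₁ a₂ b₂ c₂))
    DRDD = D-∣ (λ a₀ b₀ c₀ → R-∣ (r ℕ.+ (r ℕ.+ 0)) (λ a₁ b₁ c₁ h → D-∣ (λ a₂ b₂ c₂ → D-∣ (λ a₃ b₃ c₃ → Ξ-zero-∣ (r ℕ.+ (r ℕ.+ 0)) (p ℕ.* a₀) (p ℕ.* b₀) (p ℕ.* c₀) a₁ b₁ c₁ (p ℕ.* a₂) (p ℕ.* b₂) (p ℕ.* c₂) (p ℕ.* a₃) (p ℕ.* b₃) (p ℕ.* c₃) ([ (λ ∤ → inj₁ (lone₁ ∤ a₂ a₃)) , [ (λ ∤ → inj₂ (inj₂ (inj₁ (lone₂ ∤ b₀ c₃)))) , (λ ∤ → inj₂ (inj₂ (inj₂ (lone₂ ∤ c₀ c₂)))) ]′ ]′ (not-all h))))))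

    DDRD : Q ∣ (D λ a₀ b₀ c₀ → D λ a₁ b₁ c₁ → R λ a₂ b₂ c₂ → D (Ξ n a₀ b₀ c₀ a₁ b₁ c₁ a₂ b₂ c₂))
    DDRD = D-∣ (λ a₀ b₀ c₀ → D-∣ (λ a₁ b₁ c₁ → R-∣ (r ℕ.+ (r ℕ.+ 0)) (λ a₂ b₂ c₂ h → D-∣ (λ a₃ b₃ c₃ → Ξ-zero-∣ (r ℕ.+ (r ℕ.+ 0)) (p ℕ.* a₀) (p ℕ.* b₀) (p ℕ.* c₀) (p ℕ.* a₁) (p ℕ.* b₁) (p ℕ.* c₁) a₂ b₂ c₂ (p ℕ.* a₃) (p ℕ.* b₃) (p ℕ.* c₃) ([ (λ ∤ → inj₁ (lone₂ ∤ a₁ a₃)) , [ (λ ∤ → inj₂ (inj₁ (lone₂ ∤ a₀ b₃))) , (λ ∤ → inj₂ (inj₂ (inj₂ (lone₃ ∤ c₀ c₁)))) ]′ ]′ (not-all h))))))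

    DDDR : Q ∣ (D λ a₀ b₀ c₀ → D λ a₁ b₁ c₁ → D λ a₂ b₂ c₂ → R (Ξ n a₀ b₀ c₀ a₁ b₁ c₁ a₂ b₂ c₂))
    DDDR = D-∣ (λ a₀ b₀ c₀ → D-∣ (λ a₁ b₁ c₁ → D-∣ (λ a₂ b₂ c₂ → R-∣ (r ℕ.+ (r ℕ.+ 0)) (λ a₃ b₃ c₃ h → Ξ-zero-∣ (r ℕ.+ (r ℕ.+ 0)) (p ℕ.* a₀) (p ℕ.* b₀) (p ℕ.* c₀) (p ℕ.* a₁) (p ℕ.* b₁) (p ℕ.* c₁) (p ℕ.* a₂) (p ℕ.* b₂) (p ℕ.* c₂) a₃ b₃ c₃ ([ (λ ∤ → inj₁ (lone₃ ∤ a₁ a₂)) , [ (λ ∤ → inj₂ (inj₁ (lone₃ ∤ a₀ b₂))) , (λ ∤ → inj₂ (inj₂ (inj₁ (lone₃ ∤ b₀ b₁)))) ]′ ]′ (not-all h))))))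

    n′ : ℕ
    n′ = ℕ.pred n

    n-suc : suc n′ ≡ n
    n-suc = ℕₚ.suc-pred n {{ℕ.≢-nonZero n≢0}}
      where
      n≢0 : n ≢ 0
      n≢0 e = ℕ.≢-nonZero⁻¹ (p ℕ.* s) {{ℕₚ.m*n≢0 p s {{p≢0}} {{ℕ.≢-nonZero s≢0}}}} (trans (sym n-def) e)

    RW-swap₁₂ : ∀ a b d → RW a b d ≡ RW b a d
    RW-swap₁₂ a b d = cong₂ (λ x y → (1ℤ - x) * y) (eq (χ a) (χ b) (χ d)) (cong +_ (trinomial-swap₁₂ a b d))
      where
      eq : ∀ x y z → x * (y * z) ≡ y * (x * z)
      eq = solve-∀

    RW-swap₂₃ : ∀ a b d → RW a b d ≡ RW a d b
    RW-swap₂₃ a b d = cong₂ (λ x y → (1ℤ - χ a * x) * y) (ℤₚ.*-comm (χ b) (χ d)) (cong +_ (trinomial-swap₂₃ a b d))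

    -- `pair-∣` expects the column missed by the other irregular row in first place; this and
    -- `R-third-first` put it there.
    R-second-first : ∀ v → R v ≡ R (λ x a d → v a x d)
    R-second-first v = subst (λ Φ → Φ v ≡ Φ (λ x a d → v a x d)) (sym R-def)
      (trans (∑₃-swap₁₂ n (λ a b d → RW a b d * v a b d)) (∑₃-cong n (λ a b d _ → cong (_* v b a d) (RW-swap₁₂ b a d))))

    R-third-first : ∀ v → R v ≡ R (λ x a b → v a b x)
    R-third-first v = trans (subst (λ Φ → Φ v ≡ Φ (λ a b d → v a d b)) (sym R-def)
      (trans (∑₃-swap₂₃ n (λ a b d → RW a b d * v a b d)) (∑₃-cong n (λ a b d _ → cong (_* v a d b) (RW-swap₂₃ a d b))))) (R-second-first (λ a b d → v a d b))

    -- In the applications g is the product of the weights of the two regular rows and C is their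
    -- sign.
    pair-∣ : ∀ α β γ α′ β′ γ′ (γγ : γ * γ ≡ 1ℤ) (β′β′ : β′ * β′ ≡ 1ℤ) (γ′γ′ : γ′ * γ′ ≡ 1ℤ) (odd : β * γ * (β′ * γ′) ≡ -1ℤ) x y z e₄ g C (X : ℕ → ℕ → ℕ → Weight) →
      (∀ a b d a′ b′ d′ → X a b d a′ b′ d′ ≡ C * ((α ^ a * β ^ b * γ ^ d) * (α′ ^ a′ * β′ ^ b′ * γ′ ^ d′) *
        (δ (+ n - + x - + a) * δ (+ n - + y - + a′) * (δ (+ n - + z - + b - + b′) * δ (e₄ - + d - + d′))))) →
      p ℕᵈ.∣ x → p ℕᵈ.∣ y → p ℕᵈ.∣ z → P ^ r ∣ g * + x → P ^ r ∣ g * + y → P ^ r ∣ g * + z → Q ∣ g * R (λ a b d → R (X a b d))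
    pair-∣ α β γ α′ β′ γ′ γγ β′β′ γ′γ′ odd x y z e₄ g C X e px py pz gx gy gz = ∣-resp (cong (λ t → g * t) (sym factored))
      (∣-resp (eq g C (R (λ a b d → R (J a b d)))) (∣n⇒∣m*n C (subst (λ Φ → Q ∣ g * Φ (λ a b d → Φ (J a b d))) (sym R-def) (pair-lemma {g} px py pz gx gy gz))))
      where
      open TwoRows r n n′ n-suc (s≤s z≤n) n-val α β γ α′ β′ γ′ γγ β′β′ γ′γ′ odd x y z e₄
      eq : ∀ g C t → C * (g * t) ≡ g * (C * t)
      eq = solve-∀
      factored : R (λ a b d → R (X a b d)) ≡ C * R (λ a b d → R (J a b d))
      factored = trans (R-linear .ext (λ a b d → trans (R-linear .ext (e a b d)) (R-linear .scale C (J a b d)))) (R-linear .scale C (λ a b d → R (J a b d)))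

    module _ {u v : ℕ} {g g′ : ℤ} where
      -- In a column with one irregular entry the two regular entries belong to different rows, and
      -- each is paired with the weight of its own row.
      two-entries : P ^ r ∣ + u * g → P ^ r ∣ + v * g′ → P ^ r ∣ g * g′ * + (u ℕ.+ v)
      two-entries h k = ∣-resp (trans (eq g g′ (+ u) (+ v)) (cong (λ t → g * g′ * t) (sym (ℤₚ.pos-+ u v)))) (∣m∣n⇒∣m+n (∣n⇒∣m*n g′ h) (∣n⇒∣m*n g k))
        where
        eq : ∀ g g′ u v → g′ * (u * g) + g * (v * g′) ≡ g * g′ * (u + v)
        eq = solve-∀

      right-entry : P ^ r ∣ + v * g′ → P ^ r ∣ g * g′ * + v
      right-entry h = ∣-resp (eq g g′ (+ v)) (∣n⇒∣m*n g h)
        where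
        eq : ∀ g g′ v → g * (v * g′) ≡ g * g′ * v
        eq = solve-∀

    module Scaled (a b d : ℕ) (e : a ℕ.+ (b ℕ.+ d) ≡ s) where
      e′ : p ℕ.* a ℕ.+ (p ℕ.* b ℕ.+ p ℕ.* d) ≡ n
      e′ = trans (scaled-sum r₀ s s-val a b d e) (sym n-def)
      entry₁ : P ^ r ∣ + (p ℕ.* a) * W′ a b d
      entry₁ = absorb₁ n-val (p ℕ.* a) (p ℕ.* b) (p ℕ.* d) e′
      entry₂ : P ^ r ∣ + (p ℕ.* b) * W′ a b d
      entry₂ = absorb₂ n-val (p ℕ.* a) (p ℕ.* b) (p ℕ.* d) e′
      entry₃ : P ^ r ∣ + (p ℕ.* d) * W′ a b d
      entry₃ = absorb₃ n-val (p ℕ.* a) (p ℕ.* b) (p ℕ.* d) e′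

    p∣p* : ∀ v → p ℕᵈ.∣ p ℕ.* v
    p∣p* v = ℕᵈ.m∣m*n v

    p∣p*+p* : ∀ v w → p ℕᵈ.∣ p ℕ.* v ℕ.+ p ℕ.* w
    p∣p*+p* v w = ℕᵈ.∣m∣n⇒∣m+n (p∣p* v) (p∣p* w)

    module _ (u v w : ℕ) where
      private
        eq₁ : ∀ n u v w → n - u - v - w ≡ n - (v + w) - u
        eq₁ = solve-∀
        eq₂ : ∀ n u v w → n - u - v - w ≡ n - (u + w) - v
        eq₂ = solve-∀
        eq₃ : ∀ n u v w → n - u - v - w ≡ n - (u + v) - w
        eq₃ = solve-∀
        eq₄ : ∀ n u v w → n - u - v - w ≡ n - w - u - v
        eq₄ = solve-∀
        eq₅ : ∀ n u v w → n - u - v - w ≡ n - v - u - w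
        eq₅ = solve-∀

      isolate₁ : δ (+ n - + u - + v - + w) ≡ δ (+ n - + (v ℕ.+ w) - + u)
      isolate₁ = cong δ (trans (eq₁ (+ n) (+ u) (+ v) (+ w)) (cong (λ t → + n - t - + u) (sym (ℤₚ.pos-+ v w))))

      isolate₂ : δ (+ n - + u - + v - + w) ≡ δ (+ n - + (u ℕ.+ w) - + v)
      isolate₂ = cong δ (trans (eq₂ (+ n) (+ u) (+ v) (+ w)) (cong (λ t → + n - t - + v) (sym (ℤₚ.pos-+ u w))))

      isolate₃ : δ (+ n - + u - + v - + w) ≡ δ (+ n - + (u ℕ.+ v) - + w)
      isolate₃ = cong δ (trans (eq₃ (+ n) (+ u) (+ v) (+ w)) (cong (λ t → + n - t - + w) (sym (ℤₚ.pos-+ u v))))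

      front₃ : δ (+ n - + u - + v - + w) ≡ δ (+ n - + w - + u - + v)
      front₃ = cong δ (eq₄ (+ n) (+ u) (+ v) (+ w))

      front₂ : δ (+ n - + u - + v - + w) ≡ δ (+ n - + v - + u - + w)
      front₂ = cong δ (eq₅ (+ n) (+ u) (+ v) (+ w))

    -- The regular rows are moved outside by linearity. Row 0 misses column 0 and row 1 misses
    -- column 1, so a₁ and a₀ are isolated there against two regular entries each, and columns 2 and
    -- 3 are common. The `refl` arguments verify the signs, the last one the orthogonality of the
    -- two rows. The other five pairs follow this pattern with the columns permuted.
    RRDD : Q ∣ (R λ a₀ b₀ c₀ → R λ a₁ b₁ c₁ → D λ a₂ b₂ c₂ → D (Ξ n a₀ b₀ c₀ a₁ b₁ c₁ a₂ b₂ c₂))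
    RRDD = ∣-resp (sym (trans (swap₁₂ {Φ₃ = D} R-linear D-linear (Ξ n)) (trans (swap₀₁ {Φ₂ = R} {D} D-linear (λ a₀ b₀ c₀ a₂ b₂ c₂ a₁ b₁ c₁ a₃ b₃ c₃ → Ξ n a₀ b₀ c₀ a₁ b₁ c₁ a₂ b₂ c₂ a₃ b₃ c₃)) (trans (swap₂₃  D-linear R-linear D-linear (λ a₂ b₂ c₂ a₀ b₀ c₀ a₁ b₁ c₁ a₃ b₃ c₃ → Ξ n a₀ b₀ c₀ a₁ b₁ c₁ a₂ b₂ c₂ a₃ b₃ c₃)) (swap₁₂ {Φ₃ = R} D-linear D-linear (λ a₂ b₂ c₂ a₀ b₀ c₀ a₃ b₃ c₃ a₁ b₁ c₁ → Ξ n a₀ b₀ c₀ a₁ b₁ c₁ a₂ b₂ c₂ a₃ b₃ c₃))))))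
      (DD-∣ {X = λ a₂ b₂ c₂ a₃ b₃ c₃ → R (λ a₀ b₀ c₀ → R (λ a₁ b₁ c₁ → Ξ n a₀ b₀ c₀ a₁ b₁ c₁ a₂ b₂ c₂ a₃ b₃ c₃))} (λ a₂ b₂ c₂ a₃ b₃ c₃ e₂ e₃ → term a₂ b₂ c₂ a₃ b₃ c₃ e₂ e₃))
      where
      shuffle : ∀ a₀ b₀ c₀ a₁ b₁ c₁ s₂ s₃ d₀ d₁ d₂ d₃ → (a₀ * b₀ * c₀) * (a₁ * b₁ * c₁) * (s₂ * s₃) * (d₀ * d₁ * (d₂ * d₃)) ≡ s₂ * s₃ * ((a₀ * b₀ * c₀) * (a₁ * b₁ * c₁) * (d₁ * d₀ * (d₂ * d₃)))
      shuffle = solve-∀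
      term : ∀ a₂ b₂ c₂ a₃ b₃ c₃ → a₂ ℕ.+ (b₂ ℕ.+ c₂) ≡ s → a₃ ℕ.+ (b₃ ℕ.+ c₃) ≡ s →
        Q ∣ W′ a₂ b₂ c₂ * W′ a₃ b₃ c₃ * R (λ a₀ b₀ c₀ → R (λ a₁ b₁ c₁ → Ξ n a₀ b₀ c₀ a₁ b₁ c₁ (p ℕ.* a₂) (p ℕ.* b₂) (p ℕ.* c₂) (p ℕ.* a₃) (p ℕ.* b₃) (p ℕ.* c₃)))
      term a₂ b₂ c₂ a₃ b₃ c₃ e₂ e₃ = pair-∣ (M 0F 1F) (M 0F 2F) (M 0F 3F) (M 1F 0F) (M 1F 2F) (M 1F 3F) refl refl refl refl (p ℕ.* b₂ ℕ.+ p ℕ.* b₃) (p ℕ.* a₂ ℕ.+ p ℕ.* a₃) (p ℕ.* c₃) (+ n - + (p ℕ.* c₂)) (W′ a₂ b₂ c₂ * W′ a₃ b₃ c₃) (sign₂ (p ℕ.* a₂) (p ℕ.* b₂) (p ℕ.* c₂) * sign₃ (p ℕ.* a₃) (p ℕ.* b₃) (p ℕ.* c₃))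
        (λ a₀ b₀ c₀ a₁ b₁ c₁ → Ξ n a₀ b₀ c₀ a₁ b₁ c₁ (p ℕ.* a₂) (p ℕ.* b₂) (p ℕ.* c₂) (p ℕ.* a₃) (p ℕ.* b₃) (p ℕ.* c₃))
        (λ a₀ b₀ c₀ a₁ b₁ c₁ → trans (product-cong (sign₀ a₀ b₀ c₀ * sign₁ a₁ b₁ c₁ * (sign₂ (p ℕ.* a₂) (p ℕ.* b₂) (p ℕ.* c₂) * sign₃ (p ℕ.* a₃) (p ℕ.* b₃) (p ℕ.* c₃))) (isolate₁ a₁ (p ℕ.* a₂) (p ℕ.* a₃)) (isolate₁ a₀ (p ℕ.* b₂) (p ℕ.* b₃)) (front₃ b₀ b₁ (p ℕ.* c₃)) (front₃ c₀ c₁ (p ℕ.* c₂))) (shuffle (M 0F 1F ^ a₀) (M 0F 2F ^ b₀) (M 0F 3F ^ c₀) (M 1F 0F ^ a₁) (M 1F 2F ^ b₁) (M 1F 3F ^ c₁) (sign₂ (p ℕ.* a₂) (p ℕ.* b₂) (p ℕ.* c₂)) (sign₃ (p ℕ.* a₃) (p ℕ.* b₃) (p ℕ.* c₃)) (δ (+ n - + (p ℕ.* a₂ ℕ.+ p ℕ.* a₃) - + a₁)) (δ (+ n - + (p ℕ.* b₂ ℕ.+ p ℕ.* b₃) - + a₀)) (δ (+ n - + (p ℕ.* c₃) - + b₀ - + b₁)) (δ (+ n - + (p ℕ.* c₂) - + c₀ - + c₁))))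
        (p∣p*+p* b₂ b₃) (p∣p*+p* a₂ a₃) (p∣p* c₃) (two-entries {p ℕ.* b₂} {p ℕ.* b₃} {W′ a₂ b₂ c₂} {W′ a₃ b₃ c₃} E₂.entry₂ E₃.entry₂) (two-entries {p ℕ.* a₂} {p ℕ.* a₃} {W′ a₂ b₂ c₂} {W′ a₃ b₃ c₃} E₂.entry₁ E₃.entry₁) (right-entry {0} {p ℕ.* c₃} {W′ a₂ b₂ c₂} {W′ a₃ b₃ c₃} E₃.entry₃)
        where
        module E₂ = Scaled a₂ b₂ c₂ e₂
        module E₃ = Scaled a₃ b₃ c₃ e₃

    RDRD : Q ∣ (R λ a₀ b₀ c₀ → D λ a₁ b₁ c₁ → R λ a₂ b₂ c₂ → D (Ξ n a₀ b₀ c₀ a₁ b₁ c₁ a₂ b₂ c₂))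
    RDRD = ∣-resp (sym (trans (swap₀₁ {Φ₂ = R} {D} D-linear (Ξ n)) (trans (swap₂₃  D-linear R-linear D-linear (λ a₁ b₁ c₁ a₀ b₀ c₀ a₂ b₂ c₂ a₃ b₃ c₃ → Ξ n a₀ b₀ c₀ a₁ b₁ c₁ a₂ b₂ c₂ a₃ b₃ c₃)) (swap₁₂ {Φ₃ = R} D-linear D-linear (λ a₁ b₁ c₁ a₀ b₀ c₀ a₃ b₃ c₃ a₂ b₂ c₂ → Ξ n a₀ b₀ c₀ a₁ b₁ c₁ a₂ b₂ c₂ a₃ b₃ c₃)))))
      (DD-∣ {X = λ a₁ b₁ c₁ a₃ b₃ c₃ → R (λ a₀ b₀ c₀ → R (λ a₂ b₂ c₂ → Ξ n a₀ b₀ c₀ a₁ b₁ c₁ a₂ b₂ c₂ a₃ b₃ c₃))} (λ a₁ b₁ c₁ a₃ b₃ c₃ e₁ e₃ → term a₁ b₁ c₁ a₃ b₃ c₃ e₁ e₃))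
      where
      shuffle : ∀ a₀ b₀ c₀ a₂ b₂ c₂ s₁ s₃ d₀ d₁ d₂ d₃ → (a₀ * b₀ * c₀) * s₁ * ((a₂ * b₂ * c₂) * s₃) * (d₀ * d₁ * (d₂ * d₃)) ≡ s₁ * s₃ * ((b₀ * a₀ * c₀) * (a₂ * b₂ * c₂) * (d₂ * d₀ * (d₁ * d₃)))
      shuffle = solve-∀
      term : ∀ a₁ b₁ c₁ a₃ b₃ c₃ → a₁ ℕ.+ (b₁ ℕ.+ c₁) ≡ s → a₃ ℕ.+ (b₃ ℕ.+ c₃) ≡ s →
        Q ∣ W′ a₁ b₁ c₁ * W′ a₃ b₃ c₃ * R (λ a₀ b₀ c₀ → R (λ a₂ b₂ c₂ → Ξ n a₀ b₀ c₀ (p ℕ.* a₁) (p ℕ.* b₁) (p ℕ.* c₁) a₂ b₂ c₂ (p ℕ.* a₃) (p ℕ.* b₃) (p ℕ.* c₃)))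
      term a₁ b₁ c₁ a₃ b₃ c₃ e₁ e₃ = ∣-resp (cong (λ t → W′ a₁ b₁ c₁ * W′ a₃ b₃ c₃ * t) (sym (R-second-first (λ a₀ b₀ c₀ → R (λ a₂ b₂ c₂ → Ξ n a₀ b₀ c₀ (p ℕ.* a₁) (p ℕ.* b₁) (p ℕ.* c₁) a₂ b₂ c₂ (p ℕ.* a₃) (p ℕ.* b₃) (p ℕ.* c₃))))))
        (pair-∣ (M 0F 2F) (M 0F 1F) (M 0F 3F) (M 2F 0F) (M 2F 1F) (M 2F 3F) refl refl refl refl (p ℕ.* b₁ ℕ.+ p ℕ.* c₃) (p ℕ.* a₁ ℕ.+ p ℕ.* a₃) (p ℕ.* b₃) (+ n - + (p ℕ.* c₁)) (W′ a₁ b₁ c₁ * W′ a₃ b₃ c₃) (sign₁ (p ℕ.* a₁) (p ℕ.* b₁) (p ℕ.* c₁) * sign₃ (p ℕ.* a₃) (p ℕ.* b₃) (p ℕ.* c₃))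
        (λ b₀ a₀ c₀ a₂ b₂ c₂ → Ξ n a₀ b₀ c₀ (p ℕ.* a₁) (p ℕ.* b₁) (p ℕ.* c₁) a₂ b₂ c₂ (p ℕ.* a₃) (p ℕ.* b₃) (p ℕ.* c₃))
        (λ b₀ a₀ c₀ a₂ b₂ c₂ → trans (product-cong (sign₀ a₀ b₀ c₀ * sign₁ (p ℕ.* a₁) (p ℕ.* b₁) (p ℕ.* c₁) * (sign₂ a₂ b₂ c₂ * sign₃ (p ℕ.* a₃) (p ℕ.* b₃) (p ℕ.* c₃))) (isolate₂ (p ℕ.* a₁) a₂ (p ℕ.* a₃)) (front₃ a₀ b₂ (p ℕ.* b₃)) (isolate₁ b₀ (p ℕ.* b₁) (p ℕ.* c₃)) (front₂ c₀ (p ℕ.* c₁) c₂)) (shuffle (M 0F 1F ^ a₀) (M 0F 2F ^ b₀) (M 0F 3F ^ c₀) (M 2F 0F ^ a₂) (M 2F 1F ^ b₂) (M 2F 3F ^ c₂) (sign₁ (p ℕ.* a₁) (p ℕ.* b₁) (p ℕ.* c₁)) (sign₃ (p ℕ.* a₃) (p ℕ.* b₃) (p ℕ.* c₃)) (δ (+ n - + (p ℕ.* a₁ ℕ.+ p ℕ.* a₃) - + a₂)) (δ (+ n - + (p ℕ.* b₃) - + a₀ - + b₂)) (δ (+ n - + (p ℕ.* b₁ ℕ.+ p ℕ.* c₃) - + b₀)) (δ (+ n - + (p ℕ.* c₁) - + c₀ - + c₂))))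
        (p∣p*+p* b₁ c₃) (p∣p*+p* a₁ a₃) (p∣p* b₃) (two-entries {p ℕ.* b₁} {p ℕ.* c₃} {W′ a₁ b₁ c₁} {W′ a₃ b₃ c₃} E₁.entry₂ E₃.entry₃) (two-entries {p ℕ.* a₁} {p ℕ.* a₃} {W′ a₁ b₁ c₁} {W′ a₃ b₃ c₃} E₁.entry₁ E₃.entry₁) (right-entry {0} {p ℕ.* b₃} {W′ a₁ b₁ c₁} {W′ a₃ b₃ c₃} E₃.entry₂))
        where
        module E₁ = Scaled a₁ b₁ c₁ e₁
        module E₃ = Scaled a₃ b₃ c₃ e₃

    RDDR : Q ∣ (R λ a₀ b₀ c₀ → D λ a₁ b₁ c₁ → D λ a₂ b₂ c₂ → R (Ξ n a₀ b₀ c₀ a₁ b₁ c₁ a₂ b₂ c₂))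
    RDDR = ∣-resp (sym (trans (swap₀₁ {Φ₂ = D} {R} D-linear (Ξ n)) (swap₁₂ {Φ₃ = R} D-linear D-linear (λ a₁ b₁ c₁ a₀ b₀ c₀ a₂ b₂ c₂ a₃ b₃ c₃ → Ξ n a₀ b₀ c₀ a₁ b₁ c₁ a₂ b₂ c₂ a₃ b₃ c₃))))
      (DD-∣ {X = λ a₁ b₁ c₁ a₂ b₂ c₂ → R (λ a₀ b₀ c₀ → R (λ a₃ b₃ c₃ → Ξ n a₀ b₀ c₀ a₁ b₁ c₁ a₂ b₂ c₂ a₃ b₃ c₃))} (λ a₁ b₁ c₁ a₂ b₂ c₂ e₁ e₂ → term a₁ b₁ c₁ a₂ b₂ c₂ e₁ e₂))
      where
      shuffle : ∀ a₀ b₀ c₀ a₃ b₃ c₃ s₁ s₂ d₀ d₁ d₂ d₃ → (a₀ * b₀ * c₀) * s₁ * (s₂ * (a₃ * b₃ * c₃)) * (d₀ * d₁ * (d₂ * d₃)) ≡ s₁ * s₂ * ((c₀ * a₀ * b₀) * (a₃ * b₃ * c₃) * (d₃ * d₀ * (d₁ * d₂)))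
      shuffle = solve-∀
      term : ∀ a₁ b₁ c₁ a₂ b₂ c₂ → a₁ ℕ.+ (b₁ ℕ.+ c₁) ≡ s → a₂ ℕ.+ (b₂ ℕ.+ c₂) ≡ s →
        Q ∣ W′ a₁ b₁ c₁ * W′ a₂ b₂ c₂ * R (λ a₀ b₀ c₀ → R (λ a₃ b₃ c₃ → Ξ n a₀ b₀ c₀ (p ℕ.* a₁) (p ℕ.* b₁) (p ℕ.* c₁) (p ℕ.* a₂) (p ℕ.* b₂) (p ℕ.* c₂) a₃ b₃ c₃))
      term a₁ b₁ c₁ a₂ b₂ c₂ e₁ e₂ = ∣-resp (cong (λ t → W′ a₁ b₁ c₁ * W′ a₂ b₂ c₂ * t) (sym (R-third-first (λ a₀ b₀ c₀ → R (λ a₃ b₃ c₃ → Ξ n a₀ b₀ c₀ (p ℕ.* a₁) (p ℕ.* b₁) (p ℕ.* c₁) (p ℕ.* a₂) (p ℕ.* b₂) (p ℕ.* c₂) a₃ b₃ c₃)))))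
        (pair-∣ (M 0F 3F) (M 0F 1F) (M 0F 2F) (M 3F 0F) (M 3F 1F) (M 3F 2F) refl refl refl refl (p ℕ.* c₁ ℕ.+ p ℕ.* c₂) (p ℕ.* a₁ ℕ.+ p ℕ.* a₂) (p ℕ.* b₂) (+ n - + (p ℕ.* b₁)) (W′ a₁ b₁ c₁ * W′ a₂ b₂ c₂) (sign₁ (p ℕ.* a₁) (p ℕ.* b₁) (p ℕ.* c₁) * sign₂ (p ℕ.* a₂) (p ℕ.* b₂) (p ℕ.* c₂))
        (λ c₀ a₀ b₀ a₃ b₃ c₃ → Ξ n a₀ b₀ c₀ (p ℕ.* a₁) (p ℕ.* b₁) (p ℕ.* c₁) (p ℕ.* a₂) (p ℕ.* b₂) (p ℕ.* c₂) a₃ b₃ c₃)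
        (λ c₀ a₀ b₀ a₃ b₃ c₃ → trans (product-cong (sign₀ a₀ b₀ c₀ * sign₁ (p ℕ.* a₁) (p ℕ.* b₁) (p ℕ.* c₁) * (sign₂ (p ℕ.* a₂) (p ℕ.* b₂) (p ℕ.* c₂) * sign₃ a₃ b₃ c₃)) (isolate₃ (p ℕ.* a₁) (p ℕ.* a₂) a₃) (front₂ a₀ (p ℕ.* b₂) b₃) (front₂ b₀ (p ℕ.* b₁) c₃) (isolate₁ c₀ (p ℕ.* c₁) (p ℕ.* c₂))) (shuffle (M 0F 1F ^ a₀) (M 0F 2F ^ b₀) (M 0F 3F ^ c₀) (M 3F 0F ^ a₃) (M 3F 1F ^ b₃) (M 3F 2F ^ c₃) (sign₁ (p ℕ.* a₁) (p ℕ.* b₁) (p ℕ.* c₁)) (sign₂ (p ℕ.* a₂) (p ℕ.* b₂) (p ℕ.* c₂)) (δ (+ n - + (p ℕ.* a₁ ℕ.+ p ℕ.* a₂) - + a₃)) (δ (+ n - + (p ℕ.* b₂) - + a₀ - + b₃)) (δ (+ n - + (p ℕ.* b₁) - + b₀ - + c₃)) (δ (+ n - + (p ℕ.* c₁ ℕ.+ p ℕ.* c₂) - + c₀))))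
        (p∣p*+p* c₁ c₂) (p∣p*+p* a₁ a₂) (p∣p* b₂) (two-entries {p ℕ.* c₁} {p ℕ.* c₂} {W′ a₁ b₁ c₁} {W′ a₂ b₂ c₂} E₁.entry₃ E₂.entry₃) (two-entries {p ℕ.* a₁} {p ℕ.* a₂} {W′ a₁ b₁ c₁} {W′ a₂ b₂ c₂} E₁.entry₁ E₂.entry₁) (right-entry {0} {p ℕ.* b₂} {W′ a₁ b₁ c₁} {W′ a₂ b₂ c₂} E₂.entry₂))
        where
        module E₁ = Scaled a₁ b₁ c₁ e₁
        module E₂ = Scaled a₂ b₂ c₂ e₂

    DRRD : Q ∣ (D λ a₀ b₀ c₀ → R λ a₁ b₁ c₁ → R λ a₂ b₂ c₂ → D (Ξ n a₀ b₀ c₀ a₁ b₁ c₁ a₂ b₂ c₂))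
    DRRD = ∣-resp (sym (trans (swap₂₃  D-linear R-linear D-linear (Ξ n)) (swap₁₂ {Φ₃ = R} D-linear D-linear (λ a₀ b₀ c₀ a₁ b₁ c₁ a₃ b₃ c₃ a₂ b₂ c₂ → Ξ n a₀ b₀ c₀ a₁ b₁ c₁ a₂ b₂ c₂ a₃ b₃ c₃))))
      (DD-∣ {X = λ a₀ b₀ c₀ a₃ b₃ c₃ → R (λ a₁ b₁ c₁ → R (λ a₂ b₂ c₂ → Ξ n a₀ b₀ c₀ a₁ b₁ c₁ a₂ b₂ c₂ a₃ b₃ c₃))} (λ a₀ b₀ c₀ a₃ b₃ c₃ e₀ e₃ → term a₀ b₀ c₀ a₃ b₃ c₃ e₀ e₃))
      where
      shuffle : ∀ a₁ b₁ c₁ a₂ b₂ c₂ s₀ s₃ d₀ d₁ d₂ d₃ → s₀ * (a₁ * b₁ * c₁) * ((a₂ * b₂ * c₂) * s₃) * (d₀ * d₁ * (d₂ * d₃)) ≡ s₀ * s₃ * ((b₁ * a₁ * c₁) * (b₂ * a₂ * c₂) * (d₂ * d₁ * (d₀ * d₃)))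
      shuffle = solve-∀
      term : ∀ a₀ b₀ c₀ a₃ b₃ c₃ → a₀ ℕ.+ (b₀ ℕ.+ c₀) ≡ s → a₃ ℕ.+ (b₃ ℕ.+ c₃) ≡ s →
        Q ∣ W′ a₀ b₀ c₀ * W′ a₃ b₃ c₃ * R (λ a₁ b₁ c₁ → R (λ a₂ b₂ c₂ → Ξ n (p ℕ.* a₀) (p ℕ.* b₀) (p ℕ.* c₀) a₁ b₁ c₁ a₂ b₂ c₂ (p ℕ.* a₃) (p ℕ.* b₃) (p ℕ.* c₃)))
      term a₀ b₀ c₀ a₃ b₃ c₃ e₀ e₃ = ∣-resp (cong (λ t → W′ a₀ b₀ c₀ * W′ a₃ b₃ c₃ * t) (sym (trans (R-linear .ext (λ a₁ b₁ c₁ → R-second-first (λ a₂ b₂ c₂ → Ξ n (p ℕ.* a₀) (p ℕ.* b₀) (p ℕ.* c₀) a₁ b₁ c₁ a₂ b₂ c₂ (p ℕ.* a₃) (p ℕ.* b₃) (p ℕ.* c₃)))) (R-second-first (λ a₁ b₁ c₁ → R (λ b₂ a₂ c₂ → Ξ n (p ℕ.* a₀) (p ℕ.* b₀) (p ℕ.* c₀) a₁ b₁ c₁ a₂ b₂ c₂ (p ℕ.* a₃) (p ℕ.* b₃) (p ℕ.* c₃)))))))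
        (pair-∣ (M 1F 2F) (M 1F 0F) (M 1F 3F) (M 2F 1F) (M 2F 0F) (M 2F 3F) refl refl refl refl (p ℕ.* b₀ ℕ.+ p ℕ.* c₃) (p ℕ.* a₀ ℕ.+ p ℕ.* b₃) (p ℕ.* a₃) (+ n - + (p ℕ.* c₀)) (W′ a₀ b₀ c₀ * W′ a₃ b₃ c₃) (sign₀ (p ℕ.* a₀) (p ℕ.* b₀) (p ℕ.* c₀) * sign₃ (p ℕ.* a₃) (p ℕ.* b₃) (p ℕ.* c₃))
        (λ b₁ a₁ c₁ b₂ a₂ c₂ → Ξ n (p ℕ.* a₀) (p ℕ.* b₀) (p ℕ.* c₀) a₁ b₁ c₁ a₂ b₂ c₂ (p ℕ.* a₃) (p ℕ.* b₃) (p ℕ.* c₃))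
        (λ b₁ a₁ c₁ b₂ a₂ c₂ → trans (product-cong (sign₀ (p ℕ.* a₀) (p ℕ.* b₀) (p ℕ.* c₀) * sign₁ a₁ b₁ c₁ * (sign₂ a₂ b₂ c₂ * sign₃ (p ℕ.* a₃) (p ℕ.* b₃) (p ℕ.* c₃))) (front₃ a₁ a₂ (p ℕ.* a₃)) (isolate₂ (p ℕ.* a₀) b₂ (p ℕ.* b₃)) (isolate₂ (p ℕ.* b₀) b₁ (p ℕ.* c₃)) (refl {x = δ (+ n - + (p ℕ.* c₀) - + c₁ - + c₂)})) (shuffle (M 1F 0F ^ a₁) (M 1F 2F ^ b₁) (M 1F 3F ^ c₁) (M 2F 0F ^ a₂) (M 2F 1F ^ b₂) (M 2F 3F ^ c₂) (sign₀ (p ℕ.* a₀) (p ℕ.* b₀) (p ℕ.* c₀)) (sign₃ (p ℕ.* a₃) (p ℕ.* b₃) (p ℕ.* c₃)) (δ (+ n - + (p ℕ.* a₃) - + a₁ - + a₂)) (δ (+ n - + (p ℕ.* a₀ ℕ.+ p ℕ.* b₃) - + b₂)) (δ (+ n - + (p ℕ.* b₀ ℕ.+ p ℕ.* c₃) - + b₁)) (δ (+ n - + (p ℕ.* c₀) - + c₁ - + c₂))))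
        (p∣p*+p* b₀ c₃) (p∣p*+p* a₀ b₃) (p∣p* a₃) (two-entries {p ℕ.* b₀} {p ℕ.* c₃} {W′ a₀ b₀ c₀} {W′ a₃ b₃ c₃} E₀.entry₂ E₃.entry₃) (two-entries {p ℕ.* a₀} {p ℕ.* b₃} {W′ a₀ b₀ c₀} {W′ a₃ b₃ c₃} E₀.entry₁ E₃.entry₂) (right-entry {0} {p ℕ.* a₃} {W′ a₀ b₀ c₀} {W′ a₃ b₃ c₃} E₃.entry₁))
        where
        module E₀ = Scaled a₀ b₀ c₀ e₀
        module E₃ = Scaled a₃ b₃ c₃ e₃

    DRDR : Q ∣ (D λ a₀ b₀ c₀ → R λ a₁ b₁ c₁ → D λ a₂ b₂ c₂ → R (Ξ n a₀ b₀ c₀ a₁ b₁ c₁ a₂ b₂ c₂))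
    DRDR = ∣-resp (sym (swap₁₂ {Φ₃ = R} D-linear D-linear (Ξ n)))
      (DD-∣ {X = λ a₀ b₀ c₀ a₂ b₂ c₂ → R (λ a₁ b₁ c₁ → R (λ a₃ b₃ c₃ → Ξ n a₀ b₀ c₀ a₁ b₁ c₁ a₂ b₂ c₂ a₃ b₃ c₃))} (λ a₀ b₀ c₀ a₂ b₂ c₂ e₀ e₂ → term a₀ b₀ c₀ a₂ b₂ c₂ e₀ e₂))
      where
      shuffle : ∀ a₁ b₁ c₁ a₃ b₃ c₃ s₀ s₂ d₀ d₁ d₂ d₃ → s₀ * (a₁ * b₁ * c₁) * (s₂ * (a₃ * b₃ * c₃)) * (d₀ * d₁ * (d₂ * d₃)) ≡ s₀ * s₂ * ((c₁ * a₁ * b₁) * (b₃ * a₃ * c₃) * (d₃ * d₁ * (d₀ * d₂)))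
      shuffle = solve-∀
      term : ∀ a₀ b₀ c₀ a₂ b₂ c₂ → a₀ ℕ.+ (b₀ ℕ.+ c₀) ≡ s → a₂ ℕ.+ (b₂ ℕ.+ c₂) ≡ s →
        Q ∣ W′ a₀ b₀ c₀ * W′ a₂ b₂ c₂ * R (λ a₁ b₁ c₁ → R (λ a₃ b₃ c₃ → Ξ n (p ℕ.* a₀) (p ℕ.* b₀) (p ℕ.* c₀) a₁ b₁ c₁ (p ℕ.* a₂) (p ℕ.* b₂) (p ℕ.* c₂) a₃ b₃ c₃))
      term a₀ b₀ c₀ a₂ b₂ c₂ e₀ e₂ = ∣-resp (cong (λ t → W′ a₀ b₀ c₀ * W′ a₂ b₂ c₂ * t) (sym (trans (R-linear .ext (λ a₁ b₁ c₁ → R-second-first (λ a₃ b₃ c₃ → Ξ n (p ℕ.* a₀) (p ℕ.* b₀) (p ℕ.* c₀) a₁ b₁ c₁ (p ℕ.* a₂) (p ℕ.* b₂) (p ℕ.* c₂) a₃ b₃ c₃))) (R-third-first (λ a₁ b₁ c₁ → R (λ b₃ a₃ c₃ → Ξ n (p ℕ.* a₀) (p ℕ.* b₀) (p ℕ.* c₀) a₁ b₁ c₁ (p ℕ.* a₂) (p ℕ.* b₂) (p ℕ.* c₂) a₃ b₃ c₃))))))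
        (pair-∣ (M 1F 3F) (M 1F 0F) (M 1F 2F) (M 3F 1F) (M 3F 0F) (M 3F 2F) refl refl refl refl (p ℕ.* c₀ ℕ.+ p ℕ.* c₂) (p ℕ.* a₀ ℕ.+ p ℕ.* b₂) (p ℕ.* a₂) (+ n - + (p ℕ.* b₀)) (W′ a₀ b₀ c₀ * W′ a₂ b₂ c₂) (sign₀ (p ℕ.* a₀) (p ℕ.* b₀) (p ℕ.* c₀) * sign₂ (p ℕ.* a₂) (p ℕ.* b₂) (p ℕ.* c₂))
        (λ c₁ a₁ b₁ b₃ a₃ c₃ → Ξ n (p ℕ.* a₀) (p ℕ.* b₀) (p ℕ.* c₀) a₁ b₁ c₁ (p ℕ.* a₂) (p ℕ.* b₂) (p ℕ.* c₂) a₃ b₃ c₃)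
        (λ c₁ a₁ b₁ b₃ a₃ c₃ → trans (product-cong (sign₀ (p ℕ.* a₀) (p ℕ.* b₀) (p ℕ.* c₀) * sign₁ a₁ b₁ c₁ * (sign₂ (p ℕ.* a₂) (p ℕ.* b₂) (p ℕ.* c₂) * sign₃ a₃ b₃ c₃)) (front₂ a₁ (p ℕ.* a₂) a₃) (isolate₃ (p ℕ.* a₀) (p ℕ.* b₂) b₃) (refl {x = δ (+ n - + (p ℕ.* b₀) - + b₁ - + c₃)}) (isolate₂ (p ℕ.* c₀) c₁ (p ℕ.* c₂))) (shuffle (M 1F 0F ^ a₁) (M 1F 2F ^ b₁) (M 1F 3F ^ c₁) (M 3F 0F ^ a₃) (M 3F 1F ^ b₃) (M 3F 2F ^ c₃) (sign₀ (p ℕ.* a₀) (p ℕ.* b₀) (p ℕ.* c₀)) (sign₂ (p ℕ.* a₂) (p ℕ.* b₂) (p ℕ.* c₂)) (δ (+ n - + (p ℕ.* a₂) - + a₁ - + a₃)) (δ (+ n - + (p ℕ.* a₀ ℕ.+ p ℕ.* b₂) - + b₃)) (δ (+ n - + (p ℕ.* b₀) - + b₁ - + c₃)) (δ (+ n - + (p ℕ.* c₀ ℕ.+ p ℕ.* c₂) - + c₁))))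
        (p∣p*+p* c₀ c₂) (p∣p*+p* a₀ b₂) (p∣p* a₂) (two-entries {p ℕ.* c₀} {p ℕ.* c₂} {W′ a₀ b₀ c₀} {W′ a₂ b₂ c₂} E₀.entry₃ E₂.entry₃) (two-entries {p ℕ.* a₀} {p ℕ.* b₂} {W′ a₀ b₀ c₀} {W′ a₂ b₂ c₂} E₀.entry₁ E₂.entry₂) (right-entry {0} {p ℕ.* a₂} {W′ a₀ b₀ c₀} {W′ a₂ b₂ c₂} E₂.entry₁))
        where
        module E₀ = Scaled a₀ b₀ c₀ e₀
        module E₂ = Scaled a₂ b₂ c₂ e₂

    DDRR : Q ∣ (D λ a₀ b₀ c₀ → D λ a₁ b₁ c₁ → R λ a₂ b₂ c₂ → R (Ξ n a₀ b₀ c₀ a₁ b₁ c₁ a₂ b₂ c₂))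
    DDRR = DD-∣ {X = λ a₀ b₀ c₀ a₁ b₁ c₁ → R (λ a₂ b₂ c₂ → R (λ a₃ b₃ c₃ → Ξ n a₀ b₀ c₀ a₁ b₁ c₁ a₂ b₂ c₂ a₃ b₃ c₃))} (λ a₀ b₀ c₀ a₁ b₁ c₁ e₀ e₁ → term a₀ b₀ c₀ a₁ b₁ c₁ e₀ e₁)
      where
      shuffle : ∀ a₂ b₂ c₂ a₃ b₃ c₃ s₀ s₁ d₀ d₁ d₂ d₃ → s₀ * s₁ * ((a₂ * b₂ * c₂) * (a₃ * b₃ * c₃)) * (d₀ * d₁ * (d₂ * d₃)) ≡ s₀ * s₁ * ((c₂ * a₂ * b₂) * (c₃ * a₃ * b₃) * (d₃ * d₂ * (d₀ * d₁)))
      shuffle = solve-∀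
      term : ∀ a₀ b₀ c₀ a₁ b₁ c₁ → a₀ ℕ.+ (b₀ ℕ.+ c₀) ≡ s → a₁ ℕ.+ (b₁ ℕ.+ c₁) ≡ s →
        Q ∣ W′ a₀ b₀ c₀ * W′ a₁ b₁ c₁ * R (λ a₂ b₂ c₂ → R (λ a₃ b₃ c₃ → Ξ n (p ℕ.* a₀) (p ℕ.* b₀) (p ℕ.* c₀) (p ℕ.* a₁) (p ℕ.* b₁) (p ℕ.* c₁) a₂ b₂ c₂ a₃ b₃ c₃))
      term a₀ b₀ c₀ a₁ b₁ c₁ e₀ e₁ = ∣-resp (cong (λ t → W′ a₀ b₀ c₀ * W′ a₁ b₁ c₁ * t) (sym (trans (R-linear .ext (λ a₂ b₂ c₂ → R-third-first (λ a₃ b₃ c₃ → Ξ n (p ℕ.* a₀) (p ℕ.* b₀) (p ℕ.* c₀) (p ℕ.* a₁) (p ℕ.* b₁) (p ℕ.* c₁) a₂ b₂ c₂ a₃ b₃ c₃))) (R-third-first (λ a₂ b₂ c₂ → R (λ c₃ a₃ b₃ → Ξ n (p ℕ.* a₀) (p ℕ.* b₀) (p ℕ.* c₀) (p ℕ.* a₁) (p ℕ.* b₁) (p ℕ.* c₁) a₂ b₂ c₂ a₃ b₃ c₃))))))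
        (pair-∣ (M 2F 3F) (M 2F 0F) (M 2F 1F) (M 3F 2F) (M 3F 0F) (M 3F 1F) refl refl refl refl (p ℕ.* c₀ ℕ.+ p ℕ.* c₁) (p ℕ.* b₀ ℕ.+ p ℕ.* b₁) (p ℕ.* a₁) (+ n - + (p ℕ.* a₀)) (W′ a₀ b₀ c₀ * W′ a₁ b₁ c₁) (sign₀ (p ℕ.* a₀) (p ℕ.* b₀) (p ℕ.* c₀) * sign₁ (p ℕ.* a₁) (p ℕ.* b₁) (p ℕ.* c₁))
        (λ c₂ a₂ b₂ c₃ a₃ b₃ → Ξ n (p ℕ.* a₀) (p ℕ.* b₀) (p ℕ.* c₀) (p ℕ.* a₁) (p ℕ.* b₁) (p ℕ.* c₁) a₂ b₂ c₂ a₃ b₃ c₃)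
        (λ c₂ a₂ b₂ c₃ a₃ b₃ → trans (product-cong (sign₀ (p ℕ.* a₀) (p ℕ.* b₀) (p ℕ.* c₀) * sign₁ (p ℕ.* a₁) (p ℕ.* b₁) (p ℕ.* c₁) * (sign₂ a₂ b₂ c₂ * sign₃ a₃ b₃ c₃)) (refl {x = δ (+ n - + (p ℕ.* a₁) - + a₂ - + a₃)}) (refl {x = δ (+ n - + (p ℕ.* a₀) - + b₂ - + b₃)}) (isolate₃ (p ℕ.* b₀) (p ℕ.* b₁) c₃) (isolate₃ (p ℕ.* c₀) (p ℕ.* c₁) c₂)) (shuffle (M 2F 0F ^ a₂) (M 2F 1F ^ b₂) (M 2F 3F ^ c₂) (M 3F 0F ^ a₃) (M 3F 1F ^ b₃) (M 3F 2F ^ c₃) (sign₀ (p ℕ.* a₀) (p ℕ.* b₀) (p ℕ.* c₀)) (sign₁ (p ℕ.* a₁) (p ℕ.* b₁) (p ℕ.* c₁)) (δ (+ n - + (p ℕ.* a₁) - + a₂ - + a₃)) (δ (+ n - + (p ℕ.* a₀) - + b₂ - + b₃)) (δ (+ n - + (p ℕ.* b₀ ℕ.+ p ℕ.* b₁) - + c₃)) (δ (+ n - + (p ℕ.* c₀ ℕ.+ p ℕ.* c₁) - + c₂))))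
        (p∣p*+p* c₀ c₁) (p∣p*+p* b₀ b₁) (p∣p* a₁) (two-entries {p ℕ.* c₀} {p ℕ.* c₁} {W′ a₀ b₀ c₀} {W′ a₁ b₁ c₁} E₀.entry₃ E₁.entry₃) (two-entries {p ℕ.* b₀} {p ℕ.* b₁} {W′ a₀ b₀ c₀} {W′ a₁ b₁ c₁} E₀.entry₂ E₁.entry₂) (right-entry {0} {p ℕ.* a₁} {W′ a₀ b₀ c₀} {W′ a₁ b₁ c₁} E₁.entry₁))
        where
        module E₀ = Scaled a₀ b₀ c₀ e₀
        module E₁ = Scaled a₁ b₁ c₁ e₁

  -- The regular arrays against T(s), and the sum of all cases.

  module Final (p : ℕ) (prime : Prime p) (5≤p : 5 ℕ.≤ p) (s n : ℕ) (n-def : n ≡ p ℕ.* s) (r₀ : ℕ) (s-val : (+ p) ^ r₀ ∣ + s) (s≢0 : s ≢ 0) where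
    open Local p prime 5≤p
    open Blocks p prime 5≤p using (q; ε-q)
    open Pairs p prime 5≤p
    open DivisibleRows p prime 5≤p
    open Assembly p prime 5≤p
    open Rows s n n-def
    open Conclusion p prime 5≤p s n n-def r₀ s-val s≢0
    open Bounds r n-val

    private
      W₁ W₂ : Functional
      W₁ = weighted s W′
      W₂ = weighted s W

      one^ : ∀ a → 1ℤ ^ (p ℕ.* a) ≡ 1ℤ ^ a
      one^ a = trans (ℤₚ.^-zeroˡ (p ℕ.* a)) (sym (ℤₚ.^-zeroˡ a))

      neg^ : ∀ a → -1ℤ ^ (p ℕ.* a) ≡ -1ℤ ^ a
      neg^ a = trans (sym (ℤₚ.^-*-assoc -1ℤ p a)) (cong (_^ a) (trans (cong (-1ℤ ^_) (sym suc-p-1)) (cong (λ z → -1ℤ * z) ε-q)))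

      triple : ∀ {x y z x′ y′ z′ : ℤ} → x ≡ x′ → y ≡ y′ → z ≡ z′ → x * y * z ≡ x′ * y′ * z′
      triple refl refl refl = refl

      quadruple : ∀ {x y z w x′ y′ z′ w′ : ℤ} → x ≡ x′ → y ≡ y′ → z ≡ z′ → w ≡ w′ → x * y * (z * w) ≡ x′ * y′ * (z′ * w′)
      quadruple refl refl refl refl = refl

      δ-scale : ∀ u v w → δ (+ n - + (p ℕ.* u) - + (p ℕ.* v) - + (p ℕ.* w)) ≡ δ (+ s - + u - + v - + w)
      δ-scale u v w = trans (cong δ (trans (cong₂ (λ x y → x - y - + (p ℕ.* v) - + (p ℕ.* w)) (trans (cong +_ n-def) (ℤₚ.pos-* p s)) (ℤₚ.pos-* p u))
          (trans (cong₂ (λ x y → P * + s - P * + u - x - y) (ℤₚ.pos-* p v) (ℤₚ.pos-* p w)) (eq P (+ s) (+ u) (+ v) (+ w)))))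
        (by-cases (+ s - + u - + v - + w) (+ s - + u - + v - + w ℤ.≟ 0ℤ))
        where
        eq : ∀ P s u v w → P * s - P * u - P * v - P * w ≡ P * (s - u - v - w)
        eq = solve-∀
        by-cases : ∀ z → Dec (z ≡ 0ℤ) → δ (P * z) ≡ δ z
        by-cases z (yes refl) = cong δ (ℤₚ.*-zeroʳ P)
        by-cases z (no z≢0) = trans (δ-≢ (λ e → z≢0 (ℤₚ.*-cancelˡ-≡ P z 0ℤ (trans e (sym (ℤₚ.*-zeroʳ P)))))) (sym (δ-≢ z≢0))

    -- Signs are unchanged because p is odd, and each column condition for n is p times the one for
    -- s. So only the trinomial weights differ between the regular part of T(n) and T(s).
    Ξ-scale : ∀ a₀ b₀ c₀ a₁ b₁ c₁ a₂ b₂ c₂ a₃ b₃ c₃ →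
      Ξ n (p ℕ.* a₀) (p ℕ.* b₀) (p ℕ.* c₀) (p ℕ.* a₁) (p ℕ.* b₁) (p ℕ.* c₁) (p ℕ.* a₂) (p ℕ.* b₂) (p ℕ.* c₂) (p ℕ.* a₃) (p ℕ.* b₃) (p ℕ.* c₃)
        ≡ Ξ s a₀ b₀ c₀ a₁ b₁ c₁ a₂ b₂ c₂ a₃ b₃ c₃
    Ξ-scale a₀ b₀ c₀ a₁ b₁ c₁ a₂ b₂ c₂ a₃ b₃ c₃ = cong₂ _*_
      (quadruple (triple (one^ a₀) (neg^ b₀) (one^ c₀)) (triple (one^ a₁) (one^ b₁) (one^ c₁)) (triple (one^ a₂) (one^ b₂) (neg^ c₂)) (triple (neg^ a₃) (one^ b₃) (one^ c₃)))
      (quadruple (δ-scale a₁ a₂ a₃) (δ-scale a₀ b₂ b₃) (δ-scale b₀ b₁ c₃) (δ-scale c₀ c₁ c₂))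

    DDDD : nest D D D D (Ξ n) ≡ nest W₁ W₁ W₁ W₁ (Ξ s)
    DDDD = trans (D-def _) (L .ext λ a₀ b₀ c₀ → trans (D-def _) (L .ext λ a₁ b₁ c₁ → trans (D-def _) (L .ext λ a₂ b₂ c₂ → trans (D-def _) (L .ext λ a₃ b₃ c₃ →
      Ξ-scale a₀ b₀ c₀ a₁ b₁ c₁ a₂ b₂ c₂ a₃ b₃ c₃))))
      where
      L : Linear W₁
      L = weighted-linear s W′

    private
      column-sum : ∀ u v w → + s - + u - + v - + w ≡ 0ℤ → u ℕ.+ (v ℕ.+ w) ≡ s
      column-sum u v w e = sym (ℤₚ.+-injective (trans (eq (+ s) (+ u) (+ v) (+ w)) (trans (cong (_+ (+ u + (+ v + + w))) e)
        (trans (ℤₚ.+-identityˡ _) (trans (cong (λ t → + u + t) (sym (ℤₚ.pos-+ v w))) (sym (ℤₚ.pos-+ u (v ℕ.+ w))))))))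
        where
        eq : ∀ s u v w → s ≡ s - u - v - w + (u + (v + w))
        eq = solve-∀

    -- The column sums required by `quad-lemma` are available exactly where `Ξ s` does not vanish.
    termwise : ∀ a₀ b₀ c₀ a₁ b₁ c₁ a₂ b₂ c₂ a₃ b₃ c₃ →
      a₀ ℕ.+ (b₀ ℕ.+ c₀) ≡ s → a₁ ℕ.+ (b₁ ℕ.+ c₁) ≡ s → a₂ ℕ.+ (b₂ ℕ.+ c₂) ≡ s → a₃ ℕ.+ (b₃ ℕ.+ c₃) ≡ s →
      Q ∣ 1ℤ * W′ a₀ b₀ c₀ * W′ a₁ b₁ c₁ * W′ a₂ b₂ c₂ * W′ a₃ b₃ c₃ * Ξ s a₀ b₀ c₀ a₁ b₁ c₁ a₂ b₂ c₂ a₃ b₃ c₃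
        - 1ℤ * W a₀ b₀ c₀ * W a₁ b₁ c₁ * W a₂ b₂ c₂ * W a₃ b₃ c₃ * Ξ s a₀ b₀ c₀ a₁ b₁ c₁ a₂ b₂ c₂ a₃ b₃ c₃
    termwise a₀ b₀ c₀ a₁ b₁ c₁ a₂ b₂ c₂ a₃ b₃ c₃ row₀ row₁ row₂ row₃ = ∣-resp (eq (W′ a₀ b₀ c₀) (W′ a₁ b₁ c₁) (W′ a₂ b₂ c₂) (W′ a₃ b₃ c₃) (W a₀ b₀ c₀) (W a₁ b₁ c₁) (W a₂ b₂ c₂) (W a₃ b₃ c₃) ξ)
      (by-columns (δ-zero (+ s - + a₁ - + a₂ - + a₃)) (δ-zero (+ s - + a₀ - + b₂ - + b₃)) (δ-zero (+ s - + b₀ - + b₁ - + c₃)) (δ-zero (+ s - + c₀ - + c₁ - + c₂)))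
      where
      eq : ∀ v₀ v₁ v₂ v₃ w₀ w₁ w₂ w₃ ξ → (v₀ * (v₁ * (v₂ * v₃)) - w₀ * (w₁ * (w₂ * w₃))) * ξ ≡ 1ℤ * v₀ * v₁ * v₂ * v₃ * ξ - 1ℤ * w₀ * w₁ * w₂ * w₃ * ξ
      eq = solve-∀
      ξ g Y : ℤ
      ξ = Ξ s a₀ b₀ c₀ a₁ b₁ c₁ a₂ b₂ c₂ a₃ b₃ c₃
      g = sign₀ a₀ b₀ c₀ * sign₁ a₁ b₁ c₁ * (sign₂ a₂ b₂ c₂ * sign₃ a₃ b₃ c₃)
      Y = W′ a₀ b₀ c₀ * (W′ a₁ b₁ c₁ * (W′ a₂ b₂ c₂ * W′ a₃ b₃ c₃)) - W a₀ b₀ c₀ * (W a₁ b₁ c₁ * (W a₂ b₂ c₂ * W a₃ b₃ c₃))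
      d₀ d₁ d₂ d₃ : ℤ
      d₀ = δ (+ s - + a₁ - + a₂ - + a₃)
      d₁ = δ (+ s - + a₀ - + b₂ - + b₃)
      d₂ = δ (+ s - + b₀ - + b₁ - + c₃)
      d₃ = δ (+ s - + c₀ - + c₁ - + c₂)
      vanish : ξ ≡ 0ℤ → Q ∣ Y * ξ
      vanish e = ∣-resp (sym (trans (cong (λ t → Y * t) e) (ℤₚ.*-zeroʳ Y))) (∣-0 Q)
      by-columns : + s - + a₁ - + a₂ - + a₃ ≡ 0ℤ ⊎ δ (+ s - + a₁ - + a₂ - + a₃) ≡ 0ℤ → + s - + a₀ - + b₂ - + b₃ ≡ 0ℤ ⊎ δ (+ s - + a₀ - + b₂ - + b₃) ≡ 0ℤ →
        + s - + b₀ - + b₁ - + c₃ ≡ 0ℤ ⊎ δ (+ s - + b₀ - + b₁ - + c₃) ≡ 0ℤ → + s - + c₀ - + c₁ - + c₂ ≡ 0ℤ ⊎ δ (+ s - + c₀ - + c₁ - + c₂) ≡ 0ℤ → Q ∣ Y * ξ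
      by-columns (inj₂ e) _ _ _ = vanish (product-zero g {d₀} {d₁} {d₂} {d₃} (inj₁ e))
      by-columns (inj₁ _) (inj₂ e) _ _ = vanish (product-zero g {d₀} {d₁} {d₂} {d₃} (inj₂ (inj₁ e)))
      by-columns (inj₁ _) (inj₁ _) (inj₂ e) _ = vanish (product-zero g {d₀} {d₁} {d₂} {d₃} (inj₂ (inj₂ (inj₁ e))))
      by-columns (inj₁ _) (inj₁ _) (inj₁ _) (inj₂ e) = vanish (product-zero g {d₀} {d₁} {d₂} {d₃} (inj₂ (inj₂ (inj₂ e))))
      by-columns (inj₁ e₀) (inj₁ e₁) (inj₁ e₂) (inj₁ e₃) = ∣m⇒∣m*n ξ (quad-lemma r₀ s s-val {a₀} {b₀} {c₀} {a₁} {b₁} {c₁} {a₂} {b₂} {c₂} {a₃} {b₃} {c₃} row₀ row₁ row₂ row₃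
        (column-sum a₁ a₂ a₃ e₀) (column-sum a₀ b₂ b₃ e₁) (column-sum b₀ b₁ c₃ e₂) (column-sum c₀ c₁ c₂ e₃))

    DDDD≡T : nest D D D D (Ξ n) ≡ T s mod Q
    DDDD≡T = trans-mod (≡⇒≡mod DDDD) (trans-mod (by (∣-resp (eq (nest W₁ W₁ W₁ W₁ (Ξ s)) (nest W₂ W₂ W₂ W₂ (Ξ s))) difference)) (≡⇒≡mod (sym (T-expansion s))))
      where
      eq : ∀ x y → 1ℤ * x - 1ℤ * y ≡ x - y
      eq = solve-∀
      difference : Q ∣ 1ℤ * nest W₁ W₁ W₁ W₁ (Ξ s) - 1ℤ * nest W₂ W₂ W₂ W₂ (Ξ s)
      difference = weighted-difference s W′ W 1ℤ 1ℤ _ _ λ a₀ b₀ c₀ r₀ → weighted-difference s W′ W (1ℤ * W′ a₀ b₀ c₀) (1ℤ * W a₀ b₀ c₀) _ _ λ a₁ b₁ c₁ r₁ →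
        weighted-difference s W′ W (1ℤ * W′ a₀ b₀ c₀ * W′ a₁ b₁ c₁) (1ℤ * W a₀ b₀ c₀ * W a₁ b₁ c₁) _ _ λ a₂ b₂ c₂ r₂ →
        weighted-difference s W′ W (1ℤ * W′ a₀ b₀ c₀ * W′ a₁ b₁ c₁ * W′ a₂ b₂ c₂) (1ℤ * W a₀ b₀ c₀ * W a₁ b₁ c₁ * W a₂ b₂ c₂) _ _ λ a₃ b₃ c₃ r₃ →
        termwise a₀ b₀ c₀ a₁ b₁ c₁ a₂ b₂ c₂ a₃ b₃ c₃ r₀ r₁ r₂ r₃

    private
      N : Functional → Functional → Functional → Functional → ℤ
      N Φ₀ Φ₁ Φ₂ Φ₃ = nest Φ₀ Φ₁ Φ₂ Φ₃ (Ξ n)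

      both : ∀ {x y z} → x ≡ y + z → Q ∣ y → Q ∣ z → Q ∣ x
      both e h k = ∣-resp (sym e) (∣m∣n⇒∣m+n h k)

      discard : ∀ {x y z} → x ≡ y + z → Q ∣ z → x ≡ y mod Q
      discard {y = y} {z} refl h = by (∣-resp (eq y z) h)
        where
        eq : ∀ y z → z ≡ y + z - y
        eq = solve-∀

      -- Sorting the arrays by their first irregular row leaves RSSS, DRSS, DDRS and DDDR, which
      -- together cover the fifteen cases other than DDDD.
      RSSS : Q ∣ N R S S S
      RSSS = both (split₁ {Φ₂ = S} {S} R-linear (Ξ n))
        (both (split₂ {Φ₃ = S} R-linear D-linear (Ξ n)) (both (split₃ R-linear D-linear D-linear (Ξ n)) RDDD RDDR) (both (split₃ R-linear D-linear R-linear (Ξ n)) RDRD (RDRR {Ξ n})))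
        (both (split₂ {Φ₃ = S} R-linear R-linear (Ξ n)) (both (split₃ R-linear R-linear D-linear (Ξ n)) RRDD (RRDR {Ξ n})) (RRRS {Ξ n}))

      DRSS : Q ∣ N D R S S
      DRSS = both (split₂ {Φ₃ = S} D-linear R-linear (Ξ n))
        (both (split₃ D-linear R-linear D-linear (Ξ n)) DRDD DRDR)
        (both (split₃ D-linear R-linear R-linear (Ξ n)) DRRD (DRRR {Ξ n}))

      DDRS : Q ∣ N D D R S
      DDRS = both (split₃ D-linear D-linear R-linear (Ξ n)) DDRD DDRR

    T-supercongruence : T n ≡ T s mod Q
    T-supercongruence = trans-mod (≡⇒≡mod (subst (λ Φ → T n ≡ N Φ Φ Φ Φ) (sym S-def) (T-expansion n)))
      (trans-mod (discard (split₀ {S} {S} {S} (Ξ n)) RSSS)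
      (trans-mod (discard (split₁ {Φ₂ = S} {S} D-linear (Ξ n)) DRSS)
      (trans-mod (discard (split₂ {Φ₃ = S} D-linear D-linear (Ξ n)) DDRS)
      (trans-mod (discard (split₃ D-linear D-linear D-linear (Ξ n)) DDDR) DDDD≡T))))

  supercongruence : ∀ p → Prime p → 5 ℕ.≤ p → ∀ m r → 1 ℕ.≤ m → + (p ℕ.^ (3 ℕ.* suc r)) ∣ Aδ (m ℕ.* p ℕ.^ suc r) - Aδ (m ℕ.* p ℕ.^ r)
  supercongruence p p-prime 5≤p m r 1≤m = ∣-trans (∣-reflexive (pos-^ p (3 ℕ.* suc r)))
    (∣-resp (cong₂ _-_ (T≡Aδ (m ℕ.* p ℕ.^ suc r)) (T≡Aδ s))
      (divides-difference (Final.T-supercongruence p p-prime 5≤p s (m ℕ.* p ℕ.^ suc r) (eq m p (p ℕ.^ r)) r (divides (+ m) (trans (ℤₚ.pos-* m (p ℕ.^ r)) (cong (λ z → + m * z) (pos-^ p r)))) s≢0)))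
    where
    s : ℕ
    s = m ℕ.* p ℕ.^ r
    eq : ∀ m p x → m ℕ.* (p ℕ.* x) ≡ p ℕ.* (m ℕ.* x)
    eq = ℕS.solve-∀
    s≢0 : s ≢ 0
    s≢0 = ℕ.≢-nonZero⁻¹ s {{ℕₚ.m*n≢0 m (p ℕ.^ r) {{ℕ.>-nonZero 1≤m}} {{ℕₚ.m^n≢0 p r {{ℕ.>-nonZero (ℕₚ.≤-trans (s≤s z≤n) 5≤p)}}}}}}

open import Defs
open import Data.Nat using (ℕ; suc; _≤_; _^_; _*_)
open import Data.Nat.Primality using (Prime)
open import Data.Integer using (+_; _-_)
open import Data.Integer.Divisibility using (_∣_)

theorem1p2 : (p : ℕ) → Prime p → 5 ≤ p → (m r : ℕ) → 1 ≤ m →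
    + (p ^ (3 * suc r)) ∣ (Aδ (m * p ^ suc r) - Aδ (m * p ^ r))
theorem1p2 p p-prime 5≤p m r 1≤m = Signed.∣⇒∣ᵤ (RowExpansion.supercongruence p p-prime 5≤p m r 1≤m)
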